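{- With $c = \frac{\pi}{\sqrt{3}}$ we have the following bounds: $$e^{(c - o(1))\sqrt{\frac{n}{\log n}}} < |A(n)| \le |B(n)| < e^{c\sqrt{n}},$$ where $o(1)$ denotes a quantity tending to $0$ as the positive integer $n$ tends to infinity (so the first inequality is an asymptotic statement: for every $\eta > 0$ one has $|A(n)| > e^{(c-\eta)\sqrt{n/\log n}}$ for all sufficiently large $n$).
   Context: For a positive rational $\alpha$ and a positive integer $n$, an $\alpha$-partition of $n$ is a finite set $\{a_1, \ldots, a_r\}$ of distinct positive integers with $a_1 + \cdots + a_r = n$ and $\frac{1}{a_1} + \cdots + \frac{1}{a_r} = \alpha$. The quantity $n_{\alpha}$ is the smallest positive integer such that for every integer $n \ge n_{\alpha}$ an $\alpha$-partition of $n$ exists (it is known, by a theorem of Graham, that $n_\alpha$ exists for every positive rational $\alpha$). $B(n)$ is the set of all positive rationals $\alpha$ for which an $\alpha$-partition of $n$ exists, and $A(n) \subseteq B(n)$ is the set of all positive rationals $\alpha$ with $n_{\alpha} \le n$. -}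

module Defs where

open import Data.Integer.Base as ℤ using (+_)
import Data.Integer.Properties as ℤ
open import Data.List.Base using (List; length; map; foldr)
open import Data.List.Relation.Unary.All using (All)
open import Data.List.Relation.Unary.Unique.Propositional using (Unique)
open import Data.Nat.Base as ℕ using (ℕ; zero; suc)
open import Data.Nat.ListAction using (sum)
import Data.Nat.Properties as ℕ
open import Data.Product.Base using (∃; ∃-syntax; _×_; _,_; proj₁; proj₂)
open import Data.Rational.Base as ℚ
  using (ℚ; mkℚ; 0ℚ; 1ℚ; ½; _/_; _+_; _*_; _-_; -_; ∣_∣; toℚᵘ)
open import Data.Rational.Properties as ℚ using (module ≤-Reasoning)
open import Data.Rational.Solver using (module +-*-Solver)
import Data.Rational.Unnormalised.Base as ℚᵘ
import Data.Rational.Unnormalised.Properties as ℚᵘ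
open import Data.Sum.Base using (_⊎_; inj₁; inj₂)
open import Level using (0ℓ)
open import Relation.Binary.PropositionalEquality
  using (_≡_; refl; sym; trans; cong; cong₂; subst; subst₂; module ≡-Reasoning)
open import Relation.Nullary using (¬_)
open import Relation.Unary using (Pred)

ℕ→ℚ : ℕ → ℚ
ℕ→ℚ n = + n / 1

-- The value at 0 is junk; every use below is at a positive argument.
1/ℕ_ : ℕ → ℚ
1/ℕ zero    = 0ℚ
1/ℕ (suc k) = + 1 / suc k

ℕ→ℚ-suc : ∀ n → ℕ→ℚ (suc n) ≡ 1ℚ + ℕ→ℚ n
ℕ→ℚ-suc n = ℚ.toℚᵘ-injective (begin
  toℚᵘ (ℕ→ℚ (suc n))                  ≈⟨ ℚ.toℚᵘ-fromℚᵘ (ℚᵘ.mkℚᵘ (+ suc n) 0) ⟩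
  ℚᵘ.mkℚᵘ (+ suc n) 0                 ≈⟨ ℚᵘ.*≡* (cong (λ z → + z ℤ.* + 1) (sym (cong suc (ℕ.*-identityʳ n)))) ⟩
  ℚᵘ.mkℚᵘ (+ suc (n ℕ.* 1)) 0         ≡⟨ cong (λ z → ℚᵘ.mkℚᵘ z 0) (cong (λ z → + 1 ℤ.+ z) (ℤ.pos-* n 1)) ⟩
  ℚᵘ.mkℚᵘ (+ 1) 0 ℚᵘ.+ ℚᵘ.mkℚᵘ (+ n) 0 ≈⟨ ℚᵘ.+-congʳ (ℚᵘ.mkℚᵘ (+ 1) 0) (ℚᵘ.≃-sym (ℚ.toℚᵘ-fromℚᵘ (ℚᵘ.mkℚᵘ (+ n) 0))) ⟩
  toℚᵘ 1ℚ ℚᵘ.+ toℚᵘ (ℕ→ℚ n)           ≈⟨ ℚᵘ.≃-sym (ℚ.toℚᵘ-homo-+ 1ℚ (ℕ→ℚ n)) ⟩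
  toℚᵘ (1ℚ + ℕ→ℚ n)                   ∎)
  where open ℚᵘ.≃-Reasoning

suc*1/ : ∀ n → ℕ→ℚ (suc n) * (1/ℕ suc n) ≡ 1ℚ
suc*1/ n = ℚ.toℚᵘ-injective (begin
  toℚᵘ (ℕ→ℚ (suc n) * (1/ℕ suc n))       ≈⟨ ℚ.toℚᵘ-homo-* (ℕ→ℚ (suc n)) (1/ℕ suc n) ⟩
  toℚᵘ (ℕ→ℚ (suc n)) ℚᵘ.* toℚᵘ (1/ℕ suc n) ≈⟨ ℚᵘ.*-cong (ℚ.toℚᵘ-fromℚᵘ (ℚᵘ.mkℚᵘ (+ suc n) 0)) (ℚ.toℚᵘ-fromℚᵘ (ℚᵘ.mkℚᵘ (+ 1) n)) ⟩
  ℚᵘ.mkℚᵘ (+ suc n) 0 ℚᵘ.* ℚᵘ.mkℚᵘ (+ 1) n ≈⟨ ℚᵘ.*≡* (cong +_ (trans (ℕ.*-identityʳ _) (trans (ℕ.*-identityʳ _) (sym (trans (ℕ.*-identityˡ _) (ℕ.*-identityˡ _)))))) ⟩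
  toℚᵘ 1ℚ                                ∎)
  where open ℚᵘ.≃-Reasoning

0≤ℕ→ℚ : ∀ n → 0ℚ ℚ.≤ ℕ→ℚ n
0≤ℕ→ℚ zero    = ℚ.≤-refl
0≤ℕ→ℚ (suc n) = subst (0ℚ ℚ.≤_) (sym (ℕ→ℚ-suc n))
  (ℚ.≤-trans (0≤ℕ→ℚ n) (subst (ℚ._≤ 1ℚ + ℕ→ℚ n) (ℚ.+-identityˡ _)
    (ℚ.+-monoˡ-≤ (ℕ→ℚ n) (ℚ.nonNegative⁻¹ 1ℚ))))

0<ℕ→ℚ-suc : ∀ n → 0ℚ ℚ.< ℕ→ℚ (suc n)
0<ℕ→ℚ-suc n = subst (0ℚ ℚ.<_) (sym (ℕ→ℚ-suc n))
  (ℚ.+-mono-<-≤ (ℚ.positive⁻¹ 1ℚ) (0≤ℕ→ℚ n))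

0<1/ : ∀ n → 0ℚ ℚ.< 1/ℕ suc n
0<1/ n = ℚ.positive⁻¹ _ {{ℚ.normalize-pos 1 (suc n)}}

ℕ→ℚ-mono : ∀ {m n} → m ℕ.≤ n → ℕ→ℚ m ℚ.≤ ℕ→ℚ n
ℕ→ℚ-mono {n = n} ℕ.z≤n = 0≤ℕ→ℚ n
ℕ→ℚ-mono {suc m} {suc n} (ℕ.s≤s p) = subst₂ ℚ._≤_ (sym (ℕ→ℚ-suc m)) (sym (ℕ→ℚ-suc n))
  (ℚ.+-monoʳ-≤ 1ℚ (ℕ→ℚ-mono p))

archimedean : ∀ q → ∃[ k ] q ℚ.≤ ℕ→ℚ k
archimedean (mkℚ (+ n) d c) = n , ℚ.toℚᵘ-cancel-≤
  (ℚᵘ.≤-respʳ-≃ (ℚᵘ.≃-sym (ℚ.toℚᵘ-fromℚᵘ (ℚᵘ.mkℚᵘ (+ n) 0)))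
    (ℚᵘ.*≤* (subst₂ ℤ._≤_ (ℤ.pos-* n 1) (ℤ.pos-* n (suc d))
      (ℤ.+≤+ (ℕ.*-monoʳ-≤ n (ℕ.s≤s (ℕ.z≤n {d})))))))
archimedean q@(mkℚ ℤ.-[1+ n ] d c) = 0 , ℚ.<⇒≤ (ℚ.negative⁻¹ q)

mono₂ : ∀ {a b c d} → 0ℚ ℚ.≤ a → 0ℚ ℚ.≤ d → a ℚ.≤ b → c ℚ.≤ d → a * c ℚ.≤ b * d
mono₂ {a} {b} {c} {d} 0≤a 0≤d a≤b c≤d = ℚ.≤-trans
  (ℚ.*-monoˡ-≤-nonNeg a {{ℚ.nonNegative 0≤a}} c≤d)
  (ℚ.*-monoʳ-≤-nonNeg d {{ℚ.nonNegative 0≤d}} a≤b)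

*-0≤ : ∀ {a b} → 0ℚ ℚ.≤ a → 0ℚ ℚ.≤ b → 0ℚ ℚ.≤ a * b
*-0≤ {a} {b} p q = subst (ℚ._≤ a * b) (ℚ.*-zeroˡ 0ℚ) (mono₂ ℚ.≤-refl q p q)

*-0< : ∀ {a b} → 0ℚ ℚ.< a → 0ℚ ℚ.< b → 0ℚ ℚ.< a * b
*-0< {a} {b} p q = subst (ℚ._< a * b) (ℚ.*-zeroˡ b) (ℚ.*-monoˡ-<-pos b {{ℚ.positive q}} p)

x≤x+y : ∀ {x y} → 0ℚ ℚ.≤ y → x ℚ.≤ x + y
x≤x+y {x} {y} p = subst (ℚ._≤ x + y) (ℚ.+-identityʳ x) (ℚ.+-monoʳ-≤ x p)

-- A positive δ with (suc k) * δ = ε.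
module Split (ε : ℚ) (0<ε : 0ℚ ℚ.< ε) (k : ℕ) where
  δ : ℚ
  δ = ε * (1/ℕ suc k)

  0<δ : 0ℚ ℚ.< δ
  0<δ = *-0< 0<ε (0<1/ k)

  k*δ : ℕ→ℚ (suc k) * δ ≡ ε
  k*δ = begin
    ℕ→ℚ (suc k) * (ε * (1/ℕ suc k)) ≡⟨ solve 3 (λ a b c → a :* (b :* c) := b :* (a :* c)) refl (ℕ→ℚ (suc k)) ε (1/ℕ suc k) ⟩
    ε * (ℕ→ℚ (suc k) * (1/ℕ suc k)) ≡⟨ cong (ε *_) (suc*1/ k) ⟩
    ε * 1ℚ                          ≡⟨ ℚ.*-identityʳ ε ⟩
    ε                               ∎
    where open ≡-Reasoning
          open +-*-Solver

half+half : ∀ ε → ½ * ε + ½ * ε ≡ ε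
half+half ε = trans (sym (ℚ.*-distribʳ-+ ε ½ ½)) (ℚ.*-identityˡ ε)

0<half : ∀ {ε} → 0ℚ ℚ.< ε → 0ℚ ℚ.< ½ * ε
0<half p = *-0< (ℚ.positive⁻¹ ½) p

-- Eventually C/(k+1) < ε.
small : ∀ C ε → 0ℚ ℚ.< ε → ∃[ K ] (∀ k → K ℕ.≤ k → C * (1/ℕ suc k) ℚ.< ε)
small C ε 0<ε = proj₁ A , λ k K≤k →
  ℚ.*-cancelʳ-<-nonNeg (ℕ→ℚ (suc k)) {{ℚ.nonNegative (0≤ℕ→ℚ (suc k))}} (begin-strict
    C * (1/ℕ suc k) * ℕ→ℚ (suc k)   ≡⟨ ℚ.*-assoc C (1/ℕ suc k) (ℕ→ℚ (suc k)) ⟩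
    C * ((1/ℕ suc k) * ℕ→ℚ (suc k)) ≡⟨ cong (C *_) (trans (ℚ.*-comm (1/ℕ suc k) (ℕ→ℚ (suc k))) (suc*1/ k)) ⟩
    C * 1ℚ                          ≡⟨ cong (C *_) (sym (ℚ.*-inverseˡ ε)) ⟩
    C * (ℚ.1/ ε * ε)                ≡⟨ sym (ℚ.*-assoc C (ℚ.1/ ε) ε) ⟩
    C * ℚ.1/ ε * ε                  ≤⟨ ℚ.*-monoʳ-≤-nonNeg ε {{ℚ.nonNegative (ℚ.<⇒≤ 0<ε)}} (ℚ.≤-trans (proj₂ A) (ℕ→ℚ-mono K≤k)) ⟩
    ℕ→ℚ k * ε                       <⟨ ℚ.*-monoˡ-<-pos ε {{ℚ.positive 0<ε}} (k<k+1 {k}) ⟩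
    ℕ→ℚ (suc k) * ε                 ≡⟨ ℚ.*-comm (ℕ→ℚ (suc k)) ε ⟩
    ε * ℕ→ℚ (suc k)                 ∎)
  where
  open ≤-Reasoning
  instance ε≢0 = ℚ.>-nonZero 0<ε
  A = archimedean (C * ℚ.1/ ε)
  k<k+1 : ∀ {k} → ℕ→ℚ k ℚ.< ℕ→ℚ (suc k)
  k<k+1 {k} = subst₂ ℚ._<_ (ℚ.+-identityˡ _) (sym (ℕ→ℚ-suc k)) (ℚ.+-monoˡ-< (ℕ→ℚ k) (ℚ.positive⁻¹ 1ℚ))

record ℝ : Set where
  constructor mkℝ
  field
    seq    : ℕ → ℚ
    cauchy : ∀ ε → 0ℚ ℚ.< ε → ∃[ N ] (∀ m n → N ℕ.≤ m → N ℕ.≤ n → ∣ seq m - seq n ∣ ℚ.< ε)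

open ℝ public

infix 4 _≃_ _<ᴿ_ _≤ᴿ_

_≃_ : ℝ → ℝ → Set
x ≃ y = ∀ ε → 0ℚ ℚ.< ε → ∃[ N ] (∀ n → N ℕ.≤ n → ∣ seq x n - seq y n ∣ ℚ.< ε)

_<ᴿ_ : ℝ → ℝ → Set
x <ᴿ y = ∃[ ε ] 0ℚ ℚ.< ε × ∃[ N ] (∀ n → N ℕ.≤ n → seq x n + ε ℚ.≤ seq y n)

_≤ᴿ_ : ℝ → ℝ → Set
x ≤ᴿ y = ¬ (y <ᴿ x)

fromℚ : ℚ → ℝ
fromℚ q = mkℝ (λ _ → q) λ ε 0<ε → 0 , λ _ _ _ _ →
  subst (ℚ._< ε) (sym (cong ∣_∣ (ℚ.+-inverseʳ q))) 0<ε

fromℕ : ℕ → ℝ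
fromℕ n = fromℚ (ℕ→ℚ n)

0ᴿ : ℝ
0ᴿ = fromℚ 0ℚ

infixl 6 _+ᴿ_ _-ᴿ_
infixl 7 _*ᴿ_
infix  8 -ᴿ_

_+ᴿ_ : ℝ → ℝ → ℝ
x +ᴿ y = mkℝ (λ n → seq x n + seq y n) λ ε 0<ε →
  let (M , hx) = cauchy x (½ * ε) (0<half 0<ε)
      (N , hy) = cauchy y (½ * ε) (0<half 0<ε)
  in M ℕ.⊔ N , λ m n p q → begin-strict
    ∣ (seq x m + seq y m) - (seq x n + seq y n) ∣
      ≡⟨ cong ∣_∣ (solve 4 (λ a b c d → (a :+ b) :- (c :+ d) := (a :- c) :+ (b :- d)) refl (seq x m) (seq y m) (seq x n) (seq y n)) ⟩
    ∣ (seq x m - seq x n) + (seq y m - seq y n) ∣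
      ≤⟨ ℚ.∣p+q∣≤∣p∣+∣q∣ (seq x m - seq x n) (seq y m - seq y n) ⟩
    ∣ seq x m - seq x n ∣ + ∣ seq y m - seq y n ∣
      <⟨ ℚ.+-mono-< (hx m n (ℕ.m⊔n≤o⇒m≤o M N p) (ℕ.m⊔n≤o⇒m≤o M N q))
                    (hy m n (ℕ.m⊔n≤o⇒n≤o M N p) (ℕ.m⊔n≤o⇒n≤o M N q)) ⟩
    ½ * ε + ½ * ε
      ≡⟨ half+half ε ⟩
    ε ∎
  where open ≤-Reasoning
        open +-*-Solver

-ᴿ_ : ℝ → ℝ
-ᴿ x = mkℝ (λ n → - seq x n) λ ε 0<ε →
  let (N , h) = cauchy x ε 0<ε
  in N , λ m n p q → subst (ℚ._< ε)
    (trans (sym (ℚ.∣-p∣≡∣p∣ (seq x m - seq x n)))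
           (cong ∣_∣ (solve 2 (λ a b → :- (a :- b) := (:- a) :- (:- b)) refl (seq x m) (seq x n))))
    (h m n p q)
  where open +-*-Solver

_-ᴿ_ : ℝ → ℝ → ℝ
x -ᴿ y = x +ᴿ (-ᴿ y)

eventuallyBounded : ∀ x → ∃[ B ] ∃[ N ] (∀ n → N ℕ.≤ n → ∣ seq x n ∣ ℚ.≤ ℕ→ℚ B)
eventuallyBounded x =
  let (N , h) = cauchy x 1ℚ (ℚ.positive⁻¹ 1ℚ)
      (B , b) = archimedean (1ℚ + ∣ seq x N ∣)
  in B , N , λ n p → begin
    ∣ seq x n ∣                       ≡⟨ cong ∣_∣ (solve 2 (λ a c → a := (a :- c) :+ c) refl (seq x n) (seq x N)) ⟩
    ∣ (seq x n - seq x N) + seq x N ∣ ≤⟨ ℚ.∣p+q∣≤∣p∣+∣q∣ (seq x n - seq x N) (seq x N) ⟩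
    ∣ seq x n - seq x N ∣ + ∣ seq x N ∣ ≤⟨ ℚ.+-monoˡ-≤ ∣ seq x N ∣ (ℚ.<⇒≤ (h n N p ℕ.≤-refl)) ⟩
    1ℚ + ∣ seq x N ∣                  ≤⟨ b ⟩
    ℕ→ℚ B                             ∎
  where open ≤-Reasoning
        open +-*-Solver

suc*< : ∀ B {u d e} → 0ℚ ℚ.≤ d → u ℚ.≤ ℕ→ℚ B → ℕ→ℚ (suc B) * d ℚ.< e → u * d ℚ.< e
suc*< B {u} {d} 0≤d u≤B h = ℚ.≤-<-trans
  (ℚ.*-monoʳ-≤-nonNeg d {{ℚ.nonNegative 0≤d}} (ℚ.≤-trans u≤B (ℕ→ℚ-mono (ℕ.n≤1+n B)))) h

scaled : ∀ B {d e} (0<e : 0ℚ ℚ.< e) → d ℚ.< Split.δ e 0<e B → ℕ→ℚ (suc B) * d ℚ.< e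
scaled B {d} {e} 0<e h = subst (ℕ→ℚ (suc B) * d ℚ.<_) (Split.k*δ e 0<e B)
  (ℚ.*-monoʳ-<-pos (ℕ→ℚ (suc B)) {{ℚ.positive (0<ℕ→ℚ-suc B)}} h)

_*ᴿ_ : ℝ → ℝ → ℝ
x *ᴿ y = mkℝ (λ n → seq x n * seq y n) λ ε 0<ε →
  let (B , N₁ , bx) = eventuallyBounded x
      (C , N₂ , by) = eventuallyBounded y
      0<ε/2 = 0<half 0<ε
      (N₃ , hx) = cauchy x (Split.δ _ 0<ε/2 C) (Split.0<δ _ 0<ε/2 C)
      (N₄ , hy) = cauchy y (Split.δ _ 0<ε/2 B) (Split.0<δ _ 0<ε/2 B)
      M = N₁ ℕ.⊔ N₂
      N = N₃ ℕ.⊔ N₄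
  in M ℕ.⊔ N , λ m n p q → begin-strict
    ∣ seq x m * seq y m - seq x n * seq y n ∣
      ≡⟨ cong ∣_∣ (solve 4 (λ a b c d → a :* b :- c :* d := a :* (b :- d) :+ d :* (a :- c)) refl (seq x m) (seq y m) (seq x n) (seq y n)) ⟩
    ∣ seq x m * (seq y m - seq y n) + seq y n * (seq x m - seq x n) ∣
      ≤⟨ ℚ.∣p+q∣≤∣p∣+∣q∣ (seq x m * (seq y m - seq y n)) (seq y n * (seq x m - seq x n)) ⟩
    ∣ seq x m * (seq y m - seq y n) ∣ + ∣ seq y n * (seq x m - seq x n) ∣
      ≡⟨ cong₂ _+_ (ℚ.∣p*q∣≡∣p∣*∣q∣ (seq x m) (seq y m - seq y n)) (ℚ.∣p*q∣≡∣p∣*∣q∣ (seq y n) (seq x m - seq x n)) ⟩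
    ∣ seq x m ∣ * ∣ seq y m - seq y n ∣ + ∣ seq y n ∣ * ∣ seq x m - seq x n ∣
      <⟨ ℚ.+-mono-<
           (suc*< B (ℚ.0≤∣p∣ (seq y m - seq y n))
             (bx m (ℕ.m⊔n≤o⇒m≤o N₁ N₂ (ℕ.m⊔n≤o⇒m≤o M N p)))
             (scaled B 0<ε/2 (hy m n (ℕ.m⊔n≤o⇒n≤o N₃ N₄ (ℕ.m⊔n≤o⇒n≤o M N p)) (ℕ.m⊔n≤o⇒n≤o N₃ N₄ (ℕ.m⊔n≤o⇒n≤o M N q)))))
           (suc*< C (ℚ.0≤∣p∣ (seq x m - seq x n))
             (by n (ℕ.m⊔n≤o⇒n≤o N₁ N₂ (ℕ.m⊔n≤o⇒m≤o M N q)))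
             (scaled C 0<ε/2 (hx m n (ℕ.m⊔n≤o⇒m≤o N₃ N₄ (ℕ.m⊔n≤o⇒n≤o M N p)) (ℕ.m⊔n≤o⇒m≤o N₃ N₄ (ℕ.m⊔n≤o⇒n≤o M N q))))) ⟩
    ½ * ε + ½ * ε
      ≡⟨ half+half ε ⟩
    ε ∎
  where open ≤-Reasoning
        open +-*-Solver

-- xᵏ / k!
powOverFact : ℚ → ℕ → ℚ
powOverFact x zero    = 1ℚ
powOverFact x (suc k) = powOverFact x k * (x * (1/ℕ suc k))

-- Σ_{k<n} sₖ xᵏ / k!
partialSum : (ℕ → ℚ) → ℚ → ℕ → ℚ
partialSum s x zero    = 0ℚ
partialSum s x (suc n) = partialSum s x n + s n * powOverFact x n

module Majorant (M : ℕ) where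
  open ≤-Reasoning
  open +-*-Solver

  M′ : ℚ
  M′ = ℕ→ℚ M

  w v E V : ℕ → ℚ
  w = powOverFact M′
  v zero    = 0ℚ
  v (suc k) = w k
  E zero    = 0ℚ
  E (suc n) = E n + w n
  V zero    = 0ℚ
  V (suc n) = V n + v n

  0≤w : ∀ k → 0ℚ ℚ.≤ w k
  0≤w zero    = ℚ.nonNegative⁻¹ 1ℚ
  0≤w (suc k) = *-0≤ (0≤w k) (*-0≤ (0≤ℕ→ℚ M) (ℚ.<⇒≤ (0<1/ k)))

  0≤v : ∀ k → 0ℚ ℚ.≤ v k
  0≤v zero    = ℚ.≤-refl
  0≤v (suc k) = 0≤w k

  0≤E : ∀ n → 0ℚ ℚ.≤ E n
  0≤E zero    = ℚ.≤-refl
  0≤E (suc n) = ℚ.+-mono-≤ (0≤E n) (0≤w n)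

  V-suc : ∀ n → V (suc n) ≡ E n
  V-suc zero    = refl
  V-suc (suc n) = cong (_+ w n) (V-suc n)

  V≤E : ∀ n → V n ℚ.≤ E n
  V≤E zero    = ℚ.≤-refl
  V≤E (suc n) = ℚ.≤-trans (ℚ.≤-reflexive (V-suc n)) (x≤x+y (0≤w n))

  M*v : ∀ k → M′ * v k ≡ ℕ→ℚ k * w k
  M*v zero    = trans (ℚ.*-zeroʳ M′) (sym (ℚ.*-zeroˡ 1ℚ))
  M*v (suc k) = begin-equality
    M′ * w k                                         ≡⟨ sym (ℚ.*-identityʳ _) ⟩
    M′ * w k * 1ℚ                                    ≡⟨ cong (M′ * w k *_) (sym (suc*1/ k)) ⟩
    M′ * w k * (ℕ→ℚ (suc k) * (1/ℕ suc k))           ≡⟨ solve 4 (λ a b c d → a :* b :* (c :* d) := c :* (b :* (a :* d))) refl M′ (w k) (ℕ→ℚ (suc k)) (1/ℕ suc k) ⟩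
    ℕ→ℚ (suc k) * (w k * (M′ * (1/ℕ suc k)))         ∎

  v-step : ∀ k → (v k * M′ + w k) * (1/ℕ suc k) ≡ w k
  v-step k = begin-equality
    (v k * M′ + w k) * (1/ℕ suc k)         ≡⟨ cong (λ z → (z + w k) * (1/ℕ suc k)) (trans (ℚ.*-comm (v k) M′) (M*v k)) ⟩
    (ℕ→ℚ k * w k + w k) * (1/ℕ suc k)      ≡⟨ solve 3 (λ a b c → (a :* b :+ b) :* c := b :* ((con 1ℚ :+ a) :* c)) refl (ℕ→ℚ k) (w k) (1/ℕ suc k) ⟩
    w k * ((1ℚ + ℕ→ℚ k) * (1/ℕ suc k))     ≡⟨ cong (λ z → w k * (z * (1/ℕ suc k))) (sym (ℕ→ℚ-suc k)) ⟩
    w k * (ℕ→ℚ (suc k) * (1/ℕ suc k))      ≡⟨ cong (w k *_) (suc*1/ k) ⟩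
    w k * 1ℚ                               ≡⟨ ℚ.*-identityʳ (w k) ⟩
    w k                                    ∎

  ∣1/∣ : ∀ k → ∣ 1/ℕ suc k ∣ ≡ 1/ℕ suc k
  ∣1/∣ k = ℚ.0≤p⇒∣p∣≡p (ℚ.<⇒≤ (0<1/ k))

  term-bound : ∀ {x} → ∣ x ∣ ℚ.≤ M′ → ∀ k → ∣ powOverFact x k ∣ ℚ.≤ w k
  term-bound         h zero    = ℚ.≤-refl
  term-bound {x = x} h (suc k) = begin
    ∣ powOverFact x k * (x * (1/ℕ suc k)) ∣       ≡⟨ ℚ.∣p*q∣≡∣p∣*∣q∣ (powOverFact x k) (x * (1/ℕ suc k)) ⟩
    ∣ powOverFact x k ∣ * ∣ x * (1/ℕ suc k) ∣     ≡⟨ cong (∣ powOverFact x k ∣ *_) (trans (ℚ.∣p*q∣≡∣p∣*∣q∣ x (1/ℕ suc k)) (cong (∣ x ∣ *_) (∣1/∣ k))) ⟩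
    ∣ powOverFact x k ∣ * (∣ x ∣ * (1/ℕ suc k))   ≤⟨ mono₂ (ℚ.0≤∣p∣ (powOverFact x k)) (*-0≤ (0≤ℕ→ℚ M) 0≤1/) (term-bound h k) (ℚ.*-monoʳ-≤-nonNeg (1/ℕ suc k) {{ℚ.nonNegative 0≤1/}} h) ⟩
    w k * (M′ * (1/ℕ suc k))                      ∎
    where 0≤1/ = ℚ.<⇒≤ (0<1/ k)

  term-lipschitz : ∀ {x y} → ∣ x ∣ ℚ.≤ M′ → ∣ y ∣ ℚ.≤ M′ → ∀ k →
                   ∣ powOverFact x k - powOverFact y k ∣ ℚ.≤ ∣ x - y ∣ * v k
  term-lipschitz {x} {y} hx hy zero    = ℚ.≤-reflexive (sym (ℚ.*-zeroʳ ∣ x - y ∣))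
  term-lipschitz {x} {y} hx hy (suc k) = begin
    ∣ s * (x * r) - t * (y * r) ∣
      ≡⟨ cong ∣_∣ (solve 5 (λ s t x y r → s :* (x :* r) :- t :* (y :* r) := ((s :- t) :* x :+ t :* (x :- y)) :* r) refl s t x y r) ⟩
    ∣ ((s - t) * x + t * (x - y)) * r ∣
      ≡⟨ trans (ℚ.∣p*q∣≡∣p∣*∣q∣ ((s - t) * x + t * (x - y)) r) (cong (∣ (s - t) * x + t * (x - y) ∣ *_) (∣1/∣ k)) ⟩
    ∣ (s - t) * x + t * (x - y) ∣ * r
      ≤⟨ monoʳ (ℚ.∣p+q∣≤∣p∣+∣q∣ ((s - t) * x) (t * (x - y))) ⟩
    (∣ (s - t) * x ∣ + ∣ t * (x - y) ∣) * r
      ≡⟨ cong (_* r) (cong₂ _+_ (ℚ.∣p*q∣≡∣p∣*∣q∣ (s - t) x) (ℚ.∣p*q∣≡∣p∣*∣q∣ t (x - y))) ⟩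
    (∣ s - t ∣ * ∣ x ∣ + ∣ t ∣ * d) * r
      ≤⟨ monoʳ (ℚ.+-mono-≤ (mono₂ (ℚ.0≤∣p∣ (s - t)) (0≤ℕ→ℚ M) (term-lipschitz hx hy k) hx)
                           (ℚ.*-monoʳ-≤-nonNeg d {{ℚ.nonNegative (ℚ.0≤∣p∣ (x - y))}} (term-bound hy k))) ⟩
    (d * v k * M′ + w k * d) * r
      ≡⟨ solve 5 (λ d v m w r → (d :* v :* m :+ w :* d) :* r := d :* ((v :* m :+ w) :* r)) refl d (v k) M′ (w k) r ⟩
    d * ((v k * M′ + w k) * r)
      ≡⟨ cong (d *_) (v-step k) ⟩
    d * w k ∎
    where
    s = powOverFact x k
    t = powOverFact y k
    r = 1/ℕ suc k
    d = ∣ x - y ∣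
    monoʳ : ∀ {a b} → a ℚ.≤ b → a * r ℚ.≤ b * r
    monoʳ = ℚ.*-monoʳ-≤-nonNeg r {{ℚ.nonNegative (ℚ.<⇒≤ (0<1/ k))}}

  U : ℕ → ℚ
  U n = E n + (w n + w n)

  U-step : ∀ k → M ℕ.+ M ℕ.≤ k → U (suc k) ℚ.≤ U k
  U-step k 2M≤k = begin
    E k + w k + (w k * (M′ * r) + w k * (M′ * r)) ≡⟨ solve 4 (λ e w m r → e :+ w :+ (w :* (m :* r) :+ w :* (m :* r)) := (e :+ w) :+ w :* ((m :+ m) :* r)) refl (E k) (w k) M′ r ⟩
    (E k + w k) + w k * ((M′ + M′) * r)           ≤⟨ ℚ.+-monoʳ-≤ (E k + w k) (ℚ.*-monoˡ-≤-nonNeg (w k) {{ℚ.nonNegative (0≤w k)}} 2Mr≤1) ⟩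
    (E k + w k) + w k * 1ℚ                        ≡⟨ solve 2 (λ e w → (e :+ w) :+ w :* con 1ℚ := e :+ (w :+ w)) refl (E k) (w k) ⟩
    E k + (w k + w k)                             ∎
    where
    r = 1/ℕ suc k
    ℕ→ℚ-+ : ∀ m n → ℕ→ℚ (m ℕ.+ n) ≡ ℕ→ℚ m + ℕ→ℚ n
    ℕ→ℚ-+ zero    n = sym (ℚ.+-identityˡ (ℕ→ℚ n))
    ℕ→ℚ-+ (suc m) n = trans (ℕ→ℚ-suc (m ℕ.+ n)) (trans (cong (λ z → 1ℚ + z) (ℕ→ℚ-+ m n))
      (trans (sym (ℚ.+-assoc 1ℚ (ℕ→ℚ m) (ℕ→ℚ n))) (cong (_+ ℕ→ℚ n) (sym (ℕ→ℚ-suc m)))))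
    2Mr≤1 : (M′ + M′) * r ℚ.≤ 1ℚ
    2Mr≤1 = begin
      (M′ + M′) * r        ≡⟨ cong (_* r) (sym (ℕ→ℚ-+ M M)) ⟩
      ℕ→ℚ (M ℕ.+ M) * r    ≤⟨ ℚ.*-monoʳ-≤-nonNeg r {{ℚ.nonNegative (ℚ.<⇒≤ (0<1/ k))}} (ℕ→ℚ-mono (ℕ.≤-trans 2M≤k (ℕ.n≤1+n k))) ⟩
      ℕ→ℚ (suc k) * r      ≡⟨ suc*1/ k ⟩
      1ℚ                   ∎

  U-antitone : ∀ {m n} → M ℕ.+ M ℕ.≤ m → m ℕ.≤′ n → U n ℚ.≤ U m
  U-antitone 2M≤m (ℕ.≤′-reflexive refl) = ℚ.≤-refl
  U-antitone 2M≤m (ℕ.≤′-step p) =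
    ℚ.≤-trans (U-step _ (ℕ.≤-trans 2M≤m (ℕ.≤′⇒≤ p))) (U-antitone 2M≤m p)

  C : ℚ
  C = U (M ℕ.+ M)

  E≤C : ∀ n → M ℕ.+ M ℕ.≤ n → E n ℚ.≤ C
  E≤C n p = ℚ.≤-trans (x≤x+y {E n} (ℚ.+-mono-≤ (0≤w n) (0≤w n))) (U-antitone ℕ.≤-refl (ℕ.≤⇒≤′ p))

  w≤C : ∀ n → M ℕ.+ M ℕ.≤ n → w n ℚ.≤ C
  w≤C n p = begin
    w n               ≤⟨ x≤x+y (0≤w n) ⟩
    w n + w n         ≡⟨ sym (ℚ.+-identityˡ _) ⟩
    0ℚ + (w n + w n)  ≤⟨ ℚ.+-monoˡ-≤ (w n + w n) (0≤E n) ⟩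
    U n               ≤⟨ U-antitone ℕ.≤-refl (ℕ.≤⇒≤′ p) ⟩
    C                 ∎

  D : ℚ
  D = (C + C) * M′

  2w≤ : ∀ k → M ℕ.+ M ℕ.≤ k → w (suc k) + w (suc k) ℚ.≤ D * (1/ℕ suc k)
  2w≤ k p = begin
    w k * (M′ * r) + w k * (M′ * r) ≤⟨ ℚ.+-mono-≤ h h ⟩
    C * (M′ * r) + C * (M′ * r)     ≡⟨ solve 3 (λ c m r → c :* (m :* r) :+ c :* (m :* r) := (c :+ c) :* m :* r) refl C M′ r ⟩
    (C + C) * M′ * r                ∎
    where
    r = 1/ℕ suc k
    h : w k * (M′ * r) ℚ.≤ C * (M′ * r)
    h = ℚ.*-monoʳ-≤-nonNeg (M′ * r) {{ℚ.nonNegative (*-0≤ (0≤ℕ→ℚ M) (ℚ.<⇒≤ (0<1/ k)))}} (w≤C k p)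

  module _ (s : ℕ → ℚ) (∣s∣≤1 : ∀ k → ∣ s k ∣ ℚ.≤ 1ℚ) where

    coeff-bound : ∀ k {a b} → ∣ a ∣ ℚ.≤ b → ∣ s k * a ∣ ℚ.≤ b
    coeff-bound k {a} {b} h = begin
      ∣ s k * a ∣       ≡⟨ ℚ.∣p*q∣≡∣p∣*∣q∣ (s k) a ⟩
      ∣ s k ∣ * ∣ a ∣   ≤⟨ ℚ.*-monoʳ-≤-nonNeg ∣ a ∣ {{ℚ.nonNegative (ℚ.0≤∣p∣ a)}} (∣s∣≤1 k) ⟩
      1ℚ * ∣ a ∣        ≡⟨ ℚ.*-identityˡ ∣ a ∣ ⟩
      ∣ a ∣             ≤⟨ h ⟩
      b                 ∎

    sum-lipschitz : ∀ {x y} → ∣ x ∣ ℚ.≤ M′ → ∣ y ∣ ℚ.≤ M′ → ∀ n →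
                    ∣ partialSum s x n - partialSum s y n ∣ ℚ.≤ ∣ x - y ∣ * V n
    sum-lipschitz {x} {y} hx hy zero    = ℚ.≤-reflexive (sym (ℚ.*-zeroʳ ∣ x - y ∣))
    sum-lipschitz {x} {y} hx hy (suc n) = begin
      ∣ (p + s n * a) - (q + s n * b) ∣ ≡⟨ cong ∣_∣ (solve 5 (λ p q s a b → (p :+ s :* a) :- (q :+ s :* b) := (p :- q) :+ s :* (a :- b)) refl p q (s n) a b) ⟩
      ∣ (p - q) + s n * (a - b) ∣       ≤⟨ ℚ.∣p+q∣≤∣p∣+∣q∣ (p - q) (s n * (a - b)) ⟩
      ∣ p - q ∣ + ∣ s n * (a - b) ∣     ≤⟨ ℚ.+-mono-≤ (sum-lipschitz hx hy n) (coeff-bound n (term-lipschitz hx hy n)) ⟩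
      ∣ x - y ∣ * V n + ∣ x - y ∣ * v n ≡⟨ sym (ℚ.*-distribˡ-+ ∣ x - y ∣ (V n) (v n)) ⟩
      ∣ x - y ∣ * (V n + v n)           ∎
      where
      p = partialSum s x n
      q = partialSum s y n
      a = powOverFact x n
      b = powOverFact y n

    sum-tail : ∀ {x} → ∣ x ∣ ℚ.≤ M′ → ∀ {m n} → m ℕ.≤′ n →
               ∣ partialSum s x n - partialSum s x m ∣ ℚ.≤ E n - E m
    sum-tail {x} hx {m} (ℕ.≤′-reflexive refl) = ℚ.≤-reflexive
      (trans (cong ∣_∣ (ℚ.+-inverseʳ (partialSum s x m))) (sym (ℚ.+-inverseʳ (E m))))
    sum-tail {x} hx {m} (ℕ.≤′-step {n} p) = begin
      ∣ (a + s n * t) - b ∣        ≡⟨ cong ∣_∣ (solve 3 (λ a t b → (a :+ t) :- b := (a :- b) :+ t) refl a (s n * t) b) ⟩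
      ∣ (a - b) + s n * t ∣        ≤⟨ ℚ.∣p+q∣≤∣p∣+∣q∣ (a - b) (s n * t) ⟩
      ∣ a - b ∣ + ∣ s n * t ∣      ≤⟨ ℚ.+-mono-≤ (sum-tail hx p) (coeff-bound n (term-bound hx n)) ⟩
      (E n - E m) + w n            ≡⟨ solve 3 (λ a b t → (a :- b) :+ t := (a :+ t) :- b) refl (E n) (E m) (w n) ⟩
      (E n + w n) - E m            ∎
      where
      a = partialSum s x n
      b = partialSum s x m
      t = powOverFact x n

    E-tail : ∀ {m n} → M ℕ.+ M ℕ.≤ m → m ℕ.≤ n → E n - E m ℚ.≤ w m + w m
    E-tail {m} {n} p m≤n = begin
      E n - E m                 ≤⟨ ℚ.+-monoˡ-≤ (- E m) (ℚ.≤-trans (x≤x+y {E n} (ℚ.+-mono-≤ (0≤w n) (0≤w n))) (U-antitone p (ℕ.≤⇒≤′ m≤n))) ⟩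
      E m + (w m + w m) - E m   ≡⟨ solve 2 (λ a b → a :+ b :- a := b) refl (E m) (w m + w m) ⟩
      w m + w m                 ∎

∣-∣-comm : ∀ p q → ∣ p - q ∣ ≡ ∣ q - p ∣
∣-∣-comm p q = trans (sym (ℚ.∣-p∣≡∣p∣ (p - q)))
  (cong ∣_∣ (solve 2 (λ p q → :- (p :- q) := q :- p) refl p q))
  where open +-*-Solver

module Convergence
  (s : ℕ → ℚ) (∣s∣≤1 : ∀ k → ∣ s k ∣ ℚ.≤ 1ℚ) (x : ℝ)
  (ε : ℚ) (0<ε/2 : 0ℚ ℚ.< ½ * ε)
  (M N₀ : ℕ) (hM : ∀ n → N₀ ℕ.≤ n → ∣ seq x n ∣ ℚ.≤ ℕ→ℚ M)
  (B : ℕ) (C≤B : Majorant.C M ℚ.≤ ℕ→ℚ B)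
  (L : ℕ) (hx : ∀ m n → L ℕ.≤ m → L ℕ.≤ n → ∣ seq x m - seq x n ∣ ℚ.< Split.δ (½ * ε) 0<ε/2 B)
  (K : ℕ) (hK : ∀ k → K ℕ.≤ k → Majorant.D M * (1/ℕ suc k) ℚ.< ½ * ε)
  where
  open ≤-Reasoning
  open +-*-Solver
  open Majorant M

  f : ℕ → ℚ
  f n = partialSum s (seq x n) n

  N₁ N₂ N : ℕ
  N₁ = N₀ ℕ.⊔ L
  N₂ = (M ℕ.+ M) ℕ.⊔ K
  N  = N₁ ℕ.⊔ suc N₂

  core : ∀ m n → N ℕ.≤ m → N ℕ.≤ n → m ℕ.≤ n → ∣ f m - f n ∣ ℚ.< ε
  core zero n N≤0 _ _ with () ← ℕ.≤-trans (ℕ.m≤n⊔m N₁ (suc N₂)) N≤0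
  core m@(suc m′) n N≤m N≤n m≤n =
    begin-strict
    ∣ f m - f n ∣
      ≡⟨ cong ∣_∣ (solve 3 (λ a b c → a :- c := (a :- b) :+ (b :- c)) refl (f m) y (f n)) ⟩
    ∣ (f m - y) + (y - f n) ∣
      ≤⟨ ℚ.∣p+q∣≤∣p∣+∣q∣ (f m - y) (y - f n) ⟩
    ∣ f m - y ∣ + ∣ y - f n ∣
      ≡⟨ cong (λ z → ∣ f m - y ∣ + z) (∣-∣-comm y (f n)) ⟩
    ∣ f m - y ∣ + ∣ f n - y ∣
      <⟨ ℚ.+-mono-<
           (ℚ.≤-<-trans (sum-lipschitz s ∣s∣≤1 hm hn m)
             (subst (ℚ._< ½ * ε) (ℚ.*-comm (V m) d)
               (suc*< B (ℚ.0≤∣p∣ (seq x m - seq x n))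
                 (ℚ.≤-trans (V≤E m) (ℚ.≤-trans (E≤C m 2M≤m) C≤B))
                 (scaled B 0<ε/2 d<))))
           (ℚ.≤-<-trans (sum-tail s ∣s∣≤1 hn (ℕ.≤⇒≤′ m≤n))
             (ℚ.≤-<-trans (E-tail s ∣s∣≤1 2M≤m m≤n)
               (ℚ.≤-<-trans (2w≤ m′ 2M≤m′) (hK m′ (ℕ.m⊔n≤o⇒n≤o (M ℕ.+ M) K N₂≤m′))))) ⟩
    ½ * ε + ½ * ε
      ≡⟨ half+half ε ⟩
    ε ∎
    where
    N₂≤m′ = ℕ.≤-pred (ℕ.m⊔n≤o⇒n≤o N₁ (suc N₂) N≤m)
    2M≤m′ = ℕ.m⊔n≤o⇒m≤o (M ℕ.+ M) K N₂≤m′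
    2M≤m  = ℕ.≤-trans 2M≤m′ (ℕ.n≤1+n m′)
    hm    = hM m (ℕ.m⊔n≤o⇒m≤o N₀ L (ℕ.m⊔n≤o⇒m≤o N₁ (suc N₂) N≤m))
    hn    = hM n (ℕ.m⊔n≤o⇒m≤o N₀ L (ℕ.m⊔n≤o⇒m≤o N₁ (suc N₂) N≤n))
    d<    = hx m n (ℕ.m⊔n≤o⇒n≤o N₀ L (ℕ.m⊔n≤o⇒m≤o N₁ (suc N₂) N≤m))
                   (ℕ.m⊔n≤o⇒n≤o N₀ L (ℕ.m⊔n≤o⇒m≤o N₁ (suc N₂) N≤n))
    d     = ∣ seq x m - seq x n ∣
    y     = partialSum s (seq x n) m

  converges : ∀ m n → N ℕ.≤ m → N ℕ.≤ n → ∣ f m - f n ∣ ℚ.< ε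
  converges m n p q with ℕ.≤-total m n
  ... | inj₁ m≤n = core m n p q m≤n
  ... | inj₂ n≤m = subst (ℚ._< ε) (∣-∣-comm (f n) (f m)) (core n m q p n≤m)

-- Σ_k sₖ xᵏ / k! at a real x, taken along the diagonal: the n-th
-- approximation is the n-th partial sum at the n-th approximation of x.
powerSeries : (s : ℕ → ℚ) → (∀ k → ∣ s k ∣ ℚ.≤ 1ℚ) → ℝ → ℝ
powerSeries s ∣s∣≤1 x = mkℝ (λ n → partialSum s (seq x n) n) λ ε 0<ε →
  let 0<ε/2        = 0<half 0<ε
      (M , N₀ , hM) = eventuallyBounded x
      (B , C≤B)    = archimedean (Majorant.C M)
      (L , hx)     = cauchy x (Split.δ (½ * ε) 0<ε/2 B) (Split.0<δ (½ * ε) 0<ε/2 B)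
      (K , hK)     = small (Majorant.D M) (½ * ε) 0<ε/2
      open Convergence s ∣s∣≤1 x ε 0<ε/2 M N₀ hM B C≤B L hx K hK
  in N , converges

exp : ℝ → ℝ
exp = powerSeries (λ _ → 1ℚ) (λ _ → ℚ.≤-refl)

-- 0, 1, 0, -1, 0, 1, …
sinCoeff : ℕ → ℚ
sinCoeff zero          = 0ℚ
sinCoeff (suc zero)    = 1ℚ
sinCoeff (suc (suc k)) = - sinCoeff k

∣sinCoeff∣≤1 : ∀ k → ∣ sinCoeff k ∣ ℚ.≤ 1ℚ
∣sinCoeff∣≤1 zero          = ℚ.nonNegative⁻¹ 1ℚ
∣sinCoeff∣≤1 (suc zero)    = ℚ.≤-refl
∣sinCoeff∣≤1 (suc (suc k)) =
  subst (ℚ._≤ 1ℚ) (sym (ℚ.∣-p∣≡∣p∣ (sinCoeff k))) (∣sinCoeff∣≤1 k)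

sin : ℝ → ℝ
sin = powerSeries sinCoeff ∣sinCoeff∣≤1

-- π, log, √ and ÷ are given by predicates rather than functions, since the
-- last three are partial; each predicate determines its real up to _≃_.

-- The least positive zero of sin.
IsPi : ℝ → Set
IsPi p = 0ᴿ <ᴿ p × sin p ≃ 0ᴿ × (∀ x → 0ᴿ <ᴿ x → x <ᴿ p → ¬ (sin x ≃ 0ᴿ))

_IsLogOf_ : ℝ → ℝ → Set
y IsLogOf x = exp y ≃ x

_IsSqrtOf_ : ℝ → ℝ → Set
y IsSqrtOf x = 0ᴿ ≤ᴿ y × y *ᴿ y ≃ x

_IsQuotientOf_and_ : ℝ → ℝ → ℝ → Set
q IsQuotientOf x and y = (0ᴿ <ᴿ y ⊎ y <ᴿ 0ᴿ) × q *ᴿ y ≃ x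

record IsPartition (α : ℚ) (n : ℕ) (as : List ℕ) : Set where
  field
    distinct        : Unique as
    positive        : All (0 ℕ.<_) as
    sum≡n           : sum as ≡ n
    sumOfInverses≡α : foldr _+_ 0ℚ (map 1/ℕ_ as) ≡ α

HasPartition : ℚ → ℕ → Set
HasPartition α n = ∃[ as ] IsPartition α n as

HasPartitionFrom : ℚ → ℕ → Set
HasPartitionFrom α N = ∀ n → N ℕ.≤ n → HasPartition α n

-- N is n_α.
IsThreshold : ℚ → ℕ → Set
IsThreshold α N =
  0 ℕ.< N × HasPartitionFrom α N × (∀ M → 0 ℕ.< M → HasPartitionFrom α M → N ℕ.≤ M)

A B : ℕ → Pred ℚ 0ℓ
A n α = 0ℚ ℚ.< α × ∃[ N ] (IsThreshold α N × N ℕ.≤ n)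
B n α = 0ℚ ℚ.< α × HasPartition α n

-- Cardinalities are compared through the numbers k with k ≤ |S|, as A n is not
-- obviously decidable, so it cannot be assumed to be enumerated by a list.
-- For finite S and T these are the usual comparisons of |S| and |T|.
_≤∣_∣ : ℕ → Pred ℚ 0ℓ → Set
k ≤∣ S ∣ = ∃[ αs ] (Unique αs × All S αs × length αs ≡ k)

_<∣_∣ : ℝ → Pred ℚ 0ℓ → Set
x <∣ S ∣ = ∃[ k ] (k ≤∣ S ∣ × x <ᴿ fromℕ k)

∣_∣<_ : Pred ℚ 0ℓ → ℝ → Set
∣ S ∣< x = ∃[ k ] ((∀ j → j ≤∣ S ∣ → j ℕ.≤ k) × fromℕ k <ᴿ x)

∣_∣≤∣_∣ : Pred ℚ 0ℓ → Pred ℚ 0ℓ → Set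
∣ S ∣≤∣ T ∣ = ∀ k → k ≤∣ S ∣ → k ≤∣ T ∣

{-# OPTIONS --safe #-}
module Submission where

open import Defs
open import Data.Bool.Base using (Bool; true; false; not)
open import Data.Empty using (⊥; ⊥-elim)
import Data.Integer.Base as ℤ
open import Data.List.Base using (List; []; _∷_; _++_; map; length; foldr)
import Data.List.Membership.DecPropositional as DecMembership
open import Data.List.Membership.Propositional using (_∈_)
open import Data.List.Membership.Propositional.Properties
  using (∈-++⁺ˡ; ∈-++⁺ʳ; ∈-++⁻; ∈-∃++; ∈-map⁺; ∈-map⁻)
import Data.List.Properties as List
open import Data.List.Relation.Binary.Permutation.Propositional as ↭ using (_↭_)
import Data.List.Relation.Binary.Permutation.Propositional.Properties as ↭
open import Data.List.Relation.Unary.All as All using (All; []; _∷_)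
import Data.List.Relation.Unary.All.Properties as All
open import Data.List.Relation.Unary.AllPairs as AllPairs using ([]; _∷_)
open import Data.List.Relation.Unary.Any using (here; there)
open import Data.List.Relation.Unary.Unique.Propositional using (Unique)
import Data.List.Relation.Unary.Unique.Propositional.Properties as Unique
open import Data.Nat.Base as ℕ using (ℕ; zero; suc; _≤_; _<_; z≤n; s≤s)
open import Data.Nat.Divisibility using () renaming (_∣_ to _∣ⁿ_)
import Data.Nat.Divisibility as Div
import Data.Nat.DivMod as DivMod
open import Data.Nat.Induction using (<-rec)
open import Data.Nat.ListAction using (sum; product)
open import Data.Nat.ListAction.Properties using (sum-↭; sum-++)
open import Data.Nat.Primality using (Prime; prime?; euclidsLemma; prime⇒nonTrivial; prime⇒nonZero)
open import Data.Nat.Primality.Factorisation using (factorise)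
import Data.Nat.Properties as ℕ
open import Data.Nat.Tactic.RingSolver using () renaming (solve-∀ to ℕ-solve-∀)
open import Data.Product.Base using (∃-syntax; _×_; _,_; proj₁; proj₂)
open import Data.Rational.Base as ℚ using (ℚ; 0ℚ; 1ℚ; ½; _+_; _*_; _-_; -_; ∣_∣)
import Data.Rational.Properties as ℚ
open import Data.Sum.Base using (_⊎_; inj₁; inj₂)
open import Data.Vec.Base as Vec using (Vec; []; _∷_)
open import Function.Base using (_∘_; case_of_)
open import Level using (0ℓ)
open import Relation.Binary.PropositionalEquality hiding ([_]; J)
open import Relation.Nullary using (¬_; Dec; yes; no)
open import Relation.Nullary.Decidable using (True; toWitness; map′; _×-dec_; ¬?)
open import Relation.Nullary.Decidable.Core using (dec⇒maybe)
open import Relation.Unary using (Decidable)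
open import Tactic.RingSolver using (solve-∀)
open import Tactic.RingSolver.Core.AlmostCommutativeRing
  using (AlmostCommutativeRing; fromCommutativeRing)

-- Upper bound: the elements of B(n) are reciprocal sums of the q(n) partitions of n
-- into distinct parts, and q(n) + 1 ≤ x⁻ⁿ Π (1 + xᵏ) for 0 < x < 1. For
-- x⁻¹ = 1 + σ + σ²/2 the right side is at most exp (n σ + ζ(2) / 2σ), and σ = c / 2√n
-- makes the exponent c √n because ζ(2) ≤ π²/6 = c²/2; the summand 1 absorbs the
-- errors of all rational approximations. The bound on ζ(2) is obtained by halving
-- the angle in Σ 1 / sin² and using sin x ≤ x.
--
-- Lower bound: by Graham's doubling every m ≥ 92 is a sum of distinct 7-smooth numbers
-- whose reciprocals sum to 1. For a set S of numbers p and 2p, with p > 13 prime, the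
-- rational α = 1 + Σ_{s ∈ S} 1/s therefore has n_α ≤ 92 + Σ S, and S can be recovered
-- from α by reduction modulo the primes p. Half of the subsets of a set of k numbers
-- have at most half of the total sum. Chebyshev's estimate π(x) ≥ (x - 2) / log₂ x,
-- which comes from the Leibniz harmonic triangle, allows k² ≈ 12 n / log₂ n, and then
-- 2^k exceeds exp (c √(n / log n)) already without the help of η.

-- The upper bound has no o(1) to hide errors in, so ζ(2) ≤ π²/6 is needed with its exact constant,
-- for π defined as the least positive zero of sin; this is why sin and cos are developed as far as
-- their addition theorems. The lower bound has room: c² < 3.3 and log 2 > 11/16 suffice. Its
-- obstacle is the constant in Chebyshev's estimate. Primes p alone would give k² ≈ 8 n / log₂ n,
-- and the squared constant in the exponent of 2^k = exp (k log 2) would be 8 (log 2)³ ≈ 2.66, below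
-- c² ≈ 3.29; together with the numbers 2p it becomes 12 (log 2)³ ≈ 4.00. A power series is
-- evaluated along the diagonal, so its functional equations hold only in the limit. Identities are
-- therefore carried as sequences tending to 0, and each inequality is one between rational
-- approximations at a common index.

ℚ-ring : AlmostCommutativeRing 0ℓ 0ℓ
ℚ-ring = fromCommutativeRing ℚ.+-*-commutativeRing (λ x → dec⇒maybe (0ℚ ℚ.≟ x))

-- Inequalities over ℚ are proved by exhibiting the slack: b ≡ a + t is a ring
-- identity, and 0 ≤ t is assembled from the combinators below.

infixl 6 _⊕_ _⊕⁺_
infixl 7 _⊗_ _⊗⁺_

-- Ordered field arithmetic.

0≤_ 0<_ : ℚ → Set
0≤ x = 0ℚ ℚ.≤ x
0< x = 0ℚ ℚ.< x

by-slack : ∀ {a b t} → 0≤ t → b ≡ a + t → a ℚ.≤ b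
by-slack 0≤t refl = x≤x+y 0≤t

by-slack⁺ : ∀ {a b t} → 0< t → b ≡ a + t → a ℚ.< b
by-slack⁺ {a} {t = t} 0<t refl = subst (ℚ._< a + t) (ℚ.+-identityʳ a) (ℚ.+-monoʳ-< a 0<t)

_⊕_ : ∀ {a b} → 0≤ a → 0≤ b → 0≤ (a + b)
p ⊕ q = ℚ.≤-trans p (x≤x+y q)

_⊕⁺_ : ∀ {a b} → 0< a → 0≤ b → 0< (a + b)
p ⊕⁺ q = ℚ.<-≤-trans p (x≤x+y q)

_⊗_ : ∀ {a b} → 0≤ a → 0≤ b → 0≤ (a * b)
_⊗_ = *-0≤

_⊗⁺_ : ∀ {a b} → 0< a → 0< b → 0< (a * b)
_⊗⁺_ = *-0<

slack : ∀ {a b} → a ℚ.≤ b → 0≤ (b - a)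
slack {a} {b} p = subst (ℚ._≤ b - a) (ℚ.+-inverseʳ a) (ℚ.+-monoˡ-≤ (- a) p)

slack⁺ : ∀ {a b} → a ℚ.< b → 0< (b - a)
slack⁺ {a} {b} p = subst (ℚ._< b - a) (ℚ.+-inverseʳ a) (ℚ.+-monoˡ-< (- a) p)

unslack : ∀ {a b} → 0≤ (b - a) → a ℚ.≤ b
unslack {a} {b} p = by-slack p (eq a b)
  where eq : ∀ a b → b ≡ a + (b - a)
        eq = solve-∀ ℚ-ring

c≥0 : ∀ c {_ : True (0ℚ ℚ.≤? c)} → 0≤ c
c≥0 _ {p} = toWitness p

c>0 : ∀ c {_ : True (0ℚ ℚ.<? c)} → 0< c
c>0 _ {p} = toWitness p

sq≥0 : ∀ a → 0≤ (a * a)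
sq≥0 a with ℚ.≤-total 0ℚ a
... | inj₁ p = p ⊗ p
... | inj₂ p = subst 0≤_ (eq a) (q ⊗ q)
  where q = slack p
        eq : ∀ a → (0ℚ - a) * (0ℚ - a) ≡ a * a
        eq = solve-∀ ℚ-ring

<-weaken : ∀ {a b} → a ℚ.< b → a ℚ.≤ b
<-weaken = ℚ.<⇒≤

≤-*ʳ : ∀ {a b c} → 0≤ c → a ℚ.≤ b → a * c ℚ.≤ b * c
≤-*ʳ {c = c} 0≤c = ℚ.*-monoʳ-≤-nonNeg c {{ℚ.nonNegative 0≤c}}

≤-*ˡ : ∀ {a b c} → 0≤ c → a ℚ.≤ b → c * a ℚ.≤ c * b
≤-*ˡ {c = c} 0≤c = ℚ.*-monoˡ-≤-nonNeg c {{ℚ.nonNegative 0≤c}}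

≤-*-cancelʳ : ∀ {a b c} → 0< c → a * c ℚ.≤ b * c → a ℚ.≤ b
≤-*-cancelʳ {c = c} 0<c = ℚ.*-cancelʳ-≤-pos c {{ℚ.positive 0<c}}

≤-*-cancelˡ : ∀ {a b c} → 0< c → c * a ℚ.≤ c * b → a ℚ.≤ b
≤-*-cancelˡ {c = c} 0<c = ℚ.*-cancelˡ-≤-pos c {{ℚ.positive 0<c}}

≤-sq-cancel : ∀ {a b} → 0≤ b → a * a ℚ.≤ b * b → a ℚ.≤ b
≤-sq-cancel {a} {b} 0≤b h = ℚ.≮⇒≥ λ b<a →
  ℚ.<-irrefl refl (ℚ.<-≤-trans (by-slack⁺ (slack⁺ b<a ⊗⁺ (ℚ.≤-<-trans 0≤b b<a) ⊕⁺ (0≤b ⊗ <-weaken (slack⁺ b<a))) (eq a b)) h)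
  where eq : ∀ a b → a * a ≡ b * b + ((a - b) * a + b * (a - b))
        eq = solve-∀ ℚ-ring

∣∣≤ : ∀ {x y} → x ℚ.≤ y → - x ℚ.≤ y → ∣ x ∣ ℚ.≤ y
∣∣≤ {x} p q with ℚ.∣p∣≡p∨∣p∣≡-p x
... | inj₁ e = subst (ℚ._≤ _) (sym e) p
... | inj₂ e = subst (ℚ._≤ _) (sym e) q

x≤∣x∣ : ∀ x → x ℚ.≤ ∣ x ∣
x≤∣x∣ x with ℚ.≤-total 0ℚ x
... | inj₁ p = ℚ.≤-reflexive (sym (ℚ.0≤p⇒∣p∣≡p p))
... | inj₂ p = ℚ.≤-trans p (ℚ.0≤∣p∣ x)

-x≤∣x∣ : ∀ x → - x ℚ.≤ ∣ x ∣
-x≤∣x∣ x = subst (- x ℚ.≤_) (ℚ.∣-p∣≡∣p∣ x) (x≤∣x∣ (- x))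

∣-∣≤ : ∀ {a b e} → ∣ a - b ∣ ℚ.≤ e → a ℚ.≤ b + e
∣-∣≤ {a} {b} {e} p = by-slack (slack (ℚ.≤-trans (x≤∣x∣ (a - b)) p)) (eq a b e)
  where eq : ∀ a b e → b + e ≡ a + (e - (a - b))
        eq = solve-∀ ℚ-ring

∣-∣≥ : ∀ {a b e} → ∣ a - b ∣ ℚ.≤ e → b ℚ.≤ a + e
∣-∣≥ {a} {b} {e} p = ∣-∣≤ (subst (ℚ._≤ e) (∣-∣-comm a b) p)

-- An inverse without the instance argument of ℚ.1/_.
1/⁺ : ∀ {a} → 0< a → ∃[ b ] (0< b × a * b ≡ 1ℚ)
1/⁺ {a} 0<a = (ℚ.1/ a) {{ℚ.>-nonZero 0<a}}
  , ℚ.positive⁻¹ _ {{ℚ.1/pos⇒pos a {{ℚ.positive 0<a}}}}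
  , ℚ.*-inverseʳ a {{ℚ.>-nonZero 0<a}}

ℕ→ℚ-+ : ∀ m n → ℕ→ℚ (m ℕ.+ n) ≡ ℕ→ℚ m + ℕ→ℚ n
ℕ→ℚ-+ zero    n = sym (ℚ.+-identityˡ (ℕ→ℚ n))
ℕ→ℚ-+ (suc m) n = begin
  ℕ→ℚ (suc m ℕ.+ n)         ≡⟨ ℕ→ℚ-suc (m ℕ.+ n) ⟩
  1ℚ + ℕ→ℚ (m ℕ.+ n)        ≡⟨ cong (1ℚ +_) (ℕ→ℚ-+ m n) ⟩
  1ℚ + (ℕ→ℚ m + ℕ→ℚ n)      ≡⟨ sym (ℚ.+-assoc 1ℚ (ℕ→ℚ m) (ℕ→ℚ n)) ⟩
  1ℚ + ℕ→ℚ m + ℕ→ℚ n        ≡⟨ cong (_+ ℕ→ℚ n) (sym (ℕ→ℚ-suc m)) ⟩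
  ℕ→ℚ (suc m) + ℕ→ℚ n       ∎
  where open ≡-Reasoning

ℕ→ℚ-* : ∀ m n → ℕ→ℚ (m ℕ.* n) ≡ ℕ→ℚ m * ℕ→ℚ n
ℕ→ℚ-* zero    n = sym (ℚ.*-zeroˡ (ℕ→ℚ n))
ℕ→ℚ-* (suc m) n = begin
  ℕ→ℚ (n ℕ.+ m ℕ.* n)       ≡⟨ ℕ→ℚ-+ n (m ℕ.* n) ⟩
  ℕ→ℚ n + ℕ→ℚ (m ℕ.* n)     ≡⟨ cong (ℕ→ℚ n +_) (ℕ→ℚ-* m n) ⟩
  ℕ→ℚ n + ℕ→ℚ m * ℕ→ℚ n     ≡⟨ eq (ℕ→ℚ m) (ℕ→ℚ n) ⟩
  (1ℚ + ℕ→ℚ m) * ℕ→ℚ n      ≡⟨ cong (_* ℕ→ℚ n) (sym (ℕ→ℚ-suc m)) ⟩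
  ℕ→ℚ (suc m) * ℕ→ℚ n       ∎
  where open ≡-Reasoning
        eq : ∀ a b → b + a * b ≡ (1ℚ + a) * b
        eq = solve-∀ ℚ-ring

ℕ→ℚ-cancel-≤ : ∀ m n → ℕ→ℚ m ℚ.≤ ℕ→ℚ n → m ≤ n
ℕ→ℚ-cancel-≤ m n p = ℕ.≮⇒≥ λ n<m → ℚ.<-irrefl refl (ℚ.<-≤-trans
  (ℚ.<-≤-trans (by-slack⁺ (c>0 1ℚ) (trans (ℕ→ℚ-suc n) (ℚ.+-comm 1ℚ (ℕ→ℚ n)))) (ℕ→ℚ-mono n<m)) p)

ℕ→ℚ-injective : ∀ m n → ℕ→ℚ m ≡ ℕ→ℚ n → m ≡ n
ℕ→ℚ-injective m n e = ℕ.≤-antisym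
  (ℕ→ℚ-cancel-≤ m n (ℚ.≤-reflexive e)) (ℕ→ℚ-cancel-≤ n m (ℚ.≤-reflexive (sym e)))

1≤ℕ→ℚ-suc : ∀ n → 1ℚ ℚ.≤ ℕ→ℚ (suc n)
1≤ℕ→ℚ-suc n = by-slack (0≤ℕ→ℚ n) (ℕ→ℚ-suc n)

0≤1/ : ∀ k → 0≤ (1/ℕ suc k)
0≤1/ k = <-weaken (0<1/ k)

-- Powers and finite sums.

infixr 8 _^_

_^_ : ℚ → ℕ → ℚ
a ^ zero  = 1ℚ
a ^ suc n = a * a ^ n

^-≥0 : ∀ {a} → 0≤ a → ∀ n → 0≤ (a ^ n)
^-≥0 p zero    = c≥0 1ℚ
^-≥0 p (suc n) = p ⊗ ^-≥0 p n

^->0 : ∀ {a} → 0< a → ∀ n → 0< (a ^ n)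
^->0 p zero    = c>0 1ℚ
^->0 p (suc n) = p ⊗⁺ ^->0 p n

^-≤1 : ∀ {a} → 0≤ a → a ℚ.≤ 1ℚ → ∀ n → a ^ n ℚ.≤ 1ℚ
^-≤1 p q zero    = ℚ.≤-refl
^-≤1 {a} p q (suc n) = ℚ.≤-trans (≤-*ˡ p (^-≤1 p q n)) (subst (ℚ._≤ 1ℚ) (sym (ℚ.*-identityʳ a)) q)

1≤^ : ∀ {a} → 1ℚ ℚ.≤ a → ∀ n → 1ℚ ℚ.≤ a ^ n
1≤^ p zero    = ℚ.≤-refl
1≤^ {a} p (suc n) = ℚ.≤-trans (1≤^ p n) (subst (ℚ._≤ a ^ suc n) (ℚ.*-identityˡ (a ^ n)) (≤-*ʳ (^-≥0 (ℚ.≤-trans (c≥0 1ℚ) p) n) p))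

^-+ : ∀ a m n → a ^ (m ℕ.+ n) ≡ a ^ m * a ^ n
^-+ a zero    n = sym (ℚ.*-identityˡ (a ^ n))
^-+ a (suc m) n = trans (cong (a *_) (^-+ a m n)) (sym (ℚ.*-assoc a (a ^ m) (a ^ n)))

^-distrib-* : ∀ a b n → (a * b) ^ n ≡ a ^ n * b ^ n
^-distrib-* a b zero    = refl
^-distrib-* a b (suc n) = trans (cong (a * b *_) (^-distrib-* a b n)) (eq a b (a ^ n) (b ^ n))
  where eq : ∀ a b c d → a * b * (c * d) ≡ a * c * (b * d)
        eq = solve-∀ ℚ-ring

1^ : ∀ n → 1ℚ ^ n ≡ 1ℚ
1^ zero    = refl
1^ (suc n) = trans (ℚ.*-identityˡ (1ℚ ^ n)) (1^ n)

^-* : ∀ a m n → a ^ (m ℕ.* n) ≡ (a ^ m) ^ n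
^-* a zero    n = sym (1^ n)
^-* a (suc m) n = trans (^-+ a n (m ℕ.* n))
  (trans (cong (a ^ n *_) (^-* a m n)) (sym (^-distrib-* a (a ^ m) n)))

^-mono : ∀ {a b} → 0≤ a → a ℚ.≤ b → ∀ n → a ^ n ℚ.≤ b ^ n
^-mono p q zero    = ℚ.≤-refl
^-mono p q (suc n) = mono₂ p (^-≥0 (ℚ.≤-trans p q) n) q (^-mono p q n)

Σ : ℕ → (ℕ → ℚ) → ℚ
Σ zero    f = 0ℚ
Σ (suc n) f = Σ n f + f n

Σ-cong : ∀ n {f g} → (∀ i → f i ≡ g i) → Σ n f ≡ Σ n g
Σ-cong zero    h = refl
Σ-cong (suc n) h = cong₂ _+_ (Σ-cong n h) (h n)

Σ-mono : ∀ n {f g} → (∀ i → i < n → f i ℚ.≤ g i) → Σ n f ℚ.≤ Σ n g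
Σ-mono zero    h = ℚ.≤-refl
Σ-mono (suc n) h = ℚ.+-mono-≤ (Σ-mono n (λ i p → h i (ℕ.m≤n⇒m≤1+n p))) (h n ℕ.≤-refl)

Σ-≥0 : ∀ n {f} → (∀ i → i < n → 0≤ f i) → 0≤ Σ n f
Σ-≥0 zero    h = ℚ.≤-refl
Σ-≥0 (suc n) h = Σ-≥0 n (λ i p → h i (ℕ.m≤n⇒m≤1+n p)) ⊕ h n ℕ.≤-refl

Σ-+ : ∀ n f g → Σ n (λ i → f i + g i) ≡ Σ n f + Σ n g
Σ-+ zero    f g = refl
Σ-+ (suc n) f g = trans (cong (_+ (f n + g n)) (Σ-+ n f g)) (eq (Σ n f) (Σ n g) (f n) (g n))
  where eq : ∀ a b c d → a + b + (c + d) ≡ a + c + (b + d)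
        eq = solve-∀ ℚ-ring

Σ-*ˡ : ∀ n c f → Σ n (λ i → c * f i) ≡ c * Σ n f
Σ-*ˡ zero    c f = sym (ℚ.*-zeroʳ c)
Σ-*ˡ (suc n) c f = trans (cong (_+ c * f n) (Σ-*ˡ n c f)) (sym (ℚ.*-distribˡ-+ c (Σ n f) (f n)))

Σ-*ʳ : ∀ n c f → Σ n (λ i → f i * c) ≡ Σ n f * c
Σ-*ʳ n c f = trans (Σ-cong n (λ i → ℚ.*-comm (f i) c)) (trans (Σ-*ˡ n c f) (ℚ.*-comm c (Σ n f)))

Σ-0 : ∀ n → Σ n (λ _ → 0ℚ) ≡ 0ℚ
Σ-0 zero    = refl
Σ-0 (suc n) = trans (ℚ.+-identityʳ _) (Σ-0 n)

Σ-swap : ∀ m n (f : ℕ → ℕ → ℚ) → Σ m (λ i → Σ n (f i)) ≡ Σ n (λ j → Σ m (λ i → f i j))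
Σ-swap zero    n f = sym (Σ-0 n)
Σ-swap (suc m) n f = trans (cong (_+ Σ n (f m)) (Σ-swap m n f)) (sym (Σ-+ n _ (f m)))

Σ-front : ∀ n f → Σ (suc n) f ≡ f 0 + Σ n (f ∘ suc)
Σ-front zero    f = ℚ.+-comm 0ℚ (f 0)
Σ-front (suc n) f = trans (cong (_+ f (suc n)) (Σ-front n f)) (ℚ.+-assoc (f 0) _ _)

Σ-split : ∀ m n f → Σ (m ℕ.+ n) f ≡ Σ m f + Σ n (λ i → f (m ℕ.+ i))
Σ-split m zero    f = trans (cong (λ k → Σ k f) (ℕ.+-identityʳ m)) (sym (ℚ.+-identityʳ _))
Σ-split m (suc n) f = trans (cong (λ k → Σ k f) (ℕ.+-suc m n))
  (trans (cong (_+ f (m ℕ.+ n)) (Σ-split m n f)) (ℚ.+-assoc (Σ m f) _ _))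

Σ-reverse : ∀ n f → Σ n (λ i → f (n ℕ.∸ suc i)) ≡ Σ n f
Σ-reverse zero    f = refl
Σ-reverse (suc n) f = trans (Σ-front n (λ i → f (n ℕ.∸ i)))
  (trans (cong (λ z → f n + z) (Σ-reverse n f)) (ℚ.+-comm (f n) _))

Σ-∣∣ : ∀ n f → ∣ Σ n f ∣ ℚ.≤ Σ n (λ i → ∣ f i ∣)
Σ-∣∣ zero    f = ℚ.≤-refl
Σ-∣∣ (suc n) f = ℚ.≤-trans (ℚ.∣p+q∣≤∣p∣+∣q∣ (Σ n f) (f n)) (ℚ.+-monoˡ-≤ ∣ f n ∣ (Σ-∣∣ n f))

Σ-≤-extend : ∀ {m n} {f} → (∀ i → 0≤ f i) → m ≤ n → Σ m f ℚ.≤ Σ n f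
Σ-≤-extend {n = n} h z≤n = Σ-≥0 n (λ i _ → h i)
Σ-≤-extend {suc m} {suc n} {f} h (s≤s p) =
  subst₂ ℚ._≤_ (sym (Σ-front m f)) (sym (Σ-front n f))
    (ℚ.+-monoʳ-≤ (f 0) (Σ-≤-extend (λ i → h (suc i)) p))

⊔≤ˡ : ∀ m n {o} → m ℕ.⊔ n ≤ o → m ≤ o
⊔≤ˡ m n = ℕ.m⊔n≤o⇒m≤o m n

⊔≤ʳ : ∀ m n {o} → m ℕ.⊔ n ≤ o → n ≤ o
⊔≤ʳ m n = ℕ.m⊔n≤o⇒n≤o m n

-- Convolution of coefficient sequences

conv : (ℕ → ℚ) → (ℕ → ℚ) → ℕ → ℚ
conv f g zero    = f 0 * g 0
conv f g (suc n) = f 0 * g (suc n) + conv (f ∘ suc) g n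

conv-cong : ∀ {f f′ g g′} → (∀ i → f i ≡ f′ i) → (∀ i → g i ≡ g′ i) → ∀ n → conv f g n ≡ conv f′ g′ n
conv-cong p q zero    = cong₂ _*_ (p 0) (q 0)
conv-cong p q (suc n) = cong₂ _+_ (cong₂ _*_ (p 0) (q (suc n))) (conv-cong (λ i → p (suc i)) q n)

conv-+ˡ : ∀ f f′ g n → conv (λ i → f i + f′ i) g n ≡ conv f g n + conv f′ g n
conv-+ˡ f f′ g zero    = ℚ.*-distribʳ-+ (g 0) (f 0) (f′ 0)
conv-+ˡ f f′ g (suc n) = trans (cong (λ z → (f 0 + f′ 0) * g (suc n) + z) (conv-+ˡ (f ∘ suc) (f′ ∘ suc) g n))
  (eq (f 0) (f′ 0) (g (suc n)) (conv (f ∘ suc) g n) (conv (f′ ∘ suc) g n))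
  where eq : ∀ a b c d e → (a + b) * c + (d + e) ≡ a * c + d + (b * c + e)
        eq = solve-∀ ℚ-ring

conv-*ˡ : ∀ c f g n → conv (λ i → c * f i) g n ≡ c * conv f g n
conv-*ˡ c f g zero    = ℚ.*-assoc c (f 0) (g 0)
conv-*ˡ c f g (suc n) = trans (cong (λ z → c * f 0 * g (suc n) + z) (conv-*ˡ c (f ∘ suc) g n))
  (eq c (f 0) (g (suc n)) (conv (f ∘ suc) g n))
  where eq : ∀ a b c d → a * b * c + a * d ≡ a * (b * c + d)
        eq = solve-∀ ℚ-ring

-- `conv` recurses on its first argument; the mirrored recursion makes commutativity an induction.
conv-snoc : ∀ f g n → conv f g (suc n) ≡ conv f (g ∘ suc) n + f (suc n) * g 0
conv-snoc f g zero    = refl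
conv-snoc f g (suc n) = trans (cong (λ z → f 0 * g (suc (suc n)) + z) (conv-snoc (f ∘ suc) g n))
  (sym (ℚ.+-assoc (f 0 * g (suc (suc n))) (conv (f ∘ suc) (g ∘ suc) n) _))

conv-comm : ∀ f g n → conv f g n ≡ conv g f n
conv-comm f g zero    = ℚ.*-comm (f 0) (g 0)
conv-comm f g (suc n) = trans (cong (λ z → f 0 * g (suc n) + z) (conv-comm (f ∘ suc) g n))
  (trans (eq (f 0) (g (suc n)) (conv g (f ∘ suc) n)) (sym (conv-snoc g f n)))
  where eq : ∀ a b c → a * b + c ≡ c + b * a
        eq = solve-∀ ℚ-ring

conv-assoc : ∀ f g h n → conv (conv f g) h n ≡ conv f (conv g h) n
conv-assoc f g h zero    = ℚ.*-assoc (f 0) (g 0) (h 0)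
conv-assoc f g h (suc n) = begin
  f 0 * g 0 * h (suc n) + conv (λ i → f 0 * g (suc i) + conv (f ∘ suc) g i) h n
    ≡⟨ cong (λ z → f 0 * g 0 * h (suc n) + z) (trans (conv-+ˡ (λ i → f 0 * g (suc i)) (conv (f ∘ suc) g) h n)
         (cong₂ _+_ (conv-*ˡ (f 0) (g ∘ suc) h n) (conv-assoc (f ∘ suc) g h n))) ⟩
  f 0 * g 0 * h (suc n) + (f 0 * conv (g ∘ suc) h n + conv (f ∘ suc) (conv g h) n)
    ≡⟨ eq (f 0) (g 0) (h (suc n)) (conv (g ∘ suc) h n) (conv (f ∘ suc) (conv g h) n) ⟩
  f 0 * (g 0 * h (suc n) + conv (g ∘ suc) h n) + conv (f ∘ suc) (conv g h) n ∎
  where open ≡-Reasoning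
        eq : ∀ a b c d e → a * b * c + (a * d + e) ≡ a * (b * c + d) + e
        eq = solve-∀ ℚ-ring

conv-≥0 : ∀ {f g} → (∀ i → 0≤ f i) → (∀ i → 0≤ g i) → ∀ n → 0≤ conv f g n
conv-≥0 p q zero    = p 0 ⊗ q 0
conv-≥0 p q (suc n) = p 0 ⊗ q (suc n) ⊕ conv-≥0 (λ i → p (suc i)) q n

-- The coefficients of x f′(x).
D : (ℕ → ℚ) → ℕ → ℚ
D f i = ℕ→ℚ i * f i

-- The Leibniz rule for x d/dx. With it, identities between power series reduce to first-order
-- recurrences for their coefficients.
D-conv : ∀ f g n → D (conv f g) n ≡ conv (D f) g n + conv f (D g) n
D-conv f g zero    = eq (f 0) (g 0)
  where eq : ∀ a b → 0ℚ * (a * b) ≡ 0ℚ * a * b + a * (0ℚ * b)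
        eq = solve-∀ ℚ-ring
D-conv f g (suc n) = begin
  ℕ→ℚ (suc n) * (f 0 * g (suc n) + conv f′ g n)
    ≡⟨ cong (λ z → z * (f 0 * g (suc n) + conv f′ g n)) (ℕ→ℚ-suc n) ⟩
  (1ℚ + ℕ→ℚ n) * (f 0 * g (suc n) + conv f′ g n)
    ≡⟨ eq (ℕ→ℚ n) (f 0) (g (suc n)) (conv f′ g n) ⟩
  f 0 * ((1ℚ + ℕ→ℚ n) * g (suc n)) + (conv f′ g n + ℕ→ℚ n * conv f′ g n)
    ≡⟨ cong₂ (λ y z → f 0 * (y * g (suc n)) + (conv f′ g n + z)) (sym (ℕ→ℚ-suc n)) (D-conv f′ g n) ⟩
  f 0 * D g (suc n) + (conv f′ g n + (conv (D f′) g n + conv f′ (D g) n))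
    ≡⟨ eq′ (f 0) (g (suc n)) (D g (suc n)) (conv f′ g n) (conv (D f′) g n) (conv f′ (D g) n) ⟩
  0ℚ * f 0 * g (suc n) + (conv f′ g n + conv (D f′) g n) + (f 0 * D g (suc n) + conv f′ (D g) n)
    ≡⟨ cong (λ z → 0ℚ * f 0 * g (suc n) + z + (f 0 * D g (suc n) + conv f′ (D g) n))
         (trans (sym (conv-+ˡ f′ (D f′) g n)) (conv-cong (λ i → shift i) (λ _ → refl) n)) ⟩
  0ℚ * f 0 * g (suc n) + conv (D f ∘ suc) g n + (f 0 * D g (suc n) + conv f′ (D g) n) ∎
  where
  open ≡-Reasoning
  f′ = f ∘ suc
  eq : ∀ n a b c → (1ℚ + n) * (a * b + c) ≡ a * ((1ℚ + n) * b) + (c + n * c)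
  eq = solve-∀ ℚ-ring
  eq′ : ∀ a b b′ c d e → a * b′ + (c + (d + e)) ≡ 0ℚ * a * b + (c + d) + (a * b′ + e)
  eq′ = solve-∀ ℚ-ring
  eq″ : ∀ n a → a + n * a ≡ (1ℚ + n) * a
  eq″ = solve-∀ ℚ-ring
  shift : ∀ i → f′ i + D f′ i ≡ D f (suc i)
  shift i = trans (eq″ (ℕ→ℚ i) (f′ i)) (cong (_* f′ i) (sym (ℕ→ℚ-suc i)))

-- The part of the product of the n-th partial sums lying outside the triangle.
excess : ℕ → (ℕ → ℚ) → (ℕ → ℚ) → ℚ
excess zero    f g = 0ℚ
excess (suc n) f g = excess n (f ∘ suc) g + Σ n (f ∘ suc) * g n

Σ-conv-suc : ∀ n f g → Σ (suc n) (conv f g) ≡ f 0 * Σ (suc n) g + Σ n (conv (f ∘ suc) g)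
Σ-conv-suc n f g = begin
  Σ (suc n) (conv f g)
    ≡⟨ Σ-front n (conv f g) ⟩
  f 0 * g 0 + Σ n (λ i → f 0 * g (suc i) + conv (f ∘ suc) g i)
    ≡⟨ cong (λ z → f 0 * g 0 + z) (trans (Σ-+ n _ _) (cong (_+ Σ n (conv (f ∘ suc) g)) (Σ-*ˡ n (f 0) (g ∘ suc)))) ⟩
  f 0 * g 0 + (f 0 * Σ n (g ∘ suc) + Σ n (conv (f ∘ suc) g))
    ≡⟨ eq (f 0) (g 0) (Σ n (g ∘ suc)) _ ⟩
  f 0 * (g 0 + Σ n (g ∘ suc)) + Σ n (conv (f ∘ suc) g)
    ≡⟨ cong (λ z → f 0 * z + Σ n (conv (f ∘ suc) g)) (sym (Σ-front n g)) ⟩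
  f 0 * Σ (suc n) g + Σ n (conv (f ∘ suc) g) ∎
  where open ≡-Reasoning
        eq : ∀ a b c d → a * b + (a * c + d) ≡ a * (b + c) + d
        eq = solve-∀ ℚ-ring

Σ*Σ : ∀ n f g → Σ n f * Σ n g ≡ Σ n (conv f g) + excess n f g
Σ*Σ zero    f g = refl
Σ*Σ (suc n) f g = begin
  Σ (suc n) f * Σ (suc n) g
    ≡⟨ cong (_* Σ (suc n) g) (Σ-front n f) ⟩
  (f 0 + Σ n f′) * (Σ n g + g n)
    ≡⟨ eq (f 0) (Σ n f′) (Σ n g) (g n) ⟩
  f 0 * (Σ n g + g n) + (Σ n f′ * Σ n g) + Σ n f′ * g n
    ≡⟨ cong (λ z → f 0 * (Σ n g + g n) + z + Σ n f′ * g n) (Σ*Σ n f′ g) ⟩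
  f 0 * (Σ n g + g n) + (Σ n (conv f′ g) + excess n f′ g) + Σ n f′ * g n
    ≡⟨ eq′ (f 0 * (Σ n g + g n)) (Σ n (conv f′ g)) (excess n f′ g) (Σ n f′ * g n) ⟩
  f 0 * (Σ n g + g n) + Σ n (conv f′ g) + (excess n f′ g + Σ n f′ * g n)
    ≡⟨ cong (_+ (excess n f′ g + Σ n f′ * g n)) (sym (Σ-conv-suc n f g)) ⟩
  Σ (suc n) (conv f g) + (excess n f′ g + Σ n f′ * g n) ∎
  where open ≡-Reasoning
        f′ = f ∘ suc
        eq : ∀ a b c d → (a + b) * (c + d) ≡ a * (c + d) + b * c + b * d
        eq = solve-∀ ℚ-ring
        eq′ : ∀ a b c d → a + (b + c) + d ≡ a + b + (c + d)
        eq′ = solve-∀ ℚ-ring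

excess-≥0 : ∀ n {f g} → (∀ i → 0≤ f i) → (∀ i → 0≤ g i) → 0≤ excess n f g
excess-≥0 zero    p q = ℚ.≤-refl
excess-≥0 (suc n) p q = excess-≥0 n (λ i → p (suc i)) q ⊕ Σ-≥0 n (λ i _ → p (suc i)) ⊗ q n

excess-∣∣ : ∀ n {f g F G} → (∀ i → ∣ f i ∣ ℚ.≤ F i) → (∀ i → ∣ g i ∣ ℚ.≤ G i) →
            ∣ excess n f g ∣ ℚ.≤ excess n F G
excess-∣∣ zero    p q = ℚ.≤-refl
excess-∣∣ (suc n) {f} {g} {F} {G} p q = ℚ.≤-trans (ℚ.∣p+q∣≤∣p∣+∣q∣ (excess n (f ∘ suc) g) (Σ n (f ∘ suc) * g n))
  (ℚ.+-mono-≤ (excess-∣∣ n (λ i → p (suc i)) q)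
    (subst (ℚ._≤ Σ n (F ∘ suc) * G n) (sym (ℚ.∣p*q∣≡∣p∣*∣q∣ (Σ n (f ∘ suc)) (g n)))
      (mono₂ (ℚ.0≤∣p∣ (Σ n (f ∘ suc))) (ℚ.≤-trans (ℚ.0≤∣p∣ (g n)) (q n))
        (ℚ.≤-trans (Σ-∣∣ n (f ∘ suc)) (Σ-mono n (λ i _ → p (suc i)))) (q n))))

-- The triangle p + q < m + n contains the m × n rectangle of products.
Σ*Σ≤Σ-conv : ∀ m n {f g} → (∀ i → 0≤ f i) → (∀ i → 0≤ g i) →
             Σ m f * Σ n g ℚ.≤ Σ (m ℕ.+ n) (conv f g)
Σ*Σ≤Σ-conv zero    n {f} {g} p q = subst (ℚ._≤ Σ n (conv f g)) (sym (ℚ.*-zeroˡ (Σ n g)))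
  (Σ-≥0 n (λ i _ → conv-≥0 p q i))
Σ*Σ≤Σ-conv (suc m) n {f} {g} p q = subst₂ ℚ._≤_
  (sym (trans (cong (_* Σ n g) (Σ-front m f)) (ℚ.*-distribʳ-+ (Σ n g) (f 0) (Σ m (f ∘ suc)))))
  (sym (Σ-conv-suc (m ℕ.+ n) f g))
  (ℚ.+-mono-≤ (≤-*ˡ (p 0) (Σ-≤-extend q (ℕ.m≤n+m n (suc m))))
    (Σ*Σ≤Σ-conv m n (λ i → p (suc i)) q))

-- Partial sums of the exponential series

D-powOverFact : ∀ a i → D (powOverFact a) (suc i) ≡ a * powOverFact a i
D-powOverFact a i = trans (eq (ℕ→ℚ (suc i)) (powOverFact a i) a (1/ℕ suc i))
  (trans (cong (λ z → z * (a * powOverFact a i)) (suc*1/ i)) (ℚ.*-identityˡ _))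
  where eq : ∀ n p a r → n * (p * (a * r)) ≡ n * r * (a * p)
        eq = solve-∀ ℚ-ring

suc-cancel : ∀ n {x y} → ℕ→ℚ (suc n) * x ≡ ℕ→ℚ (suc n) * y → x ≡ y
suc-cancel n {x} {y} e = trans (eq x) (trans (cong ((1/ℕ suc n) *_) e) (sym (eq y)))
  where eq′ : ∀ n r z → n * r * z ≡ r * (n * z)
        eq′ = solve-∀ ℚ-ring
        eq : ∀ z → z ≡ (1/ℕ suc n) * (ℕ→ℚ (suc n) * z)
        eq z = trans (sym (ℚ.*-identityˡ z)) (trans (cong (_* z) (sym (suc*1/ n))) (eq′ (ℕ→ℚ (suc n)) (1/ℕ suc n) z))

-- The binomial theorem as exp (a x) exp (b x) = exp ((a + b) x): both sides solve the same
-- first-order differential equation with constant term 1.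
binomial : ∀ a b n → conv (powOverFact a) (powOverFact b) n ≡ powOverFact (a + b) n
binomial a b zero    = refl
binomial a b (suc n) = suc-cancel n (begin
  D (conv P Q) (suc n)
    ≡⟨ D-conv P Q (suc n) ⟩
  0ℚ * 1ℚ * Q (suc n) + conv (D P ∘ suc) Q n + conv P (D Q) (suc n)
    ≡⟨ cong₂ (λ y z → 0ℚ * 1ℚ * Q (suc n) + y + z)
         (trans (conv-cong (D-powOverFact a) (λ _ → refl) n) (conv-*ˡ a P Q n))
         (trans (conv-snoc P (D Q) n) (cong (_+ P (suc n) * (0ℚ * 1ℚ))
           (trans (conv-comm P (D Q ∘ suc) n) (trans (conv-cong (D-powOverFact b) (λ _ → refl) n)
             (trans (conv-*ˡ b Q P n) (cong (b *_) (conv-comm Q P n))))))) ⟩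
  0ℚ * 1ℚ * Q (suc n) + a * conv P Q n + (b * conv P Q n + P (suc n) * (0ℚ * 1ℚ))
    ≡⟨ eq a b (conv P Q n) (P (suc n)) (Q (suc n)) ⟩
  (a + b) * conv P Q n
    ≡⟨ cong ((a + b) *_) (binomial a b n) ⟩
  (a + b) * powOverFact (a + b) n
    ≡⟨ sym (D-powOverFact (a + b) n) ⟩
  D (powOverFact (a + b)) (suc n) ∎)
  where open ≡-Reasoning
        P = powOverFact a
        Q = powOverFact b
        eq : ∀ a b c p q → 0ℚ * 1ℚ * q + a * c + (b * c + p * (0ℚ * 1ℚ)) ≡ (a + b) * c
        eq = solve-∀ ℚ-ring

powOverFact-≥0 : ∀ {a} → 0≤ a → ∀ k → 0≤ powOverFact a k
powOverFact-≥0 p zero    = c≥0 1ℚ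
powOverFact-≥0 p (suc k) = powOverFact-≥0 p k ⊗ (p ⊗ 0≤1/ k)

powOverFact-mono : ∀ {a b} → 0≤ a → a ℚ.≤ b → ∀ k → powOverFact a k ℚ.≤ powOverFact b k
powOverFact-mono p q zero    = ℚ.≤-refl
powOverFact-mono p q (suc k) = mono₂ (powOverFact-≥0 p k) (ℚ.≤-trans p q ⊗ 0≤1/ k)
  (powOverFact-mono p q k) (≤-*ʳ (0≤1/ k) q)

expSum : ℚ → ℕ → ℚ
expSum a n = Σ n (powOverFact a)

partialSum≡Σ : ∀ s x n → partialSum s x n ≡ Σ n (λ k → s k * powOverFact x k)
partialSum≡Σ s x zero    = refl
partialSum≡Σ s x (suc n) = cong (_+ s n * powOverFact x n) (partialSum≡Σ s x n)

partialSum≡expSum : ∀ x n → partialSum (λ _ → 1ℚ) x n ≡ expSum x n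
partialSum≡expSum x n = trans (partialSum≡Σ _ x n) (Σ-cong n (λ i → ℚ.*-identityˡ _))

expSum-mono : ∀ {a b m n} → 0≤ a → a ℚ.≤ b → m ≤ n → expSum a m ℚ.≤ expSum b n
expSum-mono {m = m} p q r = ℚ.≤-trans (Σ-mono m (λ i _ → powOverFact-mono p q i))
  (Σ-≤-extend (powOverFact-≥0 (ℚ.≤-trans p q)) r)

expSum-≥0 : ∀ {a} → 0≤ a → ∀ n → 0≤ expSum a n
expSum-≥0 p n = Σ-≥0 n (λ i _ → powOverFact-≥0 p i)

expSum-*-≤ : ∀ {a b} → 0≤ a → 0≤ b → ∀ m n → expSum a m * expSum b n ℚ.≤ expSum (a + b) (m ℕ.+ n)
expSum-*-≤ {a} {b} p q m n = subst (expSum a m * expSum b n ℚ.≤_) (Σ-cong (m ℕ.+ n) (binomial a b))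
  (Σ*Σ≤Σ-conv m n (powOverFact-≥0 p) (powOverFact-≥0 q))

expSum-* : ∀ a b n → expSum a n * expSum b n ≡ expSum (a + b) n + excess n (powOverFact a) (powOverFact b)
expSum-* a b n = trans (Σ*Σ n _ _) (cong (_+ excess n (powOverFact a) (powOverFact b)) (Σ-cong n (binomial a b)))

expSum-+-≤ : ∀ {a b} → 0≤ a → 0≤ b → ∀ n → expSum (a + b) n ℚ.≤ expSum a n * expSum b n
expSum-+-≤ {a} {b} p q n = by-slack (excess-≥0 n (powOverFact-≥0 p) (powOverFact-≥0 q)) (expSum-* a b n)

expSum-multiple : ∀ {a} → 0≤ a → ∀ j n → expSum (ℕ→ℚ j * a) (suc n) ℚ.≤ expSum a (suc n) ^ j
expSum-multiple {a} p zero    n = ℚ.≤-reflexive (trans (cong (λ z → expSum z (suc n)) (ℚ.*-zeroˡ a)) (at0 n))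
  where
  term0 : ∀ k → powOverFact 0ℚ (suc k) ≡ 0ℚ
  term0 k = trans (cong (powOverFact 0ℚ k *_) (ℚ.*-zeroˡ (1/ℕ suc k))) (ℚ.*-zeroʳ (powOverFact 0ℚ k))
  at0 : ∀ n → expSum 0ℚ (suc n) ≡ 1ℚ
  at0 n = trans (Σ-front n _) (cong (1ℚ +_) (trans (Σ-cong n term0) (Σ-0 n)))
expSum-multiple {a} p (suc j) n = ℚ.≤-trans
  (ℚ.≤-trans (ℚ.≤-reflexive (cong (λ z → expSum z (suc n)) (trans (cong (_* a) (ℕ→ℚ-suc j)) (eq a (ℕ→ℚ j)))))
    (expSum-+-≤ p (0≤ℕ→ℚ j ⊗ p) (suc n)))
  (≤-*ˡ (expSum-≥0 p (suc n)) (expSum-multiple p j n))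
  where eq : ∀ a j → (1ℚ + j) * a ≡ a + j * a
        eq = solve-∀ ℚ-ring

∣coeff∣ : ∀ {s x y} → ∣ s ∣ ℚ.≤ 1ℚ → ∣ x ∣ ℚ.≤ y → ∣ s * x ∣ ℚ.≤ y
∣coeff∣ {s} {x} {y} p q = subst₂ ℚ._≤_ (sym (ℚ.∣p*q∣≡∣p∣*∣q∣ s x)) (ℚ.*-identityˡ y)
  (mono₂ (ℚ.0≤∣p∣ s) (ℚ.≤-trans (ℚ.0≤∣p∣ x) q) p q)

Majorant-E≡expSum : ∀ M n → Majorant.E M n ≡ expSum (ℕ→ℚ M) n
Majorant-E≡expSum M zero    = refl
Majorant-E≡expSum M (suc n) = cong (_+ powOverFact (ℕ→ℚ M) n) (Majorant-E≡expSum M n)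

-- Twice the first omitted term. It bounds the remainder of the series at M once n ≥ 2 M, because
-- from there on each term is at most half of the preceding one.
tail : ℕ → ℕ → ℚ
tail M n = powOverFact (ℕ→ℚ M) n + powOverFact (ℕ→ℚ M) n

abstract
 tail-small : ∀ M ε → 0< ε → ∃[ K ] (∀ n → K ≤ n → tail M n ℚ.< ε)
 tail-small M ε 0<ε =
   let (K , hK) = small (Majorant.D M) ε 0<ε
   in suc (K ℕ.⊔ (M ℕ.+ M)) , λ { (suc n) (s≤s p) →
        ℚ.≤-<-trans (Majorant.2w≤ M n (⊔≤ʳ K (M ℕ.+ M) p)) (hK n (⊔≤ˡ K (M ℕ.+ M) p)) }

expSum-tail : ∀ M {m n} → M ℕ.+ M ≤ m → m ≤ n → expSum (ℕ→ℚ M) n - expSum (ℕ→ℚ M) m ℚ.≤ tail M m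
expSum-tail M {m} {n} p q = subst₂ (λ x y → x - y ℚ.≤ tail M m) (Majorant-E≡expSum M n) (Majorant-E≡expSum M m)
  (Majorant.E-tail M (λ _ → 1ℚ) (λ _ → ℚ.≤-refl) p q)

partialSum-tail : ∀ M s → (∀ k → ∣ s k ∣ ℚ.≤ 1ℚ) → ∀ {x m n} → ∣ x ∣ ℚ.≤ ℕ→ℚ M → M ℕ.+ M ≤ m → m ≤ n →
                  ∣ partialSum s x n - partialSum s x m ∣ ℚ.≤ tail M m
partialSum-tail M s hs hx p q = ℚ.≤-trans (Majorant.sum-tail M s hs hx (ℕ.≤⇒≤′ q))
  (Majorant.E-tail M s hs p q)

abstract
 partialSum-uniform : ∀ M s → (∀ k → ∣ s k ∣ ℚ.≤ 1ℚ) → ∀ ε → 0< ε → ∃[ K ] (∀ x m n → ∣ x ∣ ℚ.≤ ℕ→ℚ M →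
                      K ≤ m → K ≤ n → ∣ partialSum s x m - partialSum s x n ∣ ℚ.< ε)
 partialSum-uniform M s hs ε 0<ε =
   let (T , hT) = tail-small M ε 0<ε
       T≤ = λ k → ⊔≤ˡ T (M ℕ.+ M) {k}
       M≤ = λ k → ⊔≤ʳ T (M ℕ.+ M) {k}
   in T ℕ.⊔ (M ℕ.+ M) , λ x m n hx p q → case ℕ.≤-total m n of λ where
     (inj₁ r) → ℚ.≤-<-trans (subst (ℚ._≤ tail M m) (∣-∣-comm (partialSum s x n) (partialSum s x m))
                  (partialSum-tail M s hs hx (M≤ m p) r)) (hT m (T≤ m p))
     (inj₂ r) → ℚ.≤-<-trans (partialSum-tail M s hs hx (M≤ n q) r) (hT n (T≤ n q))

-- For the majorants, the excess is the square of the n-th partial sum of exp M minus the n-th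
-- partial sum of exp (2 M). The square is at most the partial sum of length 2 n at 2 M, so only a
-- tail of exp (2 M) remains.
excess-bound : ∀ M {n} {f g} → (∀ i → ∣ f i ∣ ℚ.≤ powOverFact (ℕ→ℚ M) i) → (∀ i → ∣ g i ∣ ℚ.≤ powOverFact (ℕ→ℚ M) i) →
               (M ℕ.+ M) ℕ.+ (M ℕ.+ M) ≤ n → ∣ excess n f g ∣ ℚ.≤ tail (M ℕ.+ M) n
excess-bound M {n} {f} {g} p q r = begin
  ∣ excess n f g ∣                           ≤⟨ excess-∣∣ n p q ⟩
  excess n W W                               ≤⟨ by-slack (slack (expSum-*-≤ (0≤ℕ→ℚ M) (0≤ℕ→ℚ M) n n)) (eq (expSum M′ n * expSum M′ n) (expSum (M′ + M′) (n ℕ.+ n)) (expSum (M′ + M′) n) (excess n W W) (expSum-* M′ M′ n)) ⟩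
  expSum (M′ + M′) (n ℕ.+ n) - expSum (M′ + M′) n
                                             ≡⟨ cong (λ z → expSum z (n ℕ.+ n) - expSum z n) (sym (ℕ→ℚ-+ M M)) ⟩
  expSum (ℕ→ℚ (M ℕ.+ M)) (n ℕ.+ n) - expSum (ℕ→ℚ (M ℕ.+ M)) n
                                             ≤⟨ expSum-tail (M ℕ.+ M) r (ℕ.m≤m+n n n) ⟩
  tail (M ℕ.+ M) n                           ∎
  where
  open ℚ.≤-Reasoning
  M′ = ℕ→ℚ M
  W  = powOverFact M′
  eq₀ : ∀ y z w → y - z ≡ w + (y - (z + w))
  eq₀ = solve-∀ ℚ-ring
  eq : ∀ x y z w → x ≡ z + w → y - z ≡ w + (y - x)
  eq x y z w refl = eq₀ y z w

-- The logarithm series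

logCoeff : ℚ → ℕ → ℚ
logCoeff y zero    = 0ℚ
logCoeff y (suc i) = y ^ suc i * (1/ℕ suc i)

-- The coefficients of (Σ_k yᵏ tᵏ / k)ʲ / j! in t.
expLog : ℚ → ℕ → ℕ → ℚ
expLog y zero    zero    = 1ℚ
expLog y zero    (suc n) = 0ℚ
expLog y (suc j) n       = (1/ℕ suc j) * conv (logCoeff y) (expLog y j) n

conv-cong-≤ : ∀ n {f f′ g g′} → (∀ i → f i ≡ f′ i) → (∀ i → i ≤ n → g i ≡ g′ i) → conv f g n ≡ conv f′ g′ n
conv-cong-≤ zero    p q = cong₂ _*_ (p 0) (q 0 z≤n)
conv-cong-≤ (suc n) p q = cong₂ _+_ (cong₂ _*_ (p 0) (q (suc n) ℕ.≤-refl))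
  (conv-cong-≤ n (λ i → p (suc i)) (λ i r → q i (ℕ.m≤n⇒m≤1+n r)))

conv-*ʳ : ∀ c f g n → conv f (λ i → c * g i) n ≡ c * conv f g n
conv-*ʳ c f g n = trans (conv-comm f _ n) (trans (conv-*ˡ c g f n) (cong (c *_) (conv-comm g f n)))

conv-0ʳ : ∀ f n → conv f (λ _ → 0ℚ) n ≡ 0ℚ
conv-0ʳ f n = trans (conv-cong (λ _ → refl) (λ _ → sym (ℚ.*-zeroˡ 0ℚ)) n)
  (trans (conv-*ʳ 0ℚ f (λ _ → 0ℚ) n) (ℚ.*-zeroˡ (conv f (λ _ → 0ℚ) n)))

conv-Σʳ : ∀ J f (g : ℕ → ℕ → ℚ) n → conv f (λ i → Σ J (λ j → g j i)) n ≡ Σ J (λ j → conv f (g j) n)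
conv-Σʳ zero    f g n = conv-0ʳ f n
conv-Σʳ (suc J) f g n = trans (conv-comm f _ n) (trans (conv-+ˡ _ (g J) f n)
  (cong₂ _+_ (trans (conv-comm _ f n) (conv-Σʳ J f g n)) (conv-comm (g J) f n)))

D-logCoeff : ∀ y i → D (logCoeff y) (suc i) ≡ y ^ suc i
D-logCoeff y i = trans (eq (ℕ→ℚ (suc i)) (y ^ suc i) (1/ℕ suc i))
  (trans (cong (_* y ^ suc i) (suc*1/ i)) (ℚ.*-identityˡ _))
  where eq : ∀ n p r → n * (p * r) ≡ n * r * p
        eq = solve-∀ ℚ-ring

-- For the series L of logarithm coefficients, x d/dx of L^(j+1) / (j+1)! is (x L′) L^j / j!.
D-expLog : ∀ y j n → D (expLog y (suc j)) n ≡ conv (D (logCoeff y)) (expLog y j) n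
D-expLog y j n = suc-cancel j (begin
  ℕ→ℚ (suc j) * (ℕ→ℚ n * ((1/ℕ suc j) * conv ℓ e n))
    ≡⟨ eq (ℕ→ℚ (suc j)) (ℕ→ℚ n) (1/ℕ suc j) (conv ℓ e n) ⟩
  ℕ→ℚ (suc j) * (1/ℕ suc j) * D (conv ℓ e) n
    ≡⟨ trans (cong (_* D (conv ℓ e) n) (suc*1/ j)) (ℚ.*-identityˡ _) ⟩
  D (conv ℓ e) n
    ≡⟨ D-conv ℓ e n ⟩
  conv (D ℓ) e n + conv ℓ (D e) n
    ≡⟨ cong (λ z → conv (D ℓ) e n + z) (lemma j) ⟩
  conv (D ℓ) e n + ℕ→ℚ j * conv (D ℓ) e n
    ≡⟨ eq′ (ℕ→ℚ j) (conv (D ℓ) e n) ⟩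
  (1ℚ + ℕ→ℚ j) * conv (D ℓ) e n
    ≡⟨ cong (_* conv (D ℓ) e n) (sym (ℕ→ℚ-suc j)) ⟩
  ℕ→ℚ (suc j) * conv (D ℓ) e n ∎)
  where
  open ≡-Reasoning
  ℓ = logCoeff y
  e = expLog y j
  eq : ∀ a b c d → a * (b * (c * d)) ≡ a * c * (b * d)
  eq = solve-∀ ℚ-ring
  eq′ : ∀ a b → b + a * b ≡ (1ℚ + a) * b
  eq′ = solve-∀ ℚ-ring
  eq″ : ∀ a b c → c ≡ a * b * c → c ≡ a * (b * c)
  eq″ a b c p = trans p (ℚ.*-assoc a b c)
  D0 : ∀ i → D (expLog y 0) i ≡ 0ℚ
  D0 zero    = ℚ.*-zeroˡ 1ℚ
  D0 (suc i) = ℚ.*-zeroʳ (ℕ→ℚ (suc i))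
  lemma : ∀ j → conv ℓ (D (expLog y j)) n ≡ ℕ→ℚ j * conv (D ℓ) (expLog y j) n
  lemma zero    = trans (conv-cong (λ _ → refl) D0 n) (trans (conv-0ʳ ℓ n) (sym (ℚ.*-zeroˡ (conv (D ℓ) (expLog y 0) n))))
  lemma (suc j) = begin
    conv ℓ (D (expLog y (suc j))) n          ≡⟨ conv-cong (λ _ → refl) (D-expLog y j) n ⟩
    conv ℓ (conv (D ℓ) e′) n                 ≡⟨ sym (conv-assoc ℓ (D ℓ) e′ n) ⟩
    conv (conv ℓ (D ℓ)) e′ n                 ≡⟨ conv-cong (conv-comm ℓ (D ℓ)) (λ _ → refl) n ⟩
    conv (conv (D ℓ) ℓ) e′ n                 ≡⟨ conv-assoc (D ℓ) ℓ e′ n ⟩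
    conv (D ℓ) (conv ℓ e′) n                 ≡⟨ conv-cong (λ _ → refl) (λ i → eq″ (ℕ→ℚ (suc j)) (1/ℕ suc j) (conv ℓ e′ i)
                                                  (sym (trans (cong (_* conv ℓ e′ i) (suc*1/ j)) (ℚ.*-identityˡ _)))) n ⟩
    conv (D ℓ) (λ i → ℕ→ℚ (suc j) * expLog y (suc j) i) n ≡⟨ conv-*ʳ (ℕ→ℚ (suc j)) (D ℓ) _ n ⟩
    ℕ→ℚ (suc j) * conv (D ℓ) (expLog y (suc j)) n ∎
    where e′ = expLog y j

conv-geometric : ∀ y p n → conv (λ i → y ^ (p ℕ.+ i)) (y ^_) n ≡ ℕ→ℚ (suc n) * y ^ (p ℕ.+ n)
conv-geometric y p zero    = trans (ℚ.*-identityʳ (y ^ (p ℕ.+ 0))) (sym (ℚ.*-identityˡ (y ^ (p ℕ.+ 0))))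
conv-geometric y p (suc n) = begin
  y ^ (p ℕ.+ 0) * y ^ suc n + conv (λ i → y ^ (p ℕ.+ suc i)) (y ^_) n
    ≡⟨ cong₂ _+_ (trans (sym (^-+ y (p ℕ.+ 0) (suc n))) (cong (y ^_) (cong (ℕ._+ suc n) (ℕ.+-identityʳ p))))
         (trans (conv-cong (λ i → cong (y ^_) (ℕ.+-suc p i)) (λ _ → refl) n)
           (trans (conv-geometric y (suc p) n) (cong (λ k → ℕ→ℚ (suc n) * y ^ k) (sym (ℕ.+-suc p n))))) ⟩
  y ^ (p ℕ.+ suc n) + ℕ→ℚ (suc n) * y ^ (p ℕ.+ suc n)
    ≡⟨ eq (y ^ (p ℕ.+ suc n)) (ℕ→ℚ (suc n)) ⟩
  (1ℚ + ℕ→ℚ (suc n)) * y ^ (p ℕ.+ suc n)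
    ≡⟨ cong (_* y ^ (p ℕ.+ suc n)) (sym (ℕ→ℚ-suc (suc n))) ⟩
  ℕ→ℚ (suc (suc n)) * y ^ (p ℕ.+ suc n) ∎
  where open ≡-Reasoning
        eq : ∀ a b → a + b * a ≡ (1ℚ + b) * a
        eq = solve-∀ ℚ-ring

-- exp (Σ_k yᵏ tᵏ / k) = 1 / (1 - y t), coefficientwise.
Σ-expLog : ∀ y J n → n < J → Σ J (λ j → expLog y j n) ≡ y ^ n
Σ-expLog y (suc J) zero    _ = trans (Σ-front J _) (cong (1ℚ +_) (trans (Σ-cong J at0) (Σ-0 J)))
  where at0 : ∀ j → expLog y (suc j) 0 ≡ 0ℚ
        at0 j = trans (cong ((1/ℕ suc j) *_) (ℚ.*-zeroˡ (expLog y j 0))) (ℚ.*-zeroʳ (1/ℕ suc j))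
Σ-expLog y (suc J) (suc n) (s≤s n<J) = suc-cancel n (begin
  ℕ→ℚ (suc n) * Σ (suc J) (λ j → expLog y j (suc n))
    ≡⟨ sym (Σ-*ˡ (suc J) (ℕ→ℚ (suc n)) _) ⟩
  Σ (suc J) (λ j → D (expLog y j) (suc n))
    ≡⟨ trans (Σ-front J _) (trans (cong (_+ Σ J (λ j → D (expLog y (suc j)) (suc n))) (ℚ.*-zeroʳ (ℕ→ℚ (suc n)))) (ℚ.+-identityˡ (Σ J (λ j → D (expLog y (suc j)) (suc n))))) ⟩
  Σ J (λ j → D (expLog y (suc j)) (suc n))
    ≡⟨ Σ-cong J (λ j → D-expLog y j (suc n)) ⟩
  Σ J (λ j → conv (D (logCoeff y)) (expLog y j) (suc n))
    ≡⟨ sym (conv-Σʳ J (D (logCoeff y)) (expLog y) (suc n)) ⟩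
  0ℚ * 0ℚ * Σ J (λ j → expLog y j (suc n)) + conv (D (logCoeff y) ∘ suc) (λ i → Σ J (λ j → expLog y j i)) n
    ≡⟨ cong₂ _+_ (ℚ.*-zeroˡ (Σ J (λ j → expLog y j (suc n)))) (conv-cong-≤ n (D-logCoeff y) (λ i i≤n → Σ-expLog y J i (ℕ.≤-<-trans i≤n n<J))) ⟩
  0ℚ + conv (λ i → y ^ suc i) (y ^_) n
    ≡⟨ trans (ℚ.+-identityˡ _) (conv-geometric y 1 n) ⟩
  ℕ→ℚ (suc n) * y ^ suc n ∎)
  where open ≡-Reasoning

logCoeff-≥0 : ∀ {y} → 0≤ y → ∀ i → 0≤ logCoeff y i
logCoeff-≥0 p zero    = ℚ.≤-refl
logCoeff-≥0 p (suc i) = ^-≥0 p (suc i) ⊗ 0≤1/ i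

expLog-≥0 : ∀ {y} → 0≤ y → ∀ j n → 0≤ expLog y j n
expLog-≥0 p zero    zero    = c≥0 1ℚ
expLog-≥0 p zero    (suc n) = ℚ.≤-refl
expLog-≥0 p (suc j) n       = 0≤1/ j ⊗ conv-≥0 (logCoeff-≥0 p) (expLog-≥0 p j) n

-- The identity for exp (log) at t = 1. As all coefficients are non-negative, the first N
-- coefficients of L^j / j! add up to at most the j-th exponential term of the truncated logarithm.
geometric≤expSum-log : ∀ {y} → 0≤ y → ∀ N → Σ N (y ^_) ℚ.≤ expSum (Σ N (logCoeff y)) N
geometric≤expSum-log {y} p N = begin
  Σ N (y ^_)                              ≤⟨ Σ-mono N (λ n n<N → ℚ.≤-reflexive (sym (Σ-expLog y N n n<N))) ⟩
  Σ N (λ n → Σ N (λ j → expLog y j n))    ≡⟨ Σ-swap N N (λ n j → expLog y j n) ⟩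
  Σ N (λ j → Σ N (expLog y j))            ≤⟨ Σ-mono N (λ j _ → bound j) ⟩
  expSum L N                              ∎
  where
  open ℚ.≤-Reasoning
  L = Σ N (logCoeff y)
  0≤L : 0≤ L
  0≤L = Σ-≥0 N (λ i _ → logCoeff-≥0 p i)
  sum0 : ∀ N → Σ N (expLog y 0) ℚ.≤ 1ℚ
  sum0 zero    = c≥0 1ℚ
  sum0 (suc N) = ℚ.≤-reflexive (trans (Σ-front N _) (trans (cong (1ℚ +_) (Σ-0 N)) (ℚ.+-identityʳ 1ℚ)))
  eq : ∀ r l q → r * (l * q) ≡ q * (l * r)
  eq = solve-∀ ℚ-ring
  bound : ∀ j → Σ N (expLog y j) ℚ.≤ powOverFact L j
  bound zero    = sum0 N
  bound (suc j) = begin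
    Σ N (expLog y (suc j))
      ≡⟨ Σ-*ˡ N (1/ℕ suc j) _ ⟩
    (1/ℕ suc j) * Σ N (conv (logCoeff y) (expLog y j))
      ≤⟨ ≤-*ˡ (0≤1/ j) (by-slack (excess-≥0 N (logCoeff-≥0 p) (expLog-≥0 p j)) (Σ*Σ N _ _)) ⟩
    (1/ℕ suc j) * (L * Σ N (expLog y j))
      ≡⟨ eq (1/ℕ suc j) L (Σ N (expLog y j)) ⟩
    Σ N (expLog y j) * (L * (1/ℕ suc j))
      ≤⟨ ≤-*ʳ (0≤L ⊗ 0≤1/ j) (bound j) ⟩
    powOverFact L j * (L * (1/ℕ suc j)) ∎

-- Finite products and Bernoulli's inequality.

Π : ℕ → (ℕ → ℚ) → ℚ
Π zero    f = 1ℚ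
Π (suc n) f = Π n f * f n

Π-* : ∀ n f g → Π n (λ i → f i * g i) ≡ Π n f * Π n g
Π-* zero    f g = refl
Π-* (suc n) f g = trans (cong (_* (f n * g n)) (Π-* n f g)) (eq (Π n f) (Π n g) (f n) (g n))
  where eq : ∀ a b c d → a * b * (c * d) ≡ a * c * (b * d)
        eq = solve-∀ ℚ-ring

Π->0 : ∀ n {f} → (∀ i → 0< f i) → 0< Π n f
Π->0 zero    p = c>0 1ℚ
Π->0 (suc n) p = Π->0 n p ⊗⁺ p n

Π-mono : ∀ n {f g} → (∀ i → 0≤ f i) → (∀ i → f i ℚ.≤ g i) → Π n f ℚ.≤ Π n g
Π-mono zero    p q = ℚ.≤-refl
Π-mono (suc n) {f} p q = mono₂ (go n) (ℚ.≤-trans (p n) (q n)) (Π-mono n p q) (q n)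
  where go : ∀ n → 0≤ Π n f
        go zero    = c≥0 1ℚ
        go (suc n) = go n ⊗ p n

Π-const : ∀ n c → Π n (λ _ → c) ≡ c ^ n
Π-const zero    c = refl
Π-const (suc n) c = trans (ℚ.*-comm _ c) (cong (c *_) (Π-const n c))

Π-antitone : ∀ {m n} f → (∀ i → 0≤ f i) → (∀ i → f i ℚ.≤ 1ℚ) → m ℕ.≤′ n → Π n f ℚ.≤ Π m f
Π-antitone f p q (ℕ.≤′-reflexive refl) = ℚ.≤-refl
Π-antitone {m} f p q (ℕ.≤′-step {n} r) = ℚ.≤-trans
  (subst (Π n f * f n ℚ.≤_) (ℚ.*-identityʳ (Π n f)) (≤-*ˡ (go n) (q n))) (Π-antitone f p q r)
  where go : ∀ n → 0≤ Π n f
        go zero    = c≥0 1ℚ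
        go (suc n) = go n ⊗ p n

Bernoulli : ∀ {t} → 0≤ t → t ℚ.≤ 1ℚ → ∀ n → 1ℚ - ℕ→ℚ n * t ℚ.≤ (1ℚ - t) ^ n
Bernoulli {t} p q zero    = ℚ.≤-reflexive (eq t)
  where eq : ∀ t → 1ℚ - 0ℚ * t ≡ 1ℚ
        eq = solve-∀ ℚ-ring
Bernoulli {t} p q (suc n) = begin
  1ℚ - ℕ→ℚ (suc n) * t           ≡⟨ cong (λ z → 1ℚ - z * t) (ℕ→ℚ-suc n) ⟩
  1ℚ - (1ℚ + ℕ→ℚ n) * t          ≤⟨ by-slack (0≤ℕ→ℚ n ⊗ sq≥0 t) (eq t (ℕ→ℚ n)) ⟩
  (1ℚ - t) * (1ℚ - ℕ→ℚ n * t)    ≤⟨ ≤-*ˡ (slack q) (Bernoulli p q n) ⟩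
  (1ℚ - t) * (1ℚ - t) ^ n        ∎
  where open ℚ.≤-Reasoning
        eq : ∀ t n → (1ℚ - t) * (1ℚ - n * t) ≡ 1ℚ - (1ℚ + n) * t + n * (t * t)
        eq = solve-∀ ℚ-ring

1+n*≤^ : ∀ {t} → 0≤ t → ∀ n → 1ℚ + ℕ→ℚ n * t ℚ.≤ (1ℚ + t) ^ n
1+n*≤^ {t} p zero    = ℚ.≤-reflexive (eq t)
  where eq : ∀ t → 1ℚ + 0ℚ * t ≡ 1ℚ
        eq = solve-∀ ℚ-ring
1+n*≤^ {t} p (suc n) = begin
  1ℚ + ℕ→ℚ (suc n) * t           ≡⟨ cong (λ z → 1ℚ + z * t) (ℕ→ℚ-suc n) ⟩
  1ℚ + (1ℚ + ℕ→ℚ n) * t          ≤⟨ by-slack (0≤ℕ→ℚ n ⊗ sq≥0 t) (eq t (ℕ→ℚ n)) ⟩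
  (1ℚ + t) * (1ℚ + ℕ→ℚ n * t)    ≤⟨ ≤-*ˡ (c≥0 1ℚ ⊕ p) (1+n*≤^ p n) ⟩
  (1ℚ + t) * (1ℚ + t) ^ n        ∎
  where open ℚ.≤-Reasoning
        eq : ∀ t n → (1ℚ + t) * (1ℚ + n * t) ≡ 1ℚ + (1ℚ + n) * t + n * (t * t)
        eq = solve-∀ ℚ-ring

geometric : ∀ y n → (1ℚ - y) * Σ n (y ^_) ≡ 1ℚ - y ^ n
geometric y zero    = ℚ.*-zeroʳ (1ℚ - y)
geometric y (suc n) = trans (ℚ.*-distribˡ-+ (1ℚ - y) (Σ n (y ^_)) (y ^ n))
  (trans (cong (_+ (1ℚ - y) * y ^ n) (geometric y n)) (eq y (y ^ n)))
  where eq : ∀ y p → 1ℚ - p + (1ℚ - y) * p ≡ 1ℚ - y * p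
        eq = solve-∀ ℚ-ring

-- The generating function of partitions into distinct parts.

ζ₂ : ℕ → ℚ
ζ₂ N = Σ N (λ m → (1/ℕ suc m) * (1/ℕ suc m))

-- With z = 1/x and 2σ ≤ z - x the generating function of partitions into
-- distinct parts is at most exp (ζ(2) / 2σ): it equals Π 1/(1 - x²ⁱ⁺¹), whose
-- logarithm is Σ_m 1 / m(zᵐ - xᵐ), and zᵐ - xᵐ ≥ m (z - x).
module GeneratingFunction (σ x z : ℚ) (0<σ : 0< σ) (0<x : 0< x) (x*z≡1 : x * z ≡ 1ℚ)
                          (z≡ : z ≡ 1ℚ + σ + ½ * (σ * σ)) where
  open ℚ.≤-Reasoning

  0≤σ = <-weaken 0<σ
  0≤x = <-weaken 0<x

  1<z : 1ℚ ℚ.< z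
  1<z = by-slack⁺ (0<σ ⊕⁺ (c≥0 ½ ⊗ sq≥0 σ)) (trans z≡ (ℚ.+-assoc 1ℚ σ _))

  0<z : 0< z
  0<z = ℚ.<-trans (c>0 1ℚ) 1<z

  2σ≤z-x : σ + σ ℚ.≤ z - x
  2σ≤z-x = by-slack (slack x≤) (eq z x σ)
    where
    eq : ∀ z x σ → z - x ≡ σ + σ + ((z - (σ + σ)) - x)
    eq = solve-∀ ℚ-ring
    eq′ : ∀ σ → (1ℚ + σ + ½ * (σ * σ) - (σ + σ)) * (1ℚ + σ + ½ * (σ * σ)) ≡ 1ℚ + ½ * ½ * (σ * σ * (σ * σ))
    eq′ = solve-∀ ℚ-ring
    -- The quadratic term of z is chosen for this: (z - 2σ) z = 1 + σ⁴/4 is at least x z = 1.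
    x≤ : x ℚ.≤ z - (σ + σ)
    x≤ = ≤-*-cancelʳ 0<z (by-slack (c≥0 (½ * ½) ⊗ (sq≥0 σ ⊗ sq≥0 σ))
      (trans (cong (λ z → (z - (σ + σ)) * z) z≡) (trans (eq′ σ) (cong (_+ ½ * ½ * (σ * σ * (σ * σ))) (sym x*z≡1)))))

  x<1 : x ℚ.< 1ℚ
  x<1 = ℚ.*-cancelʳ-<-nonNeg z {{ℚ.nonNegative (<-weaken 0<z)}}
    (subst₂ ℚ._<_ (sym x*z≡1) (sym (ℚ.*-identityˡ z)) 1<z)

  x^*z^ : ∀ m → x ^ m * z ^ m ≡ 1ℚ
  x^*z^ m = trans (sym (^-distrib-* x z m)) (trans (cong (_^ m) x*z≡1) (1^ m))

  x^-<1 : ∀ m → x ^ suc m ℚ.< 1ℚ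
  x^-<1 m = ℚ.≤-<-trans (≤-*ˡ 0≤x (^-≤1 0≤x (<-weaken x<1) m)) (subst (ℚ._< 1ℚ) (sym (ℚ.*-identityʳ x)) x<1)

  gap : ℕ → ℚ
  gap m = z ^ m - x ^ m

  -- The increments of zᵐ - xᵐ grow: since x z = 1, its second difference is (z + x - 2) times the
  -- middle value, and z + x ≥ 2. The first increment is z - x.
  gap-step : ∀ m → 0≤ gap m × (z - x) ℚ.≤ gap (suc m) - gap m
  gap-step zero = ℚ.≤-refl , ℚ.≤-reflexive (eq z x)
    where eq : ∀ z x → z - x ≡ z * 1ℚ - x * 1ℚ - 0ℚ
          eq = solve-∀ ℚ-ring
  gap-step (suc m) = 0≤g′ , (begin
    z - x                                           ≤⟨ proj₂ IH ⟩
    gap (suc m) - gap m                             ≤⟨ by-slack (0≤z+x-2 ⊗ 0≤g′) refl ⟩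
    gap (suc m) - gap m + (z + x - (1ℚ + 1ℚ)) * gap (suc m)
      ≡⟨ eq z x (z ^ m) (x ^ m) ⟩
    (z * (z * z ^ m) - x * (x * x ^ m)) + (x * z - 1ℚ) * (z ^ m - x ^ m) - (z * z ^ m - x * x ^ m)
      ≡⟨ cong (λ w → z * (z * z ^ m) - x * (x * x ^ m) + (w - 1ℚ) * (z ^ m - x ^ m) - (z * z ^ m - x * x ^ m)) x*z≡1 ⟩
    (z * (z * z ^ m) - x * (x * x ^ m)) + (1ℚ - 1ℚ) * (z ^ m - x ^ m) - (z * z ^ m - x * x ^ m)
      ≡⟨ eq′ (z * (z * z ^ m) - x * (x * x ^ m)) (z ^ m - x ^ m) (z * z ^ m - x * x ^ m) ⟩
    gap (suc (suc m)) - gap (suc m) ∎)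
    where
    IH = gap-step m
    eq₀ : ∀ g g′ d → g′ ≡ (g + d) + (g′ - g - d)
    eq₀ = solve-∀ ℚ-ring
    eq₁ : ∀ z x → (z - 1ℚ) * (1ℚ - x) + (x * z - 1ℚ) ≡ z + x - (1ℚ + 1ℚ)
    eq₁ = solve-∀ ℚ-ring
    0≤z-x : 0≤ (z - x)
    0≤z-x = ℚ.≤-trans (0≤σ ⊕ 0≤σ) 2σ≤z-x
    0≤g′ : 0≤ gap (suc m)
    0≤g′ = ℚ.≤-trans (proj₁ IH ⊕ 0≤z-x) (by-slack (slack (proj₂ IH)) (eq₀ (gap m) (gap (suc m)) (z - x)))
    0≤z+x-2 : 0≤ (z + x - (1ℚ + 1ℚ))
    0≤z+x-2 = subst 0≤_ (eq₁ z x) ((slack (<-weaken 1<z) ⊗ slack (<-weaken x<1)) ⊕ slack (ℚ.≤-reflexive (sym x*z≡1)))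
    eq : ∀ z x p q → z * p - x * q - (p - q) + (z + x - (1ℚ + 1ℚ)) * (z * p - x * q)
         ≡ (z * (z * p) - x * (x * q)) + (x * z - 1ℚ) * (p - q) - (z * p - x * q)
    eq = solve-∀ ℚ-ring
    eq′ : ∀ a b c → a + (1ℚ - 1ℚ) * b - c ≡ a - c
    eq′ = solve-∀ ℚ-ring

  gap-≥ : ∀ m → ℕ→ℚ m * (σ + σ) ℚ.≤ gap m
  gap-≥ zero    = ℚ.≤-reflexive (ℚ.*-zeroˡ (σ + σ))
  gap-≥ (suc m) = begin
    ℕ→ℚ (suc m) * (σ + σ)          ≡⟨ trans (cong (_* (σ + σ)) (ℕ→ℚ-suc m)) (eq (ℕ→ℚ m) (σ + σ)) ⟩
    ℕ→ℚ m * (σ + σ) + (σ + σ)      ≤⟨ ℚ.+-mono-≤ (gap-≥ m) (ℚ.≤-trans 2σ≤z-x (proj₂ (gap-step m))) ⟩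
    gap m + (gap (suc m) - gap m)  ≡⟨ eq′ (gap m) (gap (suc m)) ⟩
    gap (suc m)                    ∎
    where eq : ∀ m s → (1ℚ + m) * s ≡ m * s + s
          eq = solve-∀ ℚ-ring
          eq′ : ∀ a b → a + (b - a) ≡ b
          eq′ = solve-∀ ℚ-ring

  y : ℕ → ℚ
  y i = x ^ (suc (i ℕ.+ i))

  -- With X = xᵐ the geometric sum is at most X / (1 - X²) = 1 / (zᵐ - xᵐ), and `gap-≥` bounds the
  -- denominator from below.
  Σ-odd-powers : ∀ m n → ℕ→ℚ m * (σ + σ) * Σ n (λ i → y i ^ m) ℚ.≤ 1ℚ
  Σ-odd-powers m n = begin
    ℕ→ℚ m * (σ + σ) * Σ n (λ i → y i ^ m)   ≤⟨ ≤-*ʳ (Σ-≥0 n (λ i _ → ^-≥0 (^-≥0 0≤x (suc (i ℕ.+ i))) m)) (gap-≥ m) ⟩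
    gap m * Σ n (λ i → y i ^ m)             ≡⟨ cong (gap m *_) (trans (Σ-cong n pow) (Σ-*ˡ n X (λ i → (X * X) ^ i))) ⟩
    (Z - X) * (X * Σ n ((X * X) ^_))        ≡⟨ eq Z X _ ⟩
    (X * Z - X * X) * Σ n ((X * X) ^_)      ≡⟨ cong (λ w → (w - X * X) * Σ n ((X * X) ^_)) (x^*z^ m) ⟩
    (1ℚ - X * X) * Σ n ((X * X) ^_)         ≡⟨ geometric (X * X) n ⟩
    1ℚ - (X * X) ^ n                        ≤⟨ by-slack (^-≥0 (sq≥0 X) n) (eq′ ((X * X) ^ n)) ⟩
    1ℚ                                      ∎
    where
    X = x ^ m
    Z = z ^ m
    eq : ∀ z x s → (z - x) * (x * s) ≡ (x * z - x * x) * s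
    eq = solve-∀ ℚ-ring
    eq′ : ∀ a → 1ℚ ≡ 1ℚ - a + a
    eq′ = solve-∀ ℚ-ring
    pow : ∀ i → y i ^ m ≡ X * (X * X) ^ i
    pow i = begin-equality
      (x * x ^ (i ℕ.+ i)) ^ m      ≡⟨ ^-distrib-* x _ m ⟩
      X * (x ^ (i ℕ.+ i)) ^ m      ≡⟨ cong (λ w → X * w ^ m) (^-+ x i i) ⟩
      X * (x ^ i * x ^ i) ^ m      ≡⟨ cong (X *_) (^-distrib-* (x ^ i) (x ^ i) m) ⟩
      X * ((x ^ i) ^ m * (x ^ i) ^ m) ≡⟨ cong (λ w → X * (w * w)) (trans (sym (^-* x i m)) (trans (cong (x ^_) (ℕ.*-comm i m)) (^-* x m i))) ⟩
      X * (X ^ i * X ^ i)          ≡⟨ cong (X *_) (sym (^-distrib-* X X i)) ⟩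
      X * (X * X) ^ i              ∎

  -- The logarithm of the product of 1 / (1 - x²ⁱ⁺¹) over i < n, its series cut off after degree N.
  Λ : ℕ → ℕ → ℚ
  Λ n N = Σ n (λ i → Σ (suc N) (logCoeff (y i)))

  Λ-bound : ∀ n N → (σ + σ) * Λ n N ℚ.≤ ζ₂ N
  Λ-bound n N = begin
    (σ + σ) * Λ n N
      ≡⟨ cong ((σ + σ) *_) (trans (Σ-cong n (λ i → trans (Σ-front N _) (ℚ.+-identityˡ _))) (Σ-swap n N _)) ⟩
    (σ + σ) * Σ N (λ m → Σ n (λ i → y i ^ suc m * (1/ℕ suc m)))
      ≡⟨ sym (Σ-*ˡ N (σ + σ) _) ⟩
    Σ N (λ m → (σ + σ) * Σ n (λ i → y i ^ suc m * (1/ℕ suc m)))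
      ≤⟨ Σ-mono N (λ m _ → term m) ⟩
    ζ₂ N ∎
    where
    eq : ∀ s t r → s * (t * r) ≡ 1ℚ * s * t * r
    eq = solve-∀ ℚ-ring
    eq′ : ∀ n s t r → n * r * s * t * r ≡ n * s * t * (r * r)
    eq′ = solve-∀ ℚ-ring
    term : ∀ m → (σ + σ) * Σ n (λ i → y i ^ suc m * (1/ℕ suc m)) ℚ.≤ (1/ℕ suc m) * (1/ℕ suc m)
    term m = begin
      (σ + σ) * Σ n (λ i → y i ^ suc m * r)             ≡⟨ cong ((σ + σ) *_) (Σ-*ʳ n r _) ⟩
      (σ + σ) * (S * r)                                 ≡⟨ eq (σ + σ) S r ⟩
      1ℚ * (σ + σ) * S * r                              ≡⟨ cong (λ w → w * (σ + σ) * S * r) (sym (suc*1/ m)) ⟩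
      ℕ→ℚ (suc m) * r * (σ + σ) * S * r                 ≡⟨ eq′ (ℕ→ℚ (suc m)) (σ + σ) S r ⟩
      ℕ→ℚ (suc m) * (σ + σ) * S * (r * r)               ≤⟨ ≤-*ʳ (sq≥0 r) (Σ-odd-powers (suc m) n) ⟩
      1ℚ * (r * r)                                      ≡⟨ ℚ.*-identityˡ _ ⟩
      r * r                                             ∎
      where r = 1/ℕ suc m
            S = Σ n (λ i → y i ^ suc m)

  distinct odd all : ℕ → ℚ
  distinct n = Π n (λ k → 1ℚ + x ^ suc k)
  odd n      = Π n (λ i → 1ℚ - y i)
  all n      = Π n (λ k → 1ℚ - x ^ suc k)

  -- A finite form of Euler's identity: (1 + xᵏ)(1 - xᵏ) = 1 - x²ᵏ supplies the factors of even
  -- degree in `all (n + n)`, and `odd n` those of odd degree.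
  Euler : ∀ n → distinct n * odd n * all n ≡ all (n ℕ.+ n)
  Euler zero    = refl
  Euler (suc n) = begin-equality
    distinct n * (1ℚ + p) * (odd n * (1ℚ - y n)) * (all n * (1ℚ - p))
      ≡⟨ eq (distinct n) (odd n) (all n) p (y n) ⟩
    distinct n * odd n * all n * (1ℚ - y n) * (1ℚ - p * p)
      ≡⟨ cong₂ (λ u v → u * (1ℚ - y n) * (1ℚ - v)) (Euler n) (trans (sym (^-+ x (suc n) (suc n))) (cong (x ^_) (cong suc (ℕ.+-suc n n)))) ⟩
    all (suc (suc (n ℕ.+ n)))
      ≡⟨ cong all (sym (cong suc (ℕ.+-suc n n))) ⟩
    all (suc n ℕ.+ suc n) ∎
    where
    p = x ^ suc n
    eq : ∀ d o a p y → d * (1ℚ + p) * (o * (1ℚ - y)) * (a * (1ℚ - p)) ≡ d * o * a * (1ℚ - y) * (1ℚ - p * p)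
    eq = solve-∀ ℚ-ring

  distinct*odd≤1 : ∀ n → distinct n * odd n ℚ.≤ 1ℚ
  distinct*odd≤1 n = ≤-*-cancelʳ (Π->0 n pos) (begin
    distinct n * odd n * all n  ≡⟨ Euler n ⟩
    all (n ℕ.+ n)               ≤⟨ Π-antitone _ (λ k → <-weaken (pos k)) (λ k → by-slack (^-≥0 0≤x (suc k)) (eq (x ^ suc k))) (ℕ.≤⇒≤′ (ℕ.m≤m+n n n)) ⟩
    all n                       ≡⟨ sym (ℚ.*-identityˡ _) ⟩
    1ℚ * all n                  ∎)
    where
    pos : ∀ k → 0< (1ℚ - x ^ suc k)
    pos k = slack⁺ (x^-<1 k)
    eq : ∀ a → 1ℚ ≡ 1ℚ - a + a
    eq = solve-∀ ℚ-ring

  Π-≤exp : ∀ {f a : ℕ → ℚ} {k} → (∀ i → 0≤ f i) → (∀ i → 0≤ a i) → (∀ i → f i ℚ.≤ expSum (a i) k) →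
           ∀ n → Π n f ℚ.≤ expSum (Σ n a) (suc (n ℕ.* k))
  Π-≤exp p q h zero = ℚ.≤-refl
  Π-≤exp {f} {a} {k} p q h (suc n) = ℚ.≤-trans
    (mono₂ (go n) (expSum-≥0 (q n) k) (Π-≤exp p q h n) (h n))
    (subst (λ j → expSum (Σ n a) (suc (n ℕ.* k)) * expSum (a n) k ℚ.≤ expSum (Σ n a + a n) j)
      (cong suc (ℕ.+-comm (n ℕ.* k) k)) (expSum-*-≤ (Σ-≥0 n (λ i _ → q i)) (q n) (suc (n ℕ.* k)) k))
    where go : ∀ n → 0≤ Π n f
          go zero    = c≥0 1ℚ
          go (suc n) = go n ⊗ p n

  z≤exp : z ℚ.≤ expSum σ 3
  z≤exp = ℚ.≤-reflexive (trans z≡ (eq σ))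
    where eq : ∀ σ → 1ℚ + σ + ½ * (σ * σ) ≡ 0ℚ + 1ℚ + 1ℚ * (σ * 1ℚ) + 1ℚ * (σ * 1ℚ) * (σ * ½)
          eq = solve-∀ ℚ-ring

  -- The factor (1 - x^(N+1))ⁿ is the cost of the truncation: geometric sums of length N + 1 equal
  -- (1 - y^(N+1)) / (1 - y) instead of 1 / (1 - y), and each y is at most x.
  distinct-≤exp : ∀ n N {e} → ℕ→ℚ n * σ + Λ n N ℚ.≤ e →
                  ∃[ k ] z ^ n * distinct n * (1ℚ - x ^ suc N) ^ n ℚ.≤ expSum e k
  distinct-≤exp n N {e} h = a ℕ.+ b , (begin
    z ^ n * distinct n * (1ℚ - x ^ suc N) ^ n
      ≤⟨ ≤-*ˡ 0≤zd (ℚ.≤-trans (ℚ.≤-reflexive (sym (Π-const n _)))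
           (Π-mono n (λ i → slack (^-≤1 0≤x (<-weaken x<1) (suc N))) (λ i → by-slack (slack (y^≤ i)) (eq (x ^ suc N) (y i ^ suc N))))) ⟩
    z ^ n * distinct n * Π n (λ i → 1ℚ - y i ^ suc N)
      ≡⟨ cong (z ^ n * distinct n *_) (trans (Π-cong n (λ i → sym (geometric (y i) (suc N)))) (Π-* n _ _)) ⟩
    z ^ n * distinct n * (odd n * G)
      ≡⟨ eq′ (z ^ n) (distinct n) (odd n) G ⟩
    distinct n * odd n * (z ^ n * G)
      ≤⟨ ≤-*ʳ 0≤zG (distinct*odd≤1 n) ⟩
    1ℚ * (z ^ n * G)
      ≡⟨ ℚ.*-identityˡ _ ⟩
    z ^ n * G
      ≤⟨ mono₂ (^-≥0 (<-weaken 0<z) n) (expSum-≥0 0≤Λ b)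
           (ℚ.≤-trans (ℚ.≤-reflexive (sym (Π-const n z))) (Π-≤exp (λ _ → <-weaken 0<z) (λ _ → 0≤σ) (λ _ → z≤exp) n))
           (Π-≤exp 0≤S 0≤L (λ i → geometric≤expSum-log (0≤y i) (suc N)) n) ⟩
    expSum (Σ n (λ _ → σ)) a * expSum (Λ n N) b
      ≡⟨ cong (λ w → expSum w a * expSum (Λ n N) b) (Σ-const n σ) ⟩
    expSum (ℕ→ℚ n * σ) a * expSum (Λ n N) b
      ≤⟨ expSum-*-≤ (0≤ℕ→ℚ n ⊗ 0≤σ) 0≤Λ a b ⟩
    expSum (ℕ→ℚ n * σ + Λ n N) (a ℕ.+ b)
      ≤⟨ expSum-mono {m = a ℕ.+ b} {n = a ℕ.+ b} (0≤ℕ→ℚ n ⊗ 0≤σ ⊕ 0≤Λ) h ℕ.≤-refl ⟩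
    expSum e (a ℕ.+ b) ∎)
    where
    a b : ℕ
    a = suc (n ℕ.* 3)
    b = suc (n ℕ.* suc N)
    G = Π n (λ i → Σ (suc N) (y i ^_))
    0≤y : ∀ i → 0≤ y i
    0≤y i = ^-≥0 0≤x (suc (i ℕ.+ i))
    0≤S : ∀ i → 0≤ Σ (suc N) (y i ^_)
    0≤S i = Σ-≥0 (suc N) (λ m _ → ^-≥0 (0≤y i) m)
    0≤L : ∀ i → 0≤ Σ (suc N) (logCoeff (y i))
    0≤L i = Σ-≥0 (suc N) (λ m _ → logCoeff-≥0 (0≤y i) m)
    0≤Λ : 0≤ Λ n N
    0≤Λ = Σ-≥0 n (λ i _ → 0≤L i)
    Π≥0 : ∀ n {f} → (∀ i → 0≤ f i) → 0≤ Π n f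
    Π≥0 zero    p = c≥0 1ℚ
    Π≥0 (suc n) p = Π≥0 n p ⊗ p n
    0≤zd : 0≤ (z ^ n * distinct n)
    0≤zd = ^-≥0 (<-weaken 0<z) n ⊗ Π≥0 n (λ k → c≥0 1ℚ ⊕ ^-≥0 0≤x (suc k))
    0≤zG : 0≤ (z ^ n * G)
    0≤zG = ^-≥0 (<-weaken 0<z) n ⊗ Π≥0 n 0≤S
    y^≤ : ∀ i → y i ^ suc N ℚ.≤ x ^ suc N
    y^≤ i = ^-mono (0≤y i) (subst (y i ℚ.≤_) (ℚ.*-identityʳ x) (≤-*ˡ 0≤x (^-≤1 0≤x (<-weaken x<1) (i ℕ.+ i)))) (suc N)
    Π-cong : ∀ n {f g} → (∀ i → f i ≡ g i) → Π n f ≡ Π n g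
    Π-cong zero    h = refl
    Π-cong (suc n) h = cong₂ _*_ (Π-cong n h) (h n)
    Σ-const : ∀ n c → Σ n (λ _ → c) ≡ ℕ→ℚ n * c
    Σ-const zero    c = sym (ℚ.*-zeroˡ c)
    Σ-const (suc n) c = trans (cong (_+ c) (Σ-const n c)) (trans (eq″ (ℕ→ℚ n) c) (cong (_* c) (sym (ℕ→ℚ-suc n))))
      where eq″ : ∀ n c → n * c + c ≡ (1ℚ + n) * c
            eq″ = solve-∀ ℚ-ring
    eq : ∀ a b → 1ℚ - b ≡ 1ℚ - a + (a - b)
    eq = solve-∀ ℚ-ring
    eq′ : ∀ z d o g → z * d * (o * g) ≡ d * o * (z * g)
    eq′ = solve-∀ ℚ-ring

  truncation-small : ∀ δ → 0< δ → ∃[ N ] x ^ N ℚ.< δ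
  truncation-small δ 0<δ = let (d , 0<d , δd≡1) = 1/⁺ 0<δ
                               (s , 0<s , σs≡1) = 1/⁺ 0<σ
                               (N , hN) = archimedean (d * s)
    in N , ℚ.*-cancelʳ-<-nonNeg (z ^ N) {{ℚ.nonNegative (^-≥0 (<-weaken 0<z) N)}} (begin-strict
      x ^ N * z ^ N            ≡⟨ trans (x^*z^ N) (eq₁ δd≡1 σs≡1) ⟩
      δ * (d * s * σ)          ≤⟨ ≤-*ˡ (<-weaken 0<δ) (≤-*ʳ 0≤σ hN) ⟩
      δ * (ℕ→ℚ N * σ)          <⟨ ℚ.*-monoʳ-<-pos δ {{ℚ.positive 0<δ}} (by-slack⁺ (c>0 1ℚ) (ℚ.+-comm 1ℚ (ℕ→ℚ N * σ))) ⟩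
      δ * (1ℚ + ℕ→ℚ N * σ)     ≤⟨ ≤-*ˡ (<-weaken 0<δ) (ℚ.≤-trans (1+n*≤^ 0≤σ N) (^-mono (c≥0 1ℚ ⊕ 0≤σ) (by-slack (c≥0 ½ ⊗ sq≥0 σ) z≡) N)) ⟩
      δ * z ^ N                ∎)
    where
    eq₂ : ∀ δ d s σ → (δ * d) * (σ * s) ≡ δ * (d * s * σ)
    eq₂ = solve-∀ ℚ-ring
    eq₁ : ∀ {d s} → δ * d ≡ 1ℚ → σ * s ≡ 1ℚ → 1ℚ ≡ δ * (d * s * σ)
    eq₁ {d} {s} p q = trans (sym (cong₂ _*_ p q)) (eq₂ δ d s σ)

-- Real numbers

Ev : (ℕ → Set) → Set
Ev P = ∃[ N ] (∀ n → N ≤ n → P n)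

ev : ∀ {P} → (∀ n → P n) → Ev P
ev h = 0 , λ n _ → h n

ev₁ : ∀ {P Q : ℕ → Set} → (∀ n → P n → Q n) → Ev P → Ev Q
ev₁ f (N , h) = N , λ n p → f n (h n p)

ev₂ : ∀ {P Q R : ℕ → Set} → (∀ n → P n → Q n → R n) → Ev P → Ev Q → Ev R
ev₂ f (M , g) (N , h) = M ℕ.⊔ N , λ n p → f n (g n (⊔≤ˡ M N p)) (h n (⊔≤ʳ M N p))

ev₃ : ∀ {P Q R S : ℕ → Set} → (∀ n → P n → Q n → R n → S n) → Ev P → Ev Q → Ev R → Ev S
ev₃ f p q r = ev₂ (λ n u v → u v) (ev₂ f p q) r

ev-≥ : ∀ N → Ev (N ≤_)
ev-≥ N = N , λ n p → p

ev-extract : ∀ {P : Set} → Ev (λ _ → P) → P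
ev-extract (N , h) = h N ℕ.≤-refl

-- _≤ᴿ_ is a negation; estimates need this positive form.
infix 4 _≼_
_≼_ : ℝ → ℝ → Set
x ≼ y = ∀ ε → 0< ε → Ev (λ n → seq x n ℚ.≤ seq y n + ε)

≼-pointwise : ∀ {x y} → Ev (λ n → seq x n ℚ.≤ seq y n) → x ≼ y
≼-pointwise h ε 0<ε = ev₁ (λ n p → ℚ.≤-trans p (x≤x+y (<-weaken 0<ε))) h

≃-pointwise : ∀ {x y} → (∀ n → seq x n ≡ seq y n) → x ≃ y
≃-pointwise {x} {y} h ε 0<ε = ev (λ n → subst (ℚ._< ε)
  (sym (cong ∣_∣ (trans (cong (_- seq y n) (h n)) (ℚ.+-inverseʳ (seq y n))))) 0<ε)

≃-sym : ∀ {x y} → x ≃ y → y ≃ x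
≃-sym {x} {y} h ε 0<ε = ev₁ (λ n → subst (ℚ._< ε) (∣-∣-comm (seq x n) (seq y n))) (h ε 0<ε)

≃⇒≼ : ∀ {x y} → x ≃ y → x ≼ y
≃⇒≼ {x} {y} h ε 0<ε = ev₁ (λ n p → ∣-∣≤ {seq x n} {seq y n} (<-weaken p)) (h ε 0<ε)

≼-trans : ∀ {x y z} → x ≼ y → y ≼ z → x ≼ z
≼-trans {x} {y} {z} p q ε 0<ε = ev₂ (λ n u v → ℚ.≤-trans u (ℚ.≤-trans (ℚ.+-monoˡ-≤ (½ * ε) v)
    (ℚ.≤-reflexive (trans (ℚ.+-assoc (seq z n) _ _) (cong (λ w → seq z n + w) (half+half ε))))))
  (p (½ * ε) (0<half 0<ε)) (q (½ * ε) (0<half 0<ε))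

≼-+ : ∀ {x x′ y y′} → x ≼ x′ → y ≼ y′ → x +ᴿ y ≼ x′ +ᴿ y′
≼-+ {x} {x′} {y} {y′} p q ε 0<ε = ev₂ (λ n u v → ℚ.≤-trans (ℚ.+-mono-≤ u v)
    (ℚ.≤-reflexive (trans (eq (seq x′ n) (seq y′ n) (½ * ε)) (cong (λ w → seq x′ n + seq y′ n + w) (half+half ε)))))
  (p (½ * ε) (0<half 0<ε)) (q (½ * ε) (0<half 0<ε))
  where eq : ∀ a b e → a + e + (b + e) ≡ a + b + (e + e)
        eq = solve-∀ ℚ-ring

≼-*ʳ : ∀ {x y} z → (∀ n → 0≤ seq z n) → x ≼ y → x *ᴿ z ≼ y *ᴿ z
≼-*ʳ {x} {y} z 0≤z h ε 0<ε =
  let (B , N , hB) = eventuallyBounded z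
      δ = Split.δ ε 0<ε B
  in ev₂ (λ n b u → ℚ.≤-trans (≤-*ʳ (0≤z n) u) (by-slack (slack (begin
            δ * seq z n          ≤⟨ ≤-*ˡ (<-weaken (Split.0<δ ε 0<ε B)) (ℚ.≤-trans (x≤∣x∣ (seq z n)) (ℚ.≤-trans b (ℕ→ℚ-mono (ℕ.n≤1+n B)))) ⟩
            δ * ℕ→ℚ (suc B)      ≡⟨ trans (ℚ.*-comm δ (ℕ→ℚ (suc B))) (Split.k*δ ε 0<ε B) ⟩
            ε                    ∎)) (eq (seq y n) δ (seq z n) ε)))
        (N , hB) (h δ (Split.0<δ ε 0<ε B))
  where open ℚ.≤-Reasoning
        eq : ∀ y d z e → y * z + e ≡ (y + d) * z + (e - d * z)
        eq = solve-∀ ℚ-ring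

≼-fromℚ : ∀ {a b} → fromℚ a ≼ fromℚ b → a ℚ.≤ b
≼-fromℚ {a} {b} h = ℚ.≮⇒≥ λ b<a →
  let 0<d = 0<half (slack⁺ b<a)
  in ℚ.<-irrefl refl (ℚ.<-≤-trans (by-slack⁺ {b + ½ * (a - b)} {a} 0<d
       (trans (sym (eq a b)) (trans (cong (b +_) (sym (half+half (a - b)))) (sym (ℚ.+-assoc b _ _)))))
     (ev-extract (h (½ * (a - b)) 0<d)))
  where eq : ∀ a b → b + (a - b) ≡ a
        eq = solve-∀ ℚ-ring

½^≤ : ∀ k → ½ ^ k ℚ.≤ 1/ℕ suc k
½^≤ k = ≤-*-cancelʳ (0<ℕ→ℚ-suc k) (begin
  ½ ^ k * ℕ→ℚ (suc k)          ≡⟨ cong (½ ^ k *_) (trans (ℕ→ℚ-suc k) (cong (1ℚ +_) (sym (ℚ.*-identityʳ (ℕ→ℚ k))))) ⟩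
  ½ ^ k * (1ℚ + ℕ→ℚ k * 1ℚ)    ≤⟨ ≤-*ˡ (^-≥0 (c≥0 ½) k) (1+n*≤^ (c≥0 1ℚ) k) ⟩
  ½ ^ k * (1ℚ + 1ℚ) ^ k        ≡⟨ trans (sym (^-distrib-* ½ (1ℚ + 1ℚ) k)) (1^ k) ⟩
  1ℚ                           ≡⟨ sym (trans (ℚ.*-comm (1/ℕ suc k) (ℕ→ℚ (suc k))) (suc*1/ k)) ⟩
  (1/ℕ suc k) * ℕ→ℚ (suc k)    ∎)
  where open ℚ.≤-Reasoning

-- The zero of the limit of a uniformly convergent sequence of increasing
-- functions, by bisection: the k-th approximation takes k steps on F k.

bisect : ℕ → (ℚ → ℚ) → ℚ → ℚ → ℚ
bisect zero    f l u = l
bisect (suc n) f l u with f (½ * (l + u)) ℚ.≤? 0ℚ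
... | yes _ = bisect n f (½ * (l + u)) u
... | no  _ = bisect n f l (½ * (l + u))

l≤mid : ∀ {l u} → l ℚ.≤ u → l ℚ.≤ ½ * (l + u)
l≤mid {l} {u} p = by-slack (c≥0 ½ ⊗ slack p) (eq l u)
  where eq : ∀ l u → ½ * (l + u) ≡ l + ½ * (u - l)
        eq = solve-∀ ℚ-ring

mid≤u : ∀ {l u} → l ℚ.≤ u → ½ * (l + u) ℚ.≤ u
mid≤u {l} {u} p = by-slack (c≥0 ½ ⊗ slack p) (eq l u)
  where eq : ∀ l u → u ≡ ½ * (l + u) + ½ * (u - l)
        eq = solve-∀ ℚ-ring

bisect-range : ∀ n (f : ℚ → ℚ) {l u} → l ℚ.≤ u → l ℚ.≤ bisect n f l u × bisect n f l u ℚ.≤ u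
bisect-range zero    f p = ℚ.≤-refl , p
bisect-range (suc n) f {l} {u} p with f (½ * (l + u)) ℚ.≤? 0ℚ
... | yes _ = ℚ.≤-trans (l≤mid p) (proj₁ R) , proj₂ R
  where R = bisect-range n f (mid≤u p)
... | no  _ = proj₁ R , ℚ.≤-trans (proj₂ R) (mid≤u p)
  where R = bisect-range n f (l≤mid p)

bisect-value : ∀ n (f : ℚ → ℚ) Λ {l u} → l ℚ.≤ u → f l ℚ.≤ 0ℚ → 0ℚ ℚ.≤ f u →
  (∀ x y → l ℚ.≤ x → x ℚ.≤ y → y ℚ.≤ u → f y - f x ℚ.≤ Λ * (y - x)) →
  f (bisect n f l u) ℚ.≤ 0ℚ × - f (bisect n f l u) ℚ.≤ Λ * (u - l) * ½ ^ n
bisect-value zero    f Λ {l} {u} p fl fu h = fl , ℚ.≤-trans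
  (by-slack fu (ℚ.+-comm (f u) (- f l))) (subst (f u - f l ℚ.≤_) (sym (ℚ.*-identityʳ _)) (h l u ℚ.≤-refl p ℚ.≤-refl))
bisect-value (suc n) f Λ {l} {u} p fl fu h with f (½ * (l + u)) ℚ.≤? 0ℚ
... | yes q = proj₁ R , ℚ.≤-trans (proj₂ R) (ℚ.≤-reflexive (eq Λ l u (½ ^ n)))
  where
  R = bisect-value n f Λ (mid≤u p) q fu (λ x y a b c → h x y (ℚ.≤-trans (l≤mid p) a) b c)
  eq : ∀ Λ l u t → Λ * (u - ½ * (l + u)) * t ≡ Λ * (u - l) * (½ * t)
  eq = solve-∀ ℚ-ring
... | no q = proj₁ R , ℚ.≤-trans (proj₂ R) (ℚ.≤-reflexive (eq Λ l u (½ ^ n)))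
  where
  R = bisect-value n f Λ (l≤mid p) fl (<-weaken (ℚ.≰⇒> q)) (λ x y a b c → h x y a b (ℚ.≤-trans c (mid≤u p)))
  eq : ∀ Λ l u t → Λ * (½ * (l + u) - l) * t ≡ Λ * (u - l) * (½ * t)
  eq = solve-∀ ℚ-ring

-- The two slopes have different tasks: Λ makes F k small at the bisected point, and κ turns small
-- values of F into small distances, so that the points form a Cauchy sequence.
module Root (F : ℕ → ℚ → ℚ) (a b κ Λ : ℚ) (N₀ : ℕ) (a≤b : a ℚ.≤ b) (0<κ : 0< κ)
  (at-a : ∀ k → N₀ ≤ k → F k a ℚ.≤ 0ℚ) (at-b : ∀ k → N₀ ≤ k → 0ℚ ℚ.≤ F k b)
  (slope≥ : ∀ k → N₀ ≤ k → ∀ x y → a ℚ.≤ x → x ℚ.≤ y → y ℚ.≤ b → κ * (y - x) ℚ.≤ F k y - F k x)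
  (slope≤ : ∀ k → N₀ ≤ k → ∀ x y → a ℚ.≤ x → x ℚ.≤ y → y ℚ.≤ b → F k y - F k x ℚ.≤ Λ * (y - x))
  (uniform : ∀ ε → 0< ε → ∃[ N ] (∀ x m n → a ℚ.≤ x → x ℚ.≤ b → N ≤ m → N ≤ n → ∣ F m x - F n x ∣ ℚ.< ε))
  where

  x̂ : ℕ → ℚ
  x̂ k = bisect k (F k) a b

  a≤x̂ : ∀ k → a ℚ.≤ x̂ k
  a≤x̂ k = proj₁ (bisect-range k (F k) a≤b)

  x̂≤b : ∀ k → x̂ k ℚ.≤ b
  x̂≤b k = proj₂ (bisect-range k (F k) a≤b)

  F-x̂ : ∀ ε → 0< ε → Ev (λ k → ∣ F k (x̂ k) ∣ ℚ.< ε)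
  F-x̂ ε 0<ε = ev₂ (λ k h p →
      let (u , v) = bisect-value k (F k) Λ a≤b (at-a k p) (at-b k p) (slope≤ k p)
          0≤c = ℚ.≤-trans (slack (ℚ.≤-trans (at-a k p) (at-b k p))) (slope≤ k p a b ℚ.≤-refl a≤b ℚ.≤-refl)
          w = ℚ.≤-<-trans (≤-*ˡ 0≤c (½^≤ k)) h
      in ℚ.≤-<-trans (∣∣≤ (ℚ.≤-trans u (0≤c ⊗ ^-≥0 (c≥0 ½) k)) v) w)
    (small (Λ * (b - a)) ε 0<ε) (ev-≥ N₀)

  separation : ∀ k → N₀ ≤ k → ∀ x y → a ℚ.≤ x → x ℚ.≤ b → a ℚ.≤ y → y ℚ.≤ b → κ * ∣ x - y ∣ ℚ.≤ ∣ F k x - F k y ∣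
  separation k p x y a≤x x≤b a≤y y≤b with ℚ.≤-total x y
  ... | inj₁ x≤y = subst₂ (λ u v → κ * u ℚ.≤ v) (trans (sym (ℚ.0≤p⇒∣p∣≡p (slack x≤y))) (∣-∣-comm y x))
                     (∣-∣-comm (F k y) (F k x)) (ℚ.≤-trans (slope≥ k p x y a≤x x≤y y≤b) (x≤∣x∣ _))
  ... | inj₂ y≤x = subst (λ u → κ * u ℚ.≤ ∣ F k x - F k y ∣) (sym (ℚ.0≤p⇒∣p∣≡p (slack y≤x)))
                     (ℚ.≤-trans (slope≥ k p y x a≤y y≤x x≤b) (x≤∣x∣ _))

  x̂-cauchy : ∀ ε → 0< ε → ∃[ N ] (∀ m n → N ≤ m → N ≤ n → ∣ x̂ m - x̂ n ∣ ℚ.< ε)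
  x̂-cauchy ε 0<ε =
    -- There are three errors below δ: the values of F m and F n at their own approximate zeros, and
    -- the change from F m to F n. With δ = κ ε / 4 their sum stays below κ ε.
    let δ = ½ * (½ * (κ * ε))
        0<δ : 0< δ
        0<δ = 0<half (0<half (0<κ ⊗⁺ 0<ε))
        (K , hK) = F-x̂ δ 0<δ
        (L , hL) = uniform δ 0<δ
        N = N₀ ℕ.⊔ K
    in N ℕ.⊔ L , λ m n p q → ℚ.*-cancelˡ-<-nonNeg κ {{ℚ.nonNegative (<-weaken 0<κ)}} (begin-strict
      κ * ∣ x̂ m - x̂ n ∣
        ≤⟨ separation m (⊔≤ˡ N₀ K (⊔≤ˡ N L p)) (x̂ m) (x̂ n) (a≤x̂ m) (x̂≤b m) (a≤x̂ n) (x̂≤b n) ⟩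
      ∣ F m (x̂ m) - F m (x̂ n) ∣
        ≡⟨ cong ∣_∣ (eq (F m (x̂ m)) (F m (x̂ n)) (F n (x̂ n))) ⟩
      ∣ F m (x̂ m) + (- F n (x̂ n) - (F m (x̂ n) - F n (x̂ n))) ∣
        ≤⟨ ℚ.≤-trans (ℚ.∣p+q∣≤∣p∣+∣q∣ (F m (x̂ m)) _) (ℚ.+-monoʳ-≤ ∣ F m (x̂ m) ∣ (ℚ.∣p-q∣≤∣p∣+∣q∣ (- F n (x̂ n)) (F m (x̂ n) - F n (x̂ n)))) ⟩
      ∣ F m (x̂ m) ∣ + (∣ - F n (x̂ n) ∣ + ∣ F m (x̂ n) - F n (x̂ n) ∣)
        <⟨ ℚ.+-mono-< (hK m (⊔≤ʳ N₀ K (⊔≤ˡ N L p))) (ℚ.+-mono-<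
             (subst (ℚ._< δ) (sym (ℚ.∣-p∣≡∣p∣ (F n (x̂ n)))) (hK n (⊔≤ʳ N₀ K (⊔≤ˡ N L q))))
             (hL (x̂ n) m n (a≤x̂ n) (x̂≤b n) (⊔≤ʳ N L p) (⊔≤ʳ N L q))) ⟩
      δ + (δ + δ)
        ≤⟨ by-slack (<-weaken 0<δ) (eq′ (κ * ε)) ⟩
      κ * ε ∎)
    where
    open ℚ.≤-Reasoning
    eq : ∀ p q r → p - q ≡ p + (- r - (q - r))
    eq = solve-∀ ℚ-ring
    eq′ : ∀ e → e ≡ ½ * (½ * e) + (½ * (½ * e) + ½ * (½ * e)) + ½ * (½ * e)
    eq′ = solve-∀ ℚ-ring

  root : ℝ
  root = mkℝ x̂ x̂-cauchy

-- The positive solution of r² l = n.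
module SqrtQuotient (n : ℕ) (1≤n : 1 ≤ n) (l : ℝ) (N₀ : ℕ)
  (½≤l : ∀ k → N₀ ≤ k → ½ ℚ.≤ seq l k) (l≤n : ∀ k → N₀ ≤ k → seq l k ℚ.≤ ℕ→ℚ n) where

  private
    n′ b : ℚ
    n′ = ℕ→ℚ n
    b  = 1ℚ + n′
    F : ℕ → ℚ → ℚ
    F k x = x * x * seq l k - n′
    0≤n′ : 0≤ n′
    0≤n′ = 0≤ℕ→ℚ n
    0≤b : 0≤ b
    0≤b = c≥0 1ℚ ⊕ 0≤n′

    -- The bracket is [1, 1 + n]: l ≤ n keeps the root above 1, and l ≥ ½ keeps it below 1 + n.
    at-1 : ∀ k → N₀ ≤ k → F k 1ℚ ℚ.≤ 0ℚ
    at-1 k p = by-slack (slack (l≤n k p)) (eq (seq l k) n′)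
      where eq : ∀ l n → 0ℚ ≡ 1ℚ * 1ℚ * l - n + (n - l)
            eq = solve-∀ ℚ-ring

    at-b : ∀ k → N₀ ≤ k → 0ℚ ℚ.≤ F k b
    at-b k p = subst 0≤_ (eq (seq l k) n′) (0≤b ⊗ 0≤b ⊗ slack (½≤l k p) ⊕ c≥0 ½ ⊗ (sq≥0 n′ ⊕ c≥0 1ℚ))
      where eq : ∀ l n → (1ℚ + n) * (1ℚ + n) * (l - ½) + ½ * (n * n + 1ℚ) ≡ (1ℚ + n) * (1ℚ + n) * l - n
            eq = solve-∀ ℚ-ring

    slope≥ : ∀ k → N₀ ≤ k → ∀ x y → 1ℚ ℚ.≤ x → x ℚ.≤ y → y ℚ.≤ b → 1ℚ * (y - x) ℚ.≤ F k y - F k x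
    slope≥ k p x y 1≤x x≤y y≤b = by-slack
      (slack x≤y ⊗ ((slack 1≤x ⊕ slack (ℚ.≤-trans 1≤x x≤y)) ⊗ ℚ.≤-trans (c≥0 ½) (½≤l k p) ⊕ (c≥0 (1ℚ + 1ℚ)) ⊗ slack (½≤l k p)))
      (eq x y (seq l k) n′)
      where eq : ∀ x y l n → (y * y * l - n) - (x * x * l - n) ≡ 1ℚ * (y - x) + (y - x) * ((x - 1ℚ + (y - 1ℚ)) * l + (1ℚ + 1ℚ) * (l - ½))
            eq = solve-∀ ℚ-ring

    Λ : ℚ
    Λ = (b + b) * n′

    slope≤ : ∀ k → N₀ ≤ k → ∀ x y → 1ℚ ℚ.≤ x → x ℚ.≤ y → y ℚ.≤ b → F k y - F k x ℚ.≤ Λ * (y - x)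
    slope≤ k p x y 1≤x x≤y y≤b = by-slack
      (slack x≤y ⊗ ((slack y≤b ⊕ slack (ℚ.≤-trans x≤y y≤b)) ⊗ ℚ.≤-trans (c≥0 ½) (½≤l k p) ⊕ (0≤b ⊕ 0≤b) ⊗ slack (l≤n k p)))
      (eq x y (seq l k) n′ b)
      where eq : ∀ x y l n b → (b + b) * n * (y - x) ≡ (y * y * l - n) - (x * x * l - n) + (y - x) * ((b - y + (b - x)) * l + (b + b) * (n - l))
            eq = solve-∀ ℚ-ring

    uniform : ∀ ε → 0< ε → ∃[ N ] (∀ x i j → 1ℚ ℚ.≤ x → x ℚ.≤ b → N ≤ i → N ≤ j → ∣ F i x - F j x ∣ ℚ.< ε)
    uniform ε 0<ε =
      let (B , hB) = archimedean (b * b)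
          (N , h)  = cauchy l (Split.δ ε 0<ε B) (Split.0<δ ε 0<ε B)
      in N , λ x i j 1≤x x≤b p q → subst (ℚ._< ε)
        (trans (cong (_* ∣ seq l i - seq l j ∣) (sym (ℚ.0≤p⇒∣p∣≡p (sq≥0 x))))
          (trans (sym (ℚ.∣p*q∣≡∣p∣*∣q∣ (x * x) (seq l i - seq l j))) (cong ∣_∣ (eq (x * x) (seq l i) (seq l j) n′))))
        (suc*< B (ℚ.0≤∣p∣ (seq l i - seq l j))
          (ℚ.≤-trans (mono₂ (ℚ.≤-trans (c≥0 1ℚ) 1≤x) 0≤b x≤b x≤b) hB) (scaled B 0<ε (h i j p q)))
      where eq : ∀ x l m n → x * (l - m) ≡ x * l - n - (x * m - n)
            eq = solve-∀ ℚ-ring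

  open Root F 1ℚ b 1ℚ Λ N₀ (by-slack 0≤n′ refl) (c>0 1ℚ) at-1 at-b slope≥ slope≤ uniform public
    using (root) renaming (a≤x̂ to 1≤root; x̂≤b to root≤; F-x̂ to root-value)

-- Growth of the exponential sums and the logarithm of a positive integer.

expSum-slope : ∀ {x y} → 0≤ x → x ℚ.≤ y → ∀ {k} → 2 ≤ k → y - x ℚ.≤ expSum y k - expSum x k
expSum-slope {x} {y} 0≤x x≤y (s≤s (s≤s {n = j} z≤n)) = subst (y - x ℚ.≤_)
    (sym (cong₂ _-_ (front2 y) (front2 x)))
    (by-slack (slack (Σ-mono j (λ i _ → powOverFact-mono 0≤x x≤y (suc (suc i))))) (eq x y (rest y) (rest x)))
  where
  rest : ℚ → ℚ
  rest x = Σ j (λ i → powOverFact x (suc (suc i)))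
  front2 : ∀ x → expSum x (suc (suc j)) ≡ 1ℚ + (1ℚ * (x * 1ℚ) + rest x)
  front2 x = trans (Σ-front (suc j) _) (cong (1ℚ +_) (Σ-front j _))
  eq : ∀ x y a b → (1ℚ + (1ℚ * (y * 1ℚ) + a)) - (1ℚ + (1ℚ * (x * 1ℚ) + b)) ≡ y - x + (a - b)
  eq = solve-∀ ℚ-ring

-- The logarithm is sought in [0, n], because exp 0 = 1 ≤ n and exp n ≥ 1 + n.
module Log (n : ℕ) (1≤n : 1 ≤ n) where

  private
    n′ : ℚ
    n′ = ℕ→ℚ n
    one : ℕ → ℚ
    one _ = 1ℚ
    one≤ : ∀ (k : ℕ) → ∣ 1ℚ ∣ ℚ.≤ 1ℚ
    one≤ k = ℚ.≤-refl
    F : ℕ → ℚ → ℚ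
    F k x = partialSum one x k - n′
    N₀ : ℕ
    N₀ = (n ℕ.+ n) ℕ.⊔ 2

    F-diff : ∀ k x y → F k y - F k x ≡ expSum y k - expSum x k
    F-diff k x y = trans (eq (partialSum one y k) (partialSum one x k) n′)
      (cong₂ _-_ (partialSum≡expSum y k) (partialSum≡expSum x k))
      where eq : ∀ a b n → a - n - (b - n) ≡ a - b
            eq = solve-∀ ℚ-ring

    slope≥ : ∀ k → N₀ ≤ k → ∀ x y → 0ℚ ℚ.≤ x → x ℚ.≤ y → y ℚ.≤ n′ → 1ℚ * (y - x) ℚ.≤ F k y - F k x
    slope≥ k p x y 0≤x x≤y y≤n = subst₂ ℚ._≤_ (sym (ℚ.*-identityˡ (y - x))) (sym (F-diff k x y)) (expSum-slope 0≤x x≤y (⊔≤ʳ (n ℕ.+ n) 2 p))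

    abs≤ : ∀ {x} → 0≤ x → x ℚ.≤ n′ → ∣ x ∣ ℚ.≤ n′
    abs≤ p q = subst (ℚ._≤ n′) (sym (ℚ.0≤p⇒∣p∣≡p p)) q

    Λ : ℚ
    Λ = Majorant.C n

    slope≤ : ∀ k → N₀ ≤ k → ∀ x y → 0ℚ ℚ.≤ x → x ℚ.≤ y → y ℚ.≤ n′ → F k y - F k x ℚ.≤ Λ * (y - x)
    slope≤ k p x y 0≤x x≤y y≤n = begin
      F k y - F k x                          ≡⟨ eq (partialSum one y k) (partialSum one x k) n′ ⟩
      partialSum one y k - partialSum one x k ≤⟨ ℚ.≤-trans (x≤∣x∣ _) (Majorant.sum-lipschitz n one one≤ (abs≤ (ℚ.≤-trans 0≤x x≤y) y≤n) (abs≤ 0≤x (ℚ.≤-trans x≤y y≤n)) k) ⟩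
      ∣ y - x ∣ * Majorant.V n k             ≤⟨ ≤-*ˡ (ℚ.0≤∣p∣ (y - x)) (ℚ.≤-trans (Majorant.V≤E n k) (Majorant.E≤C n k (⊔≤ˡ (n ℕ.+ n) 2 p))) ⟩
      ∣ y - x ∣ * Λ                          ≡⟨ trans (cong (_* Λ) (ℚ.0≤p⇒∣p∣≡p (slack x≤y))) (ℚ.*-comm (y - x) Λ) ⟩
      Λ * (y - x)                            ∎
      where open ℚ.≤-Reasoning
            eq : ∀ a b n → a - n - (b - n) ≡ a - b
            eq = solve-∀ ℚ-ring

    at-0 : ∀ k → N₀ ≤ k → F k 0ℚ ℚ.≤ 0ℚ
    at-0 k p with ℕ.m⊔n≤o⇒n≤o (n ℕ.+ n) 2 p
    ... | s≤s {n = j} _ = ℚ.≤-trans (ℚ.+-monoˡ-≤ (- n′) (begin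
        partialSum one 0ℚ (suc j)     ≡⟨ trans (partialSum≡expSum 0ℚ (suc j)) (cong (λ z → expSum z (suc j)) (sym (ℚ.*-zeroˡ 1ℚ))) ⟩
        expSum (ℕ→ℚ 0 * 1ℚ) (suc j)   ≤⟨ expSum-multiple (c≥0 1ℚ) 0 j ⟩
        1ℚ                            ≤⟨ ℕ→ℚ-mono 1≤n ⟩
        n′                            ∎)) (ℚ.≤-reflexive (ℚ.+-inverseʳ n′))
      where open ℚ.≤-Reasoning

    at-n : ∀ k → N₀ ≤ k → 0ℚ ℚ.≤ F k n′
    at-n k p with ℕ.m⊔n≤o⇒n≤o (n ℕ.+ n) 2 p
    ... | s≤s (s≤s {n = j} z≤n) = subst (0ℚ ℚ.≤_)
      (sym (trans (cong (_- n′) (trans (partialSum≡expSum n′ (suc (suc j))) (trans (Σ-front (suc j) _) (cong (1ℚ +_) (Σ-front j _))))) (eq n′ rest)))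
      (c≥0 1ℚ ⊕ Σ-≥0 j (λ i _ → powOverFact-≥0 (0≤ℕ→ℚ n) (suc (suc i))))
      where
      rest = Σ j (λ i → powOverFact n′ (suc (suc i)))
      eq : ∀ n r → (1ℚ + (1ℚ * (n * 1ℚ) + r)) - n ≡ 1ℚ + r
      eq = solve-∀ ℚ-ring

    uniform : ∀ ε → 0< ε → ∃[ N ] (∀ x i j → 0ℚ ℚ.≤ x → x ℚ.≤ n′ → N ≤ i → N ≤ j → ∣ F i x - F j x ∣ ℚ.< ε)
    uniform ε 0<ε = let (N , h) = partialSum-uniform n one one≤ ε 0<ε
      in N , λ x i j 0≤x x≤n p q → subst (ℚ._< ε) (cong ∣_∣ (eq (partialSum one x i) (partialSum one x j) n′))
           (h x i j (abs≤ 0≤x x≤n) p q)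
      where eq : ∀ a b n → a - b ≡ a - n - (b - n)
            eq = solve-∀ ℚ-ring

  open Root F 0ℚ n′ 1ℚ Λ N₀ (0≤ℕ→ℚ n) (c>0 1ℚ) at-0 at-n slope≥ slope≤ uniform public
    using () renaming (root to log; a≤x̂ to 0≤log; x̂≤b to log≤n; F-x̂ to exp-log)

  log-IsLogOf : log IsLogOf fromℕ n
  log-IsLogOf = exp-log

-- Null sequences; `x ≃ y` unfolds to `Null` of the difference of the approximations.

Null : (ℕ → ℚ) → Set
Null u = ∀ ε → 0< ε → Ev (λ n → ∣ u n ∣ ℚ.< ε)

Bounded : (ℕ → ℚ) → Set
Bounded u = ∃[ B ] Ev (λ n → ∣ u n ∣ ℚ.≤ ℕ→ℚ B)

null-cong : ∀ {u v} → (∀ n → v n ≡ u n) → Null u → Null v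
null-cong e h ε 0<ε = ev₁ (λ n p → subst (λ z → ∣ z ∣ ℚ.< ε) (sym (e n)) p) (h ε 0<ε)

null-+ : ∀ {u v} → Null u → Null v → Null (λ n → u n + v n)
null-+ {u} {v} p q ε 0<ε = ev₂ (λ n a b → ℚ.≤-<-trans (ℚ.∣p+q∣≤∣p∣+∣q∣ (u n) (v n))
  (subst (∣ u n ∣ + ∣ v n ∣ ℚ.<_) (half+half ε) (ℚ.+-mono-< a b))) (p (½ * ε) (0<half 0<ε)) (q (½ * ε) (0<half 0<ε))

null-* : ∀ {u v} → Bounded u → Null v → Null (λ n → u n * v n)
null-* {u} {v} (B , hB) q ε 0<ε = ev₂ (λ n b w → subst (ℚ._< ε) (sym (ℚ.∣p*q∣≡∣p∣*∣q∣ (u n) (v n)))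
  (suc*< B (ℚ.0≤∣p∣ (v n)) b (scaled B 0<ε w))) hB (q (Split.δ ε 0<ε B) (Split.0<δ ε 0<ε B))

null-neg : ∀ {u} → Null u → Null (λ n → - u n)
null-neg {u} h ε 0<ε = ev₁ (λ n → subst (ℚ._< ε) (sym (ℚ.∣-p∣≡∣p∣ (u n)))) (h ε 0<ε)

null-squeeze : ∀ {u v} → Ev (λ n → ∣ u n ∣ ℚ.≤ ∣ v n ∣) → Null v → Null u
null-squeeze h q ε 0<ε = ev₂ (λ n → ℚ.≤-<-trans) h (q ε 0<ε)

bounded : ∀ x → Bounded (seq x)
bounded = eventuallyBounded

bounded-const : ∀ c → Bounded (λ _ → c)
bounded-const c = let (B , hB) = archimedean ∣ c ∣ in B , ev (λ _ → hB)

bounded-+ : ∀ {u v} → Bounded u → Bounded v → Bounded (λ n → u n + v n)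
bounded-+ {u} {v} (B , p) (C , q) = B ℕ.+ C , ev₂ (λ n a b → ℚ.≤-trans (ℚ.∣p+q∣≤∣p∣+∣q∣ (u n) (v n))
  (subst (∣ u n ∣ + ∣ v n ∣ ℚ.≤_) (sym (ℕ→ℚ-+ B C)) (ℚ.+-mono-≤ a b))) p q

bounded-* : ∀ {u v} → Bounded u → Bounded v → Bounded (λ n → u n * v n)
bounded-* {u} {v} (B , p) (C , q) = B ℕ.* C , ev₂ (λ n a b → subst₂ ℚ._≤_ (sym (ℚ.∣p*q∣≡∣p∣*∣q∣ (u n) (v n))) (sym (ℕ→ℚ-* B C))
  (mono₂ (ℚ.0≤∣p∣ (u n)) (0≤ℕ→ℚ C) a b)) p q

-- Addition formulas

module _ (f g : ℕ → ℚ) (hf : ∀ k → ∣ f k ∣ ℚ.≤ 1ℚ) (hg : ∀ k → ∣ g k ∣ ℚ.≤ 1ℚ) (x y : ℝ) where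

  -- The difference is exactly `excess`, which is majorised by the excess of two exponential series
  -- at a common bound M of |x| and |y|.
  Cauchy-product : Null (λ n → seq (powerSeries f hf x *ᴿ powerSeries g hg y) n
    - Σ n (conv (λ k → f k * powOverFact (seq x n) k) (λ k → g k * powOverFact (seq y n) k)))
  Cauchy-product ε 0<ε =
    let (M₁ , N₁ , h₁) = eventuallyBounded x
        (M₂ , N₂ , h₂) = eventuallyBounded y
        M = M₁ ℕ.⊔ M₂
        (K , hK) = tail-small (M ℕ.+ M) ε 0<ε
    in ev₃ (λ n p q r →
      let F = λ k → f k * powOverFact (seq x n) k
          G = λ k → g k * powOverFact (seq y n) k
      in ℚ.≤-<-trans (subst (λ z → ∣ z ∣ ℚ.≤ tail (M ℕ.+ M) n)
           (sym (trans (cong (λ z → z - Σ n (conv F G))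
                  (trans (cong₂ _*_ (partialSum≡Σ f (seq x n) n) (partialSum≡Σ g (seq y n) n)) (Σ*Σ n F G)))
                (eq (Σ n (conv F G)) (excess n F G))))
           (excess-bound M
             (λ i → ∣coeff∣ {f i} (hf i) (Majorant.term-bound M (ℚ.≤-trans p (ℕ→ℚ-mono (ℕ.m≤m⊔n M₁ M₂))) i))
             (λ i → ∣coeff∣ {g i} (hg i) (Majorant.term-bound M (ℚ.≤-trans q (ℕ→ℚ-mono (ℕ.m≤n⊔m M₁ M₂))) i)) (proj₁ r)))
         (proj₂ r))
      (N₁ , h₁) (N₂ , h₂) (ev₂ (λ n a b → a , b) (ev-≥ ((M ℕ.+ M) ℕ.+ (M ℕ.+ M))) (K , hK))
    where eq : ∀ a b → a + b - a ≡ b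
          eq = solve-∀ ℚ-ring

-- The terms of the n-th convolution have p + q = n, so a coefficient identity whose right side
-- depends on p + q alone factors out as `h n`.
conv-addition : ∀ (f₁ g₁ f₂ g₂ h : ℕ → ℚ) → (∀ p q → f₁ p * g₁ q + f₂ p * g₂ q ≡ h (p ℕ.+ q)) → ∀ (P Q : ℕ → ℚ) n →
  conv (λ k → f₁ k * P k) (λ k → g₁ k * Q k) n + conv (λ k → f₂ k * P k) (λ k → g₂ k * Q k) n ≡ h n * conv P Q n
conv-addition f₁ g₁ f₂ g₂ h e P Q zero = trans (eq (f₁ 0) (g₁ 0) (f₂ 0) (g₂ 0) (P 0) (Q 0)) (cong (_* (P 0 * Q 0)) (e 0 0))
  where eq : ∀ a b c d p q → a * p * (b * q) + c * p * (d * q) ≡ (a * b + c * d) * (p * q)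
        eq = solve-∀ ℚ-ring
conv-addition f₁ g₁ f₂ g₂ h e P Q (suc n) = trans
  (eq (f₁ 0) (g₁ (suc n)) (f₂ 0) (g₂ (suc n)) (P 0) (Q (suc n))
    (conv (λ k → f₁ (suc k) * P (suc k)) (λ k → g₁ k * Q k) n) (conv (λ k → f₂ (suc k) * P (suc k)) (λ k → g₂ k * Q k) n))
  (trans (cong₂ (λ u v → u * (P 0 * Q (suc n)) + v) (e 0 (suc n)) (conv-addition (f₁ ∘ suc) g₁ (f₂ ∘ suc) g₂ (h ∘ suc) (λ p q → e (suc p) q) (P ∘ suc) Q n))
    (sym (ℚ.*-distribˡ-+ (h (suc n)) (P 0 * Q (suc n)) (conv (P ∘ suc) Q n))))
  where eq : ∀ a b c d p q u v → a * p * (b * q) + u + (c * p * (d * q) + v) ≡ (a * b + c * d) * (p * q) + (u + v)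
        eq = solve-∀ ℚ-ring

-- One argument for sin, cos and exp: each addition theorem is a bilinear identity between
-- coefficients, while the powers combine by `binomial`.
addition : ∀ (f₁ g₁ f₂ g₂ h : ℕ → ℚ) → (∀ p q → f₁ p * g₁ q + f₂ p * g₂ q ≡ h (p ℕ.+ q)) →
  ∀ hf₁ hg₁ hf₂ hg₂ hh x y →
  powerSeries f₁ hf₁ x *ᴿ powerSeries g₁ hg₁ y +ᴿ powerSeries f₂ hf₂ x *ᴿ powerSeries g₂ hg₂ y ≃ powerSeries h hh (x +ᴿ y)
addition f₁ g₁ f₂ g₂ h e hf₁ hg₁ hf₂ hg₂ hh x y = null-cong pointwise
  (null-+ (Cauchy-product f₁ g₁ hf₁ hg₁ x y) (Cauchy-product f₂ g₂ hf₂ hg₂ x y))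
  where
  eq : ∀ a b c d s → s ≡ c + d → a + b - s ≡ (a - c) + (b - d)
  eq a b c d s refl = eq′ a b c d
    where eq′ : ∀ a b c d → a + b - (c + d) ≡ (a - c) + (b - d)
          eq′ = solve-∀ ℚ-ring
  pointwise : ∀ n → _
  pointwise n = eq (partialSum f₁ X n * partialSum g₁ Y n) (partialSum f₂ X n * partialSum g₂ Y n)
    (Σ n (conv (λ k → f₁ k * P k) (λ k → g₁ k * Q k))) (Σ n (conv (λ k → f₂ k * P k) (λ k → g₂ k * Q k)))
    (partialSum h (X + Y) n)
    (trans (partialSum≡Σ h (X + Y) n) (trans (Σ-cong n (λ k → trans (cong (h k *_) (sym (binomial X Y k)))
      (sym (conv-addition f₁ g₁ f₂ g₂ h e P Q k)))) (Σ-+ n (conv (λ k → f₁ k * P k) (λ k → g₁ k * Q k)) (conv (λ k → f₂ k * P k) (λ k → g₂ k * Q k)))))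
    where
    X = seq x n
    Y = seq y n
    P = powOverFact X
    Q = powOverFact Y

cosCoeff : ℕ → ℚ
cosCoeff k = sinCoeff (suc k)

∣cosCoeff∣≤1 : ∀ k → ∣ cosCoeff k ∣ ℚ.≤ 1ℚ
∣cosCoeff∣≤1 k = ∣sinCoeff∣≤1 (suc k)

cos : ℝ → ℝ
cos = powerSeries cosCoeff ∣cosCoeff∣≤1

-sinCoeff : ℕ → ℚ
-sinCoeff k = - sinCoeff k

∣-sinCoeff∣≤1 : ∀ k → ∣ -sinCoeff k ∣ ℚ.≤ 1ℚ
∣-sinCoeff∣≤1 k = subst (ℚ._≤ 1ℚ) (sym (ℚ.∣-p∣≡∣p∣ (sinCoeff k))) (∣sinCoeff∣≤1 k)

sinCoeff-+ : ∀ p q → sinCoeff p * cosCoeff q + cosCoeff p * sinCoeff q ≡ sinCoeff (p ℕ.+ q)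
sinCoeff-+ zero          q = eq (cosCoeff q) (sinCoeff q)
  where eq : ∀ c s → 0ℚ * c + 1ℚ * s ≡ s
        eq = solve-∀ ℚ-ring
sinCoeff-+ (suc zero)    q = eq (cosCoeff q) (sinCoeff q)
  where eq : ∀ c s → 1ℚ * c + - 0ℚ * s ≡ c
        eq = solve-∀ ℚ-ring
sinCoeff-+ (suc (suc p)) q = trans (eq (sinCoeff p) (cosCoeff q) (cosCoeff p) (sinCoeff q)) (cong (λ z → - z) (sinCoeff-+ p q))
  where eq : ∀ a b c d → - a * b + - c * d ≡ - (a * b + c * d)
        eq = solve-∀ ℚ-ring

cosCoeff-+ : ∀ p q → cosCoeff p * cosCoeff q + -sinCoeff p * sinCoeff q ≡ cosCoeff (p ℕ.+ q)
cosCoeff-+ zero          q = eq (cosCoeff q) (sinCoeff q)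
  where eq : ∀ c s → 1ℚ * c + - 0ℚ * s ≡ c
        eq = solve-∀ ℚ-ring
cosCoeff-+ (suc zero)    q = eq (cosCoeff q) (sinCoeff q)
  where eq : ∀ c s → - 0ℚ * c + - 1ℚ * s ≡ - s
        eq = solve-∀ ℚ-ring
cosCoeff-+ (suc (suc p)) q = trans (eq (cosCoeff p) (cosCoeff q) (sinCoeff p) (sinCoeff q)) (cong (λ z → - z) (cosCoeff-+ p q))
  where eq : ∀ a b c d → - a * b + - - c * d ≡ - (a * b + - c * d)
        eq = solve-∀ ℚ-ring

S C : ℕ → ℚ → ℚ
S n x = partialSum sinCoeff x n
C n x = partialSum cosCoeff x n

sin-+ : ∀ x y → Null (λ n → S n (seq x n + seq y n) - (S n (seq x n) * C n (seq y n) + C n (seq x n) * S n (seq y n)))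
sin-+ x y = ≃-sym {sin x *ᴿ cos y +ᴿ cos x *ᴿ sin y} {sin (x +ᴿ y)}
  (addition sinCoeff cosCoeff cosCoeff sinCoeff sinCoeff sinCoeff-+ ∣sinCoeff∣≤1 ∣cosCoeff∣≤1 ∣cosCoeff∣≤1 ∣sinCoeff∣≤1 ∣sinCoeff∣≤1 x y)

partialSum-neg : ∀ s x n → partialSum (λ k → - s k) x n ≡ - partialSum s x n
partialSum-neg s x zero    = refl
partialSum-neg s x (suc n) = trans (cong (_+ - s n * powOverFact x n) (partialSum-neg s x n)) (eq (partialSum s x n) (s n) (powOverFact x n))
  where eq : ∀ a b c → - a + - b * c ≡ - (a + b * c)
        eq = solve-∀ ℚ-ring

cos-+ : ∀ x y → Null (λ n → C n (seq x n + seq y n) - (C n (seq x n) * C n (seq y n) - S n (seq x n) * S n (seq y n)))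
cos-+ x y = null-cong (λ n → trans (eq (C n (seq x n + seq y n)) (C n (seq x n) * C n (seq y n)) (S n (seq x n)) (S n (seq y n)))
    (cong (λ z → C n (seq x n + seq y n) - (C n (seq x n) * C n (seq y n) + z * S n (seq y n))) (sym (partialSum-neg sinCoeff (seq x n) n))))
  (≃-sym {cos x *ᴿ cos y +ᴿ powerSeries -sinCoeff ∣-sinCoeff∣≤1 x *ᴿ sin y} {cos (x +ᴿ y)}
    (addition cosCoeff cosCoeff -sinCoeff sinCoeff cosCoeff cosCoeff-+ ∣cosCoeff∣≤1 ∣cosCoeff∣≤1 ∣-sinCoeff∣≤1 ∣sinCoeff∣≤1 ∣cosCoeff∣≤1 x y))
  where eq : ∀ a b c d → a - (b - c * d) ≡ a - (b + - c * d)
        eq = solve-∀ ℚ-ring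

exp-+ : ∀ x y → Null (λ n → partialSum (λ _ → 1ℚ) (seq x n) n * partialSum (λ _ → 1ℚ) (seq y n) n
                            - partialSum (λ _ → 1ℚ) (seq x n + seq y n) n)
exp-+ x y = null-cong (λ n → eq (partialSum one (seq x n) n) (partialSum one (seq y n) n)
    (partialSum nil (seq x n) n) (partialSum nil (seq y n) n) (partialSum one (seq x n + seq y n) n) (partialSum-0 (seq x n) n))
  (addition one one nil nil one (λ _ _ → refl) (λ _ → ℚ.≤-refl) (λ _ → ℚ.≤-refl) (λ _ → c≥0 1ℚ) (λ _ → c≥0 1ℚ) (λ _ → ℚ.≤-refl) x y)
  where
  one nil : ℕ → ℚ
  one _ = 1ℚ
  nil _ = 0ℚ
  partialSum-0 : ∀ x n → partialSum nil x n ≡ 0ℚ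
  partialSum-0 x zero    = refl
  partialSum-0 x (suc n) = trans (cong₂ _+_ (partialSum-0 x n) (ℚ.*-zeroˡ (powOverFact x n))) (ℚ.+-identityʳ 0ℚ)
  eq : ∀ a b c d e → c ≡ 0ℚ → a * b - e ≡ a * b + c * d - e
  eq a b _ d e refl = eq′ a b d e
    where eq′ : ∀ a b d e → a * b - e ≡ a * b + 0ℚ * d - e
          eq′ = solve-∀ ℚ-ring

-- Alternating sums

-- `sinCoeff` serves as the sign pattern 0, 1, 0, -1, so this is t 1 - t 3 + t 5 - ... with the even
-- indices skipped.
alternating : (ℕ → ℚ) → ℕ → ℚ
alternating t n = Σ n (λ k → sinCoeff k * t k)

alternating-step : ∀ t n → alternating t (suc (suc n)) ≡ t 1 - alternating (t ∘ suc ∘ suc) n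
alternating-step t n = trans (Σ-front (suc n) _) (trans (cong (0ℚ * t 0 +_) (Σ-front n _))
  (trans (cong (λ z → 0ℚ * t 0 + (1ℚ * t 1 + z)) (trans (Σ-cong n (λ k → sym (ℚ.neg-distribˡ-* (sinCoeff k) (t (suc (suc k)))))) (neg n)))
    (eq (t 0) (t 1) (alternating (t ∘ suc ∘ suc) n))))
  where
  eq : ∀ a b c → 0ℚ * a + (1ℚ * b + - c) ≡ b - c
  eq = solve-∀ ℚ-ring
  eq′ : ∀ a b → - a + - b ≡ - (a + b)
  eq′ = solve-∀ ℚ-ring
  neg : ∀ n {f : ℕ → ℚ} → Σ n (λ k → - f k) ≡ - Σ n f
  neg zero        = refl
  neg (suc n) {f} = trans (cong (_+ - f n) (neg n)) (eq′ (Σ n f) (f n))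

-- Leibniz' criterion: the sum is t 1 minus a sum of the same kind that starts at t 3 and hence lies
-- between 0 and t 3.
alternating-bounds : ∀ n t → (∀ k → 0≤ t (suc k)) → (∀ k → t (suc (suc (suc k))) ℚ.≤ t (suc k)) →
  0≤ alternating t n × alternating t n ℚ.≤ t 1
alternating-bounds zero          t p q = ℚ.≤-refl , p 0
alternating-bounds (suc zero)    t p q = ℚ.≤-reflexive (sym e) , ℚ.≤-trans (ℚ.≤-reflexive e) (p 0)
  where e : 0ℚ + 0ℚ * t 0 ≡ 0ℚ
        e = trans (ℚ.+-identityˡ _) (ℚ.*-zeroˡ (t 0))
alternating-bounds (suc (suc n)) t p q = subst (λ z → 0≤ z × z ℚ.≤ t 1) (sym (alternating-step t n))
  ( slack (ℚ.≤-trans (proj₂ IH) (q 0)) , by-slack (proj₁ IH) (eq (t 1) _))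
  where
  IH = alternating-bounds n (t ∘ suc ∘ suc) (λ k → p (suc (suc k))) (λ k → q (suc (suc k)))
  eq : ∀ a b → a ≡ a - b + b
  eq = solve-∀ ℚ-ring

sin-alternating : ∀ n x → S n x ≡ alternating (powOverFact x) n
sin-alternating n x = partialSum≡Σ sinCoeff x n

cos-alternating : ∀ n x → C (suc n) x ≡ 1ℚ - alternating (powOverFact x ∘ suc) n
cos-alternating n x = trans (partialSum≡Σ cosCoeff x (suc n)) (trans (Σ-front n _)
  (trans (cong (1ℚ * 1ℚ +_) (trans (Σ-cong n (λ k → eq (sinCoeff k) (powOverFact x (suc k)))) (Σ-*ˡ n (- 1ℚ) _)))
    (eq′ (alternating (powOverFact x ∘ suc) n))))
  where eq : ∀ a b → - a * b ≡ - 1ℚ * (a * b)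
        eq = solve-∀ ℚ-ring
        eq′ : ∀ a → 1ℚ * 1ℚ + - 1ℚ * a ≡ 1ℚ - a
        eq′ = solve-∀ ℚ-ring

2ℚ : ℚ
2ℚ = 1ℚ + 1ℚ

2≤ℕ→ℚ : ∀ k → 2ℚ ℚ.≤ ℕ→ℚ (suc (suc k))
2≤ℕ→ℚ k = ℕ→ℚ-mono {2} {suc (suc k)} (s≤s (s≤s z≤n))

powOverFact-antitone : ∀ {x} → 0≤ x → x ℚ.≤ 2ℚ → ∀ k → powOverFact x (suc (suc k)) ℚ.≤ powOverFact x (suc k)
powOverFact-antitone {x} 0≤x x≤2 k = subst (powOverFact x (suc (suc k)) ℚ.≤_) (ℚ.*-identityʳ _)
  (≤-*ˡ (powOverFact-≥0 0≤x (suc k)) (subst (x * (1/ℕ suc (suc k)) ℚ.≤_) (suc*1/ (suc k))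
    (≤-*ʳ (0≤1/ (suc k)) (ℚ.≤-trans x≤2 (2≤ℕ→ℚ k)))))

powOverFact-antitone₂ : ∀ {x} → 0≤ x → x ℚ.≤ 2ℚ → ∀ k → powOverFact x (suc (suc (suc k))) ℚ.≤ powOverFact x (suc k)
powOverFact-antitone₂ p q k = ℚ.≤-trans (powOverFact-antitone p q (suc k)) (powOverFact-antitone p q k)

S-bounds : ∀ n {x} → 0≤ x → x ℚ.≤ 2ℚ → 0≤ S n x × S n x ℚ.≤ x
S-bounds n {x} p q = subst (λ z → 0≤ z × z ℚ.≤ x) (sym (sin-alternating n x))
  (proj₁ R , subst (alternating (powOverFact x) n ℚ.≤_) (eq x) (proj₂ R))
  where R = alternating-bounds n (powOverFact x) (λ k → powOverFact-≥0 p (suc k)) (powOverFact-antitone₂ p q)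
        eq : ∀ x → 1ℚ * (x * 1ℚ) ≡ x
        eq = solve-∀ ℚ-ring

⅓ ⅙ : ℚ
⅓ = 1/ℕ 3
⅙ = 1/ℕ 6

-- sin x ≥ x - x³/6, and x² ≤ 4.
S-≥ : ∀ n {x} → 0≤ x → x ℚ.≤ 2ℚ → ⅓ * x ℚ.≤ S (suc (suc n)) x
S-≥ n {x} p q = subst (⅓ * x ℚ.≤_) (sym (trans (sin-alternating (suc (suc n)) x) (alternating-step t n)))
  (by-slack (slack (proj₂ (alternating-bounds n (t ∘ suc ∘ suc) (λ k → powOverFact-≥0 p (suc (suc (suc k)))) (λ k → powOverFact-antitone₂ p q (suc (suc k)))))
      ⊕ c≥0 ⅙ ⊗ p ⊗ (slack (ℚ.≤-trans (≤-*ˡ p q) (≤-*ʳ (c≥0 2ℚ) q))))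
    (eq x (alternating (t ∘ suc ∘ suc) n)))
  where t = powOverFact x
        eq : ∀ x a → 1ℚ * (x * 1ℚ) - a ≡ ⅓ * x + ((1ℚ * (x * 1ℚ) * (x * ½) * (x * ⅓) - a) + ⅙ * x * (2ℚ * 2ℚ - x * x))
        eq = solve-∀ ℚ-ring

-- In place of the mean value theorem: cos x - cos y is itself an alternating sum, with terms d k =
-- (yᵏ - xᵏ) / k!, and Leibniz' bounds apply once these are known to decrease.
module CosSlope (x y : ℚ) (0≤x : 0≤ x) (x≤y : x ℚ.≤ y) (y≤2 : y ℚ.≤ 2ℚ) where

  private
    X Y d : ℕ → ℚ
    X = powOverFact x
    Y = powOverFact y
    d k = Y k - X k
    0≤y = ℚ.≤-trans 0≤x x≤y

    scale : ∀ k a → ℕ→ℚ (suc k) * (powOverFact a (suc k)) ≡ a * powOverFact a k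
    scale k a = D-powOverFact a k

    0≤d : ∀ k → 0≤ d k
    0≤d k = slack (powOverFact-mono 0≤x x≤y k)

    tangent : ∀ k → (y - x) * X k ℚ.≤ d (suc k)
    tangent zero    = ℚ.≤-reflexive (eq x y)
      where eq : ∀ x y → (y - x) * 1ℚ ≡ 1ℚ * (y * 1ℚ) - 1ℚ * (x * 1ℚ)
            eq = solve-∀ ℚ-ring
    tangent (suc k) = ≤-*-cancelˡ (0<ℕ→ℚ-suc (suc k)) (begin
      ℕ→ℚ (suc (suc k)) * ((y - x) * X (suc k))
        ≡⟨ trans (cong (_* ((y - x) * X (suc k))) (ℕ→ℚ-suc (suc k))) (eq (ℕ→ℚ (suc k)) (y - x) (X (suc k))) ⟩
      (y - x) * (X (suc k) + ℕ→ℚ (suc k) * X (suc k))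
        ≡⟨ cong (λ z → (y - x) * (X (suc k) + z)) (scale k x) ⟩
      (y - x) * (X (suc k) + x * X k)
        ≤⟨ by-slack (0≤y ⊗ slack (tangent k) ⊕ sq≥0 (y - x) ⊗ powOverFact-≥0 0≤x k) (eq′ x y (X (suc k)) (Y (suc k)) (X k)) ⟩
      y * Y (suc k) - x * X (suc k)
        ≡⟨ cong₂ _-_ (sym (scale (suc k) y)) (sym (scale (suc k) x)) ⟩
      ℕ→ℚ (suc (suc k)) * Y (suc (suc k)) - ℕ→ℚ (suc (suc k)) * X (suc (suc k))
        ≡⟨ eq″ (ℕ→ℚ (suc (suc k))) (Y (suc (suc k))) (X (suc (suc k))) ⟩
      ℕ→ℚ (suc (suc k)) * d (suc (suc k)) ∎)
      where
      open ℚ.≤-Reasoning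
      eq : ∀ k a b → (1ℚ + k) * (a * b) ≡ a * (b + k * b)
      eq = solve-∀ ℚ-ring
      eq′ : ∀ x y u v w → y * v - x * u ≡ (y - x) * (u + x * w) + (y * ((v - u) - (y - x) * w) + (y - x) * (y - x) * w)
      eq′ = solve-∀ ℚ-ring
      eq″ : ∀ a b c → a * b - a * c ≡ a * (b - c)
      eq″ = solve-∀ ℚ-ring

    -- (k + 2) d (k + 2) = y d (k + 1) + (y - x) X (k + 1), and by `tangent` the last term is at
    -- most one copy of d (k + 2).
    shrink : ∀ k → ℕ→ℚ (suc k) * d (suc (suc k)) ℚ.≤ 2ℚ * d (suc k)
    shrink k = begin
      n * d (suc (suc k))                              ≤⟨ by-slack (slack (tangent (suc k))) (eq n x y (X (suc k)) (d (suc (suc k)))) ⟩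
      (1ℚ + n) * d (suc (suc k)) - (y - x) * X (suc k) ≡⟨ cong (λ z → z * d (suc (suc k)) - (y - x) * X (suc k)) (sym (ℕ→ℚ-suc (suc k))) ⟩
      n′ * d (suc (suc k)) - (y - x) * X (suc k)       ≡⟨ eq₁ n′ (Y (suc (suc k))) (X (suc (suc k))) ((y - x) * X (suc k)) ⟩
      n′ * Y (suc (suc k)) - n′ * X (suc (suc k)) - (y - x) * X (suc k)
                                                       ≡⟨ cong₂ (λ u v → u - v - (y - x) * X (suc k)) (scale (suc k) y) (scale (suc k) x) ⟩
      y * Y (suc k) - x * X (suc k) - (y - x) * X (suc k) ≡⟨ eq₂ x y (X (suc k)) (Y (suc k)) ⟩
      y * d (suc k)                                    ≤⟨ ≤-*ʳ (0≤d (suc k)) y≤2 ⟩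
      2ℚ * d (suc k)                                   ∎
      where
      open ℚ.≤-Reasoning
      n = ℕ→ℚ (suc k)
      n′ = ℕ→ℚ (suc (suc k))
      eq : ∀ n x y u v → (1ℚ + n) * v - (y - x) * u ≡ n * v + (v - (y - x) * u)
      eq = solve-∀ ℚ-ring
      eq₁ : ∀ n a b c → n * (a - b) - c ≡ n * a - n * b - c
      eq₁ = solve-∀ ℚ-ring
      eq₂ : ∀ x y u v → y * v - x * u - (y - x) * u ≡ y * (v - u)
      eq₂ = solve-∀ ℚ-ring

    d-antitone : ∀ k → d (suc (suc (suc k))) ℚ.≤ d (suc (suc k))
    d-antitone k = ≤-*-cancelˡ (0<ℕ→ℚ-suc (suc k)) (ℚ.≤-trans (shrink (suc k)) (≤-*ʳ (0≤d (suc (suc k))) (2≤ℕ→ℚ k)))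

    d-antitone₂ : ∀ k → d (suc (suc (suc (suc k)))) ℚ.≤ d (suc (suc k))
    d-antitone₂ k = ℚ.≤-trans (d-antitone (suc k)) (d-antitone k)

    difference : ∀ n → C (suc n) x - C (suc n) y ≡ alternating (d ∘ suc) n
    difference n = trans (cong₂ _-_ (cos-alternating n x) (cos-alternating n y)) (trans (eq (alternating (X ∘ suc) n) (alternating (Y ∘ suc) n))
      (trans (cong (λ z → alternating (Y ∘ suc) n + z) (sym (Σ-*ˡ n (- 1ℚ) _))) (trans (sym (Σ-+ n _ _))
        (Σ-cong n (λ k → eq′ (sinCoeff k) (Y (suc k)) (X (suc k)))))))
      where eq : ∀ a b → 1ℚ - a - (1ℚ - b) ≡ b + - 1ℚ * a
            eq = solve-∀ ℚ-ring
            eq′ : ∀ s a b → s * a + - 1ℚ * (s * b) ≡ s * (a - b)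
            eq′ = solve-∀ ℚ-ring

  ≤-slope : ∀ n → C (suc n) x - C (suc n) y ℚ.≤ 2ℚ * (y - x)
  ≤-slope n = subst (ℚ._≤ 2ℚ * (y - x)) (sym (difference n)) (ℚ.≤-trans
    (proj₂ (alternating-bounds n (d ∘ suc) (λ k → 0≤d (suc (suc k))) d-antitone₂))
    (by-slack (c≥0 ½ ⊗ slack x≤y ⊗ (slack y≤2 ⊕ slack (ℚ.≤-trans x≤y y≤2))) (eq x y)))
    where eq : ∀ x y → 2ℚ * (y - x) ≡ (1ℚ * (y * 1ℚ) * (y * ½) - 1ℚ * (x * 1ℚ) * (x * ½)) + ½ * (y - x) * (2ℚ - y + (2ℚ - x))
          eq = solve-∀ ℚ-ring

  -- The difference is at least d 2 - d 4. Two uses of `shrink` give d 4 ≤ ⅔ d 2, which leaves ⅓ d 2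
  -- = (y² - x²) / 6.
  ≥-slope : ∀ n → ⅙ * ((y - x) * (y + x)) ℚ.≤ C (suc (suc (suc n))) x - C (suc (suc (suc n))) y
  ≥-slope n = subst (⅙ * ((y - x) * (y + x)) ℚ.≤_)
    (sym (trans (difference (suc (suc n))) (alternating-step (d ∘ suc) n)))
    (by-slack (slack (proj₂ (alternating-bounds n (d ∘ suc ∘ suc ∘ suc) (λ k → 0≤d (suc (suc (suc (suc k))))) (λ k → d-antitone₂ (suc (suc k)))))
       ⊕ c≥0 ⅓ ⊗ slack (shrink 2) ⊕ c≥0 ⅓ ⊗ slack (shrink 1))
      (eq x y (X 3) (Y 3) (X 4) (Y 4) (alternating (d ∘ suc ∘ suc ∘ suc) n)))
    where eq : ∀ x y a b a′ b′ r → 1ℚ * (y * 1ℚ) * (y * ½) - 1ℚ * (x * 1ℚ) * (x * ½) - r ≡ ⅙ * ((y - x) * (y + x))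
             + (((b′ - a′) - r) + ⅓ * (2ℚ * (b - a) - (2ℚ + 1ℚ) * (b′ - a′)) + ⅓ * (2ℚ * (1ℚ * (y * 1ℚ) * (y * ½) - 1ℚ * (x * 1ℚ) * (x * ½)) - 2ℚ * (b - a)))
          eq = solve-∀ ℚ-ring

-- π

-- Slightly above π/2, and small enough that c² = (4/3) (π/2)² is below 3.3.
cosRootBound : ℚ
cosRootBound = ℤ.+ 1573 ℚ./ 1000

private
  bnd = cosRootBound

  1≤bnd : 1ℚ ℚ.≤ bnd
  1≤bnd = toWitness {a? = 1ℚ ℚ.≤? bnd} _

  bnd≤2 : bnd ℚ.≤ 2ℚ
  bnd≤2 = toWitness {a? = bnd ℚ.≤? 2ℚ} _

  -- The sign is reversed because `Root` expects increasing functions.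
  -C : ℕ → ℚ → ℚ
  -C k x = - C k x

  -C-at-1 : ∀ k → 9 ≤ k → -C k 1ℚ ℚ.≤ 0ℚ
  -C-at-1 (suc k) _ = by-slack (slack (proj₂ (alternating-bounds k (powOverFact 1ℚ ∘ suc)
      (λ i → powOverFact-≥0 (c≥0 1ℚ) (suc (suc i)))
      (λ i → powOverFact-antitone₂ (c≥0 1ℚ) (by-slack (c≥0 1ℚ) refl) (suc i)))) ⊕ c≥0 ½)
      (trans (eq (alternating (powOverFact 1ℚ ∘ suc) k)) (cong (λ z → - z + ((½ - alternating (powOverFact 1ℚ ∘ suc) k) + ½)) (sym (cos-alternating k 1ℚ))))
    where eq : ∀ a → 0ℚ ≡ - (1ℚ - a) + ((½ - a) + ½)
          eq = solve-∀ ℚ-ring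

  -C-at-bnd : ∀ k → 9 ≤ k → 0ℚ ℚ.≤ -C k bnd
  -C-at-bnd (suc k) (s≤s 8≤k) = go k 8≤k
    where
    t : ℕ → ℚ
    t = powOverFact bnd
    0≤bnd : 0≤ bnd
    0≤bnd = ℚ.≤-trans (c≥0 1ℚ) 1≤bnd
    -- The Taylor polynomial of degree 8 bounds cos from above and is already negative here; that of
    -- degree 4 is not, this close to π/2.
    value : 0≤ (t 2 - t 4 + t 6 - t 8 - 1ℚ)
    value = toWitness {a? = 0ℚ ℚ.≤? (t 2 - t 4 + t 6 - t 8 - 1ℚ)} _
    eq : ∀ a b c d r → a - (b - (c - r)) - 1ℚ ≡ a - b + c - d - 1ℚ + (d - r)
    eq = solve-∀ ℚ-ring
    eq′ : ∀ a → - (1ℚ - a) ≡ a - 1ℚ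
    eq′ = solve-∀ ℚ-ring
    go : ∀ k → 8 ≤ k → 0ℚ ℚ.≤ -C (suc k) bnd
    go (suc (suc (suc (suc (suc (suc k)))))) (s≤s (s≤s (s≤s (s≤s (s≤s (s≤s _)))))) = subst (0ℚ ℚ.≤_)
      (sym (trans (cong (λ z → - z) (cos-alternating (6 ℕ.+ k) bnd)) (trans (eq′ (alternating (t ∘ suc) (6 ℕ.+ k)))
        (trans (cong (_- 1ℚ) (trans (alternating-step (t ∘ suc) (4 ℕ.+ k))
           (cong (λ z → t 2 - z) (trans (alternating-step (t ∘ suc ∘ suc ∘ suc) (2 ℕ.+ k))
             (cong (λ z → t 4 - z) (alternating-step (t ∘ suc ∘ suc ∘ suc ∘ suc ∘ suc) k))))))
          (eq (t 2) (t 4) (t 6) (t 8) (alternating t₇ k))))))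
      (value ⊕ slack (proj₂ (alternating-bounds k t₇ (λ i → powOverFact-≥0 0≤bnd (8 ℕ.+ i)) (λ i → powOverFact-antitone₂ 0≤bnd bnd≤2 (7 ℕ.+ i)))))
      where t₇ = λ i → t (7 ℕ.+ i)

  slope≥ : ∀ k → 9 ≤ k → ∀ x y → 1ℚ ℚ.≤ x → x ℚ.≤ y → y ℚ.≤ bnd → ⅓ * (y - x) ℚ.≤ -C k y - -C k x
  slope≥ (suc (suc (suc k))) (s≤s (s≤s (s≤s _))) x y 1≤x x≤y y≤b = ℚ.≤-trans
    (by-slack (c≥0 ⅙ ⊗ (slack x≤y ⊗ (slack 1≤x ⊕ slack (ℚ.≤-trans 1≤x x≤y)))) (eq x y))
    (subst (⅙ * ((y - x) * (y + x)) ℚ.≤_) (eq′ (C (3 ℕ.+ k) x) (C (3 ℕ.+ k) y))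
      (CosSlope.≥-slope x y (ℚ.≤-trans (c≥0 1ℚ) 1≤x) x≤y (ℚ.≤-trans y≤b bnd≤2) k))
    where eq : ∀ x y → ⅙ * ((y - x) * (y + x)) ≡ ⅓ * (y - x) + ⅙ * ((y - x) * (x - 1ℚ + (y - 1ℚ)))
          eq = solve-∀ ℚ-ring
          eq′ : ∀ a b → a - b ≡ - b - - a
          eq′ = solve-∀ ℚ-ring

  slope≤ : ∀ k → 9 ≤ k → ∀ x y → 1ℚ ℚ.≤ x → x ℚ.≤ y → y ℚ.≤ bnd → -C k y - -C k x ℚ.≤ 2ℚ * (y - x)
  slope≤ (suc k) _ x y 1≤x x≤y y≤b = subst (ℚ._≤ 2ℚ * (y - x)) (eq′ (C (suc k) x) (C (suc k) y))
      (CosSlope.≤-slope x y (ℚ.≤-trans (c≥0 1ℚ) 1≤x) x≤y (ℚ.≤-trans y≤b bnd≤2) k)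
    where eq′ : ∀ a b → a - b ≡ - b - - a
          eq′ = solve-∀ ℚ-ring

  uniform : ∀ ε → 0< ε → ∃[ N ] (∀ x i j → 1ℚ ℚ.≤ x → x ℚ.≤ bnd → N ≤ i → N ≤ j → ∣ -C i x - -C j x ∣ ℚ.< ε)
  uniform ε 0<ε = let (N , h) = partialSum-uniform 2 cosCoeff ∣cosCoeff∣≤1 ε 0<ε
    in N , λ x i j 1≤x x≤b p q → subst (ℚ._< ε)
         (trans (sym (ℚ.∣-p∣≡∣p∣ (C i x - C j x))) (cong ∣_∣ (eq (C i x) (C j x))))
         (h x i j (subst (ℚ._≤ ℕ→ℚ 2) (sym (ℚ.0≤p⇒∣p∣≡p (ℚ.≤-trans (c≥0 1ℚ) 1≤x))) (ℚ.≤-trans x≤b bnd≤2)) p q)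
    where eq : ∀ a b → - (a - b) ≡ - a - - b
          eq = solve-∀ ℚ-ring

open Root -C 1ℚ bnd ⅓ 2ℚ 9 1≤bnd (c>0 ⅓) -C-at-1 -C-at-bnd slope≥ slope≤ uniform
  public using () renaming (root to π/2; a≤x̂ to 1≤π/2; x̂≤b to π/2≤; F-x̂ to -cos-π/2)

h : ℕ → ℚ
h = seq π/2

0≤h : ∀ n → 0≤ h n
0≤h n = ℚ.≤-trans (c≥0 1ℚ) (1≤π/2 n)

h≤2 : ∀ n → h n ℚ.≤ 2ℚ
h≤2 n = ℚ.≤-trans (π/2≤ n) bnd≤2

cos-π/2 : Null (λ n → C n (h n))
cos-π/2 ε 0<ε = ev₁ (λ n → subst (ℚ._< ε) (ℚ.∣-p∣≡∣p∣ (C n (h n)))) (-cos-π/2 ε 0<ε)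

π : ℝ
π = π/2 +ᴿ π/2

sin-double : ∀ x → Null (λ n → S n (seq x n + seq x n) - 2ℚ * (S n (seq x n) * C n (seq x n)))
sin-double x = null-cong (λ n → eq (S n (seq x n + seq x n)) (S n (seq x n)) (C n (seq x n))) (sin-+ x x)
  where eq : ∀ a s c → a - 2ℚ * (s * c) ≡ a - (s * c + c * s)
        eq = solve-∀ ℚ-ring

sin-π : sin π ≃ 0ᴿ
sin-π = null-cong (λ n → eq (S n (h n + h n)) (S n (h n)) (C n (h n)))
  (null-+ (sin-double π/2) (null-* (bounded-* (bounded-const 2ℚ) (bounded (sin π/2))) cos-π/2))
  where eq : ∀ a s c → a - 0ℚ ≡ a - 2ℚ * (s * c) + 2ℚ * s * c
        eq = solve-∀ ℚ-ring

-- By sin x = 2 sin (x/2) cos (x/2): the half angle lies between 0 and π/2, where sin is at least a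
-- third of the angle, and cos is bounded below by its slope towards the zero π/2.
sin-nonzero : ∀ x → 0ᴿ <ᴿ x → x <ᴿ π → ¬ (sin x ≃ 0ᴿ)
sin-nonzero x (ε₁ , 0<ε₁ , N₁ , h₁) (ε₂ , 0<ε₂ , N₂ , h₂) sinx≃0 =
  ev-extract (ev₂ (λ n u v → u v)
    (ev₃ (λ n p q r s → contra n (h₁ n p) (h₂ n q) (proj₁ r) (proj₂ r) (proj₁ s) (proj₂ s))
      (ev-≥ N₁) (ev-≥ N₂) (ev₂ (λ n a b → a , b) (ev-≥ 3) (cos-π/2 δ (0<δ))))
    (ev₂ (λ n a b → a , b) (sin-double (fromℚ ½ *ᴿ x) e 0<e) (sinx≃0 e 0<e)))
  where
  open ℚ.≤-Reasoning
  -- s₀ = ε₁ / 6 and δ = ε₂ / 24 are lower bounds for sin (x/2) and cos (x/2). The double angle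
  -- formula and sin x ≃ 0 each have an error below e = s₀ δ, which contradicts sin x ≥ 2 s₀ δ.
  twelfth = ½ * ⅙
  δ = ½ * (twelfth * ε₂)
  0<δ : 0< δ
  0<δ = c>0 ½ ⊗⁺ (c>0 twelfth ⊗⁺ 0<ε₂)
  s₀ = ⅙ * ε₁
  e = s₀ * δ
  0<e : 0< e
  0<e = c>0 ⅙ ⊗⁺ 0<ε₁ ⊗⁺ 0<δ
  contra : ∀ n → 0ℚ + ε₁ ℚ.≤ seq x n → seq x n + ε₂ ℚ.≤ h n + h n → 3 ≤ n → ∣ C n (h n) ∣ ℚ.< δ →
           ∣ S n (½ * seq x n + ½ * seq x n) - 2ℚ * (S n (½ * seq x n) * C n (½ * seq x n)) ∣ ℚ.< e →
           ∣ S n (seq x n) - 0ℚ ∣ ℚ.< e → ⊥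
  contra n@(suc (suc (suc k))) p q (s≤s (s≤s (s≤s _))) r s t = ℚ.<-irrefl refl (begin-strict
    e + e                       ≡⟨ eq₁ s₀ δ ⟩
    2ℚ * (s₀ * δ)               ≤⟨ ≤-*ˡ (c≥0 2ℚ) (mono₂ (<-weaken (c>0 ⅙ ⊗⁺ 0<ε₁)) (ℚ.≤-trans (<-weaken 0<δ) δ≤C) s₀≤S δ≤C) ⟩
    2ℚ * (S n u * C n u)        ≤⟨ ∣-∣≥ {S n (u + u)} (<-weaken s) ⟩
    S n (u + u) + e             ≡⟨ cong (λ z → S n z + e) (half+half (seq x n)) ⟩
    S n (seq x n) + e           ≡⟨ cong (_+ e) (sym (ℚ.+-identityʳ (S n (seq x n)))) ⟩
    S n (seq x n) + 0ℚ + e      ≤⟨ ℚ.+-monoˡ-≤ e (x≤∣x∣ (S n (seq x n) - 0ℚ)) ⟩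
    ∣ S n (seq x n) - 0ℚ ∣ + e  <⟨ ℚ.+-monoˡ-< e t ⟩
    e + e                       ∎)
    where
    u = ½ * seq x n
    eq₁ : ∀ a b → a * b + a * b ≡ 2ℚ * (a * b)
    eq₁ = solve-∀ ℚ-ring
    ε₁≤x : ε₁ ℚ.≤ seq x n
    ε₁≤x = subst (ℚ._≤ seq x n) (ℚ.+-identityˡ ε₁) p
    0≤u : 0≤ u
    0≤u = c≥0 ½ ⊗ ℚ.≤-trans (<-weaken 0<ε₁) ε₁≤x
    gap : ½ * ε₂ ℚ.≤ h n - u
    gap = by-slack (c≥0 ½ ⊗ slack q) (eq (h n) (seq x n) ε₂)
      where eq : ∀ h x e → h - ½ * x ≡ ½ * e + ½ * (h + h - (x + e))
            eq = solve-∀ ℚ-ring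
    u≤h : u ℚ.≤ h n
    u≤h = unslack (ℚ.≤-trans (<-weaken (0<half 0<ε₂)) gap)
    s₀≤S : s₀ ℚ.≤ S n u
    s₀≤S = ℚ.≤-trans (by-slack (c≥0 ⅙ ⊗ slack ε₁≤x) (eq (seq x n) ε₁)) (S-≥ (suc k) 0≤u (ℚ.≤-trans u≤h (h≤2 n)))
      where eq : ∀ x e → ⅓ * (½ * x) ≡ ⅙ * e + ⅙ * (x - e)
            eq = solve-∀ ℚ-ring
    δ≤C : δ ℚ.≤ C n u
    δ≤C = begin
      δ                                     ≤⟨ by-slack (c≥0 ⅙ ⊗ (slack gap ⊗ (slack (1≤π/2 n) ⊕ c≥0 1ℚ ⊕ 0≤u) ⊕ <-weaken (0<half 0<ε₂) ⊗ (slack (1≤π/2 n) ⊕ 0≤u))) (eq (h n) u ε₂) ⟩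
      ⅙ * ((h n - u) * (h n + u)) - δ       ≤⟨ ℚ.+-mono-≤ (CosSlope.≥-slope u (h n) 0≤u u≤h (h≤2 n) k) (by-slack (slack (ℚ.≤-trans (-x≤∣x∣ (C n (h n))) (<-weaken r))) (eq′ (C n (h n)) δ)) ⟩
      (C n u - C n (h n)) + C n (h n)       ≡⟨ eq″ (C n u) (C n (h n)) ⟩
      C n u                                 ∎
      where eq : ∀ h u e → ⅙ * ((h - u) * (h + u)) - ½ * (½ * ⅙ * e) ≡ ½ * (½ * ⅙ * e) + ⅙ * (((h - u) - ½ * e) * ((h - 1ℚ) + 1ℚ + u) + ½ * e * ((h - 1ℚ) + u))
            eq = solve-∀ ℚ-ring
            eq′ : ∀ c d → c ≡ - d + (d - - c)
            eq′ = solve-∀ ℚ-ring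
            eq″ : ∀ a b → a - b + b ≡ a
            eq″ = solve-∀ ℚ-ring

π-IsPi : IsPi π
π-IsPi = (1ℚ , c>0 1ℚ , 0 , λ n _ → ℚ.+-mono-≤ (0≤h n) (1≤π/2 n)) , sin-π , sin-nonzero

-- The Basel sum

sign : ℕ → ℚ
sign zero    = 1ℚ
sign (suc k) = - sign k

powOverFact-neg : ∀ x k → powOverFact (- x) k ≡ sign k * powOverFact x k
powOverFact-neg x zero    = refl
powOverFact-neg x (suc k) = trans (cong (_* (- x * (1/ℕ suc k))) (powOverFact-neg x k)) (eq (sign k) (powOverFact x k) x (1/ℕ suc k))
  where eq : ∀ s p x r → s * p * (- x * r) ≡ - s * (p * (x * r))
        eq = solve-∀ ℚ-ring

cosCoeff-sign : ∀ k → cosCoeff k * sign k ≡ cosCoeff k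
cosCoeff-sign zero          = refl
cosCoeff-sign (suc zero)    = refl
cosCoeff-sign (suc (suc k)) = trans (eq (cosCoeff k) (sign k)) (cong (λ z → - z) (cosCoeff-sign k))
  where eq : ∀ a b → - a * - - b ≡ - (a * b)
        eq = solve-∀ ℚ-ring

sinCoeff-sign : ∀ k → sinCoeff k * sign k ≡ - sinCoeff k
sinCoeff-sign zero          = refl
sinCoeff-sign (suc zero)    = refl
sinCoeff-sign (suc (suc k)) = trans (eq (sinCoeff k) (sign k)) (cong (λ z → - z) (sinCoeff-sign k))
  where eq : ∀ a b → - a * - - b ≡ - (a * b)
        eq = solve-∀ ℚ-ring

C-even : ∀ n x → C n (- x) ≡ C n x
C-even n x = trans (partialSum≡Σ cosCoeff (- x) n) (trans (Σ-cong n term) (sym (partialSum≡Σ cosCoeff x n)))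
  where term : ∀ k → cosCoeff k * powOverFact (- x) k ≡ cosCoeff k * powOverFact x k
        term k = trans (cong (cosCoeff k *_) (powOverFact-neg x k))
          (trans (sym (ℚ.*-assoc (cosCoeff k) (sign k) (powOverFact x k))) (cong (_* powOverFact x k) (cosCoeff-sign k)))

S-odd : ∀ n x → S n (- x) ≡ - S n x
S-odd n x = trans (partialSum≡Σ sinCoeff (- x) n) (trans (Σ-cong n term)
    (trans (sym (partialSum≡Σ -sinCoeff x n)) (partialSum-neg sinCoeff x n)))
  where term : ∀ k → sinCoeff k * powOverFact (- x) k ≡ -sinCoeff k * powOverFact x k
        term k = trans (cong (sinCoeff k *_) (powOverFact-neg x k))
          (trans (sym (ℚ.*-assoc (sinCoeff k) (sign k) (powOverFact x k))) (cong (_* powOverFact x k) (sinCoeff-sign k)))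

C-0 : ∀ n → C (suc n) 0ℚ ≡ 1ℚ
C-0 n = trans (partialSum≡Σ cosCoeff 0ℚ (suc n)) (trans (Σ-front n _) (cong (1ℚ +_) (trans (Σ-cong n term) (Σ-0 n))))
  where term : ∀ k → cosCoeff (suc k) * powOverFact 0ℚ (suc k) ≡ 0ℚ
        term k = trans (cong (cosCoeff (suc k) *_) (trans (cong (powOverFact 0ℚ k *_) (ℚ.*-zeroˡ (1/ℕ suc k))) (ℚ.*-zeroʳ (powOverFact 0ℚ k))))
                   (ℚ.*-zeroʳ (cosCoeff (suc k)))

-- The addition formula for cos (x + (-x)), combined with the parities and cos 0 = 1.
sin²+cos² : ∀ x → Null (λ n → S n (seq x n) * S n (seq x n) + C n (seq x n) * C n (seq x n) - 1ℚ)
sin²+cos² x ε 0<ε = ev₂ (λ { (suc k) (s≤s _) p → subst (λ z → ∣ z ∣ ℚ.< ε) (rearrange k) p }) (ev-≥ 1) (null-neg (cos-+ x (-ᴿ x)) ε 0<ε)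
  where
  rearrange : ∀ k → let n = suc k; X = seq x n in
    - (C n (X + - X) - (C n X * C n (- X) - S n X * S n (- X))) ≡ S n X * S n X + C n X * C n X - 1ℚ
  rearrange k = trans (cong₂ (λ u v → - (u - (C n X * v - S n X * S n (- X)))) (trans (cong (C n) (ℚ.+-inverseʳ X)) (C-0 k)) (C-even n X))
      (trans (cong (λ w → - (1ℚ - (C n X * C n X - S n X * w))) (S-odd n X)) (eq (C n X) (S n X)))
    where n = suc k
          X = seq x n
          eq : ∀ c s → - (1ℚ - (c * c - s * - s)) ≡ s * s + c * c - 1ℚ
          eq = solve-∀ ℚ-ring

-- cos vanishes, so sin² tends to 1. The sign is settled by sin ≥ 0 on [0, 2]: it makes the factor s
-- + 1 of s² - 1 at least 1.
sin-π/2 : Null (λ n → S n (h n) - 1ℚ)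
sin-π/2 = null-squeeze (ev₁ bound (ev-≥ 2)) (null-+ (sin²+cos² π/2) (null-neg (null-* (bounded (cos π/2)) cos-π/2)))
  where
  bound : ∀ n → 2 ≤ n → ∣ S n (h n) - 1ℚ ∣ ℚ.≤
    ∣ S n (h n) * S n (h n) + C n (h n) * C n (h n) - 1ℚ + - (C n (h n) * C n (h n)) ∣
  bound n _ = subst (∣ S n (h n) - 1ℚ ∣ ℚ.≤_)
    (trans (sym (ℚ.∣p*q∣≡∣p∣*∣q∣ (S n (h n) + 1ℚ) (S n (h n) - 1ℚ))) (cong ∣_∣ (eq (S n (h n)) (C n (h n)))))
    (subst (ℚ._≤ ∣ S n (h n) + 1ℚ ∣ * ∣ S n (h n) - 1ℚ ∣) (ℚ.*-identityˡ _)
      (≤-*ʳ (ℚ.0≤∣p∣ (S n (h n) - 1ℚ)) (ℚ.≤-trans (by-slack {1ℚ} {S n (h n) + 1ℚ} (proj₁ (S-bounds n (0≤h n) (h≤2 n))) (ℚ.+-comm (S n (h n)) 1ℚ)) (x≤∣x∣ _))))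
    where eq : ∀ s c → (s + 1ℚ) * (s - 1ℚ) ≡ s * s + c * c - 1ℚ + - (c * c)
          eq = solve-∀ ℚ-ring

-- sn α and cs α approximate sin and cos of α π/2.
angle : ℚ → ℝ
angle α = fromℚ α *ᴿ π/2

sn cs : ℚ → ℕ → ℚ
sn α n = S n (α * h n)
cs α n = C n (α * h n)

sn-bounded : ∀ α → Bounded (sn α)
sn-bounded α = bounded (sin (angle α))

cs-bounded : ∀ α → Bounded (cs α)
cs-bounded α = bounded (cos (angle α))

sn-double : ∀ α β → α ≡ β + β → Null (λ n → sn α n - 2ℚ * (sn β n * cs β n))
sn-double _ β refl = null-cong (λ n → cong (λ z → S n z - 2ℚ * (sn β n * cs β n)) (ℚ.*-distribʳ-+ (h n) β β)) (sin-double (angle β))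

-- sin α = sin (α + β) cos β - cos (α + β) sin β, verified through the two addition formulas and
-- sin² + cos² = 1 at β; here α + β is a right angle.
sn-complement : ∀ α β → α + β ≡ 1ℚ → Null (λ n → sn α n - cs β n)
sn-complement α β e = null-cong (λ n → eq (sn α n) (cs α n) (sn β n) (cs β n) (S n (h n)) (C n (h n)))
  (null-+ (null-+ (null-neg (null-* (sn-bounded α) (sin²+cos² (angle β))))
                  (null-* (cs-bounded β) (null-+ (null-neg n₁) sin-π/2)))
          (null-* (sn-bounded β) (null-+ n₂ (null-neg cos-π/2))))
  where
  α+β : ∀ n → α * h n + β * h n ≡ h n
  α+β n = trans (sym (ℚ.*-distribʳ-+ (h n) α β)) (trans (cong (_* h n) e) (ℚ.*-identityˡ (h n)))
  n₁ : Null (λ n → S n (h n) - (sn α n * cs β n + cs α n * sn β n))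
  n₁ = null-cong (λ n → cong (λ z → S n z - (sn α n * cs β n + cs α n * sn β n)) (sym (α+β n))) (sin-+ (angle α) (angle β))
  n₂ : Null (λ n → C n (h n) - (cs α n * cs β n - sn α n * sn β n))
  n₂ = null-cong (λ n → cong (λ z → C n z - (cs α n * cs β n - sn α n * sn β n)) (sym (α+β n))) (cos-+ (angle α) (angle β))
  eq : ∀ s c s′ c′ p q → s - c′ ≡ - (s * (s′ * s′ + c′ * c′ - 1ℚ)) + c′ * (- (p - (s * c′ + c * s′)) + (p - 1ℚ))
       + s′ * (q - (c * c′ - s * s′) + - q)
  eq = solve-∀ ℚ-ring

dbl : ℕ → ℕ
dbl zero    = 1
dbl (suc N) = dbl N ℕ.+ dbl N

dbl*½^ : ∀ N → ℕ→ℚ (dbl N) * ½ ^ N ≡ 1ℚ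
dbl*½^ zero    = refl
dbl*½^ (suc N) = trans (cong (_* (½ * ½ ^ N)) (ℕ→ℚ-+ (dbl N) (dbl N))) (trans (eq (ℕ→ℚ (dbl N)) (½ ^ N)) (dbl*½^ N))
  where eq : ∀ a b → (a + a) * (½ * b) ≡ a * b
        eq = solve-∀ ℚ-ring

-- In units of π/2: the angle is (2 i + 1) π / 2^(N+2).
odd-angle : ℕ → ℕ → ℚ
odd-angle N i = ℕ→ℚ (suc (i ℕ.+ i)) * ½ ^ suc N

-- The index i is paired with 2 m - 1 - i, that is, the odd number j = 2 i + 1 with 4 m - j:
-- complementary angles.
Σ-pairs : ∀ m f → Σ (m ℕ.+ m) f ≡ Σ m (λ i → f i + f (m ℕ.+ (m ℕ.∸ suc i)))
Σ-pairs m f = trans (Σ-split m m f) (trans (cong (λ z → Σ m f + z) (sym (Σ-reverse m (λ i → f (m ℕ.+ i))))) (sym (Σ-+ m _ _)))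

4ℚ : ℚ
4ℚ = 2ℚ + 2ℚ

¼ : ℚ
¼ = ½ * ½

-- For j odd the reciprocals of sin² (jπ/2M), j < M = 2ᴺ⁺¹, sum to M²/2; stated
-- with rational lower bounds b of the reciprocals, and proved by halving M: the
-- terms at j and M - j combine to 4 / sin² (2jπ/2M), since sin² + cos² = 1.
Σ-csc² : ∀ N (b : ℕ → ℚ) → (∀ i → i < dbl N → fromℚ (b i) *ᴿ (sin (angle (odd-angle N i)) *ᴿ sin (angle (odd-angle N i))) ≼ fromℚ 1ℚ) →
         Σ (dbl N) b ℚ.≤ 2ℚ * 4ℚ ^ N
Σ-csc² zero b hyp = ℚ.≤-trans (ℚ.≤-reflexive (eq₁ (b 0))) (ℚ.≤-trans (≤-*ˡ (c≥0 2ℚ) b½≤1) (ℚ.≤-reflexive refl))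
  where
  eq₁ : ∀ b → 0ℚ + b ≡ 2ℚ * (b * ½)
  eq₁ = solve-∀ ℚ-ring
  s c : ℕ → ℚ
  s = sn ½
  c = cs ½
  sin²-π/4 : Null (λ n → b 0 * ½ - b 0 * (s n * s n))
  sin²-π/4 = null-cong (λ n → eq (b 0) (s n) (c n) (C n (½ * h n + ½ * h n)))
    (null-* (bounded-const (½ * b 0)) (null-+ (null-neg (sin²+cos² (angle ½)))
      (null-+ (null-neg (cos-+ (angle ½) (angle ½))) (null-cong (λ n → cong (C n) (half+half (h n))) cos-π/2))))
    where eq : ∀ b s c q → b * ½ - b * (s * s) ≡ ½ * b * (- (s * s + c * c - 1ℚ) + (- (q - (c * c - s * s)) + q))
          eq = solve-∀ ℚ-ring
  b½≤1 : b 0 * ½ ℚ.≤ 1ℚ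
  b½≤1 = ≼-fromℚ (≼-trans {fromℚ (b 0 * ½)} {fromℚ (b 0) *ᴿ (sin (angle ½) *ᴿ sin (angle ½))} {fromℚ 1ℚ}
    (≃⇒≼ {fromℚ (b 0 * ½)} {fromℚ (b 0) *ᴿ (sin (angle ½) *ᴿ sin (angle ½))} sin²-π/4) (hyp 0 (s≤s z≤n)))
Σ-csc² (suc N) b hyp = begin
  Σ (m ℕ.+ m) b                      ≡⟨ Σ-pairs m b ⟩
  Σ m (λ i → b i + b (refl-index i)) ≡⟨ Σ-cong m (λ i → eq₁ (b i) (b (refl-index i))) ⟩
  Σ m (λ i → 4ℚ * b′ i)              ≡⟨ Σ-*ˡ m 4ℚ b′ ⟩
  4ℚ * Σ m b′                        ≤⟨ ≤-*ˡ (c≥0 4ℚ) (Σ-csc² N b′ hyp′) ⟩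
  4ℚ * (2ℚ * 4ℚ ^ N)                 ≡⟨ eq₂ (4ℚ ^ N) ⟩
  2ℚ * (4ℚ * 4ℚ ^ N)                 ∎
  where
  open ℚ.≤-Reasoning
  m = dbl N
  refl-index : ℕ → ℕ
  refl-index i = m ℕ.+ (m ℕ.∸ suc i)
  -- If β s² ≤ 1 and γ c² ≤ 1 for s = sin α, c = cos α, then ¼ (β + γ) sin² 2α = (β s²) c² + (γ c²)
  -- s² ≤ 1, so the pair yields an admissible bound at the doubled angle.
  b′ : ℕ → ℚ
  b′ i = ¼ * (b i + b (refl-index i))
  eq₁ : ∀ a b → a + b ≡ 4ℚ * (¼ * (a + b))
  eq₁ = solve-∀ ℚ-ring
  eq₂ : ∀ a → 4ℚ * (2ℚ * a) ≡ 2ℚ * (4ℚ * a)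
  eq₂ = solve-∀ ℚ-ring
  hyp′ : ∀ i → i < m → fromℚ (b′ i) *ᴿ (sin (angle (odd-angle N i)) *ᴿ sin (angle (odd-angle N i))) ≼ fromℚ 1ℚ
  hyp′ i i<m = ≼-trans {L} {R} {fromℚ 1ℚ} (≃⇒≼ {L} {R} L≃R)
    (≼-trans {R} {R′} {fromℚ 1ℚ} (≼-+ {P *ᴿ c²} {fromℚ 1ℚ *ᴿ c²} {Q *ᴿ s²} {fromℚ 1ℚ *ᴿ s²}
        (≼-*ʳ {P} {fromℚ 1ℚ} c² (λ n → sq≥0 (cs α n)) (hyp i (ℕ.≤-trans i<m (ℕ.m≤m+n m m))))
        (≼-*ʳ {Q} {fromℚ 1ℚ} s² (λ n → sq≥0 (sn α n)) (hyp i′ i′<)))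
      (≃⇒≼ {R′} {fromℚ 1ℚ} (null-cong (λ n → eq₄ (cs α n) (sn α n)) (sin²+cos² (angle α)))))
    where
    i′ = refl-index i
    i′< : i′ < m ℕ.+ m
    i′< = ℕ.+-monoʳ-< m (ℕ.∸-monoʳ-< {m} {suc i} {0} (s≤s z≤n) i<m)
    α = odd-angle (suc N) i
    β = odd-angle (suc N) i′
    sum-index : suc (i ℕ.+ i) ℕ.+ suc (i′ ℕ.+ i′) ≡ (m ℕ.+ m) ℕ.+ (m ℕ.+ m)
    sum-index with ℕ.m≤n⇒∃[o]m+o≡n i<m
    ... | d , e = trans (cong (λ z → suc (i ℕ.+ i) ℕ.+ suc (z ℕ.+ z)) (cong (m ℕ.+_) (trans (cong (ℕ._∸ suc i) (sym e)) (ℕ.m+n∸m≡n (suc i) d))))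
        (subst (λ m → suc (i ℕ.+ i) ℕ.+ suc (m ℕ.+ d ℕ.+ (m ℕ.+ d)) ≡ (m ℕ.+ m) ℕ.+ (m ℕ.+ m)) e (eq-ℕ i d))
      where
      eq-ℕ : ∀ i d → suc (i ℕ.+ i) ℕ.+ suc (suc i ℕ.+ d ℕ.+ d ℕ.+ (suc i ℕ.+ d ℕ.+ d)) ≡ (suc i ℕ.+ d ℕ.+ (suc i ℕ.+ d)) ℕ.+ (suc i ℕ.+ d ℕ.+ (suc i ℕ.+ d))
      eq-ℕ = ℕ-solve-∀
    α+β : β + α ≡ 1ℚ
    α+β = trans (sym (ℚ.*-distribʳ-+ (½ ^ suc (suc N)) (ℕ→ℚ (suc (i′ ℕ.+ i′))) (ℕ→ℚ (suc (i ℕ.+ i)))))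
      (trans (cong (_* ½ ^ suc (suc N)) (trans (trans (ℚ.+-comm (ℕ→ℚ (suc (i′ ℕ.+ i′))) (ℕ→ℚ (suc (i ℕ.+ i)))) (sym (ℕ→ℚ-+ (suc (i ℕ.+ i)) (suc (i′ ℕ.+ i′))))) (cong ℕ→ℚ sum-index)))
        (dbl*½^ (suc (suc N))))
    2α : odd-angle N i ≡ α + α
    2α = eq (ℕ→ℚ (suc (i ℕ.+ i))) (½ ^ suc N)
      where eq : ∀ a b → a * b ≡ a * (½ * b) + a * (½ * b)
            eq = solve-∀ ℚ-ring
    s² c² P Q L R R′ : ℝ
    s² = sin (angle α) *ᴿ sin (angle α)
    c² = cos (angle α) *ᴿ cos (angle α)
    P = fromℚ (b i) *ᴿ (sin (angle α) *ᴿ sin (angle α))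
    Q = fromℚ (b i′) *ᴿ (sin (angle β) *ᴿ sin (angle β))
    L = fromℚ (b′ i) *ᴿ (sin (angle (odd-angle N i)) *ᴿ sin (angle (odd-angle N i)))
    R = P *ᴿ c² +ᴿ Q *ᴿ s²
    R′ = fromℚ 1ℚ *ᴿ c² +ᴿ fromℚ 1ℚ *ᴿ s²
    eq₄ : ∀ c s → 1ℚ * (c * c) + 1ℚ * (s * s) - 1ℚ ≡ s * s + c * c - 1ℚ
    eq₄ = solve-∀ ℚ-ring
    S₂ = sn (odd-angle N i)
    L≃R : L ≃ R
    L≃R = null-cong (λ n → eq (b i) (b i′) (sn α n) (cs α n) (sn β n) (S₂ n))
      (null-+ (null-* (bounded-* (bounded-const (¼ * (b i + b i′))) (bounded-+ (sn-bounded (odd-angle N i)) (bounded-* (bounded-const 2ℚ) (bounded-* (sn-bounded α) (cs-bounded α)))))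
                 (sn-double (odd-angle N i) α 2α))
              (null-* (bounded-* (bounded-* (bounded-const (- b i′)) (bounded-* (sn-bounded α) (sn-bounded α))) (bounded-+ (sn-bounded β) (cs-bounded α)))
                 (sn-complement β α α+β)))
      where
      eq : ∀ b b′ s c s′ s₂ → ¼ * (b + b′) * (s₂ * s₂) - (b * (s * s) * (c * c) + b′ * (s′ * s′) * (s * s))
           ≡ ¼ * (b + b′) * (s₂ + 2ℚ * (s * c)) * (s₂ - 2ℚ * (s * c)) + - b′ * (s * s) * (s′ + c) * (s′ - c)
      eq = solve-∀ ℚ-ring

-- By sin a ≤ a, the number 4^(N+1) / (g (2 i + 1)²) is an admissible lower bound for 1 / sin² when
-- (π/2)² ≤ g. After summation the powers of 4 cancel, and ½ g remains for every N.
Σ-odd-squares : ∀ g → 0< g → π/2 *ᴿ π/2 ≼ fromℚ g → ∀ N → Σ (dbl N) (λ i → (1/ℕ suc (i ℕ.+ i)) * (1/ℕ suc (i ℕ.+ i))) ℚ.≤ ½ * g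
Σ-odd-squares g 0<g h²≤g N = ≤-*-cancelˡ (0<g⁻¹ ⊗⁺ ^->0 (c>0 4ℚ) (suc N)) (begin
  ρ * Σ (dbl N) (λ i → r i * r i)     ≡⟨ sym (Σ-*ˡ (dbl N) ρ _) ⟩
  Σ (dbl N) (λ i → ρ * (r i * r i))   ≤⟨ Σ-csc² N (λ i → ρ * (r i * r i)) hyp ⟩
  2ℚ * 4ℚ ^ N                         ≡⟨ eq (4ℚ ^ N) ⟩
  1ℚ * (4ℚ * 4ℚ ^ N) * ½              ≡⟨ cong (λ z → z * (4ℚ * 4ℚ ^ N) * ½) (sym gg⁻¹) ⟩
  g * g⁻¹ * (4ℚ * 4ℚ ^ N) * ½         ≡⟨ eq′ g g⁻¹ (4ℚ * 4ℚ ^ N) ⟩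
  ρ * (½ * g)                         ∎)
  where
  open ℚ.≤-Reasoning
  inverse = 1/⁺ 0<g
  g⁻¹ = proj₁ inverse
  0<g⁻¹ : 0< g⁻¹
  0<g⁻¹ = proj₁ (proj₂ inverse)
  gg⁻¹ : g * g⁻¹ ≡ 1ℚ
  gg⁻¹ = proj₂ (proj₂ inverse)
  ρ = g⁻¹ * 4ℚ ^ suc N
  r : ℕ → ℚ
  r i = 1/ℕ suc (i ℕ.+ i)
  eq : ∀ a → 2ℚ * a ≡ 1ℚ * (4ℚ * a) * ½
  eq = solve-∀ ℚ-ring
  eq′ : ∀ g k a → g * k * a * ½ ≡ k * a * (½ * g)
  eq′ = solve-∀ ℚ-ring
  angle≤1 : ∀ i → i < dbl N → odd-angle N i ℚ.≤ 1ℚ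
  angle≤1 i i<m = subst (odd-angle N i ℚ.≤_) (dbl*½^ (suc N))
    (≤-*ʳ (^-≥0 (c≥0 ½) (suc N)) (ℕ→ℚ-mono (ℕ.≤-trans (ℕ.≤-reflexive (sym (ℕ.+-suc i i)) ) (ℕ.+-mono-≤ (ℕ.<⇒≤ i<m) i<m))))
  hyp : ∀ i → i < dbl N → fromℚ (ρ * (r i * r i)) *ᴿ (sin (angle (odd-angle N i)) *ᴿ sin (angle (odd-angle N i))) ≼ fromℚ 1ℚ
  hyp i i<m = ≼-trans {X} {Y} {fromℚ 1ℚ} (≼-pointwise {X} {Y} (ev pointwise))
    (≼-trans {Y} {fromℚ g *ᴿ fromℚ g⁻¹} {fromℚ 1ℚ} (≼-*ʳ {π/2 *ᴿ π/2} {fromℚ g} (fromℚ g⁻¹) (λ _ → <-weaken 0<g⁻¹) h²≤g)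
      (≃⇒≼ {fromℚ g *ᴿ fromℚ g⁻¹} {fromℚ 1ℚ} (≃-pointwise {fromℚ g *ᴿ fromℚ g⁻¹} {fromℚ 1ℚ} (λ _ → gg⁻¹))))
    where
    X Y : ℝ
    X = fromℚ (ρ * (r i * r i)) *ᴿ (sin (angle (odd-angle N i)) *ᴿ sin (angle (odd-angle N i)))
    Y = π/2 *ᴿ π/2 *ᴿ fromℚ g⁻¹
    a = odd-angle N i
    0≤a : 0≤ a
    0≤a = 0≤ℕ→ℚ (suc (i ℕ.+ i)) ⊗ ^-≥0 (c≥0 ½) (suc N)
    0≤ρ : 0≤ ρ
    0≤ρ = <-weaken 0<g⁻¹ ⊗ ^-≥0 (c≥0 4ℚ) (suc N)
    4^½^ : 4ℚ ^ suc N * (½ ^ suc N * ½ ^ suc N) ≡ 1ℚ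
    4^½^ = trans (cong (4ℚ ^ suc N *_) (sym (^-distrib-* ½ ½ (suc N)))) (trans (sym (^-distrib-* 4ℚ ¼ (suc N))) (1^ (suc N)))
    pointwise : ∀ n → ρ * (r i * r i) * (sn a n * sn a n) ℚ.≤ h n * h n * g⁻¹
    pointwise n = begin
      ρ * (r i * r i) * (sn a n * sn a n)
        ≤⟨ ≤-*ˡ (0≤ρ ⊗ sq≥0 (r i)) (mono₂ (proj₁ sb) 0≤ah (proj₂ sb) (proj₂ sb)) ⟩
      ρ * (r i * r i) * (a * h n * (a * h n))
        ≡⟨ eq₁ g⁻¹ (4ℚ ^ suc N) (r i) (ℕ→ℚ (suc (i ℕ.+ i))) (½ ^ suc N) (h n) ⟩
      h n * h n * g⁻¹ * (ℕ→ℚ (suc (i ℕ.+ i)) * r i * (ℕ→ℚ (suc (i ℕ.+ i)) * r i)) * (4ℚ ^ suc N * (½ ^ suc N * ½ ^ suc N))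
        ≡⟨ cong₂ (λ u v → h n * h n * g⁻¹ * (u * u) * v) (suc*1/ (i ℕ.+ i)) 4^½^ ⟩
      h n * h n * g⁻¹ * (1ℚ * 1ℚ) * 1ℚ
        ≡⟨ eq₂ (h n * h n * g⁻¹) ⟩
      h n * h n * g⁻¹ ∎
      where
      0≤ah : 0≤ (a * h n)
      0≤ah = 0≤a ⊗ 0≤h n
      sb = S-bounds n 0≤ah (ℚ.≤-trans (≤-*ʳ (0≤h n) (angle≤1 i i<m)) (subst (ℚ._≤ 2ℚ) (sym (ℚ.*-identityˡ (h n))) (h≤2 n)))
      eq₁ : ∀ k f r m w h → k * f * (r * r) * (m * w * h * (m * w * h)) ≡ h * h * k * (m * r * (m * r)) * (f * (w * w))
      eq₁ = solve-∀ ℚ-ring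
      eq₂ : ∀ a → a * (1ℚ * 1ℚ) * 1ℚ ≡ a
      eq₂ = solve-∀ ℚ-ring

1/ℕ-even : ∀ i → 1/ℕ suc (suc (i ℕ.+ i)) ≡ ½ * (1/ℕ suc i)
1/ℕ-even i = suc-cancel (suc (i ℕ.+ i)) (trans (suc*1/ (suc (i ℕ.+ i))) (sym (trans
    (cong (_* (½ * (1/ℕ suc i))) (trans (cong ℕ→ℚ (cong suc (sym (ℕ.+-suc i i)))) (ℕ→ℚ-+ (suc i) (suc i))))
    (trans (eq (ℕ→ℚ (suc i)) (1/ℕ suc i)) (suc*1/ i)))))
  where eq : ∀ a r → (a + a) * (½ * r) ≡ a * r
        eq = solve-∀ ℚ-ring

ζ₂-split : ∀ m → ζ₂ (m ℕ.+ m) ≡ Σ m (λ i → (1/ℕ suc (i ℕ.+ i)) * (1/ℕ suc (i ℕ.+ i))) + ¼ * ζ₂ m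
ζ₂-split zero    = refl
ζ₂-split (suc m) = trans (cong ζ₂ (cong suc (ℕ.+-suc m m))) (trans
    (cong₂ (λ u v → u + (1/ℕ suc (m ℕ.+ m)) * (1/ℕ suc (m ℕ.+ m)) + v * v) (ζ₂-split m) (1/ℕ-even m))
    (eq (Σ m _) (ζ₂ m) (1/ℕ suc (m ℕ.+ m)) (1/ℕ suc m)))
  where eq : ∀ a z o e → a + ¼ * z + o * o + ½ * e * (½ * e) ≡ a + o * o + ¼ * (z + e * e)
        eq = solve-∀ ℚ-ring

m≤dbl : ∀ m → m ≤ dbl m
m≤dbl zero    = z≤n
m≤dbl (suc m) = ℕ.≤-trans (ℕ.+-monoˡ-≤ m (1≤dbl m)) (ℕ.+-monoʳ-≤ (dbl m) (m≤dbl m))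
  where 1≤dbl : ∀ m → 1 ≤ dbl m
        1≤dbl zero    = s≤s z≤n
        1≤dbl (suc m) = ℕ.≤-trans (1≤dbl m) (ℕ.m≤m+n _ _)

-- In the limit g → (π/2)² this is ζ(2) ≤ π²/6.
Basel : ∀ g → 0< g → π/2 *ᴿ π/2 ≼ fromℚ g → ∀ m → ζ₂ m ℚ.≤ 2ℚ * ⅓ * g
Basel g 0<g h²≤g m = ℚ.≤-trans mono (by-slack
    (c≥0 (4ℚ * ⅓) ⊗ (slack grow ⊕ slack (Σ-odd-squares g 0<g h²≤g m))) (eq g (ζ₂ k) (Σ k o)))
  where
  k = dbl m
  o : ℕ → ℚ
  o i = (1/ℕ suc (i ℕ.+ i)) * (1/ℕ suc (i ℕ.+ i))
  0≤sq : ∀ i → 0≤ ((1/ℕ suc i) * (1/ℕ suc i))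
  0≤sq i = sq≥0 (1/ℕ suc i)
  mono : ζ₂ m ℚ.≤ ζ₂ k
  mono = Σ-≤-extend 0≤sq (m≤dbl m)
  -- ζ₂ k ≤ ζ₂ (2 k), which is the odd part plus ¼ ζ₂ k; hence ¾ ζ₂ k is at most the odd part.
  grow : ζ₂ k ℚ.≤ Σ k o + ¼ * ζ₂ k
  grow = subst (ζ₂ k ℚ.≤_) (ζ₂-split k) (Σ-≤-extend 0≤sq (ℕ.m≤m+n k k))
  eq : ∀ g z o → 2ℚ * ⅓ * g ≡ z + 4ℚ * ⅓ * ((o + ¼ * z - z) + (½ * g - o))
  eq = solve-∀ ℚ-ring

-- Partitions into distinct parts

Unique-↭ : ∀ {T : Set} {xs ys : List T} → xs ↭ ys → Unique xs → Unique ys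
Unique-↭ ↭.refl         u                     = u
Unique-↭ (↭.prep x p)   (a ∷ u)               = ↭.All-resp-↭ p a ∷ Unique-↭ p u
Unique-↭ (↭.swap x y p) ((x≢y ∷ a) ∷ (b ∷ u)) = ((x≢y ∘ sym) ∷ ↭.All-resp-↭ p b) ∷ (↭.All-resp-↭ p a ∷ Unique-↭ p u)
Unique-↭ (↭.trans p q)  u                     = Unique-↭ q (Unique-↭ p u)

extract : ∀ {T : Set} {x : T} {xs} → x ∈ xs → ∃[ ys ] xs ↭ x ∷ ys
extract {x = x} x∈xs with ∈-∃++ x∈xs
... | ys , zs , refl = ys ++ zs , ↭.shift x ys zs

pigeonhole : ∀ {T : Set} {xs ys : List T} → Unique xs → (∀ {x} → x ∈ xs → x ∈ ys) → length xs ≤ length ys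
pigeonhole []       h = z≤n
pigeonhole {xs = x ∷ xs} {ys} (x∉ ∷ u) h with extract (h (here refl))
... | zs , p = subst (suc (length xs) ≤_) (sym (↭.↭-length p)) (s≤s (pigeonhole u λ y∈xs →
  case ↭.∈-resp-↭ p (h (there y∈xs)) of λ where
    (here refl)  → ⊥-elim (All.lookup x∉ y∈xs refl)
    (there y∈zs) → y∈zs))

inverseSum : List ℕ → ℚ
inverseSum as = foldr _+_ 0ℚ (map 1/ℕ_ as)

inverseSum-↭ : ∀ {xs ys} → xs ↭ ys → inverseSum xs ≡ inverseSum ys
inverseSum-↭ ↭.refl         = refl
inverseSum-↭ (↭.prep x p)   = cong (λ z → (1/ℕ x) + z) (inverseSum-↭ p)
inverseSum-↭ {_ ∷ _ ∷ xs} (↭.swap x y p) = trans (cong (λ z → (1/ℕ x) + ((1/ℕ y) + z)) (inverseSum-↭ p)) (eq (1/ℕ x) (1/ℕ y) _)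
  where eq : ∀ a b c → a + (b + c) ≡ b + (a + c)
        eq = solve-∀ ℚ-ring
inverseSum-↭ (↭.trans p q)  = trans (inverseSum-↭ p) (inverseSum-↭ q)

inverseSum-++ : ∀ xs ys → inverseSum (xs ++ ys) ≡ inverseSum xs + inverseSum ys
inverseSum-++ []       ys = sym (ℚ.+-identityˡ _)
inverseSum-++ (x ∷ xs) ys = trans (cong (λ z → (1/ℕ x) + z) (inverseSum-++ xs ys)) (sym (ℚ.+-assoc (1/ℕ x) (inverseSum xs) (inverseSum ys)))

-- The values of Σ 1/a over the subsets of {1, …, m} with sum s.
values : ℕ → ℕ → List ℚ
values-with : ∀ m s → Dec (suc m ≤ s) → List ℚ
values zero    zero    = 0ℚ ∷ []
values zero    (suc s) = []
values (suc m) s       = values m s ++ values-with m s (suc m ℕ.≤? s)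
values-with m s (yes _) = map ((1/ℕ suc m) +_) (values m (s ℕ.∸ suc m))
values-with m s (no _)  = []

values-complete : ∀ m as → Unique as → All (0 <_) as → All (_≤ m) as → inverseSum as ∈ values m (sum as)
values-complete zero    []       _ _          _        = here refl
values-complete zero    (a ∷ as) _ (0<a ∷ _) (a≤0 ∷ _) = ⊥-elim (ℕ.<⇒≱ 0<a a≤0)
values-complete (suc m) as u pos bnd with DecMembership._∈?_ ℕ._≟_ (suc m) as
... | no m∉as = ∈-++⁺ˡ (values-complete m as u pos (All.tabulate λ {a} a∈as →
        ℕ.≤-pred (ℕ.≤∧≢⇒< (All.lookup bnd a∈as) λ { refl → m∉as a∈as })))
... | yes m∈as with extract m∈as
...   | bs , p with Unique-↭ p u | ↭.All-resp-↭ p pos | ↭.All-resp-↭ p bnd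
...     | m∉ ∷ u′ | _ ∷ pos′ | _ ∷ bnd′ = subst₂ (λ v s → v ∈ values (suc m) s) (sym (inverseSum-↭ p)) (sym (sum-↭ p)) (∈-++⁺ʳ (values m (suc m ℕ.+ sum bs)) (go (suc m ℕ.≤? (suc m ℕ.+ sum bs))))
  where
  IH : inverseSum bs ∈ values m (sum bs)
  IH = values-complete m bs u′ pos′ (All.tabulate λ {a} a∈bs →
         ℕ.≤-pred (ℕ.≤∧≢⇒< (All.lookup bnd′ a∈bs) λ { refl → All.lookup m∉ a∈bs refl }))
  go : ∀ d → inverseSum (suc m ∷ bs) ∈ values-with m (suc m ℕ.+ sum bs) d
  go (yes _) = ∈-map⁺ ((1/ℕ suc m) +_) (subst (λ s → inverseSum bs ∈ values m s) (sym (ℕ.m+n∸m≡n (suc m) (sum bs))) IH)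
  go (no m≰) = ⊥-elim (m≰ (ℕ.m≤m+n (suc m) (sum bs)))

values-sound : ∀ m s {α} → α ∈ values m s → ∃[ as ] (Unique as × All (0 <_) as × All (_≤ m) as × sum as ≡ s × inverseSum as ≡ α)
values-sound zero    zero    (here refl) = [] , [] , [] , [] , refl , refl
values-sound (suc m) s {α} p with ∈-++⁻ (values m s) p
... | inj₁ q = let (as , u , pos , bnd , e , e′) = values-sound m s q
               in as , u , pos , All.map ℕ.m≤n⇒m≤1+n bnd , e , e′
... | inj₂ q = go (suc m ℕ.≤? s) q
  where
  go : ∀ d → α ∈ values-with m s d → ∃[ as ] (Unique as × All (0 <_) as × All (_≤ suc m) as × sum as ≡ s × inverseSum as ≡ α)
  go (yes m<s) r with ∈-map⁻ ((1/ℕ suc m) +_) r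
  ... | β , β∈ , refl = let (as , u , pos , bnd , e , e′) = values-sound m (s ℕ.∸ suc m) β∈
    in suc m ∷ as , (All.map (λ { a≤m refl → ℕ.<-irrefl refl a≤m }) bnd) ∷ u , s≤s z≤n ∷ pos , ℕ.≤-refl ∷ All.map ℕ.m≤n⇒m≤1+n bnd
       , trans (cong (suc m ℕ.+_) e) (ℕ.m+[n∸m]≡n m<s) , cong ((1/ℕ suc m) +_) e′

All-≤-sum : ∀ as → All (_≤ sum as) as
All-≤-sum []       = []
All-≤-sum (a ∷ as) = ℕ.m≤m+n a (sum as) ∷ All.map (λ p → ℕ.≤-trans p (ℕ.m≤n+m (sum as) a)) (All-≤-sum as)

HasPartition⇒∈values : ∀ {α n} → HasPartition α n → α ∈ values n n
HasPartition⇒∈values (as , record { distinct = u ; positive = pos ; sum≡n = refl ; sumOfInverses≡α = refl }) =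
  values-complete (sum as) as u pos (All-≤-sum as)

-- Decidability is what lets the least threshold n_α be found by a search.
HasPartition? : ∀ α n → Dec (HasPartition α n)
HasPartition? α n = map′
  (λ p → let (as , u , pos , _ , e , e′) = values-sound n n p in as , record { distinct = u ; positive = pos ; sum≡n = e ; sumOfInverses≡α = e′ })
  HasPartition⇒∈values (DecMembership._∈?_ ℚ._≟_ α (values n n))

-- The search descends from `suc N` as long as the next smaller number has a partition; the first
-- failure certifies minimality.
IsThreshold-below : ∀ {α} N → HasPartitionFrom α (suc N) → ∃[ M ] (IsThreshold α M × M ≤ suc N)
IsThreshold-below {α} zero    from = 1 , (s≤s z≤n , from , λ M 0<M _ → 0<M) , ℕ.≤-refl
IsThreshold-below {α} (suc N) from = case HasPartition? α (suc N) of λ where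
    (yes p) → let (M , t , M≤) = IsThreshold-below N (extend p) in M , t , ℕ.m≤n⇒m≤1+n M≤
    (no ¬p) → suc (suc N) , (s≤s z≤n , from , λ M 0<M fromM → ℕ.≮⇒≥ λ { (s≤s M≤) → ¬p (fromM (suc N) M≤) }) , ℕ.≤-refl
  where
  extend : HasPartition α (suc N) → HasPartitionFrom α (suc N)
  extend p n N<n with ℕ.m≤n⇒m<n∨m≡n N<n
  ... | inj₁ q    = from n q
  ... | inj₂ refl = p

A⇒B : ∀ n {α} → A n α → B n α
A⇒B n (0<α , N , (_ , from , _) , N≤n) = 0<α , from n N≤n

-- Counting subsets through the generating function.

count : ℕ → ℕ → ℚ
count m s = ℕ→ℚ (length (values m s))

B-bound : ∀ n j → j ≤∣ B n ∣ → j ≤ length (values n n)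
B-bound n j (αs , u , all , refl) = pigeonhole u (λ α∈ → HasPartition⇒∈values (proj₂ (All.lookup all α∈)))

module Counting (x : ℚ) (0<x : 0< x) where
  open ℚ.≤-Reasoning

  GF : ℕ → ℚ
  GF m = Π m (λ k → 1ℚ + x ^ suc k)

  0≤x^ : ∀ n → 0≤ (x ^ n)
  0≤x^ = ^-≥0 (<-weaken 0<x)

  0≤GF : ∀ m → 0≤ GF m
  0≤GF zero    = c≥0 1ℚ
  0≤GF (suc m) = 0≤GF m ⊗ (c≥0 1ℚ ⊕ 0≤x^ (suc m))

  with-yes : ∀ m s d → suc m ≤ s → ℕ→ℚ (length (values-with m s d)) * x ^ s ≡ count m (s ℕ.∸ suc m) * x ^ (s ℕ.∸ suc m) * x ^ suc m
  with-yes m s (yes _) p = trans (cong₂ (λ u v → ℕ→ℚ u * x ^ v) (List.length-map _ (values m (s ℕ.∸ suc m))) (sym (ℕ.m∸n+n≡m p)))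
    (trans (cong (count m (s ℕ.∸ suc m) *_) (^-+ x (s ℕ.∸ suc m) (suc m))) (sym (ℚ.*-assoc (count m (s ℕ.∸ suc m)) _ _)))
  with-yes m s (no ¬p) p = ⊥-elim (¬p p)

  with-no : ∀ m s d → ¬ (suc m ≤ s) → ℕ→ℚ (length (values-with m s d)) * x ^ s ≡ 0ℚ
  with-no m s (yes p) ¬p = ⊥-elim (¬p p)
  with-no m s (no _)  _  = ℚ.*-zeroˡ (x ^ s)

  count-suc : ∀ m s → count (suc m) s * x ^ s ≡ count m s * x ^ s + ℕ→ℚ (length (values-with m s (suc m ℕ.≤? s))) * x ^ s
  count-suc m s = trans (cong (λ l → ℕ→ℚ l * x ^ s) (List.length-++ (values m s)))
    (trans (cong (_* x ^ s) (ℕ→ℚ-+ (length (values m s)) _)) (ℚ.*-distribʳ-+ (x ^ s) (count m s) _))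

  count-bound : ∀ m s → count m s * x ^ s ℚ.≤ GF m
  count-bound zero    zero    = ℚ.≤-refl
  count-bound zero    (suc s) = ℚ.≤-trans (ℚ.≤-reflexive (ℚ.*-zeroˡ (x ^ suc s))) (c≥0 1ℚ)
  count-bound (suc m) s = begin
    count (suc m) s * x ^ s              ≡⟨ count-suc m s ⟩
    count m s * x ^ s + W * x ^ s        ≤⟨ ℚ.+-mono-≤ (count-bound m s) W≤ ⟩
    GF m + GF m * x ^ suc m    ≡⟨ eq (GF m) (x ^ suc m) ⟩
    GF (suc m)                      ∎
    where
    W = ℕ→ℚ (length (values-with m s (suc m ℕ.≤? s)))
    eq : ∀ a b → a + a * b ≡ a * (1ℚ + b)
    eq = solve-∀ ℚ-ring
    W≤ : W * x ^ s ℚ.≤ GF m * x ^ suc m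
    W≤ = case suc m ℕ.≤? s of λ where
      (yes p) → ℚ.≤-trans (ℚ.≤-reflexive (with-yes m s (suc m ℕ.≤? s) p)) (≤-*ʳ (0≤x^ (suc m)) (count-bound m (s ℕ.∸ suc m)))
      (no ¬p) → ℚ.≤-trans (ℚ.≤-reflexive (with-no m s (suc m ℕ.≤? s) ¬p)) (0≤GF m ⊗ 0≤x^ (suc m))

  -- The empty subset accounts for the 1.
  count-bound⁺ : ∀ m s → count m (suc s) * x ^ suc s + 1ℚ ℚ.≤ GF m
  count-bound⁺ zero    s = ℚ.≤-reflexive (trans (cong (_+ 1ℚ) (ℚ.*-zeroˡ (x ^ suc s))) (ℚ.+-identityˡ 1ℚ))
  count-bound⁺ (suc m) s = begin
    count (suc m) (suc s) * x ^ suc s + 1ℚ                   ≡⟨ cong (_+ 1ℚ) (count-suc m (suc s)) ⟩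
    count m (suc s) * x ^ suc s + W * x ^ suc s + 1ℚ         ≡⟨ eq (count m (suc s) * x ^ suc s) (W * x ^ suc s) ⟩
    (count m (suc s) * x ^ suc s + 1ℚ) + W * x ^ suc s       ≤⟨ ℚ.+-mono-≤ (count-bound⁺ m s) W≤ ⟩
    GF m + GF m * x ^ suc m                        ≡⟨ eq′ (GF m) (x ^ suc m) ⟩
    GF (suc m)                                          ∎
    where
    W = ℕ→ℚ (length (values-with m (suc s) (suc m ℕ.≤? suc s)))
    eq : ∀ a b → a + b + 1ℚ ≡ a + 1ℚ + b
    eq = solve-∀ ℚ-ring
    eq′ : ∀ a b → a + a * b ≡ a * (1ℚ + b)
    eq′ = solve-∀ ℚ-ring
    W≤ : W * x ^ suc s ℚ.≤ GF m * x ^ suc m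
    W≤ = case suc m ℕ.≤? suc s of λ where
      (yes p) → ℚ.≤-trans (ℚ.≤-reflexive (with-yes m (suc s) (suc m ℕ.≤? suc s) p)) (≤-*ʳ (0≤x^ (suc m)) (count-bound m (suc s ℕ.∸ suc m)))
      (no ¬p) → ℚ.≤-trans (ℚ.≤-reflexive (with-no m (suc s) (suc m ℕ.≤? suc s) ¬p)) (0≤GF m ⊗ 0≤x^ (suc m))

-- The hypothesis on ζ₂ is n σ + ζ(2) / 2σ ≤ e (with `suc n` for n), cleared of its denominator. The
-- factor 1 - δ pays for the truncation, by Bernoulli's inequality.
count≤exp : ∀ n σ e → 0< σ → (∀ N → ζ₂ N ℚ.≤ (σ + σ) * (e - ℕ→ℚ (suc n) * σ)) → ∀ δ → 0< δ → δ ℚ.≤ 1ℚ →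
            ∃[ k ] (count (suc n) (suc n) + 1ℚ) * (1ℚ - δ) ℚ.≤ expSum e k
count≤exp n σ e 0<σ hζ δ 0<δ δ≤1 =
  let (N , hN) = truncation-small (δ * (1/ℕ suc n)) (0<δ ⊗⁺ 0<1/ n)
      (k , hk) = distinct-≤exp (suc n) N {e} (exponent N)
  in k , (begin
    (count (suc n) (suc n) + 1ℚ) * (1ℚ - δ)
      ≤⟨ mono₂ (0≤ℕ→ℚ (length (values (suc n) (suc n))) ⊕ c≥0 1ℚ) (^-≥0 (slack (x^≤1 (suc N))) (suc n)) count≤
           (ℚ.≤-trans (by-slack (slack (nx^≤δ N (<-weaken hN))) (eq δ (ℕ→ℚ (suc n) * x ^ suc N))) (Bernoulli (^-≥0 0≤x (suc N)) (x^≤1 (suc N)) (suc n))) ⟩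
    z ^ suc n * distinct (suc n) * (1ℚ - x ^ suc N) ^ suc n ≤⟨ hk ⟩
    expSum e k ∎)
  where
  open ℚ.≤-Reasoning
  z = 1ℚ + σ + ½ * (σ * σ)
  0<z′ : 0< z
  0<z′ = c>0 1ℚ ⊕⁺ <-weaken 0<σ ⊕⁺ c≥0 ½ ⊗ sq≥0 σ
  inverse = 1/⁺ 0<z′
  x = proj₁ inverse
  0<x : 0< x
  0<x = proj₁ (proj₂ inverse)
  x*z≡1 : x * z ≡ 1ℚ
  x*z≡1 = trans (ℚ.*-comm x z) (proj₂ (proj₂ inverse))
  open GeneratingFunction σ x z 0<σ 0<x x*z≡1 refl
    using (truncation-small; distinct-≤exp; distinct; Λ; Λ-bound; x<1; 1<z; x^*z^; 0≤x)
  x^≤1 : ∀ m → x ^ m ℚ.≤ 1ℚ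
  x^≤1 = ^-≤1 0≤x (<-weaken x<1)
  eq : ∀ d t → 1ℚ - t ≡ 1ℚ - d + (d - t)
  eq = solve-∀ ℚ-ring
  nx^≤δ : ∀ N → x ^ N ℚ.≤ δ * (1/ℕ suc n) → ℕ→ℚ (suc n) * x ^ suc N ℚ.≤ δ
  nx^≤δ N p = begin
    ℕ→ℚ (suc n) * (x * x ^ N)          ≤⟨ ≤-*ˡ (0≤ℕ→ℚ (suc n)) (≤-*ʳ (^-≥0 0≤x N) (<-weaken x<1)) ⟩
    ℕ→ℚ (suc n) * (1ℚ * x ^ N)         ≡⟨ cong (ℕ→ℚ (suc n) *_) (ℚ.*-identityˡ (x ^ N)) ⟩
    ℕ→ℚ (suc n) * x ^ N                ≤⟨ ≤-*ˡ (0≤ℕ→ℚ (suc n)) p ⟩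
    ℕ→ℚ (suc n) * (δ * (1/ℕ suc n))    ≡⟨ Split.k*δ δ 0<δ n ⟩
    δ                                  ∎
  exponent : ∀ N → ℕ→ℚ (suc n) * σ + Λ (suc n) N ℚ.≤ e
  exponent N = by-slack (slack (≤-*-cancelˡ (0<σ ⊕⁺ <-weaken 0<σ) (ℚ.≤-trans (Λ-bound (suc n) N) (hζ N)))) (eq′ e (ℕ→ℚ (suc n) * σ) (Λ (suc n) N))
    where eq′ : ∀ e a l → e ≡ a + l + (e - a - l)
          eq′ = solve-∀ ℚ-ring
  count≤ : count (suc n) (suc n) + 1ℚ ℚ.≤ z ^ suc n * distinct (suc n)
  count≤ = begin
    q + 1ℚ                                     ≤⟨ ℚ.+-monoʳ-≤ q (1≤^ (<-weaken 1<z) (suc n)) ⟩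
    q + z ^ suc n                              ≡⟨ cong (_+ z ^ suc n) (sym (ℚ.*-identityʳ q)) ⟩
    q * 1ℚ + z ^ suc n                         ≡⟨ cong (λ w → q * w + z ^ suc n) (sym (x^*z^ (suc n))) ⟩
    q * (x ^ suc n * z ^ suc n) + z ^ suc n    ≡⟨ eq′ q (x ^ suc n) (z ^ suc n) ⟩
    z ^ suc n * (q * x ^ suc n + 1ℚ)           ≤⟨ ≤-*ˡ (^-≥0 (<-weaken 0<z′) (suc n)) (Counting.count-bound⁺ x 0<x (suc n) n) ⟩
    z ^ suc n * distinct (suc n)               ∎
    where q = count (suc n) (suc n)
          eq′ : ∀ q x z → q * (x * z) + z ≡ z * (q * x + 1ℚ)
          eq′ = solve-∀ ℚ-ring

-- Square roots and the constant c.

module Sqrt (n : ℕ) (1≤n : 1 ≤ n) where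
  open SqrtQuotient n 1≤n (fromℚ 1ℚ) 0 (λ _ _ → toWitness {a? = ½ ℚ.≤? 1ℚ} _) (λ _ _ → ℕ→ℚ-mono 1≤n)
    public using (1≤root; root≤) renaming (root to √; root-value to private-value)

  √²-null : Null (λ k → seq √ k * seq √ k - ℕ→ℚ n)
  √²-null = null-cong (λ k → cong (_- ℕ→ℚ n) (sym (ℚ.*-identityʳ (seq √ k * seq √ k)))) private-value

nonneg-≤ᴿ : ∀ {x} → (∀ k → 0≤ seq x k) → 0ᴿ ≤ᴿ x
nonneg-≤ᴿ {x} p (ε , 0<ε , N , h) = ℚ.<-irrefl refl (ℚ.<-≤-trans (0<ε ⊕⁺ p N)
  (subst (ℚ._≤ 0ℚ) (ℚ.+-comm (seq x N) ε) (h N ℕ.≤-refl)))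

√-IsSqrtOf : ∀ n 1≤n → Sqrt.√ n 1≤n IsSqrtOf fromℕ n
√-IsSqrtOf n 1≤n = nonneg-≤ᴿ {Sqrt.√ n 1≤n} (λ k → ℚ.≤-trans (c≥0 1ℚ) (Sqrt.1≤root n 1≤n k)) , Sqrt.√²-null n 1≤n

√3 : ℝ
√3 = Sqrt.√ 3 (s≤s z≤n)

-- Written as π √3 / 3 to avoid a division by a real; it is the quotient because the square of √3 is
-- 3.
π/√3 : ℝ
π/√3 = fromℚ ⅓ *ᴿ (π *ᴿ √3)

t : ℕ → ℚ
t = seq √3

t²-null : Null (λ k → t k * t k - ℕ→ℚ 3)
t²-null = Sqrt.√²-null 3 (s≤s z≤n)

1≤t : ∀ k → 1ℚ ℚ.≤ t k
1≤t = Sqrt.1≤root 3 (s≤s z≤n)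

π/√3-IsQuotientOf : π/√3 IsQuotientOf π and √3
π/√3-IsQuotientOf = inj₁ (½ , c>0 ½ , 0 , λ k _ → ℚ.≤-trans (toWitness {a? = (0ℚ + ½) ℚ.≤? 1ℚ} _) (1≤t k))
  , null-cong (λ k → eq (h k) (t k)) (null-* (bounded-* (bounded-const ⅓) (bounded π)) t²-null)
  where eq : ∀ h t → ⅓ * ((h + h) * t) * t - (h + h) ≡ ⅓ * (h + h) * (t * t - ℕ→ℚ 3)
        eq = solve-∀ ℚ-ring

-- The upper bound

ĉ : ℕ → ℚ
ĉ = seq π/√3

t≤4 : ∀ k → t k ℚ.≤ 4ℚ
t≤4 = Sqrt.root≤ 3 (s≤s z≤n)

ĉ-≥ : ∀ k → 2ℚ * ⅓ ℚ.≤ ĉ k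
ĉ-≥ k = by-slack (c≥0 (2ℚ * ⅓) ⊗ (0≤h k ⊗ slack (1≤t k) ⊕ slack (1≤π/2 k))) (eq (h k) (t k))
  where eq : ∀ h t → ⅓ * ((h + h) * t) ≡ 2ℚ * ⅓ + 2ℚ * ⅓ * (h * (t - 1ℚ) + (h - 1ℚ))
        eq = solve-∀ ℚ-ring

ĉ-≤ : ∀ k → ĉ k ℚ.≤ ℕ→ℚ 6
ĉ-≤ k = by-slack (c≥0 (2ℚ * ⅓) ⊗ (0≤h k ⊗ slack (t≤4 k) ⊕ c≥0 4ℚ ⊗ slack (h≤2 k)) ⊕ c≥0 (2ℚ * ⅓)) (eq (h k) (t k))
  where eq : ∀ h t → ℕ→ℚ 6 ≡ ⅓ * ((h + h) * t) + (2ℚ * ⅓ * (h * (4ℚ - t) + 4ℚ * (2ℚ - h)) + 2ℚ * ⅓)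
        eq = solve-∀ ℚ-ring

0≤ĉ : ∀ k → 0≤ ĉ k
0≤ĉ k = ℚ.≤-trans (c≥0 (2ℚ * ⅓)) (ĉ-≥ k)

⅛ : ℚ
⅛ = ½ * ¼

module UpperBound (n : ℕ) where
  open ℚ.≤-Reasoning
  open Sqrt (suc n) (s≤s z≤n)

  r : ℕ → ℚ
  r = seq √

  n′ b : ℚ
  n′ = ℕ→ℚ (suc n)
  b  = 1ℚ + n′

  0<b : 0< b
  0<b = c>0 1ℚ ⊕⁺ 0≤ℕ→ℚ (suc n)

  0<r : ∀ k → 0< r k
  0<r k = ℚ.<-≤-trans (c>0 1ℚ) (1≤root k)

  -- With σ = c / 2r the exponent n σ + ζ(2) / 2σ is c r up to η.
  exponent : ∀ k δ η → 0< δ → ∣ r k * r k - n′ ∣ ℚ.≤ δ → ∣ t k * t k - ℕ→ℚ 3 ∣ ℚ.≤ δ →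
             (∀ N → ζ₂ N ℚ.≤ 2ℚ * ⅓ * (h k * h k + δ)) → ℕ→ℚ 30 * δ * b ℚ.≤ η →
             ∃[ σ ] (0< σ × (∀ N → ζ₂ N ℚ.≤ (σ + σ) * (ĉ k * r k + η - n′ * σ)))
  exponent k δ η 0<δ hr ht hζ hδ =
    σ , (c>0 ½ ⊗⁺ 0<c ⊗⁺ 0<s) , λ N → ℚ.≤-trans (hζ N) goal
    where
    c = ĉ k
    H = h k
    T = t k
    R = r k
    inverse = 1/⁺ (0<r k)
    s = proj₁ inverse
    0<s : 0< s
    0<s = proj₁ (proj₂ inverse)
    rs : R * s ≡ 1ℚ
    rs = proj₂ (proj₂ inverse)
    0<c : 0< c
    0<c = ℚ.<-≤-trans (c>0 (2ℚ * ⅓)) (ĉ-≥ k)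
    σ = ½ * c * s
    s≤1 : s ℚ.≤ 1ℚ
    s≤1 = ≤-*-cancelˡ (0<r k) (subst₂ ℚ._≤_ (sym rs) (sym (ℚ.*-identityʳ R)) (1≤root k))
    n≤ : n′ ℚ.≤ R * R + δ
    n≤ = ∣-∣≥ {R * R} hr
    3≤ : ℕ→ℚ 3 ℚ.≤ T * T + δ
    3≤ = ∣-∣≥ {T * T} ht
    H²≤4 : H * H ℚ.≤ 4ℚ
    H²≤4 = mono₂ (0≤h k) (c≥0 2ℚ) (h≤2 k) (h≤2 k)
    c²≤36 : c * c ℚ.≤ ℕ→ℚ 36
    c²≤36 = mono₂ (0≤ĉ k) (c≥0 (ℕ→ℚ 6)) (ĉ-≤ k) (ĉ-≤ k)
    ns²≤ : n′ * (s * s) ℚ.≤ 1ℚ + δ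
    ns²≤ = begin
      n′ * (s * s)                       ≤⟨ ≤-*ʳ (sq≥0 s) n≤ ⟩
      (R * R + δ) * (s * s)              ≡⟨ eq R s δ ⟩
      (R * s) * (R * s) + δ * (s * s)    ≤⟨ ℚ.+-mono-≤ (ℚ.≤-reflexive (cong₂ _*_ rs rs)) (≤-*ˡ (<-weaken 0<δ) (mono₂ (<-weaken 0<s) (c≥0 1ℚ) s≤1 s≤1)) ⟩
      1ℚ * 1ℚ + δ * (1ℚ * 1ℚ)            ≡⟨ eq′ δ ⟩
      1ℚ + δ                             ∎
      where eq : ∀ r s d → (r * r + d) * (s * s) ≡ r * s * (r * s) + d * (s * s)
            eq = solve-∀ ℚ-ring
            eq′ : ∀ d → 1ℚ * 1ℚ + d * (1ℚ * 1ℚ) ≡ 1ℚ + d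
            eq′ = solve-∀ ℚ-ring
    -- The errors of √3 and h cost 2 δ, and that of r costs ½ c² δ ≤ 18 δ, together 20 δ. Since c ≥
    -- ⅔ and s = 1/r ≥ 1/b, this is covered by η c s when η ≥ 30 δ b.
    ηcs≥ : ℕ→ℚ 20 * δ ℚ.≤ η * (c * s)
    ηcs≥ = begin
      ℕ→ℚ 20 * δ                         ≡⟨ sym (ℚ.*-identityʳ _) ⟩
      ℕ→ℚ 20 * δ * 1ℚ                    ≡⟨ cong (ℕ→ℚ 20 * δ *_) (sym rs) ⟩
      ℕ→ℚ 20 * δ * (R * s)               ≤⟨ ≤-*ˡ (c≥0 (ℕ→ℚ 20) ⊗ <-weaken 0<δ) (≤-*ʳ (<-weaken 0<s) (root≤ k)) ⟩
      ℕ→ℚ 20 * δ * (b * s)               ≡⟨ eq δ b s ⟩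
      ℕ→ℚ 30 * δ * b * (2ℚ * ⅓ * s)      ≤⟨ mono₂ (c≥0 (ℕ→ℚ 30) ⊗ <-weaken 0<δ ⊗ <-weaken 0<b) (<-weaken (0<c ⊗⁺ 0<s)) hδ (≤-*ʳ (<-weaken 0<s) (ĉ-≥ k)) ⟩
      η * (c * s)                        ∎
      where eq : ∀ d b s → ℕ→ℚ 20 * d * (b * s) ≡ ℕ→ℚ 30 * d * b * (2ℚ * ⅓ * s)
            eq = solve-∀ ℚ-ring
    goal : 2ℚ * ⅓ * (H * H + δ) ℚ.≤ (σ + σ) * (c * R + η - n′ * σ)
    goal = begin
      2ℚ * ⅓ * (H * H + δ)
        ≤⟨ by-slack (c≥0 (2ℚ * (⅓ * ⅓)) ⊗ (sq≥0 H ⊗ slack 3≤ ⊕ slack H²≤4 ⊗ <-weaken 0<δ) ⊕ c≥0 (4ℚ * (⅓ * ⅓)) ⊗ <-weaken 0<δ) (eq H T δ) ⟩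
      ½ * (c * c) + 2ℚ * δ
        ≤⟨ by-slack (slack ηcs≥ ⊕ c≥0 ½ ⊗ sq≥0 c ⊗ slack ns²≤ ⊕ c≥0 ½ ⊗ (slack c²≤36 ⊗ <-weaken 0<δ)) (eq′ c δ (η * (c * s)) (n′ * (s * s))) ⟩
      c * c * 1ℚ + η * (c * s) - ½ * (c * c) * (n′ * (s * s))
        ≡⟨ cong (λ w → c * c * w + η * (c * s) - ½ * (c * c) * (n′ * (s * s))) (sym rs) ⟩
      c * c * (R * s) + η * (c * s) - ½ * (c * c) * (n′ * (s * s))
        ≡⟨ eq″ c R s η n′ ⟩
      (σ + σ) * (c * R + η - n′ * σ) ∎
      where
      eq : ∀ H T d → ½ * (⅓ * ((H + H) * T) * (⅓ * ((H + H) * T))) + 2ℚ * d ≡ 2ℚ * ⅓ * (H * H + d)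
           + (2ℚ * (⅓ * ⅓) * (H * H * (T * T + d - ℕ→ℚ 3) + (4ℚ - H * H) * d) + 4ℚ * (⅓ * ⅓) * d)
      eq = solve-∀ ℚ-ring
      eq′ : ∀ c d e m → c * c * 1ℚ + e - ½ * (c * c) * m ≡ ½ * (c * c) + 2ℚ * d
            + ((e - ℕ→ℚ 20 * d) + ½ * (c * c) * (1ℚ + d - m) + ½ * ((ℕ→ℚ 36 - c * c) * d))
      eq′ = solve-∀ ℚ-ring
      eq″ : ∀ c r s e n → c * c * (r * s) + e * (c * s) - ½ * (c * c) * (n * (s * s)) ≡ (½ * c * s + ½ * c * s) * (c * r + e - n * (½ * c * s))
      eq″ = solve-∀ ℚ-ring

  q : ℕ
  q = length (values (suc n) (suc n))

  one : ℕ → ℚ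
  one _ = 1ℚ

  one≤ : ∀ (k : ℕ) → ∣ 1ℚ ∣ ℚ.≤ 1ℚ
  one≤ _ = ℚ.≤-refl

  -- δ = 1 / 2(q + 1) makes (q + 1)(1 - δ) equal to q + ½, so half of the summand 1 survives the
  -- truncation.
  half-count : ∀ e σ → 0< σ → (∀ N → ζ₂ N ℚ.≤ (σ + σ) * (e - n′ * σ)) → ∃[ j ] ℕ→ℚ q + ½ ℚ.≤ expSum e j
  half-count e σ 0<σ hζ = let (j , hj) = count≤exp n σ e 0<σ hζ δ (c>0 ½ ⊗⁺ 0<1/ q) δ≤1
    in j , ℚ.≤-trans (ℚ.≤-reflexive eq) hj
    where
    δ = ½ * (1/ℕ suc q)
    1/≤1 : (1/ℕ suc q) ℚ.≤ 1ℚ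
    1/≤1 = ≤-*-cancelˡ (0<ℕ→ℚ-suc q) (subst₂ ℚ._≤_ (sym (suc*1/ q)) (sym (ℚ.*-identityʳ _)) (1≤ℕ→ℚ-suc q))
    δ≤1 : δ ℚ.≤ 1ℚ
    δ≤1 = ℚ.≤-trans (≤-*ˡ (c≥0 ½) 1/≤1) (toWitness {a? = ½ * 1ℚ ℚ.≤? 1ℚ} _)
    eq₁ : ∀ q s r → s ≡ 1ℚ + q → s * r ≡ 1ℚ → q + ½ ≡ (q + 1ℚ) * (1ℚ - ½ * r)
    eq₁ q s r refl e = trans (eq₂ q) (trans (cong (λ z → q + 1ℚ - ½ * z) (sym e)) (eq₃ q r))
      where eq₂ : ∀ q → q + ½ ≡ q + 1ℚ - ½ * 1ℚ
            eq₂ = solve-∀ ℚ-ring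
            eq₃ : ∀ q r → q + 1ℚ - ½ * ((1ℚ + q) * r) ≡ (q + 1ℚ) * (1ℚ - ½ * r)
            eq₃ = solve-∀ ℚ-ring
    eq : ℕ→ℚ q + ½ ≡ (ℕ→ℚ q + 1ℚ) * (1ℚ - δ)
    eq = eq₁ (ℕ→ℚ q) (ℕ→ℚ (suc q)) (1/ℕ suc q) (ℕ→ℚ-suc q) (suc*1/ q)

  -- Passing from a + η to a costs η times a Lipschitz constant. Passing from the uncontrolled
  -- length j to the diagonal index k costs the tail at k.
  continuity : ∀ M k j a η → 0≤ a → 0≤ η → a + η ℚ.≤ ℕ→ℚ M → M ℕ.+ M ≤ k →
               expSum (a + η) j ℚ.≤ partialSum one a k + (η * Majorant.C M + tail M k)
  continuity M k j a η 0≤a 0≤η a+η≤M M≤k = begin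
    expSum (a + η) j              ≤⟨ expSum-mono {m = j} {n = L} (0≤a ⊕ 0≤η) ℚ.≤-refl (ℕ.m≤m⊔n j k) ⟩
    expSum (a + η) L              ≡⟨ sym (partialSum≡expSum (a + η) L) ⟩
    partialSum one (a + η) L      ≤⟨ ∣-∣≤ {partialSum one (a + η) L} {partialSum one a L} lip ⟩
    partialSum one a L + η * Cᴹ   ≤⟨ ℚ.+-monoˡ-≤ (η * Cᴹ) (∣-∣≤ {partialSum one a L} {partialSum one a k} (partialSum-tail M one one≤ ∣a∣ M≤k (ℕ.m≤n⊔m j k))) ⟩
    partialSum one a k + tail M k + η * Cᴹ ≡⟨ eq (partialSum one a k) (tail M k) (η * Cᴹ) ⟩
    partialSum one a k + (η * Cᴹ + tail M k) ∎
    where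
    L = j ℕ.⊔ k
    Cᴹ = Majorant.C M
    eq : ∀ a b c → a + b + c ≡ a + (c + b)
    eq = solve-∀ ℚ-ring
    eq′ : ∀ a e → a + e - a ≡ e
    eq′ = solve-∀ ℚ-ring
    ∣a∣ : ∣ a ∣ ℚ.≤ ℕ→ℚ M
    ∣a∣ = subst (ℚ._≤ ℕ→ℚ M) (sym (ℚ.0≤p⇒∣p∣≡p 0≤a)) (ℚ.≤-trans (x≤x+y 0≤η) a+η≤M)
    ∣a+η∣ : ∣ a + η ∣ ℚ.≤ ℕ→ℚ M
    ∣a+η∣ = subst (ℚ._≤ ℕ→ℚ M) (sym (ℚ.0≤p⇒∣p∣≡p (0≤a ⊕ 0≤η))) a+η≤M
    lip : ∣ partialSum one (a + η) L - partialSum one a L ∣ ℚ.≤ η * Cᴹ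
    lip = ℚ.≤-trans (Majorant.sum-lipschitz M one one≤ ∣a+η∣ ∣a∣ L)
      (subst (λ z → z * Majorant.V M L ℚ.≤ η * Cᴹ) (sym (trans (cong ∣_∣ (eq′ a η)) (ℚ.0≤p⇒∣p∣≡p 0≤η)))
        (≤-*ˡ 0≤η (ℚ.≤-trans (Majorant.V≤E M L) (Majorant.E≤C M L (ℕ.≤-trans M≤k (ℕ.m≤n⊔m j k))))))

  private
    eq₀ : ∀ k b u η → k * (η * u) * b ≡ η * (k * b * u)
    eq₀ = solve-∀ ℚ-ring
    eq₁ : ∀ k b u η → k * b * u ≡ 1ℚ → k * (η * u) * b ≡ η
    eq₁ k b u η e = trans (eq₀ k b u η) (trans (cong (η *_) e) (ℚ.*-identityʳ η))

    conclude : ∀ E T x Q → Q + ½ ℚ.≤ E + (x + T) → x ℚ.≤ ⅛ → T ℚ.≤ ⅛ → Q + ¼ ℚ.≤ E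
    conclude E T x Q p q r = by-slack (slack p ⊕ slack q ⊕ slack r) (eq E T x Q)
      where eq : ∀ e t x q → e ≡ q + ¼ + ((e + (x + t) - (q + ½)) + (⅛ - x) + (⅛ - t))
            eq = solve-∀ ℚ-ring

  -- Of the slack ½, one ⅛ is spent on η and one ⅛ on the tail, and ¼ is left for strictness.
  -- `Basel` is applied with g = (h k)² + η u for each k separately, while η and u are fixed
  -- beforehand.
  eventually : ∀ M D K η u → 0< η → 0< u → ℕ→ℚ 6 * b + 1ℚ ℚ.≤ ℕ→ℚ M → Majorant.C M ℚ.≤ ℕ→ℚ D →
    ℕ→ℚ (suc D) * η ≡ ⅛ → ℕ→ℚ 30 * b * u ≡ 1ℚ →
    (∀ m k → K ≤ m → K ≤ k → ∣ h m * h m - h k * h k ∣ ℚ.< η * u) →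
    ∀ k → K ≤ k → M ℕ.+ M ≤ k → ∣ r k * r k - n′ ∣ ℚ.< η * u → ∣ t k * t k - ℕ→ℚ 3 ∣ ℚ.< η * u → tail M k ℚ.< ⅛ →
    ℕ→ℚ q + ¼ ℚ.≤ partialSum one (ĉ k * r k) k
  eventually M D K η u 0<η 0<u hM hD ηD bu hK k K≤k M≤k hr ht htail =
    conclude (partialSum one (ĉ k * r k) k) (tail M k) (η * Majorant.C M) (ℕ→ℚ q)
      (ℚ.≤-trans (proj₂ hc) (continuity M k (proj₁ hc) (ĉ k * r k) η (0≤ĉ k ⊗ <-weaken (0<r k)) (<-weaken 0<η) bound M≤k))
      ηC≤ (<-weaken htail)
    where
    0<δ : 0< (η * u)
    0<δ = 0<η ⊗⁺ 0<u
    η≤⅛ : η ℚ.≤ ⅛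
    η≤⅛ = subst₂ ℚ._≤_ (ℚ.*-identityˡ η) ηD (≤-*ʳ (<-weaken 0<η) (1≤ℕ→ℚ-suc D))
    ηC≤ : η * Majorant.C M ℚ.≤ ⅛
    ηC≤ = subst₂ ℚ._≤_ (ℚ.*-comm (Majorant.C M) η) ηD (≤-*ʳ (<-weaken 0<η) (ℚ.≤-trans hD (ℕ→ℚ-mono (ℕ.n≤1+n D))))
    bound : ĉ k * r k + η ℚ.≤ ℕ→ℚ M
    bound = ℚ.≤-trans (ℚ.+-mono-≤ (mono₂ (0≤ĉ k) (<-weaken 0<b) (ĉ-≤ k) (root≤ k)) (ℚ.≤-trans η≤⅛ (toWitness {a? = ⅛ ℚ.≤? 1ℚ} _))) hM
    0<g : 0< (h k * h k + η * u)
    0<g = subst 0<_ (ℚ.+-comm (η * u) (h k * h k)) (0<δ ⊕⁺ sq≥0 (h k))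
    ex = exponent k (η * u) η 0<δ (<-weaken hr) (<-weaken ht)
      (Basel (h k * h k + η * u) 0<g (λ ε 0<ε → K , λ m K≤m →
        ℚ.≤-trans (∣-∣≤ {h m * h m} (<-weaken (hK m k K≤m K≤k))) (x≤x+y (<-weaken 0<ε))))
      (ℚ.≤-reflexive (eq₁ (ℕ→ℚ 30) b u η bu))
    hc = half-count (ĉ k * r k + η) (proj₁ ex) (proj₁ (proj₂ ex)) (proj₂ (proj₂ ex))

  q<exp : fromℕ q <ᴿ exp (π/√3 *ᴿ √)
  q<exp =
    let (M , hM) = archimedean (ℕ→ℚ 6 * b + 1ℚ)
        (D , hD) = archimedean (Majorant.C M)
        (u , 0<u , bu) = 1/⁺ (c>0 (ℕ→ℚ 30) ⊗⁺ 0<b)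
        η = Split.δ ⅛ (c>0 ⅛) D
        0<η = Split.0<δ ⅛ (c>0 ⅛) D
        (K , hK) = cauchy (π/2 *ᴿ π/2) (η * u) (0<η ⊗⁺ 0<u)
        (N₁ , h₁) = √²-null (η * u) (0<η ⊗⁺ 0<u)
        (N₂ , h₂) = t²-null (η * u) (0<η ⊗⁺ 0<u)
        (N₃ , h₃) = tail-small M ⅛ (c>0 ⅛)
        L₁ = K ℕ.⊔ (M ℕ.+ M)
        L₂ = N₁ ℕ.⊔ N₂
        L₃ = L₂ ℕ.⊔ N₃
    in ¼ , c>0 ¼ , L₁ ℕ.⊔ L₃ , λ k p → eventually M D K η u 0<η 0<u hM hD (Split.k*δ ⅛ (c>0 ⅛) D) bu hK k
      (⊔≤ˡ K (M ℕ.+ M) (⊔≤ˡ L₁ L₃ p)) (⊔≤ʳ K (M ℕ.+ M) (⊔≤ˡ L₁ L₃ p))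
      (h₁ k (⊔≤ˡ N₁ N₂ (⊔≤ˡ L₂ N₃ (⊔≤ʳ L₁ L₃ p)))) (h₂ k (⊔≤ʳ N₁ N₂ (⊔≤ˡ L₂ N₃ (⊔≤ʳ L₁ L₃ p))))
      (h₃ k (⊔≤ʳ L₂ N₃ (⊔≤ʳ L₁ L₃ p)))

  ∣B∣< : ∣ B (suc n) ∣< exp (π/√3 *ᴿ √)
  ∣B∣< = q , B-bound (suc n) , q<exp

-- Prime numbers

ind : ∀ {P : Set} → Dec P → ℕ
ind (yes _) = 1
ind (no _)  = 0

ind≤1 : ∀ {P : Set} (d : Dec P) → ind d ≤ 1
ind≤1 (yes _) = ℕ.≤-refl
ind≤1 (no _)  = z≤n

prime-divisor : ∀ k → 2 ≤ k → ∃[ p ] (Prime p × p ∣ⁿ k)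
prime-divisor (suc (suc k)) (s≤s (s≤s _)) with factorise (suc (suc k))
... | record { factors = []     ; isFactorisation = () }
... | record { factors = p ∷ ps ; isFactorisation = e ; factorsPrime = pr ∷ _ } =
  p , pr , subst (p ∣ⁿ_) (sym e) (Div.m∣m*n _)

2≤prime : ∀ {p} → Prime p → 2 ≤ p
2≤prime {p} pr = ℕ.nonTrivial⇒n>1 p {{prime⇒nonTrivial pr}}

n<b^n : ∀ {b} → 2 ≤ b → ∀ n → n < b ℕ.^ n
n<b^n 2≤b zero    = s≤s z≤n
n<b^n {b} 2≤b (suc n) = begin
  suc (suc n)           ≤⟨ s≤s (n<b^n 2≤b n) ⟩
  suc (b ℕ.^ n)         ≤⟨ ℕ.+-monoˡ-≤ (b ℕ.^ n) (ℕ.≤-trans (s≤s z≤n) (n<b^n 2≤b n)) ⟩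
  b ℕ.^ n ℕ.+ b ℕ.^ n   ≡⟨ cong (b ℕ.^ n ℕ.+_) (sym (ℕ.+-identityʳ _)) ⟩
  2 ℕ.* b ℕ.^ n         ≤⟨ ℕ.*-monoˡ-≤ (b ℕ.^ n) 2≤b ⟩
  b ℕ.^ suc n           ∎
  where open ℕ.≤-Reasoning

max-exponent : ∀ b n → 2 ≤ b → 1 ≤ n → ∃[ e ] (b ℕ.^ e ≤ n × (∀ v → b ℕ.^ v ≤ n → v ≤ e))
max-exponent b n 2≤b 1≤n =
  let (e , p , h) = search n in e , p , λ v q → h v (ℕ.<⇒≤ (ℕ.<-≤-trans (n<b^n 2≤b v) q)) q
  where
  search : ∀ k → ∃[ e ] (b ℕ.^ e ≤ n × (∀ v → v ≤ k → b ℕ.^ v ≤ n → v ≤ e))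
  search zero = 0 , 1≤n , λ v p _ → p
  search (suc k) with b ℕ.^ suc k ℕ.≤? n
  ... | yes p = suc k , p , λ v q _ → q
  ... | no ¬p = let (e , p , h) = search k in e , p , λ v q r → case ℕ.m≤n⇒m<n∨m≡n q of λ where
      (inj₁ (s≤s v≤k)) → h v v≤k r
      (inj₂ refl)      → ⊥-elim (¬p r)

prime-part : ∀ {p} → Prime p → ∀ k → 1 ≤ k → ∃[ v ] ∃[ m ] (k ≡ p ℕ.^ v ℕ.* m × ¬ (p ∣ⁿ m))
prime-part {p} pr = <-rec _ step
  where
  Part : ℕ → Set
  Part k = 1 ≤ k → ∃[ v ] ∃[ m ] (k ≡ p ℕ.^ v ℕ.* m × ¬ (p ∣ⁿ m))
  eq : ∀ p a m → a ℕ.* m ℕ.* p ≡ p ℕ.* a ℕ.* m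
  eq = ℕ-solve-∀
  step : ∀ k → (∀ {j} → j < k → Part j) → Part k
  step k rec 1≤k with p Div.∣? k
  ... | no ¬d = 0 , k , sym (ℕ.*-identityˡ k) , ¬d
  ... | yes (Div.divides q e) =
    let (v , m , e′ , ¬d) = rec q<k 1≤q
    in suc v , m , trans e (trans (cong (ℕ._* p) e′) (eq p (p ℕ.^ v) m)) , ¬d
    where
    1≤q : 1 ≤ q
    1≤q = ℕ.n≢0⇒n>0 λ { refl → ℕ.<-irrefl (sym e) 1≤k }
    q<k : q < k
    q<k = subst (q <_) (sym e) (subst (_< q ℕ.* p) (ℕ.*-identityʳ q) (ℕ.*-monoʳ-< q {{ℕ.>-nonZero 1≤q}} (2≤prime pr)))

-- Chebyshev's estimate.

π# : ℕ → ℕ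
π# zero    = 0
π# (suc t) = ind (prime? (suc t)) ℕ.+ π# t

-- `multiple X` is the least common multiple of 1, ..., X, built as the product of the largest prime
-- powers not exceeding X.
module CommonMultiple (X : ℕ) (1≤X : 1 ≤ X) where

  factor : ∀ {p} → Dec (Prime p) → ℕ
  factor {p} (yes pr) = p ℕ.^ proj₁ (max-exponent p X (2≤prime pr) 1≤X)
  factor {p} (no _)   = 1

  multiple : ℕ → ℕ
  multiple zero    = 1
  multiple (suc t) = factor (prime? (suc t)) ℕ.* multiple t

  -- Induction on a bound t for the prime divisors of k: the full power of the prime `suc t` in k is
  -- split off, and the cofactor has only smaller prime divisors.
  ∣multiple : ∀ t k → 1 ≤ k → k ≤ X → (∀ p → Prime p → p ∣ⁿ k → p ≤ t) → k ∣ⁿ multiple t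
  ∣multiple zero    (suc zero)    _ _ _ = Div.∣-refl
  ∣multiple zero    (suc (suc k)) _ _ h with prime-divisor (suc (suc k)) (s≤s (s≤s z≤n))
  ... | p , pr , p∣k = ⊥-elim (ℕ.<⇒≱ (2≤prime pr) (ℕ.≤-trans (h p pr p∣k) z≤n))
  ∣multiple (suc t) k 1≤k k≤X h with prime? (suc t)
  ... | no ¬pr = subst (k ∣ⁿ_) (sym (ℕ.*-identityˡ (multiple t)))
        (∣multiple t k 1≤k k≤X λ p pr p∣k → ℕ.≤-pred (ℕ.≤∧≢⇒< (h p pr p∣k) λ { refl → ¬pr pr }))
  ... | yes pr with prime-part pr k 1≤k
  ...   | v , m , refl , ¬d = Div.*-pres-∣
          (subst ((suc t) ℕ.^ v ∣ⁿ_) (trans (sym (ℕ.^-distribˡ-+-* (suc t) v (proj₁ max ℕ.∸ v))) (cong ((suc t) ℕ.^_) (ℕ.m+[n∸m]≡n v≤e))) (Div.m∣m*n _))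
          (∣multiple t m 1≤m (ℕ.≤-trans (Div.∣⇒≤ {{ℕ.>-nonZero 1≤k}} m∣k) k≤X) λ p pr′ p∣m →
            ℕ.≤-pred (ℕ.≤∧≢⇒< (h p pr′ (Div.∣-trans p∣m m∣k)) λ { refl → ¬d p∣m }))
    where
    max = max-exponent (suc t) X (2≤prime pr) 1≤X
    m∣k : m ∣ⁿ (suc t) ℕ.^ v ℕ.* m
    m∣k = Div.n∣m*n ((suc t) ℕ.^ v)
    1≤m : 1 ≤ m
    1≤m = ℕ.n≢0⇒n>0 λ { refl → ℕ.<-irrefl (sym (ℕ.*-zeroʳ ((suc t) ℕ.^ v))) 1≤k }
    v≤e : v ≤ proj₁ max
    v≤e = proj₂ (proj₂ max) v (ℕ.≤-trans (Div.∣⇒≤ {{ℕ.>-nonZero 1≤k}} (Div.m∣m*n {(suc t) ℕ.^ v} m)) k≤X)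

  divides-multiple : ∀ k → 1 ≤ k → k ≤ X → k ∣ⁿ multiple X
  divides-multiple k 1≤k k≤X = ∣multiple X k 1≤k k≤X λ p pr p∣k → ℕ.≤-trans (Div.∣⇒≤ {{ℕ.>-nonZero 1≤k}} p∣k) k≤X

  -- Each of the π# t prime powers is at most X ≤ 2ʰ.
  multiple≤ : ∀ {c} h → X ≤ 2 ℕ.^ h → c ≡ h → ∀ t → multiple t ≤ 2 ℕ.^ (c ℕ.* π# t)
  multiple≤ h X≤ refl zero = ℕ.≤-reflexive (cong (2 ℕ.^_) (sym (ℕ.*-zeroʳ h)))
  multiple≤ h X≤ refl (suc t) with prime? (suc t)
  ... | no _   = ℕ.≤-trans (ℕ.≤-reflexive (ℕ.*-identityˡ _)) (multiple≤ h X≤ refl t)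
  ... | yes pr = ℕ.≤-trans (ℕ.*-mono-≤ (ℕ.≤-trans (proj₁ (proj₂ (max-exponent (suc t) X (2≤prime pr) 1≤X))) X≤) (multiple≤ h X≤ refl t))
        (ℕ.≤-reflexive (trans (sym (ℕ.^-distribˡ-+-* 2 h (h ℕ.* π# t))) (cong (2 ℕ.^_) (sym (ℕ.*-suc h (π# t))))))

  -- M times the entry (a, b) of the Leibniz harmonic triangle is an integer.
  Leibniz : ∀ M N → (∀ k → 1 ≤ k → k ≤ N → k ∣ⁿ M) → ∀ b a → suc (a ℕ.+ b) ≤ N →
            ∃[ g ] g ℕ.* (suc (a ℕ.+ b)) ℕ.! ≡ M ℕ.* (a ℕ.! ℕ.* b ℕ.!)
  Leibniz M N hM zero a p with hM (suc (a ℕ.+ 0)) (s≤s z≤n) p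
  ... | Div.divides g e = g , trans (eq g (suc (a ℕ.+ 0)) ((a ℕ.+ 0) ℕ.!))
      (cong₂ ℕ._*_ (sym e) (trans (cong ℕ._! (ℕ.+-identityʳ a)) (sym (ℕ.*-identityʳ (a ℕ.!)))))
    where eq : ∀ g s f → g ℕ.* (s ℕ.* f) ≡ g ℕ.* s ℕ.* f
          eq = ℕ-solve-∀
  -- With the entries a! b! / (a+b+1)!, the one at (a, b + 1) is the entry at (a, b) minus the entry
  -- at (a + 1, b).
  Leibniz M N hM (suc b) a p =
    let (g₁ , e₁) = Leibniz M N hM b a (ℕ.≤-trans (ℕ.s≤s (ℕ.+-monoʳ-≤ a (ℕ.n≤1+n b))) p)
        (g₂ , e₂) = Leibniz M N hM b (suc a) (subst (_≤ N) (cong suc (ℕ.+-suc a b)) p)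
    in g₁ ℕ.∸ g₂ , difference g₁ g₂ e₁ e₂
    where
    F = (suc (a ℕ.+ b)) ℕ.!
    s = suc (suc (a ℕ.+ b))
    eq₁ : ∀ g s f → g ℕ.* (s ℕ.* f) ≡ s ℕ.* (g ℕ.* f)
    eq₁ = ℕ-solve-∀
    eq₂ : ∀ a b M x y → suc (suc (a ℕ.+ b)) ℕ.* (M ℕ.* (x ℕ.* y)) ≡ M ℕ.* (x ℕ.* (suc b ℕ.* y)) ℕ.+ M ℕ.* (suc a ℕ.* x ℕ.* y)
    eq₂ = ℕ-solve-∀
    difference : ∀ g₁ g₂ → g₁ ℕ.* F ≡ M ℕ.* (a ℕ.! ℕ.* b ℕ.!) → g₂ ℕ.* (s ℕ.* F) ≡ M ℕ.* ((suc a) ℕ.! ℕ.* b ℕ.!) →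
                 (g₁ ℕ.∸ g₂) ℕ.* (suc (a ℕ.+ suc b)) ℕ.! ≡ M ℕ.* (a ℕ.! ℕ.* (suc b) ℕ.!)
    difference g₁ g₂ e₁ e₂ = begin
      (g₁ ℕ.∸ g₂) ℕ.* (suc (a ℕ.+ suc b)) ℕ.!        ≡⟨ cong (λ k → (g₁ ℕ.∸ g₂) ℕ.* k ℕ.!) (cong suc (ℕ.+-suc a b)) ⟩
      (g₁ ℕ.∸ g₂) ℕ.* (s ℕ.* F)                      ≡⟨ ℕ.*-distribʳ-∸ (s ℕ.* F) g₁ g₂ ⟩
      g₁ ℕ.* (s ℕ.* F) ℕ.∸ g₂ ℕ.* (s ℕ.* F)          ≡⟨ cong₂ ℕ._∸_ (trans (eq₁ g₁ s F) (trans (cong (s ℕ.*_) e₁) (eq₂ a b M (a ℕ.!) (b ℕ.!)))) e₂ ⟩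
      M ℕ.* (a ℕ.! ℕ.* (suc b) ℕ.!) ℕ.+ M ℕ.* ((suc a) ℕ.! ℕ.* b ℕ.!) ℕ.∸ M ℕ.* ((suc a) ℕ.! ℕ.* b ℕ.!)
                                                     ≡⟨ ℕ.m+n∸n≡m (M ℕ.* (a ℕ.! ℕ.* (suc b) ℕ.!)) (M ℕ.* ((suc a) ℕ.! ℕ.* b ℕ.!)) ⟩
      M ℕ.* (a ℕ.! ℕ.* (suc b) ℕ.!)                  ∎
      where open ≡-Reasoning

!>0 : ∀ n → 1 ≤ n ℕ.!
!>0 zero    = s≤s z≤n
!>0 (suc n) = ℕ.*-mono-≤ {1} {suc n} (s≤s z≤n) (!>0 n)

4^≤central : ∀ m → 4 ℕ.^ m ℕ.* (m ℕ.! ℕ.* m ℕ.!) ≤ (suc (m ℕ.+ m)) ℕ.!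
4^≤central zero    = s≤s z≤n
4^≤central (suc m) = begin
  4 ℕ.* 4 ℕ.^ m ℕ.* (suc m ℕ.* m ℕ.! ℕ.* (suc m ℕ.* m ℕ.!))   ≡⟨ eq (4 ℕ.^ m) m (m ℕ.!) ⟩
  (suc m ℕ.+ suc m) ℕ.* (suc m ℕ.+ suc m) ℕ.* (4 ℕ.^ m ℕ.* (m ℕ.! ℕ.* m ℕ.!))
    ≤⟨ ℕ.*-mono-≤ (ℕ.*-monoˡ-≤ (suc m ℕ.+ suc m) (ℕ.n≤1+n (suc m ℕ.+ suc m))) (4^≤central m) ⟩
  suc (suc m ℕ.+ suc m) ℕ.* (suc m ℕ.+ suc m) ℕ.* (suc (m ℕ.+ m)) ℕ.!
    ≡⟨ ℕ.*-assoc (suc (suc m ℕ.+ suc m)) (suc m ℕ.+ suc m) _ ⟩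
  suc (suc m ℕ.+ suc m) ℕ.* ((suc m ℕ.+ suc m) ℕ.* (suc (m ℕ.+ m)) ℕ.!)
    ≡⟨ cong (λ k → suc (suc m ℕ.+ suc m) ℕ.* ((suc m ℕ.+ suc m) ℕ.* k ℕ.!)) (sym (ℕ.+-suc m m)) ⟩
  (suc (suc m ℕ.+ suc m)) ℕ.! ∎
  where open ℕ.≤-Reasoning
        eq : ∀ a m f → 4 ℕ.* a ℕ.* (suc m ℕ.* f ℕ.* (suc m ℕ.* f)) ≡ (suc m ℕ.+ suc m) ℕ.* (suc m ℕ.+ suc m) ℕ.* (a ℕ.* (f ℕ.* f))
        eq = ℕ-solve-∀

2^-cancel-≤ : ∀ a b → 2 ℕ.^ a ≤ 2 ℕ.^ b → a ≤ b
2^-cancel-≤ a b p = ℕ.≮⇒≥ λ b<a → ℕ.<⇒≱ (ℕ.^-monoʳ-< 2 (s≤s (s≤s z≤n)) b<a) p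

half : ∀ t → ∃[ m ] (t ≡ m ℕ.+ m ⊎ t ≡ suc (m ℕ.+ m))
half zero = 0 , inj₁ refl
half (suc t) with half t
... | m , inj₁ refl = m , inj₂ refl
... | m , inj₂ refl = suc m , inj₁ (cong suc (sym (ℕ.+-suc m m)))

-- For 2 m + 1 ≤ t and M = `multiple t`, the number M m! m! / (2 m + 1)! is a positive integer, so
-- 4ᵐ ≤ (2 m + 1)! / (m! m!) ≤ M ≤ 2^(h π# t). The summand 2 covers the rounding of t to 2 m.
Chebyshev : ∀ h t → t ≤ 2 ℕ.^ h → t ≤ h ℕ.* π# t ℕ.+ 2
Chebyshev h zero      _  = z≤n
Chebyshev h t@(suc s) t≤ = let (m , q) = half s in ℕ.≤-trans (t≤2m+2 m q) (ℕ.+-monoˡ-≤ 2 (2m≤ m (2m<t m q)))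
  where
  open CommonMultiple t (s≤s z≤n)
  t≤2m+2 : ∀ m → s ≡ m ℕ.+ m ⊎ s ≡ suc (m ℕ.+ m) → t ≤ m ℕ.+ m ℕ.+ 2
  t≤2m+2 m (inj₁ refl) = subst (_≤ m ℕ.+ m ℕ.+ 2) (ℕ.+-comm (m ℕ.+ m) 1) (ℕ.+-monoʳ-≤ (m ℕ.+ m) (s≤s z≤n))
  t≤2m+2 m (inj₂ refl) = ℕ.≤-reflexive (ℕ.+-comm 2 (m ℕ.+ m))
  2m<t : ∀ m → s ≡ m ℕ.+ m ⊎ s ≡ suc (m ℕ.+ m) → suc (m ℕ.+ m) ≤ t
  2m<t m (inj₁ refl) = ℕ.≤-refl
  2m<t m (inj₂ refl) = ℕ.n≤1+n _
  2m≤ : ∀ m → suc (m ℕ.+ m) ≤ t → m ℕ.+ m ≤ h ℕ.* π# t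
  2m≤ m p = 2^-cancel-≤ (m ℕ.+ m) (h ℕ.* π# t) (ℕ.≤-trans (ℕ.≤-trans (ℕ.≤-reflexive 2^2m) 4^m≤) (multiple≤ h t≤ refl t))
    where
    open ℕ.≤-Reasoning
    2^2m : 2 ℕ.^ (m ℕ.+ m) ≡ 4 ℕ.^ m
    2^2m = trans (cong (2 ℕ.^_) (cong (m ℕ.+_) (sym (ℕ.+-identityʳ m)))) (sym (ℕ.^-*-assoc 2 2 m))
    L = Leibniz (multiple t) t divides-multiple m m p
    L>0 : 1 ≤ multiple t
    L>0 = go t
      where
      factor>0 : ∀ {p} (d : Dec (Prime p)) → 1 ≤ factor d
      factor>0 {p} (yes pr) = ℕ.m^n>0 p {{prime⇒nonZero pr}} (proj₁ (max-exponent p t (2≤prime pr) (s≤s z≤n)))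
      factor>0 (no _)   = s≤s z≤n
      go : ∀ t → 1 ≤ multiple t
      go zero    = s≤s z≤n
      go (suc u) = ℕ.*-mono-≤ (factor>0 (prime? (suc u))) (go u)
    ff = m ℕ.! ℕ.* m ℕ.!
    ff>0 : 1 ≤ ff
    ff>0 = ℕ.*-mono-≤ (!>0 m) (!>0 m)
    g>0 : 1 ≤ proj₁ L
    g>0 = ℕ.n≢0⇒n>0 λ g≡0 → ℕ.<-irrefl (trans (cong (ℕ._* (suc (m ℕ.+ m)) ℕ.!) (sym g≡0)) (proj₂ L)) (ℕ.*-mono-≤ L>0 ff>0)
    4^m≤ : 4 ℕ.^ m ≤ multiple t
    4^m≤ = ℕ.*-cancelʳ-≤ (4 ℕ.^ m) (multiple t) ff {{ℕ.>-nonZero ff>0}} (begin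
      4 ℕ.^ m ℕ.* ff                          ≤⟨ 4^≤central m ⟩
      (suc (m ℕ.+ m)) ℕ.!                     ≡⟨ sym (ℕ.*-identityˡ _) ⟩
      1 ℕ.* (suc (m ℕ.+ m)) ℕ.!               ≤⟨ ℕ.*-monoˡ-≤ ((suc (m ℕ.+ m)) ℕ.!) g>0 ⟩
      proj₁ L ℕ.* (suc (m ℕ.+ m)) ℕ.!         ≡⟨ proj₂ L ⟩
      multiple t ℕ.* ff                       ∎)

-- Any bound from 7 on would do in place of 13: these primes must not divide the
-- 7-smooth parts that complete a partition.
BigPrime : ℕ → Set
BigPrime p = Prime p × 13 < p

bigPrime? : Decidable BigPrime
bigPrime? p = prime? p ×-dec (13 ℕ.<? p)

π⁺ : ℕ → ℕ
π⁺ zero    = 0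
π⁺ (suc t) = ind (bigPrime? (suc t)) ℕ.+ π⁺ t

-- There are 6 primes up to 13.
π#≤ : ∀ t → π# t ≤ π⁺ t ℕ.+ 6
π#≤ t with ℕ.≤-total t 13
... | inj₁ p = ℕ.≤-trans (mono (ℕ.≤⇒≤′ p)) (ℕ.m≤n+m 6 (π⁺ t))
  where mono : ∀ {s t} → s ℕ.≤′ t → π# s ≤ π# t
        mono (ℕ.≤′-reflexive refl) = ℕ.≤-refl
        mono (ℕ.≤′-step {t} p)     = ℕ.≤-trans (mono p) (ℕ.m≤n+m (π# t) (ind (prime? (suc t))))
... | inj₂ p = subst (λ t → π# t ≤ π⁺ t ℕ.+ 6) (ℕ.m∸n+n≡m p) (go (t ℕ.∸ 13))
  where
  same : ∀ {p} (d : Dec (Prime p)) (e : Dec (BigPrime p)) → 13 < p → ind d ≤ ind e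
  same (yes pr) (yes _)  _ = ℕ.≤-refl
  same (yes pr) (no ¬b)  q = ⊥-elim (¬b (pr , q))
  same (no _)   _        _ = z≤n
  go : ∀ s → π# (s ℕ.+ 13) ≤ π⁺ (s ℕ.+ 13) ℕ.+ 6
  go zero    = ℕ.≤-refl
  go (suc s) = subst (π# (suc s ℕ.+ 13) ≤_) (sym (ℕ.+-assoc (ind (bigPrime? (suc s ℕ.+ 13))) (π⁺ (s ℕ.+ 13)) 6))
    (ℕ.+-mono-≤ (same (prime? (suc s ℕ.+ 13)) (bigPrime? (suc s ℕ.+ 13)) (s≤s (ℕ.m≤n+m 13 s))) (go s))

π⁺-≥ : ∀ h t → t ≤ 2 ℕ.^ h → t ≤ h ℕ.* (π⁺ t ℕ.+ 6) ℕ.+ 2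
π⁺-≥ h t p = ℕ.≤-trans (Chebyshev h t p) (ℕ.+-monoˡ-≤ 2 (ℕ.*-monoʳ-≤ h (π#≤ t)))

module _ {A B P Q : ℕ} where
  -- The counterpart of `by-slack` over ℕ: A ≤ B is reduced to P ≤ Q by an identity without
  -- subtraction, which the ring solver can check.
  ℕ-cert : ∀ s → A ℕ.+ Q ℕ.+ s ≡ B ℕ.+ P → P ≤ Q → A ≤ B
  ℕ-cert s e P≤Q = ℕ.+-cancelʳ-≤ Q A B (begin
    A ℕ.+ Q            ≤⟨ ℕ.m≤m+n (A ℕ.+ Q) s ⟩
    A ℕ.+ Q ℕ.+ s      ≡⟨ e ⟩
    B ℕ.+ P            ≤⟨ ℕ.+-monoʳ-≤ B P≤Q ⟩
    B ℕ.+ Q            ∎)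
    where open ℕ.≤-Reasoning

-- The elements p and 2p, and the independence of their reciprocals.

block : ∀ p → Dec (BigPrime p) → ∀ {m} → Dec (p ≤ m) → List ℕ
block p (yes _) (yes _) = p ∷ p ℕ.+ p ∷ []
block p (yes _) (no _)  = p ∷ []
block p (no _)  _       = []

-- For t = X and m = ⌊X/2⌋ these are the numbers p and 2p up to X.
elements : ℕ → ℕ → List ℕ
elements m zero    = []
elements m (suc t) = block (suc t) (bigPrime? (suc t)) (suc t ℕ.≤? m) ++ elements m t

IsElement : ℕ → ℕ → Set
IsElement t e = ∃[ p ] (BigPrime p × p ≤ t × (e ≡ p ⊎ e ≡ p ℕ.+ p))

elements-IsElement : ∀ m t → All (IsElement t) (elements m t)
elements-IsElement m zero    = []
elements-IsElement m (suc t) = go (bigPrime? (suc t)) (suc t ℕ.≤? m)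
  where
  rest : All (IsElement (suc t)) (elements m t)
  rest = All.map (λ (p , b , p≤t , e) → p , b , ℕ.m≤n⇒m≤1+n p≤t , e) (elements-IsElement m t)
  go : ∀ d (e : Dec (suc t ≤ m)) → All (IsElement (suc t)) (block (suc t) d e ++ elements m t)
  go (yes b) (yes _) = (suc t , b , ℕ.≤-refl , inj₁ refl) ∷ (suc t , b , ℕ.≤-refl , inj₂ refl) ∷ rest
  go (yes b) (no _)  = (suc t , b , ℕ.≤-refl , inj₁ refl) ∷ rest
  go (no _)  _       = rest

2p≡ : ∀ p → 2 ℕ.* p ≡ p ℕ.+ p
2p≡ p = cong (p ℕ.+_) (ℕ.+-identityʳ p)

prime-∤-smaller : ∀ {p q} → Prime p → 1 ≤ q → q < p → ¬ (p ∣ⁿ q)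
prime-∤-smaller pr 1≤q q<p p∣q = ℕ.<⇒≱ q<p (Div.∣⇒≤ {{ℕ.>-nonZero 1≤q}} p∣q)

∤-element : ∀ {p t e} → BigPrime p → t < p → IsElement t e → ¬ (p ∣ⁿ e)
∤-element {p} (pr , 13<p) t<p (q , (pr′ , _) , q≤t , inj₁ refl) = prime-∤-smaller pr (ℕ.<⇒≤ (2≤prime pr′)) (ℕ.≤-<-trans q≤t t<p)
∤-element {p} (pr , 13<p) t<p (q , (pr′ , _) , q≤t , inj₂ refl) p∣ = case euclidsLemma 2 q pr (subst (p ∣ⁿ_) (sym (2p≡ q)) p∣) of λ where
  (inj₁ p∣2) → prime-∤-smaller pr (s≤s z≤n) (ℕ.≤-trans (s≤s (s≤s (s≤s z≤n))) 13<p) p∣2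
  (inj₂ p∣q) → prime-∤-smaller pr (ℕ.<⇒≤ (2≤prime pr′)) (ℕ.≤-<-trans q≤t t<p) p∣q

∤-product : ∀ {p} → Prime p → ∀ {es} → All (λ e → ¬ (p ∣ⁿ e)) es → ¬ (p ∣ⁿ product es)
∤-product pr []       p∣1 = prime-∤-smaller pr (s≤s z≤n) (2≤prime pr) p∣1
∤-product pr {e ∷ es} (h ∷ hs) p∣ = case euclidsLemma e (product es) pr p∣ of λ where
  (inj₁ q) → h q
  (inj₂ q) → ∤-product pr hs q

elements-unique : ∀ m t → Unique (elements m t)
elements-unique m zero    = []
elements-unique m (suc t) = go (bigPrime? (suc t)) (suc t ℕ.≤? m)
  where
  p = suc t
  fresh : BigPrime p → ∀ {a} → p ∣ⁿ a → All (a ≢_) (elements m t)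
  fresh b p∣a = All.map (λ { e refl → ∤-element b ℕ.≤-refl e p∣a }) (elements-IsElement m t)
  p∣2p : p ∣ⁿ p ℕ.+ p
  p∣2p = subst (p ∣ⁿ_) (2p≡ p) (Div.n∣m*n 2)
  go : ∀ d (e : Dec (p ≤ m)) → Unique (block p d e ++ elements m t)
  go (yes b) (yes _) = ((λ e → ℕ.m≢1+m+n p (trans e (ℕ.+-suc p t))) ∷ fresh b Div.∣-refl) ∷ (fresh b p∣2p ∷ elements-unique m t)
  go (yes b) (no _)  = fresh b Div.∣-refl ∷ elements-unique m t
  go (no _)  _       = elements-unique m t

-- Subsets are given by masks, and Σ 1/e over a subset by its numerator over
-- the product of all elements.

bit : Bool → ℕ
bit false = 0
bit true  = 1

pick : (es : List ℕ) → Vec Bool (length es) → List ℕ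
pick []       []          = []
pick (e ∷ es) (true ∷ v)  = e ∷ pick es v
pick (e ∷ es) (false ∷ v) = pick es v

pick-All : ∀ {P : ℕ → Set} es v → All P es → All P (pick es v)
pick-All []       []          _        = []
pick-All (e ∷ es) (true ∷ v)  (p ∷ ps) = p ∷ pick-All es v ps
pick-All (e ∷ es) (false ∷ v) (p ∷ ps) = pick-All es v ps

pick-Unique : ∀ es v → Unique es → Unique (pick es v)
pick-Unique []       []          _       = []
pick-Unique (e ∷ es) (true ∷ v)  (a ∷ u) = pick-All es v a ∷ pick-Unique es v u
pick-Unique (e ∷ es) (false ∷ v) (a ∷ u) = pick-Unique es v u

numerator : (es : List ℕ) → Vec Bool (length es) → ℕ
numerator []       []      = 0
numerator (e ∷ es) (b ∷ v) = bit b ℕ.* product es ℕ.+ e ℕ.* numerator es v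

Independent : List ℕ → Set
Independent es = ∀ v w → numerator es v ≡ numerator es w → v ≡ w

ℕ→ℚ*1/ : ∀ e → 0 < e → ℕ→ℚ e * (1/ℕ e) ≡ 1ℚ
ℕ→ℚ*1/ (suc e) _ = suc*1/ e

numerator-inverseSum : ∀ es → All (0 <_) es → ∀ v → ℕ→ℚ (product es) * inverseSum (pick es v) ≡ ℕ→ℚ (numerator es v)
numerator-inverseSum []       _        []      = ℚ.*-zeroʳ 1ℚ
numerator-inverseSum (e ∷ es) (p ∷ ps) (b ∷ v) = trans (go b) (trans (cong₂ _+_ (sym (ℕ→ℚ-* (bit b) (product es))) (sym (ℕ→ℚ-* e (numerator es v)))) (sym (ℕ→ℚ-+ (bit b ℕ.* product es) (e ℕ.* numerator es v))))
  where
  e′ Q σ N : ℚ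
  e′ = ℕ→ℚ e
  Q = ℕ→ℚ (product es)
  σ = inverseSum (pick es v)
  N = ℕ→ℚ (numerator es v)
  IH : Q * σ ≡ N
  IH = numerator-inverseSum es ps v
  eq₁ : ∀ e q r s → e * q * (r + s) ≡ (e * r) * q + e * (q * s)
  eq₁ = solve-∀ ℚ-ring
  eq₂ : ∀ e q s → e * q * s ≡ 0ℚ * q + e * (q * s)
  eq₂ = solve-∀ ℚ-ring
  go : ∀ b → ℕ→ℚ (e ℕ.* product es) * inverseSum (pick (e ∷ es) (b ∷ v)) ≡ ℕ→ℚ (bit b) * Q + e′ * N
  go true  = trans (cong (_* ((1/ℕ e) + σ)) (ℕ→ℚ-* e (product es)))
    (trans (eq₁ e′ Q (1/ℕ e) σ) (cong₂ (λ x y → x * Q + e′ * y) (ℕ→ℚ*1/ e p) IH))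
  go false = trans (cong (_* σ) (ℕ→ℚ-* e (product es))) (trans (eq₂ e′ Q σ) (cong (λ y → 0ℚ * Q + e′ * y) IH))

inverseSum-injective : ∀ es → All (0 <_) es → Independent es → ∀ v w → inverseSum (pick es v) ≡ inverseSum (pick es w) → v ≡ w
inverseSum-injective es ps ind-es v w e = ind-es v w (ℕ→ℚ-injective (numerator es v) (numerator es w)
  (trans (sym (numerator-inverseSum es ps v)) (trans (cong (ℕ→ℚ (product es) *_) e) (numerator-inverseSum es ps w))))

-- Reduction modulo p gives U Q ≡ V Q, and Q is invertible, so U and V agree as residues below p.
-- The rest of the equation can then be divided by p.
digits : ∀ {p Q U V A B} → Prime p → ¬ (p ∣ⁿ Q) → U < p → V < p → U ℕ.* Q ℕ.+ p ℕ.* A ≡ V ℕ.* Q ℕ.+ p ℕ.* B → U ≡ V × A ≡ B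
digits {p} {Q} {U} {V} {A} {B} pr p∤Q U<p V<p e = U≡V , A≡B U≡V
  where
  0<p : 0 < p
  0<p = ℕ.<⇒≤ (2≤prime pr)
  ≤⇒≡ : ∀ {U V A B} → V < p → U ≤ V → U ℕ.* Q ℕ.+ p ℕ.* A ≡ V ℕ.* Q ℕ.+ p ℕ.* B → U ≡ V
  ≤⇒≡ {U} {V} {A} {B} V<p U≤V e with ℕ.m≤n⇒∃[o]m+o≡n U≤V
  ... | zero  , refl = sym (ℕ.+-identityʳ U)
  ... | suc d , refl = ⊥-elim (case euclidsLemma (suc d) Q pr p∣dQ of λ where
      (inj₁ p∣d) → prime-∤-smaller pr (s≤s z≤n) (ℕ.≤-<-trans (ℕ.m≤n+m (suc d) U) V<p) p∣d
      (inj₂ p∣Q) → p∤Q p∣Q)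
    where
    eq : ∀ u d q b → (u ℕ.+ d) ℕ.* q ℕ.+ b ≡ u ℕ.* q ℕ.+ (b ℕ.+ d ℕ.* q)
    eq = ℕ-solve-∀
    pA≡ : p ℕ.* A ≡ p ℕ.* B ℕ.+ suc d ℕ.* Q
    pA≡ = ℕ.+-cancelˡ-≡ (U ℕ.* Q) _ _ (trans e (eq U (suc d) Q (p ℕ.* B)))
    p∣dQ : p ∣ⁿ suc d ℕ.* Q
    p∣dQ = Div.∣m+n∣m⇒∣n (subst (p ∣ⁿ_) pA≡ (Div.m∣m*n A)) (Div.m∣m*n B)
  U≡V : U ≡ V
  U≡V with ℕ.≤-total U V
  ... | inj₁ p = ≤⇒≡ V<p p e
  ... | inj₂ p = sym (≤⇒≡ U<p p (sym e))
  A≡B : U ≡ V → A ≡ B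
  A≡B refl = ℕ.*-cancelˡ-≡ A B p {{ℕ.>-nonZero 0<p}} (ℕ.+-cancelˡ-≡ (U ℕ.* Q) _ _ e)

bit-injective : ∀ a b → bit a ≡ bit b → a ≡ b
bit-injective false false _ = refl
bit-injective true  true  _ = refl

bits-injective : ∀ a a′ b b′ → 2 ℕ.* bit a ℕ.+ bit a′ ≡ 2 ℕ.* bit b ℕ.+ bit b′ → a ≡ b × a′ ≡ b′
bits-injective false false false false _ = refl , refl
bits-injective false true  false true  _ = refl , refl
bits-injective true  false true  false _ = refl , refl
bits-injective true  true  true  true  _ = refl , refl
bits-injective true  true  false true  ()
bits-injective true  true  false false ()
bits-injective true  true  true  false ()
bits-injective true  false false true  ()
bits-injective true  false false false ()
bits-injective true  false true  true  ()

bit≤1 : ∀ b → bit b ≤ 1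
bit≤1 false = z≤n
bit≤1 true  = ℕ.≤-refl

independent-p : ∀ {p es} → BigPrime p → ¬ (p ∣ⁿ product es) → Independent es → Independent (p ∷ es)
independent-p {p} {es} (pr , 13<p) p∤ ih (a ∷ v) (b ∷ w) e =
  let (u , u′) = digits pr p∤ (small-bit a) (small-bit b) e in cong₂ _∷_ (bit-injective a b u) (ih v w u′)
  where small-bit : ∀ b → bit b < p
        small-bit b = ℕ.≤-<-trans (bit≤1 b) (ℕ.≤-trans (s≤s (s≤s z≤n)) 13<p)

-- The bits a of p and a′ of 2p contribute (2 a + a′) / 2p. The digit 2 a + a′ < 4 < p is determined
-- modulo p and encodes both bits.
independent-p-2p : ∀ {p es} → BigPrime p → ¬ (p ∣ⁿ product es) → Independent es → Independent (p ∷ p ℕ.+ p ∷ es)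
independent-p-2p {p} {es} (pr , 13<p) p∤ ih (a ∷ a′ ∷ v) (b ∷ b′ ∷ w) e =
  let (u , u′) = digits {A = 2 ℕ.* N v} {B = 2 ℕ.* N w} pr p∤ (small-digit a a′) (small-digit b b′)
                   (ℕ.*-cancelˡ-≡ _ _ p {{prime⇒nonZero pr}} (trans (sym (eq p (bit a) (bit a′) Q (N v))) (trans e (eq p (bit b) (bit b′) Q (N w)))))
      (r , r′) = bits-injective a a′ b b′ u
  in cong₂ _∷_ r (cong₂ _∷_ r′ (ih v w (ℕ.*-cancelˡ-≡ (N v) (N w) 2 u′)))
  where
  Q = product es
  N = numerator es
  eq : ∀ p a b q n → a ℕ.* ((p ℕ.+ p) ℕ.* q) ℕ.+ p ℕ.* (b ℕ.* q ℕ.+ (p ℕ.+ p) ℕ.* n) ≡ p ℕ.* ((2 ℕ.* a ℕ.+ b) ℕ.* q ℕ.+ p ℕ.* (2 ℕ.* n))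
  eq = ℕ-solve-∀
  small-digit : ∀ a b → 2 ℕ.* bit a ℕ.+ bit b < p
  small-digit a b = ℕ.≤-<-trans (ℕ.+-mono-≤ (ℕ.*-monoʳ-≤ 2 (bit≤1 a)) (bit≤1 b)) (ℕ.≤-trans (s≤s (s≤s (s≤s (s≤s z≤n)))) 13<p)

elements-independent : ∀ m t → Independent (elements m t)
elements-independent m zero    [] [] _ = refl
elements-independent m (suc t) = go (bigPrime? (suc t)) (suc t ℕ.≤? m)
  where
  p∤ : BigPrime (suc t) → ¬ (suc t ∣ⁿ product (elements m t))
  p∤ b = ∤-product (proj₁ b) (All.map (∤-element b ℕ.≤-refl) (elements-IsElement m t))
  go : ∀ d (e : Dec (suc t ≤ m)) → Independent (block (suc t) d e ++ elements m t)
  go (yes b) (yes _) = independent-p-2p {es = elements m t} b (p∤ b) (elements-independent m t)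
  go (yes b) (no _)  = independent-p {es = elements m t} b (p∤ b) (elements-independent m t)
  go (no _)  _       = elements-independent m t

-- The number and the sum of the elements.

S⁺ : ℕ → ℕ
S⁺ zero    = 0
S⁺ (suc t) = ind (bigPrime? (suc t)) ℕ.* suc t ℕ.+ S⁺ t

block-size : ∀ {m t} (d : Dec (BigPrime (suc t))) (e : Dec (suc t ≤ m)) (es : List ℕ) →
  length es ≡ π⁺ t ℕ.+ π⁺ (t ℕ.⊓ m) → sum es ≡ S⁺ t ℕ.+ 2 ℕ.* S⁺ (t ℕ.⊓ m) → bigPrime? (suc t) ≡ d →
  length (block (suc t) d e ++ es) ≡ ind d ℕ.+ π⁺ t ℕ.+ π⁺ (suc t ℕ.⊓ m) ×
  sum (block (suc t) d e ++ es) ≡ ind d ℕ.* suc t ℕ.+ S⁺ t ℕ.+ 2 ℕ.* S⁺ (suc t ℕ.⊓ m)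
block-size {m} {t} d (yes q) es hl hs refl
  rewrite ℕ.m≤n⇒m⊓n≡m q | ℕ.m≤n⇒m⊓n≡m (ℕ.≤-trans (ℕ.n≤1+n t) q) with bigPrime? (suc t)
... | yes _ = trans (cong (λ l → suc (suc l)) hl) (cong suc (sym (ℕ.+-suc (π⁺ t) (π⁺ t))))
            , trans (cong (λ s → suc t ℕ.+ (suc t ℕ.+ suc t ℕ.+ s)) hs) (eq (suc t) (S⁺ t))
  where eq : ∀ a s → a ℕ.+ (a ℕ.+ a ℕ.+ (s ℕ.+ 2 ℕ.* s)) ≡ (a ℕ.+ 0) ℕ.+ s ℕ.+ 2 ℕ.* (a ℕ.+ 0 ℕ.+ s)
        eq = ℕ-solve-∀
... | no _ = hl , hs
block-size {m} {t} d (no ¬q) es hl hs refl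
  rewrite ℕ.m≥n⇒m⊓n≡n (ℕ.≤-pred (ℕ.≰⇒> ¬q)) | ℕ.m≥n⇒m⊓n≡n (ℕ.m≤n⇒m≤1+n (ℕ.≤-pred (ℕ.≰⇒> ¬q))) with bigPrime? (suc t)
... | yes _ = cong suc hl , trans (cong (suc t ℕ.+_) hs) (eq (suc t) (S⁺ t) (2 ℕ.* S⁺ m))
  where eq : ∀ a s r → a ℕ.+ (s ℕ.+ r) ≡ (a ℕ.+ 0) ℕ.+ s ℕ.+ r
        eq = ℕ-solve-∀
... | no _ = hl , hs

elements-size : ∀ m t → length (elements m t) ≡ π⁺ t ℕ.+ π⁺ (t ℕ.⊓ m) × sum (elements m t) ≡ S⁺ t ℕ.+ 2 ℕ.* S⁺ (t ℕ.⊓ m)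
elements-size m zero    = refl , refl
elements-size m (suc t) = let (hl , hs) = elements-size m t
  in block-size (bigPrime? (suc t)) (suc t ℕ.≤? m) (elements m t) hl hs refl

-- Summation by parts, with π⁺ bounded below by Chebyshev's estimate.
S⁺-bound : ∀ h Y → Y ≤ 2 ℕ.^ h → 2 ℕ.* h ℕ.* S⁺ Y ℕ.+ Y ℕ.* Y ≤ 2 ℕ.* h ℕ.* Y ℕ.* π⁺ Y ℕ.+ (12 ℕ.* h ℕ.+ 5) ℕ.* Y
S⁺-bound h zero    _ = ℕ.≤-reflexive (eq h)
  where eq : ∀ h → 2 ℕ.* h ℕ.* 0 ℕ.+ 0 ≡ 2 ℕ.* h ℕ.* 0 ℕ.* 0 ℕ.+ (12 ℕ.* h ℕ.+ 5) ℕ.* 0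
        eq = ℕ-solve-∀
S⁺-bound h (suc Y) p = ℕ-cert 0 (eq h Y (ind (bigPrime? (suc Y))) (π⁺ Y) (S⁺ Y))
    (ℕ.+-mono-≤ (S⁺-bound h Y Y≤) (ℕ.+-monoˡ-≤ 1 (ℕ.*-monoʳ-≤ 2 (π⁺-≥ h Y Y≤))))
  where
  Y≤ : Y ≤ 2 ℕ.^ h
  Y≤ = ℕ.<⇒≤ p
  eq : ∀ h Y i π S → 2 ℕ.* h ℕ.* (i ℕ.* suc Y ℕ.+ S) ℕ.+ suc Y ℕ.* suc Y ℕ.+ (2 ℕ.* h ℕ.* Y ℕ.* π ℕ.+ (12 ℕ.* h ℕ.+ 5) ℕ.* Y ℕ.+ (2 ℕ.* (h ℕ.* (π ℕ.+ 6) ℕ.+ 2) ℕ.+ 1)) ℕ.+ 0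
       ≡ 2 ℕ.* h ℕ.* suc Y ℕ.* (i ℕ.+ π) ℕ.+ (12 ℕ.* h ℕ.+ 5) ℕ.* suc Y ℕ.+ (2 ℕ.* h ℕ.* S ℕ.+ Y ℕ.* Y ℕ.+ (2 ℕ.* Y ℕ.+ 1))
  eq = ℕ-solve-∀

2ab≤a²+b² : ∀ a b → 2 ℕ.* (a ℕ.* b) ≤ a ℕ.* a ℕ.+ b ℕ.* b
2ab≤a²+b² a b with ℕ.≤-total a b
... | inj₁ p with ℕ.m≤n⇒∃[o]m+o≡n p
...   | d , refl = subst (2 ℕ.* (a ℕ.* (a ℕ.+ d)) ≤_) (eq a d) (ℕ.m≤m+n _ (d ℕ.* d))
  where eq : ∀ a d → 2 ℕ.* (a ℕ.* (a ℕ.+ d)) ℕ.+ d ℕ.* d ≡ a ℕ.* a ℕ.+ (a ℕ.+ d) ℕ.* (a ℕ.+ d)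
        eq = ℕ-solve-∀
2ab≤a²+b² a b | inj₂ p with ℕ.m≤n⇒∃[o]m+o≡n p
...   | d , refl = subst (2 ℕ.* ((b ℕ.+ d) ℕ.* b) ≤_) (eq b d) (ℕ.m≤m+n _ (d ℕ.* d))
  where eq : ∀ b d → 2 ℕ.* ((b ℕ.+ d) ℕ.* b) ℕ.+ d ℕ.* d ≡ (b ℕ.+ d) ℕ.* (b ℕ.+ d) ℕ.+ b ℕ.* b
        eq = ℕ-solve-∀

⌊/2⌋-step : ∀ n → ℕ.⌊ suc n /2⌋ ≡ ℕ.⌊ n /2⌋ ⊎ ℕ.⌊ suc n /2⌋ ≡ suc ℕ.⌊ n /2⌋
⌊/2⌋-step zero          = inj₁ refl
⌊/2⌋-step (suc zero)    = inj₂ refl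
⌊/2⌋-step (suc (suc n)) with ⌊/2⌋-step n
... | inj₁ e = inj₁ (cong suc e)
... | inj₂ e = inj₂ (cong suc e)

⌊/2⌋-bounds : ∀ n → ℕ.⌊ n /2⌋ ℕ.+ ℕ.⌊ n /2⌋ ≤ n × n ≤ suc (ℕ.⌊ n /2⌋ ℕ.+ ℕ.⌊ n /2⌋)
⌊/2⌋-bounds zero          = z≤n , z≤n
⌊/2⌋-bounds (suc zero)    = z≤n , ℕ.≤-refl
⌊/2⌋-bounds (suc (suc n)) = let (p , q) = ⌊/2⌋-bounds n
  in s≤s (subst (_≤ suc n) (sym (ℕ.+-suc ℕ.⌊ n /2⌋ ℕ.⌊ n /2⌋)) (s≤s p))
   , s≤s (s≤s (subst (n ≤_) (sym (ℕ.+-suc ℕ.⌊ n /2⌋ ℕ.⌊ n /2⌋)) q))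

size : ℕ → ℕ
size X = π⁺ X ℕ.+ π⁺ ℕ.⌊ X /2⌋

π⁺-step : ∀ t → π⁺ (suc t) ≤ suc (π⁺ t)
π⁺-step t = ℕ.+-monoˡ-≤ (π⁺ t) (ind≤1 (bigPrime? (suc t)))

size-step : ∀ X → size (suc X) ≤ 2 ℕ.+ size X
size-step X = ℕ.≤-trans (ℕ.+-mono-≤ (π⁺-step X) (half-step (⌊/2⌋-step X))) (ℕ.≤-reflexive (cong suc (ℕ.+-suc (π⁺ X) _)))
  where half-step : ℕ.⌊ suc X /2⌋ ≡ ℕ.⌊ X /2⌋ ⊎ ℕ.⌊ suc X /2⌋ ≡ suc ℕ.⌊ X /2⌋ → π⁺ ℕ.⌊ suc X /2⌋ ≤ suc (π⁺ ℕ.⌊ X /2⌋)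
        half-step (inj₁ e) rewrite e = ℕ.n≤1+n _
        half-step (inj₂ e) rewrite e = π⁺-step ℕ.⌊ X /2⌋

-- As `size` starts at 0 and grows by at most 2 per step, every k that it reaches is overshot by at
-- most 1.
first-above : ∀ k X → k ≤ size X → ∃[ Y ] (Y ≤ X × k ≤ size Y × size Y ≤ suc k)
first-above k zero    p = 0 , z≤n , p , z≤n
first-above k (suc X) p with k ℕ.≤? size X
... | yes q = let (Y , Y≤ , a , b) = first-above k X q in Y , ℕ.m≤n⇒m≤1+n Y≤ , a , b
... | no ¬q = suc X , ℕ.≤-refl , p , ℕ.≤-trans (size-step X) (s≤s (ℕ.≰⇒> ¬q))

-- Eliminating X by the inequality of arithmetic and geometric means.
sum-bound : ∀ h X → 1 ≤ h → X ≤ 2 ℕ.^ h → 3 ℕ.* (S⁺ X ℕ.+ 2 ℕ.* S⁺ ℕ.⌊ X /2⌋) ≤ h ℕ.* ((size X ℕ.+ 18) ℕ.* (size X ℕ.+ 18))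
sum-bound h X 1≤h X≤ = ℕ.*-cancelˡ-≤ (16 ℕ.* h) {{ℕ.>-nonZero (ℕ.*-mono-≤ {1} {16} (s≤s z≤n) 1≤h)}} (begin
  16 ℕ.* h ℕ.* (3 ℕ.* Σₑ)        ≡⟨ eq₁ h Σₑ ⟩
  -- 48 h Σₑ + 36 X² ≤ 12 X W ≤ W² + 36 X², and 36 X² cancels; the coefficient 6 in (W, 6 X) is
  -- chosen for this.
  48 ℕ.* h ℕ.* Σₑ                ≤⟨ ℕ-cert 0 (eq₂ h Σₑ X W) (ℕ.+-mono-≤ (ℕ.*-monoʳ-≤ 12 main) (2ab≤a²+b² W (6 ℕ.* X))) ⟩
  W ℕ.* W                        ≤⟨ ℕ.*-mono-≤ W≤ W≤ ⟩
  4 ℕ.* h ℕ.* (k ℕ.+ 18) ℕ.* (4 ℕ.* h ℕ.* (k ℕ.+ 18)) ≡⟨ eq₃ h (k ℕ.+ 18) ⟩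
  16 ℕ.* h ℕ.* (h ℕ.* ((k ℕ.+ 18) ℕ.* (k ℕ.+ 18))) ∎)
  where
  open ℕ.≤-Reasoning
  m = ℕ.⌊ X /2⌋
  k = size X
  Σₑ = S⁺ X ℕ.+ 2 ℕ.* S⁺ m
  W = 4 ℕ.* h ℕ.* k ℕ.+ (48 ℕ.* h ℕ.+ 22)
  m≤ : m ≤ 2 ℕ.^ h
  m≤ = ℕ.≤-trans (ℕ.⌊n/2⌋≤n X) X≤
  W≤ : W ≤ 4 ℕ.* h ℕ.* (k ℕ.+ 18)
  W≤ = ℕ-cert (2 ℕ.* h) (eq h k) (ℕ.*-monoʳ-≤ 22 1≤h)
    where eq : ∀ h k → 4 ℕ.* h ℕ.* k ℕ.+ (48 ℕ.* h ℕ.+ 22) ℕ.+ 22 ℕ.* h ℕ.+ 2 ℕ.* h ≡ 4 ℕ.* h ℕ.* (k ℕ.+ 18) ℕ.+ 22 ℕ.* 1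
          eq = ℕ-solve-∀
  eq₁ : ∀ h s → 16 ℕ.* h ℕ.* (3 ℕ.* s) ≡ 48 ℕ.* h ℕ.* s
  eq₁ = ℕ-solve-∀
  eq₂ : ∀ h s X W → 48 ℕ.* h ℕ.* s ℕ.+ (12 ℕ.* (X ℕ.* W) ℕ.+ (W ℕ.* W ℕ.+ 6 ℕ.* X ℕ.* (6 ℕ.* X))) ℕ.+ 0
      ≡ W ℕ.* W ℕ.+ (12 ℕ.* (4 ℕ.* h ℕ.* s ℕ.+ 3 ℕ.* (X ℕ.* X)) ℕ.+ 2 ℕ.* (W ℕ.* (6 ℕ.* X)))
  eq₂ = ℕ-solve-∀
  eq₃ : ∀ h a → 4 ℕ.* h ℕ.* a ℕ.* (4 ℕ.* h ℕ.* a) ≡ 16 ℕ.* h ℕ.* (h ℕ.* (a ℕ.* a))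
  eq₃ = ℕ-solve-∀
  -- Twice `S⁺-bound` for X plus four times the one for m; here 4 m² replaces X² up to 2 X, and 2 m
  -- ≤ X.
  main : 4 ℕ.* h ℕ.* Σₑ ℕ.+ 3 ℕ.* (X ℕ.* X) ≤ X ℕ.* W
  main = ℕ-cert 0 (eq h (S⁺ X) (S⁺ m) X m (π⁺ X) (π⁺ m)) (ℕ.+-mono-≤ (ℕ.+-mono-≤ (ℕ.*-monoʳ-≤ 2 (S⁺-bound h X X≤)) (ℕ.*-monoʳ-≤ 4 (S⁺-bound h m m≤)))
           (ℕ.+-mono-≤ X²≤ (ℕ.*-monoʳ-≤ (4 ℕ.* h ℕ.* π⁺ m ℕ.+ (24 ℕ.* h ℕ.+ 10)) (proj₁ (⌊/2⌋-bounds X)))))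
    where
    X²≤ : X ℕ.* X ≤ 4 ℕ.* (m ℕ.* m) ℕ.+ 2 ℕ.* X
    X²≤ with ℕ.m≤n⇒∃[o]m+o≡n (proj₁ (⌊/2⌋-bounds X)) | proj₂ (⌊/2⌋-bounds X)
    ... | zero , e | _ = ℕ.≤-trans (ℕ.≤-reflexive (trans (cong (λ x → x ℕ.* x) (sym (trans (sym (ℕ.+-identityʳ _)) e))) (eq₀ m))) (ℕ.m≤m+n _ _)
      where eq₀ : ∀ m → (m ℕ.+ m) ℕ.* (m ℕ.+ m) ≡ 4 ℕ.* (m ℕ.* m)
            eq₀ = ℕ-solve-∀
    ... | suc zero , e | _ = ℕ.≤-trans (ℕ.m≤m+n (X ℕ.* X) 1) (ℕ.≤-reflexive (subst (λ x → x ℕ.* x ℕ.+ 1 ≡ 4 ℕ.* (m ℕ.* m) ℕ.+ 2 ℕ.* x) e (eq₀ m)))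
      where eq₀ : ∀ m → (m ℕ.+ m ℕ.+ 1) ℕ.* (m ℕ.+ m ℕ.+ 1) ℕ.+ 1 ≡ 4 ℕ.* (m ℕ.* m) ℕ.+ 2 ℕ.* (m ℕ.+ m ℕ.+ 1)
            eq₀ = ℕ-solve-∀
    ... | suc (suc d) , e | q = ⊥-elim (ℕ.<⇒≱ (subst (suc (m ℕ.+ m) <_) e (subst (_≤ m ℕ.+ m ℕ.+ suc (suc d)) (ℕ.+-comm (m ℕ.+ m) 2) (ℕ.+-monoʳ-≤ (m ℕ.+ m) (s≤s (s≤s z≤n))))) q)
    eq : ∀ h S s X m P p → 4 ℕ.* h ℕ.* (S ℕ.+ 2 ℕ.* s) ℕ.+ 3 ℕ.* (X ℕ.* X)
          ℕ.+ (2 ℕ.* (2 ℕ.* h ℕ.* X ℕ.* P ℕ.+ (12 ℕ.* h ℕ.+ 5) ℕ.* X) ℕ.+ 4 ℕ.* (2 ℕ.* h ℕ.* m ℕ.* p ℕ.+ (12 ℕ.* h ℕ.+ 5) ℕ.* m)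
               ℕ.+ (4 ℕ.* (m ℕ.* m) ℕ.+ 2 ℕ.* X ℕ.+ (4 ℕ.* h ℕ.* p ℕ.+ (24 ℕ.* h ℕ.+ 10)) ℕ.* X)) ℕ.+ 0
        ≡ X ℕ.* (4 ℕ.* h ℕ.* (P ℕ.+ p) ℕ.+ (48 ℕ.* h ℕ.+ 22))
          ℕ.+ (2 ℕ.* (2 ℕ.* h ℕ.* S ℕ.+ X ℕ.* X) ℕ.+ 4 ℕ.* (2 ℕ.* h ℕ.* s ℕ.+ m ℕ.* m)
               ℕ.+ (X ℕ.* X ℕ.+ (4 ℕ.* h ℕ.* p ℕ.+ (24 ℕ.* h ℕ.+ 10)) ℕ.* (m ℕ.+ m)))
    eq = ℕ-solve-∀

-- 1-partitions into 7-smooth parts, by Graham's doubling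

double : ℕ → ℕ
double e = e ℕ.+ e

-- Excluding the parts 1 and 7 keeps the parts 2 and 14 added below new.
Good : ℕ → Set
Good e = 0 < e × e ∣ⁿ 210 ℕ.^ 4 × e ≢ 1 × e ≢ 7

-- 7-smooth means dividing a power of 210 = 2 · 3 · 5 · 7. In `Good` the exponent is fixed at 4, so
-- that the table can be checked by computation.
Smooth : ℕ → Set
Smooth e = 0 < e × (∃[ k ] e ∣ⁿ 210 ℕ.^ k) × e ≢ 1 × e ≢ 7

record SmoothPartition (m : ℕ) : Set where
  constructor smoothPartition
  field
    parts   : List ℕ
    unique  : Unique parts
    smooth  : All Smooth parts
    sum≡m   : sum parts ≡ m
    inverse : inverseSum parts ≡ 1ℚ

Checked : ℕ → List ℕ → Set
Checked m as = Unique as × All Good as × sum as ≡ m × inverseSum as ≡ 1ℚ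

Good? : Decidable Good
Good? e = (0 ℕ.<? e) ×-dec (e Div.∣? 210 ℕ.^ 4) ×-dec ¬? (e ℕ.≟ 1) ×-dec ¬? (e ℕ.≟ 7)

Checked? : ∀ m as → Dec (Checked m as)
Checked? m as = AllPairs.allPairs? (λ a b → ¬? (a ℕ.≟ b)) as ×-dec All.all? Good? as ×-dec (sum as ℕ.≟ m) ×-dec (inverseSum as ℚ.≟ 1ℚ)

data CheckedFrom : ℕ → List (List ℕ) → Set where
  []  : ∀ {m} → CheckedFrom m []
  _∷_ : ∀ {m as ass} → Checked m as → CheckedFrom (suc m) ass → CheckedFrom m (as ∷ ass)

CheckedFrom? : ∀ m ass → Dec (CheckedFrom m ass)
CheckedFrom? m []         = yes []
CheckedFrom? m (as ∷ ass) = map′ (λ (p , ps) → p ∷ ps) (λ { (p ∷ ps) → p , ps }) (Checked? m as ×-dec CheckedFrom? (suc m) ass)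

-- One row for each m from 92 to 250. The range is dictated by `odd-step`: 251 = 67 + 2 · 92 is the
-- first odd number that it reaches.
table : List (List ℕ)
table =
    (2 ∷ 4 ∷ 5 ∷ 36 ∷ 45 ∷ []) ∷ (2 ∷ 5 ∷ 8 ∷ 9 ∷ 24 ∷ 45 ∷ []) ∷ (3 ∷ 4 ∷ 6 ∷ 8 ∷ 21 ∷ 24 ∷ 28 ∷ []) ∷
    (2 ∷ 4 ∷ 8 ∷ 9 ∷ 72 ∷ []) ∷ (3 ∷ 4 ∷ 5 ∷ 14 ∷ 15 ∷ 20 ∷ 35 ∷ []) ∷ (2 ∷ 5 ∷ 6 ∷ 16 ∷ 20 ∷ 48 ∷ []) ∷
    (3 ∷ 4 ∷ 5 ∷ 12 ∷ 18 ∷ 20 ∷ 36 ∷ []) ∷ (3 ∷ 4 ∷ 5 ∷ 6 ∷ 36 ∷ 45 ∷ []) ∷ (3 ∷ 5 ∷ 6 ∷ 8 ∷ 9 ∷ 24 ∷ 45 ∷ []) ∷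
    (2 ∷ 4 ∷ 5 ∷ 30 ∷ 60 ∷ []) ∷ (3 ∷ 4 ∷ 6 ∷ 8 ∷ 9 ∷ 72 ∷ []) ∷ (2 ∷ 4 ∷ 8 ∷ 14 ∷ 35 ∷ 40 ∷ []) ∷
    (2 ∷ 3 ∷ 20 ∷ 21 ∷ 28 ∷ 30 ∷ []) ∷ (4 ∷ 5 ∷ 6 ∷ 8 ∷ 10 ∷ 12 ∷ 20 ∷ 40 ∷ []) ∷ (2 ∷ 5 ∷ 6 ∷ 12 ∷ 36 ∷ 45 ∷ []) ∷
    (3 ∷ 5 ∷ 8 ∷ 9 ∷ 10 ∷ 18 ∷ 24 ∷ 30 ∷ []) ∷ (3 ∷ 4 ∷ 5 ∷ 6 ∷ 30 ∷ 60 ∷ []) ∷ (2 ∷ 4 ∷ 5 ∷ 28 ∷ 70 ∷ []) ∷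
    (2 ∷ 4 ∷ 6 ∷ 14 ∷ 84 ∷ []) ∷ (2 ∷ 3 ∷ 8 ∷ 42 ∷ 56 ∷ []) ∷ (2 ∷ 4 ∷ 8 ∷ 14 ∷ 28 ∷ 56 ∷ []) ∷
    (2 ∷ 3 ∷ 8 ∷ 40 ∷ 60 ∷ []) ∷ (2 ∷ 3 ∷ 15 ∷ 24 ∷ 30 ∷ 40 ∷ []) ∷ (2 ∷ 3 ∷ 12 ∷ 14 ∷ 84 ∷ []) ∷
    (3 ∷ 4 ∷ 5 ∷ 6 ∷ 28 ∷ 70 ∷ []) ∷ (2 ∷ 6 ∷ 9 ∷ 10 ∷ 15 ∷ 30 ∷ 45 ∷ []) ∷ (2 ∷ 5 ∷ 6 ∷ 14 ∷ 21 ∷ 70 ∷ []) ∷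
    (2 ∷ 3 ∷ 16 ∷ 20 ∷ 30 ∷ 48 ∷ []) ∷ (3 ∷ 4 ∷ 6 ∷ 8 ∷ 15 ∷ 24 ∷ 60 ∷ []) ∷ (2 ∷ 3 ∷ 8 ∷ 36 ∷ 72 ∷ []) ∷
    (3 ∷ 4 ∷ 5 ∷ 9 ∷ 20 ∷ 27 ∷ 54 ∷ []) ∷ (2 ∷ 3 ∷ 10 ∷ 18 ∷ 90 ∷ []) ∷ (2 ∷ 4 ∷ 8 ∷ 12 ∷ 42 ∷ 56 ∷ []) ∷
    (3 ∷ 4 ∷ 5 ∷ 8 ∷ 24 ∷ 36 ∷ 45 ∷ []) ∷ (2 ∷ 4 ∷ 8 ∷ 12 ∷ 40 ∷ 60 ∷ []) ∷ (2 ∷ 3 ∷ 14 ∷ 24 ∷ 28 ∷ 56 ∷ []) ∷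
    (2 ∷ 3 ∷ 12 ∷ 30 ∷ 36 ∷ 45 ∷ []) ∷ (2 ∷ 4 ∷ 10 ∷ 14 ∷ 15 ∷ 84 ∷ []) ∷ (2 ∷ 4 ∷ 9 ∷ 10 ∷ 45 ∷ 60 ∷ []) ∷
    (2 ∷ 5 ∷ 6 ∷ 14 ∷ 20 ∷ 84 ∷ []) ∷ (2 ∷ 5 ∷ 8 ∷ 12 ∷ 24 ∷ 36 ∷ 45 ∷ []) ∷ (3 ∷ 4 ∷ 6 ∷ 8 ∷ 12 ∷ 40 ∷ 60 ∷ []) ∷
    (2 ∷ 4 ∷ 8 ∷ 12 ∷ 36 ∷ 72 ∷ []) ∷ (3 ∷ 4 ∷ 5 ∷ 10 ∷ 15 ∷ 28 ∷ 70 ∷ []) ∷ (2 ∷ 5 ∷ 6 ∷ 15 ∷ 18 ∷ 90 ∷ []) ∷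
    (2 ∷ 4 ∷ 9 ∷ 10 ∷ 40 ∷ 72 ∷ []) ∷ (2 ∷ 3 ∷ 15 ∷ 20 ∷ 28 ∷ 70 ∷ []) ∷ (2 ∷ 3 ∷ 12 ∷ 24 ∷ 42 ∷ 56 ∷ []) ∷
    (2 ∷ 4 ∷ 6 ∷ 28 ∷ 30 ∷ 70 ∷ []) ∷ (2 ∷ 5 ∷ 6 ∷ 8 ∷ 120 ∷ []) ∷ (2 ∷ 3 ∷ 14 ∷ 18 ∷ 42 ∷ 63 ∷ []) ∷
    (3 ∷ 4 ∷ 6 ∷ 10 ∷ 12 ∷ 18 ∷ 90 ∷ []) ∷ (2 ∷ 4 ∷ 6 ∷ 24 ∷ 36 ∷ 72 ∷ []) ∷ (2 ∷ 3 ∷ 16 ∷ 20 ∷ 24 ∷ 80 ∷ []) ∷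
    (2 ∷ 6 ∷ 8 ∷ 9 ∷ 21 ∷ 28 ∷ 72 ∷ []) ∷ (3 ∷ 4 ∷ 5 ∷ 12 ∷ 15 ∷ 18 ∷ 90 ∷ []) ∷ (3 ∷ 4 ∷ 5 ∷ 9 ∷ 15 ∷ 40 ∷ 72 ∷ []) ∷
    (2 ∷ 3 ∷ 12 ∷ 24 ∷ 36 ∷ 72 ∷ []) ∷ (3 ∷ 4 ∷ 5 ∷ 10 ∷ 18 ∷ 20 ∷ 90 ∷ []) ∷ (2 ∷ 5 ∷ 6 ∷ 10 ∷ 48 ∷ 80 ∷ []) ∷
    (3 ∷ 4 ∷ 5 ∷ 8 ∷ 12 ∷ 120 ∷ []) ∷ (2 ∷ 3 ∷ 14 ∷ 20 ∷ 30 ∷ 84 ∷ []) ∷ (2 ∷ 4 ∷ 10 ∷ 14 ∷ 28 ∷ 40 ∷ 56 ∷ []) ∷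
    (2 ∷ 4 ∷ 5 ∷ 24 ∷ 120 ∷ []) ∷ (2 ∷ 3 ∷ 15 ∷ 16 ∷ 40 ∷ 80 ∷ []) ∷ (2 ∷ 3 ∷ 14 ∷ 18 ∷ 36 ∷ 84 ∷ []) ∷
    (2 ∷ 5 ∷ 6 ∷ 10 ∷ 45 ∷ 90 ∷ []) ∷ (2 ∷ 4 ∷ 6 ∷ 21 ∷ 42 ∷ 84 ∷ []) ∷ (2 ∷ 5 ∷ 8 ∷ 10 ∷ 15 ∷ 120 ∷ []) ∷
    (2 ∷ 6 ∷ 8 ∷ 9 ∷ 16 ∷ 48 ∷ 72 ∷ []) ∷ (3 ∷ 4 ∷ 5 ∷ 6 ∷ 24 ∷ 120 ∷ []) ∷ (2 ∷ 3 ∷ 8 ∷ 30 ∷ 120 ∷ []) ∷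
    (2 ∷ 3 ∷ 12 ∷ 21 ∷ 42 ∷ 84 ∷ []) ∷ (2 ∷ 3 ∷ 12 ∷ 20 ∷ 48 ∷ 80 ∷ []) ∷ (2 ∷ 6 ∷ 8 ∷ 9 ∷ 16 ∷ 45 ∷ 80 ∷ []) ∷
    (2 ∷ 4 ∷ 6 ∷ 20 ∷ 45 ∷ 90 ∷ []) ∷ (3 ∷ 4 ∷ 5 ∷ 8 ∷ 18 ∷ 40 ∷ 90 ∷ []) ∷ (2 ∷ 5 ∷ 6 ∷ 12 ∷ 24 ∷ 120 ∷ []) ∷
    (2 ∷ 5 ∷ 6 ∷ 10 ∷ 42 ∷ 105 ∷ []) ∷ (2 ∷ 5 ∷ 9 ∷ 12 ∷ 14 ∷ 45 ∷ 84 ∷ []) ∷ (2 ∷ 3 ∷ 14 ∷ 20 ∷ 28 ∷ 105 ∷ []) ∷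
    (2 ∷ 3 ∷ 10 ∷ 30 ∷ 48 ∷ 80 ∷ []) ∷ (2 ∷ 4 ∷ 10 ∷ 18 ∷ 20 ∷ 30 ∷ 90 ∷ []) ∷ (2 ∷ 5 ∷ 8 ∷ 12 ∷ 18 ∷ 40 ∷ 90 ∷ []) ∷
    (2 ∷ 4 ∷ 8 ∷ 12 ∷ 30 ∷ 120 ∷ []) ∷ (2 ∷ 4 ∷ 6 ∷ 18 ∷ 63 ∷ 84 ∷ []) ∷ (2 ∷ 3 ∷ 14 ∷ 15 ∷ 60 ∷ 84 ∷ []) ∷
    (2 ∷ 4 ∷ 6 ∷ 20 ∷ 42 ∷ 105 ∷ []) ∷ (2 ∷ 4 ∷ 6 ∷ 18 ∷ 60 ∷ 90 ∷ []) ∷ (3 ∷ 4 ∷ 5 ∷ 10 ∷ 15 ∷ 24 ∷ 120 ∷ []) ∷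
    (2 ∷ 3 ∷ 12 ∷ 18 ∷ 63 ∷ 84 ∷ []) ∷ (2 ∷ 5 ∷ 6 ∷ 10 ∷ 40 ∷ 120 ∷ []) ∷ (2 ∷ 3 ∷ 15 ∷ 20 ∷ 24 ∷ 120 ∷ []) ∷
    (2 ∷ 3 ∷ 12 ∷ 18 ∷ 60 ∷ 90 ∷ []) ∷ (2 ∷ 4 ∷ 8 ∷ 10 ∷ 72 ∷ 90 ∷ []) ∷ (2 ∷ 3 ∷ 9 ∷ 45 ∷ 48 ∷ 80 ∷ []) ∷
    (2 ∷ 5 ∷ 10 ∷ 12 ∷ 15 ∷ 24 ∷ 120 ∷ []) ∷ (2 ∷ 3 ∷ 14 ∷ 16 ∷ 42 ∷ 112 ∷ []) ∷ (3 ∷ 4 ∷ 5 ∷ 8 ∷ 20 ∷ 30 ∷ 120 ∷ []) ∷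
    (2 ∷ 3 ∷ 12 ∷ 24 ∷ 30 ∷ 120 ∷ []) ∷ (2 ∷ 4 ∷ 6 ∷ 20 ∷ 40 ∷ 120 ∷ []) ∷ (3 ∷ 4 ∷ 6 ∷ 8 ∷ 10 ∷ 72 ∷ 90 ∷ []) ∷
    (3 ∷ 4 ∷ 5 ∷ 10 ∷ 12 ∷ 40 ∷ 120 ∷ []) ∷ (2 ∷ 6 ∷ 8 ∷ 10 ∷ 14 ∷ 35 ∷ 120 ∷ []) ∷
    (2 ∷ 5 ∷ 8 ∷ 12 ∷ 21 ∷ 28 ∷ 120 ∷ []) ∷ (2 ∷ 3 ∷ 12 ∷ 20 ∷ 40 ∷ 120 ∷ []) ∷ (2 ∷ 5 ∷ 6 ∷ 18 ∷ 20 ∷ 63 ∷ 84 ∷ []) ∷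
    (2 ∷ 4 ∷ 5 ∷ 48 ∷ 60 ∷ 80 ∷ []) ∷ (2 ∷ 3 ∷ 9 ∷ 36 ∷ 60 ∷ 90 ∷ []) ∷ (2 ∷ 3 ∷ 10 ∷ 24 ∷ 72 ∷ 90 ∷ []) ∷
    (2 ∷ 3 ∷ 9 ∷ 35 ∷ 63 ∷ 90 ∷ []) ∷ (2 ∷ 4 ∷ 5 ∷ 45 ∷ 63 ∷ 84 ∷ []) ∷ (2 ∷ 4 ∷ 8 ∷ 10 ∷ 60 ∷ 120 ∷ []) ∷
    (2 ∷ 3 ∷ 10 ∷ 30 ∷ 40 ∷ 120 ∷ []) ∷ (2 ∷ 4 ∷ 5 ∷ 45 ∷ 60 ∷ 90 ∷ []) ∷ (2 ∷ 4 ∷ 5 ∷ 42 ∷ 70 ∷ 84 ∷ []) ∷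
    (2 ∷ 4 ∷ 8 ∷ 16 ∷ 28 ∷ 70 ∷ 80 ∷ []) ∷ (2 ∷ 5 ∷ 8 ∷ 10 ∷ 24 ∷ 40 ∷ 120 ∷ []) ∷
    (3 ∷ 4 ∷ 5 ∷ 6 ∷ 45 ∷ 63 ∷ 84 ∷ []) ∷ (3 ∷ 4 ∷ 6 ∷ 8 ∷ 10 ∷ 60 ∷ 120 ∷ []) ∷ (2 ∷ 3 ∷ 9 ∷ 36 ∷ 54 ∷ 108 ∷ []) ∷
    (2 ∷ 4 ∷ 5 ∷ 40 ∷ 72 ∷ 90 ∷ []) ∷ (2 ∷ 5 ∷ 6 ∷ 9 ∷ 72 ∷ 120 ∷ []) ∷ (3 ∷ 4 ∷ 5 ∷ 8 ∷ 15 ∷ 60 ∷ 120 ∷ []) ∷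
    (2 ∷ 4 ∷ 8 ∷ 20 ∷ 21 ∷ 56 ∷ 105 ∷ []) ∷ (2 ∷ 5 ∷ 6 ∷ 12 ∷ 45 ∷ 63 ∷ 84 ∷ []) ∷ (2 ∷ 4 ∷ 5 ∷ 45 ∷ 54 ∷ 108 ∷ []) ∷
    (2 ∷ 3 ∷ 10 ∷ 24 ∷ 60 ∷ 120 ∷ []) ∷ (3 ∷ 4 ∷ 5 ∷ 6 ∷ 40 ∷ 72 ∷ 90 ∷ []) ∷ (2 ∷ 5 ∷ 6 ∷ 16 ∷ 24 ∷ 48 ∷ 120 ∷ []) ∷
    (2 ∷ 5 ∷ 8 ∷ 12 ∷ 15 ∷ 60 ∷ 120 ∷ []) ∷ (2 ∷ 3 ∷ 18 ∷ 20 ∷ 30 ∷ 60 ∷ 90 ∷ []) ∷ (2 ∷ 4 ∷ 6 ∷ 16 ∷ 84 ∷ 112 ∷ []) ∷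
    (3 ∷ 4 ∷ 5 ∷ 9 ∷ 12 ∷ 72 ∷ 120 ∷ []) ∷ (2 ∷ 4 ∷ 8 ∷ 16 ∷ 28 ∷ 56 ∷ 112 ∷ []) ∷
    (2 ∷ 5 ∷ 6 ∷ 12 ∷ 40 ∷ 72 ∷ 90 ∷ []) ∷ (2 ∷ 4 ∷ 6 ∷ 16 ∷ 80 ∷ 120 ∷ []) ∷ (2 ∷ 4 ∷ 5 ∷ 42 ∷ 56 ∷ 120 ∷ []) ∷
    (2 ∷ 4 ∷ 8 ∷ 15 ∷ 36 ∷ 45 ∷ 120 ∷ []) ∷ (2 ∷ 4 ∷ 5 ∷ 40 ∷ 60 ∷ 120 ∷ []) ∷ (2 ∷ 3 ∷ 8 ∷ 63 ∷ 72 ∷ 84 ∷ []) ∷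
    (2 ∷ 3 ∷ 12 ∷ 16 ∷ 80 ∷ 120 ∷ []) ∷ (2 ∷ 4 ∷ 6 ∷ 30 ∷ 45 ∷ 63 ∷ 84 ∷ []) ∷ (2 ∷ 4 ∷ 5 ∷ 35 ∷ 84 ∷ 105 ∷ []) ∷
    (2 ∷ 3 ∷ 9 ∷ 30 ∷ 72 ∷ 120 ∷ []) ∷ (2 ∷ 4 ∷ 6 ∷ 30 ∷ 45 ∷ 60 ∷ 90 ∷ []) ∷ (2 ∷ 4 ∷ 5 ∷ 35 ∷ 80 ∷ 112 ∷ []) ∷
    (2 ∷ 4 ∷ 5 ∷ 36 ∷ 72 ∷ 120 ∷ []) ∷ (2 ∷ 5 ∷ 8 ∷ 9 ∷ 24 ∷ 72 ∷ 120 ∷ []) ∷ (2 ∷ 3 ∷ 16 ∷ 24 ∷ 28 ∷ 56 ∷ 112 ∷ []) ∷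
    (3 ∷ 4 ∷ 5 ∷ 6 ∷ 35 ∷ 84 ∷ 105 ∷ []) ∷ (2 ∷ 5 ∷ 6 ∷ 12 ∷ 42 ∷ 56 ∷ 120 ∷ []) ∷ (2 ∷ 3 ∷ 8 ∷ 56 ∷ 70 ∷ 105 ∷ []) ∷
    (3 ∷ 4 ∷ 5 ∷ 6 ∷ 35 ∷ 80 ∷ 112 ∷ []) ∷ (3 ∷ 4 ∷ 5 ∷ 6 ∷ 36 ∷ 72 ∷ 120 ∷ []) ∷ (2 ∷ 3 ∷ 8 ∷ 54 ∷ 72 ∷ 108 ∷ []) ∷
    (2 ∷ 4 ∷ 8 ∷ 12 ∷ 60 ∷ 72 ∷ 90 ∷ []) ∷ (2 ∷ 5 ∷ 6 ∷ 16 ∷ 20 ∷ 80 ∷ 120 ∷ []) ∷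
    (2 ∷ 4 ∷ 8 ∷ 16 ∷ 24 ∷ 84 ∷ 112 ∷ []) ∷ []

table-checked : CheckedFrom 92 table
table-checked = toWitness {a? = CheckedFrom? 92 table} _

from-table : ∀ {m ass} → CheckedFrom m ass → ∀ i → i < length ass → SmoothPartition (i ℕ.+ m)
from-table ((u , g , s , v) ∷ _) zero _ = smoothPartition _ u (All.map (λ (a , b , c) → a , (4 , b) , c) g) s v
from-table {m} (_ ∷ ps) (suc i) (s≤s p) = subst SmoothPartition (ℕ.+-suc i m) (from-table ps i p)

double-injective : ∀ {a b} → double a ≡ double b → a ≡ b
double-injective {a} {b} e = ℕ.*-cancelˡ-≡ a b 2 (trans (2p≡ a) (trans e (sym (2p≡ b))))

double-not-odd : ∀ a b → double a ≢ suc (double b)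
double-not-odd (suc a) zero    e = ℕ.1+n≢0 (trans (sym (ℕ.+-suc a a)) (ℕ.suc-injective e))
double-not-odd (suc a) (suc b) e = double-not-odd a b (ℕ.suc-injective (ℕ.suc-injective
  (trans (cong suc (sym (ℕ.+-suc a a))) (trans e (cong (λ k → suc (suc k)) (ℕ.+-suc b b))))))

smooth-double : ∀ {e} → Smooth e → Smooth (double e)
smooth-double {e} (p , (k , d) , _) = ℕ.≤-trans p (ℕ.m≤m+n e e)
  , (suc k , subst (_∣ⁿ 210 ℕ.^ suc k) (2p≡ e) (Div.*-pres-∣ {o = 2} {m = 210} {p = e} {n = 210 ℕ.^ k} (Div.divides 105 refl) d))
  , double-not-odd e 0 , double-not-odd e 3

sum-double : ∀ as → sum (map double as) ≡ double (sum as)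
sum-double []       = refl
sum-double (a ∷ as) = trans (cong (double a ℕ.+_) (sum-double as)) (eq a (sum as))
  where eq : ∀ a s → a ℕ.+ a ℕ.+ (s ℕ.+ s) ≡ a ℕ.+ s ℕ.+ (a ℕ.+ s)
        eq = ℕ-solve-∀

1/ℕ-double : ∀ e → 0 < e → 1/ℕ (double e) ≡ ½ * (1/ℕ e)
1/ℕ-double (suc e) _ = trans (cong (λ k → 1/ℕ suc k) (ℕ.+-suc e e)) (1/ℕ-even e)

inverseSum-double : ∀ as → All Smooth as → inverseSum (map double as) ≡ ½ * inverseSum as
inverseSum-double []       _        = sym (ℚ.*-zeroʳ ½)
inverseSum-double (a ∷ as) (p ∷ ps) = trans (cong₂ _+_ (1/ℕ-double a (proj₁ p)) (inverseSum-double as ps)) (sym (ℚ.*-distribˡ-+ ½ (1/ℕ a) (inverseSum as)))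

-- Doubling all parts halves the sum of reciprocals, and `us` supplies the missing half.
extend-double : ∀ {m} us → Unique us → All Smooth us → inverseSum us ≡ ½ →
                All (λ u → ∀ a → Smooth a → u ≢ double a) us → SmoothPartition m → SmoothPartition (sum us ℕ.+ double m)
extend-double us uu su iu new (smoothPartition as u s refl i) = smoothPartition (us ++ map double as)
  (Unique.++⁺ uu (Unique.map⁺ double-injective u) disjoint)
  (All.++⁺ su (All.map⁺ (All.map smooth-double s)))
  (trans (sum-++ us (map double as)) (cong (sum us ℕ.+_) (sum-double as)))
  (trans (inverseSum-++ us (map double as)) (cong₂ _+_ iu (trans (inverseSum-double as s) (trans (cong (½ *_) i) refl))))
  where
  disjoint : ∀ {v} → ¬ (v ∈ us × v ∈ map double as)
  disjoint (p , q) with ∈-map⁻ double q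
  ... | a , a∈ , refl = All.lookup new p a (All.lookup s a∈) refl

210-smooth : ∀ e → {_ : True (0 ℕ.<? e)} → {_ : True (e Div.∣? 210)} → {_ : True (¬? (e ℕ.≟ 1))} → {_ : True (¬? (e ℕ.≟ 7))} → Smooth e
210-smooth e {p} {q} {r} {s} = toWitness p , (1 , toWitness q) , toWitness r , toWitness s

even-step : ∀ {m} → SmoothPartition m → SmoothPartition (2 ℕ.+ double m)
even-step = extend-double (2 ∷ []) ([] ∷ []) (210-smooth 2 ∷ []) refl
  ((λ a s e → proj₁ (proj₂ (proj₂ s)) (sym (double-injective {1} {a} e))) ∷ [])

-- 1/3 + 1/14 + 1/15 + 1/35 = ½ with the odd sum 67. Three of these parts are odd and so differ from
-- every doubled part; 14 is new because 7 is excluded.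
odd-step : ∀ {m} → SmoothPartition m → SmoothPartition (67 ℕ.+ double m)
odd-step = extend-double (3 ∷ 14 ∷ 15 ∷ 35 ∷ []) (toWitness {a? = AllPairs.allPairs? (λ a b → ¬? (a ℕ.≟ b)) (3 ∷ 14 ∷ 15 ∷ 35 ∷ [])} _)
  (210-smooth 3 ∷ 210-smooth 14 ∷ 210-smooth 15 ∷ 210-smooth 35 ∷ []) refl
  ( (λ a _ e → double-not-odd a 1 (sym e)) ∷ (λ a s e → proj₂ (proj₂ (proj₂ s)) (sym (double-injective {7} {a} e)))
  ∷ (λ a _ e → double-not-odd a 7 (sym e)) ∷ (λ a _ e → double-not-odd a 17 (sym e)) ∷ [])

smooth-partition : ∀ m → 92 ≤ m → SmoothPartition m
smooth-partition = <-rec _ step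
  where
  step : ∀ m → (∀ {j} → j < m → 92 ≤ j → SmoothPartition j) → 92 ≤ m → SmoothPartition m
  step m rec 92≤m with m ℕ.<? 251
  ... | yes m<251 = subst SmoothPartition (ℕ.m∸n+n≡m 92≤m) (from-table table-checked (m ℕ.∸ 92) (ℕ.∸-monoˡ-< m<251 92≤m))
  ... | no m≮251 with half m
  ...   | a , inj₁ refl = subst SmoothPartition (trans (eq (a ℕ.∸ 1)) (cong double (ℕ.m+[n∸m]≡n {1} 1≤a)))
          (even-step (rec (ℕ.<-≤-trans (ℕ.∸-monoʳ-< {a} {1} {0} (s≤s z≤n) 1≤a) (ℕ.m≤m+n a a)) (ℕ.∸-monoˡ-≤ 1 93≤a)))
    where
    93≤a : 93 ≤ a
    93≤a = ℕ.≮⇒≥ λ { (s≤s a<93) → m≮251 (s≤s (ℕ.≤-trans (ℕ.+-mono-≤ a<93 a<93) (ℕ.m≤m+n 184 66))) }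
    1≤a : 1 ≤ a
    1≤a = ℕ.≤-trans (s≤s z≤n) 93≤a
    eq : ∀ k → 2 ℕ.+ (k ℕ.+ k) ≡ (1 ℕ.+ k) ℕ.+ (1 ℕ.+ k)
    eq = ℕ-solve-∀
  ...   | a , inj₂ refl = subst SmoothPartition (trans (eq (a ℕ.∸ 33)) (cong (λ k → suc (double k)) (ℕ.m+[n∸m]≡n {33} 33≤a)))
          (odd-step (rec (s≤s (ℕ.≤-trans (ℕ.m∸n≤m a 33) (ℕ.m≤m+n a a))) (ℕ.∸-monoˡ-≤ 33 125≤a)))
    where
    125≤a : 125 ≤ a
    125≤a = ℕ.≮⇒≥ λ { (s≤s a<125) → m≮251 (s≤s (s≤s (ℕ.≤-trans (ℕ.+-mono-≤ a<125 a<125) (ℕ.m≤m+n 248 1)))) }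
    33≤a : 33 ≤ a
    33≤a = ℕ.≤-trans (ℕ.m≤m+n 33 92) 125≤a
    eq : ∀ k → 67 ℕ.+ (k ℕ.+ k) ≡ suc ((33 ℕ.+ k) ℕ.+ (33 ℕ.+ k))
    eq = ℕ-solve-∀

-- Many values α with n_α ≤ n

nonneg-inverseSum : ∀ as → All (0 <_) as → 0≤ inverseSum as
nonneg-inverseSum []           _        = ℚ.≤-refl
nonneg-inverseSum (suc a ∷ as) (_ ∷ ps) = 0≤1/ a ⊕ nonneg-inverseSum as ps

IsElement⇒>0 : ∀ {t e} → IsElement t e → 0 < e
IsElement⇒>0 (p , (pr , _) , _ , inj₁ refl) = ℕ.<⇒≤ (2≤prime pr)
IsElement⇒>0 (p , (pr , _) , _ , inj₂ refl) = ℕ.≤-trans (ℕ.<⇒≤ (2≤prime pr)) (ℕ.m≤m+n p p)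

∤-210^ : ∀ {p} → BigPrime p → ∀ k → ¬ (p ∣ⁿ 210 ℕ.^ k)
∤-210^ (pr , _) zero p∣1 = prime-∤-smaller pr (s≤s z≤n) (2≤prime pr) p∣1
∤-210^ b@(pr , 13<p) (suc k) p∣ = case euclidsLemma 210 (210 ℕ.^ k) pr p∣ of λ where
    (inj₂ q) → ∤-210^ b k q
    (inj₁ q) → ∤-product pr {2 ∷ 3 ∷ 5 ∷ 7 ∷ []} (below 2 ∷ below 3 ∷ below 5 ∷ below 7 ∷ []) q
  where below : ∀ q {_ : True (0 ℕ.<? q)} {_ : True (q ℕ.≤? 13)} → ¬ (_ ∣ⁿ q)
        below q {u} {v} = prime-∤-smaller pr (toWitness u) (ℕ.≤-<-trans (toWitness v) 13<p)

element-not-smooth : ∀ {t e} → IsElement t e → ¬ Smooth e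
element-not-smooth (p , b , _ , inj₁ refl) (_ , (k , d) , _) = ∤-210^ b k d
element-not-smooth (p , b , _ , inj₂ refl) (_ , (k , d) , _) = ∤-210^ b k (Div.∣-trans (subst (p ∣ⁿ_) (2p≡ p) (Div.n∣m*n 2)) d)

-- The remainder N - sum us ≥ 92 is filled with 7-smooth parts, which cannot meet `us` because each
-- element has a prime factor above 13. The bound 92 + sum us is written as a successor to suit
-- `IsThreshold-below`.
partitions-from : ∀ {t} us → Unique us → All (IsElement t) us → HasPartitionFrom (inverseSum us + 1ℚ) (suc (91 ℕ.+ sum us))
partitions-from us uu eu N N≥ = us ++ parts , record
    { distinct        = Unique.++⁺ uu unique λ (p , q) → element-not-smooth (All.lookup eu p) (All.lookup smooth q)
    ; positive        = All.++⁺ (All.map IsElement⇒>0 eu) (All.map proj₁ smooth)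
    ; sum≡n           = trans (sum-++ us parts) (trans (cong (sum us ℕ.+_) sum≡m) (ℕ.m+[n∸m]≡n us≤N))
    ; sumOfInverses≡α = trans (inverseSum-++ us parts) (cong (inverseSum us +_) inverse)
    }
  where
  us≤N : sum us ≤ N
  us≤N = ℕ.≤-trans (ℕ.m≤n+m (sum us) 92) N≥
  open SmoothPartition (smooth-partition (N ℕ.∸ sum us) (ℕ.m+n≤o⇒m≤o∸n 92 N≥))

element-sum-∈A : ∀ {t n} us → Unique us → All (IsElement t) us → 92 ℕ.+ sum us ≤ n → A n (inverseSum us + 1ℚ)
element-sum-∈A us uu eu p =
  let (M , t , M≤) = IsThreshold-below (91 ℕ.+ sum us) (partitions-from us uu eu)
  in subst 0<_ (ℚ.+-comm 1ℚ (inverseSum us)) (c>0 1ℚ ⊕⁺ nonneg-inverseSum us (All.map IsElement⇒>0 eu)) , M , t , ℕ.≤-trans M≤ p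

-- Half of the subsets have at most half of the sum.

masks : ∀ n → List (Vec Bool n)
masks zero    = [] ∷ []
masks (suc n) = map (true ∷_) (masks n) ++ map (false ∷_) (masks n)

∷-injective : ∀ {n b} {v w : Vec Bool n} → _≡_ {A = Vec Bool (suc n)} (b ∷ v) (b ∷ w) → v ≡ w
∷-injective refl = refl

masks-unique : ∀ n → Unique (masks n)
masks-unique zero    = [] ∷ []
masks-unique (suc n) = Unique.++⁺ (Unique.map⁺ ∷-injective (masks-unique n)) (Unique.map⁺ ∷-injective (masks-unique n)) disjoint
  where disjoint : ∀ {v} → ¬ (v ∈ map (true ∷_) (masks n) × v ∈ map (false ∷_) (masks n))
        disjoint (p , q) with ∈-map⁻ (true ∷_) p | ∈-map⁻ (false ∷_) q
        ... | _ , _ , refl | _ , _ , ()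

length-masks : ∀ n → length (masks n) ≡ 2 ℕ.^ n
length-masks zero    = refl
length-masks (suc n) = trans (List.length-++ (map (true ∷_) (masks n)))
  (cong₂ ℕ._+_ (trans (List.length-map (true ∷_) (masks n)) (length-masks n))
    (trans (List.length-map (false ∷_) (masks n)) (trans (length-masks n) (sym (ℕ.+-identityʳ (2 ℕ.^ n))))))

complement-sum : ∀ es v → sum (pick es v) ℕ.+ sum (pick es (Vec.map not v)) ≡ sum es
complement-sum []       []          = refl
complement-sum (e ∷ es) (true ∷ v)  = trans (ℕ.+-assoc e _ _) (cong (e ℕ.+_) (complement-sum es v))
complement-sum (e ∷ es) (false ∷ v) = trans (eq (sum (pick es v)) e _) (cong (e ℕ.+_) (complement-sum es v))
  where eq : ∀ a e b → a ℕ.+ (e ℕ.+ b) ≡ e ℕ.+ (a ℕ.+ b)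
        eq = ℕ-solve-∀

-- One of two complementary subsets has at most half of the sum.
module Lighter (e : ℕ) (es : List ℕ) where

  light-with : ∀ v → Dec (sum (pick (e ∷ es) (true ∷ v)) ≤ sum (pick es (Vec.map not v))) → Vec Bool (suc (length es))
  light-with v (yes _) = true ∷ v
  light-with v (no _)  = false ∷ Vec.map not v

  light : Vec Bool (length es) → Vec Bool (suc (length es))
  light v = light-with v (_ ℕ.≤? _)

  light-sum : ∀ v → 2 ℕ.* sum (pick (e ∷ es) (light v)) ≤ sum (e ∷ es)
  light-sum v = go (_ ℕ.≤? _)
    where
    total : sum (pick (e ∷ es) (true ∷ v)) ℕ.+ sum (pick es (Vec.map not v)) ≡ sum (e ∷ es)
    total = complement-sum (e ∷ es) (true ∷ v)
    go : ∀ d → 2 ℕ.* sum (pick (e ∷ es) (light-with v d)) ≤ sum (e ∷ es)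
    go (yes p) = subst₂ _≤_ (sym (2p≡ (sum (pick (e ∷ es) (true ∷ v))))) total (ℕ.+-monoʳ-≤ (sum (pick (e ∷ es) (true ∷ v))) p)
    go (no ¬p) = subst₂ _≤_ (sym (2p≡ (sum (pick es (Vec.map not v))))) total (ℕ.+-monoˡ-≤ (sum (pick es (Vec.map not v))) (ℕ.<⇒≤ (ℕ.≰⇒> ¬p)))

  not-injective : ∀ {n} (v w : Vec Bool n) → Vec.map not v ≡ Vec.map not w → v ≡ w
  not-injective []          []          _ = refl
  not-injective (true ∷ v)  (true ∷ w)  e = cong (true ∷_) (not-injective v w (∷-injective e))
  not-injective (false ∷ v) (false ∷ w) e = cong (false ∷_) (not-injective v w (∷-injective e))
  not-injective (true ∷ v)  (false ∷ w) ()
  not-injective (false ∷ v) (true ∷ w)  ()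

  light-injective : ∀ {v w} → light v ≡ light w → v ≡ w
  light-injective {v} {w} = go (_ ℕ.≤? _) (_ ℕ.≤? _)
    where
    go : ∀ d d′ → light-with v d ≡ light-with w d′ → v ≡ w
    go (yes _) (yes _) e = ∷-injective e
    go (no _)  (no _)  e = not-injective v w (∷-injective e)
    go (yes _) (no _)  ()
    go (no _)  (yes _) ()

-- Masks of the elements after the first index the pairs of complementary subsets. The lighter
-- member of a pair has sum at most n - 92, and distinct pairs give distinct values by independence.
many : ∀ {t n} es → Unique es → All (IsElement t) es → Independent es → sum es ℕ.+ 184 ≤ 2 ℕ.* n →
       ∀ k → suc k ≡ length es → (2 ℕ.^ k) ≤∣ A n ∣
many {t} {n} (e ∷ es) u all-el ind-es p _ refl = map value (masks (length es))
  , Unique.map⁺ value-injective (masks-unique (length es))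
  , All.map⁺ (All.tabulate λ {v} _ → member v)
  , trans (List.length-map value (masks (length es))) (length-masks (length es))
  where
  open Lighter e es
  value : Vec Bool (length es) → ℚ
  value v = inverseSum (pick (e ∷ es) (light v)) + 1ℚ
  value-injective : ∀ {v w} → value v ≡ value w → v ≡ w
  value-injective {v} {w} q = light-injective (inverseSum-injective (e ∷ es) (All.map IsElement⇒>0 all-el) ind-es (light v) (light w)
    (+-cancelʳ (inverseSum (pick (e ∷ es) (light v))) (inverseSum (pick (e ∷ es) (light w))) q))
    where +-cancelʳ : ∀ a b → a + 1ℚ ≡ b + 1ℚ → a ≡ b
          +-cancelʳ a b q = trans (eq a) (trans (cong (_- 1ℚ) q) (sym (eq b)))
            where eq : ∀ a → a ≡ a + 1ℚ - 1ℚ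
                  eq = solve-∀ ℚ-ring
  member : ∀ v → A n (value v)
  member v = element-sum-∈A (pick (e ∷ es) (light v)) (pick-Unique (e ∷ es) (light v) u) (pick-All (e ∷ es) (light v) all-el)
    (ℕ.*-cancelˡ-≤ {92 ℕ.+ sum (pick (e ∷ es) (light v))} {n} 2 (ℕ.≤-trans (ℕ.≤-reflexive (eq (sum (pick (e ∷ es) (light v))))) (ℕ.≤-trans (ℕ.+-monoˡ-≤ 184 (light-sum v)) p)))
    where eq : ∀ s → 2 ℕ.* (92 ℕ.+ s) ≡ 2 ℕ.* s ℕ.+ 184
          eq = ℕ-solve-∀

many-A : ∀ X n → S⁺ X ℕ.+ 2 ℕ.* S⁺ ℕ.⌊ X /2⌋ ℕ.+ 184 ≤ 2 ℕ.* n → ∀ k → suc k ≡ size X → (2 ℕ.^ k) ≤∣ A n ∣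
many-A X n p k q = many (elements m X) (elements-unique m X) (elements-IsElement m X) (elements-independent m X)
    (subst (λ s → s ℕ.+ 184 ≤ 2 ℕ.* n) (sym (trans (proj₂ (elements-size m X)) (cong (λ i → S⁺ X ℕ.+ 2 ℕ.* S⁺ i) min))) p)
    k (trans q (sym (trans (proj₁ (elements-size m X)) (cong (λ i → π⁺ X ℕ.+ π⁺ i) min))))
  where
  m = ℕ.⌊ X /2⌋
  min : X ℕ.⊓ m ≡ m
  min = ℕ.m≥n⇒m⊓n≡n (ℕ.⌊n/2⌋≤n X)

-- Choice of the parameters.

last-true : ∀ {P : ℕ → Set} → Decidable P → P 0 → ∀ b → ¬ P b → ∃[ k ] (P k × ¬ P (suc k))
last-true P? p zero    ¬p = ⊥-elim (¬p p)
last-true P? p (suc b) ¬p with P? b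
... | yes q = b , q , ¬p
... | no ¬q = last-true P? p b ¬q

sq-cancel-< : ∀ a b → a ℕ.* a < b ℕ.* b → a < b
sq-cancel-< a b p = ℕ.≰⇒> λ b≤a → ℕ.<⇒≱ p (ℕ.*-mono-≤ b≤a b≤a)

-- Here u is about (log₂ n) / 128, and ω is slightly more than (log₂ n) / 2, so that
-- the elements up to 2^ω are numerous enough. Large numerals are kept to the
-- right of products and sums, which would otherwise be unfolded in unary.
module Parameters (n D u : ℕ) (41≤u : 41 ≤ u) (D< : D < u ℕ.* 128) (D≥ : u ℕ.* 128 ≤ D ℕ.+ 128)
                  (2^D≤n : 2 ℕ.^ D ≤ n) (n<2^ : n < 2 ℕ.^ suc D) where
  open ℕ.≤-Reasoning

  ω : ℕ
  ω = u ℕ.* 66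

  1≤u : 1 ≤ u
  1≤u = ℕ.≤-trans (s≤s z≤n) 41≤u

  1≤ω : 1 ≤ ω
  1≤ω = ℕ.*-mono-≤ {1} {u} {1} {66} 1≤u (s≤s z≤n)

  u*2^40≤n : u ℕ.* 2 ℕ.^ 40 ≤ n
  u*2^40≤n = begin
    u ℕ.* 2 ℕ.^ 40            ≤⟨ ℕ.*-monoˡ-≤ (2 ℕ.^ 40) (ℕ.<⇒≤ (n<b^n (s≤s (s≤s z≤n)) u)) ⟩
    2 ℕ.^ u ℕ.* 2 ℕ.^ 40      ≡⟨ sym (ℕ.^-distribˡ-+-* 2 u 40) ⟩
    2 ℕ.^ (u ℕ.+ 40)          ≤⟨ ℕ.^-monoʳ-≤ 2 u+40≤D ⟩
    2 ℕ.^ D                   ≤⟨ 2^D≤n ⟩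
    n                         ∎
    where
    eq : ∀ u D → u ℕ.+ 40 ℕ.+ (D ℕ.+ 128 ℕ.+ u ℕ.* 127) ℕ.+ 5039 ≡ D ℕ.+ (u ℕ.* 128 ℕ.+ 41 ℕ.* 127)
    eq = ℕ-solve-∀
    u+40≤D : u ℕ.+ 40 ≤ D
    u+40≤D = ℕ-cert 5039 (eq u D) (ℕ.+-mono-≤ D≥ (ℕ.*-monoˡ-≤ 127 41≤u))

  -- If at most k + 1 elements are used, sum-bound makes their sum at most 2 (n - 92).
  Fits : ℕ → Set
  Fits k = ω ℕ.* ((k ℕ.+ 19) ℕ.* (k ℕ.+ 19)) ℕ.+ 552 ≤ n ℕ.* 6

  small-fits : ∀ c → c ℕ.* 66 ℕ.+ 552 ≤ 2 ℕ.^ 40 ℕ.* 6 → ω ℕ.* c ℕ.+ 552 ≤ n ℕ.* 6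
  small-fits c p = begin
    ω ℕ.* c ℕ.+ 552                ≤⟨ ℕ.+-monoʳ-≤ (ω ℕ.* c) (ℕ.≤-trans (ℕ.≤-reflexive (sym (ℕ.*-identityˡ 552))) (ℕ.*-monoˡ-≤ 552 1≤u)) ⟩
    ω ℕ.* c ℕ.+ u ℕ.* 552          ≡⟨ eq u c ⟩
    u ℕ.* (c ℕ.* 66 ℕ.+ 552)       ≤⟨ ℕ.*-monoʳ-≤ u p ⟩
    u ℕ.* (2 ℕ.^ 40 ℕ.* 6)         ≡⟨ sym (ℕ.*-assoc u (2 ℕ.^ 40) 6) ⟩
    u ℕ.* 2 ℕ.^ 40 ℕ.* 6           ≤⟨ ℕ.*-monoˡ-≤ 6 u*2^40≤n ⟩
    n ℕ.* 6                        ∎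
    where eq : ∀ u c → u ℕ.* 66 ℕ.* c ℕ.+ u ℕ.* 552 ≡ u ℕ.* (c ℕ.* 66 ℕ.+ 552)
          eq = ℕ-solve-∀

  not-fits : ¬ Fits n
  not-fits p = ℕ.<⇒≱ (begin-strict
    n ℕ.* 6                                            ≤⟨ ℕ.*-mono-≤ (ℕ.m≤m+n n 19) (ℕ.≤-trans (ℕ.m≤m+n 6 13) (ℕ.m≤n+m 19 n)) ⟩
    (n ℕ.+ 19) ℕ.* (n ℕ.+ 19)                          ≡⟨ sym (ℕ.*-identityˡ _) ⟩
    1 ℕ.* ((n ℕ.+ 19) ℕ.* (n ℕ.+ 19))                  ≤⟨ ℕ.*-monoˡ-≤ ((n ℕ.+ 19) ℕ.* (n ℕ.+ 19)) 1≤ω ⟩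
    ω ℕ.* ((n ℕ.+ 19) ℕ.* (n ℕ.+ 19))                  <⟨ ℕ.m<m+n (ω ℕ.* ((n ℕ.+ 19) ℕ.* (n ℕ.+ 19))) {552} (s≤s z≤n) ⟩
    ω ℕ.* ((n ℕ.+ 19) ℕ.* (n ℕ.+ 19)) ℕ.+ 552          ∎) p

  abstract
    found : ∃[ k ] (Fits k × ¬ Fits (suc k))
    found = last-true {Fits} (λ k → _ ℕ.≤? _) (small-fits 361 (toWitness {a? = 361 ℕ.* 66 ℕ.+ 552 ℕ.≤? 2 ℕ.^ 40 ℕ.* 6} _)) n not-fits

  k₀ : ℕ
  k₀ = proj₁ found

  fits : Fits k₀
  fits = proj₁ (proj₂ found)

  ¬fits : ¬ Fits (suc k₀)
  ¬fits = proj₂ (proj₂ found)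

  2200≤k₀ : 2200 ≤ k₀
  2200≤k₀ = ℕ.≮⇒≥ λ k₀< → ¬fits (ℕ.≤-trans
    (ℕ.+-monoˡ-≤ 552 (ℕ.*-monoʳ-≤ ω (ℕ.*-mono-≤ (ℕ.+-monoˡ-≤ 19 k₀<) (ℕ.+-monoˡ-≤ 19 k₀<))))
    (small-fits (2219 ℕ.* 2219) (toWitness {a? = 2219 ℕ.* 2219 ℕ.* 66 ℕ.+ 552 ℕ.≤? 2 ℕ.^ 40 ℕ.* 6} _)))

  -- One of the two bits is lost to choosing the lighter subset. The other turns 2ʲ into at least 2ʲ
  -- + 1, the slack consumed by the diagonal approximation of exp.
  j : ℕ
  j = k₀ ℕ.∸ 2

  j+2 : j ℕ.+ 2 ≡ k₀
  j+2 = ℕ.m∸n+n≡m (ℕ.≤-trans (s≤s (s≤s z≤n)) 2200≤k₀)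

  2198≤j : 2198 ≤ j
  2198≤j = ℕ.∸-monoˡ-≤ 2 2200≤k₀

  -- Makes j² small against n, so that an error of 1 in the estimate of log n costs little.
  j²-upper : j ℕ.* j ℕ.* 2000 ≤ n ℕ.* 6
  j²-upper = begin
    j ℕ.* j ℕ.* 2000                             ≤⟨ ℕ.*-mono-≤ (ℕ.*-mono-≤ j≤ j≤) 2000≤ω ⟩
    (k₀ ℕ.+ 19) ℕ.* (k₀ ℕ.+ 19) ℕ.* ω            ≡⟨ ℕ.*-comm _ ω ⟩
    ω ℕ.* ((k₀ ℕ.+ 19) ℕ.* (k₀ ℕ.+ 19))          ≤⟨ ℕ.m≤m+n _ 552 ⟩
    ω ℕ.* ((k₀ ℕ.+ 19) ℕ.* (k₀ ℕ.+ 19)) ℕ.+ 552  ≤⟨ fits ⟩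
    n ℕ.* 6                                      ∎
    where j≤ : j ≤ k₀ ℕ.+ 19
          j≤ = ℕ.≤-trans (ℕ.m∸n≤m k₀ 2) (ℕ.m≤m+n k₀ 19)
          2000≤ω : 2000 ≤ ω
          2000≤ω = ℕ.≤-trans (toWitness {a? = 2000 ℕ.≤? 41 ℕ.* 66} _) (ℕ.*-monoˡ-≤ 66 41≤u)

  j+22 : (j ℕ.+ 22) ℕ.* (j ℕ.+ 22) ℕ.* 100 ≤ j ℕ.* j ℕ.* 103
  j+22 = begin
    (j ℕ.+ 22) ℕ.* (j ℕ.+ 22) ℕ.* 100             ≡⟨ eq j ⟩
    j ℕ.* j ℕ.* 100 ℕ.+ (j ℕ.* 4400 ℕ.+ 48400)    ≤⟨ ℕ.+-monoʳ-≤ (j ℕ.* j ℕ.* 100) (ℕ.+-monoʳ-≤ (j ℕ.* 4400) (ℕ.≤-trans (toWitness {a? = 48400 ℕ.≤? 2198 ℕ.* 2194} _) (ℕ.*-monoˡ-≤ 2194 2198≤j))) ⟩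
    j ℕ.* j ℕ.* 100 ℕ.+ (j ℕ.* 4400 ℕ.+ j ℕ.* 2194) ≡⟨ cong (j ℕ.* j ℕ.* 100 ℕ.+_) (sym (ℕ.*-distribˡ-+ j 4400 2194)) ⟩
    j ℕ.* j ℕ.* 100 ℕ.+ j ℕ.* (2198 ℕ.* 3)        ≤⟨ ℕ.+-monoʳ-≤ (j ℕ.* j ℕ.* 100) (ℕ.*-monoʳ-≤ j (ℕ.*-monoˡ-≤ 3 2198≤j)) ⟩
    j ℕ.* j ℕ.* 100 ℕ.+ j ℕ.* (j ℕ.* 3)           ≡⟨ eq′ j ⟩
    j ℕ.* j ℕ.* 103                               ∎
    where eq : ∀ j → (j ℕ.+ 22) ℕ.* (j ℕ.+ 22) ℕ.* 100 ≡ j ℕ.* j ℕ.* 100 ℕ.+ (j ℕ.* 4400 ℕ.+ 48400)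
          eq = ℕ-solve-∀
          eq′ : ∀ j → j ℕ.* j ℕ.* 100 ℕ.+ j ℕ.* (j ℕ.* 3) ≡ j ℕ.* j ℕ.* 103
          eq′ = ℕ-solve-∀

  -- Ideally D j² ≈ 12 n. The losses are 66/64 in ω, 41/40 from rounding u, 103/100 from the shift
  -- by 22 and 600/599 from the additive constant; the bound 10.5 n that is kept still exceeds 3.3 n
  -- / λ₀³.
  j²-lower : n ℕ.* 21 ≤ D ℕ.* (j ℕ.* j) ℕ.* 2
  j²-lower = ℕ.*-cancelʳ-≤ (n ℕ.* 21) (D ℕ.* s ℕ.* 2) 146040 (begin
    n ℕ.* 21 ℕ.* 146040               ≡⟨ ℕ.*-assoc n 21 146040 ⟩
    n ℕ.* (21 ℕ.* 146040)             ≤⟨ ℕ.*-monoʳ-≤ n (toWitness {a? = 21 ℕ.* 146040 ℕ.≤? 599 ℕ.* 5120} _) ⟩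
    n ℕ.* (599 ℕ.* 5120)              ≡⟨ sym (ℕ.*-assoc n 599 5120) ⟩
    n ℕ.* 599 ℕ.* 5120                ≤⟨ ℕ.*-monoˡ-≤ 5120 n≤ ⟩
    ω ℕ.* (s ℕ.* 103) ℕ.* 5120        ≡⟨ eq₂ u s ⟩
    u ℕ.* 5120 ℕ.* s ℕ.* (103 ℕ.* 66) ≤⟨ ℕ.*-monoˡ-≤ (103 ℕ.* 66) (ℕ.*-monoˡ-≤ s u≤) ⟩
    D ℕ.* 41 ℕ.* s ℕ.* (103 ℕ.* 66)   ≡⟨ eq₃ D s ⟩
    D ℕ.* s ℕ.* (41 ℕ.* (103 ℕ.* 66)) ≤⟨ ℕ.*-monoʳ-≤ (D ℕ.* s) (toWitness {a? = 41 ℕ.* (103 ℕ.* 66) ℕ.≤? 2 ℕ.* 146040} _) ⟩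
    D ℕ.* s ℕ.* (2 ℕ.* 146040)        ≡⟨ sym (ℕ.*-assoc (D ℕ.* s) 2 146040) ⟩
    D ℕ.* s ℕ.* 2 ℕ.* 146040          ∎)
    where
    s = j ℕ.* j
    eq₂ : ∀ u s → u ℕ.* 66 ℕ.* (s ℕ.* 103) ℕ.* 5120 ≡ u ℕ.* 5120 ℕ.* s ℕ.* (103 ℕ.* 66)
    eq₂ = ℕ-solve-∀
    eq₃ : ∀ D s → D ℕ.* 41 ℕ.* s ℕ.* (103 ℕ.* 66) ≡ D ℕ.* s ℕ.* (41 ℕ.* (103 ℕ.* 66))
    eq₃ = ℕ-solve-∀
    u≤ : u ℕ.* 5120 ≤ D ℕ.* 41
    u≤ = ℕ-cert 0 (eq u D) (ℕ.+-mono-≤ (ℕ.*-monoˡ-≤ 41 D≥) (ℕ.*-monoˡ-≤ 128 41≤u))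
      where eq : ∀ u D → u ℕ.* 5120 ℕ.+ ((D ℕ.+ 128) ℕ.* 41 ℕ.+ u ℕ.* 128) ℕ.+ 0 ≡ D ℕ.* 41 ℕ.+ (u ℕ.* 128 ℕ.* 41 ℕ.+ 41 ℕ.* 128)
            eq = ℕ-solve-∀
    6n≤ : n ℕ.* 6 ≤ ω ℕ.* ((j ℕ.+ 22) ℕ.* (j ℕ.+ 22)) ℕ.+ 552
    6n≤ = subst (λ i → n ℕ.* 6 ≤ ω ℕ.* (i ℕ.* i) ℕ.+ 552) (trans (cong (λ k → suc k ℕ.+ 19) (sym j+2)) (eq j)) (ℕ.<⇒≤ (ℕ.≰⇒> ¬fits))
      where eq : ∀ j → suc (j ℕ.+ 2) ℕ.+ 19 ≡ j ℕ.+ 22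
            eq = ℕ-solve-∀
    55200≤n : 55200 ≤ n
    55200≤n = ℕ.≤-trans (ℕ.≤-trans (toWitness {a? = 55200 ℕ.≤? 41 ℕ.* 2 ℕ.^ 40} _) (ℕ.*-monoˡ-≤ (2 ℕ.^ 40) 41≤u)) u*2^40≤n
    n≤ : n ℕ.* 599 ≤ ω ℕ.* (s ℕ.* 103)
    n≤ = ℕ-cert 0 (eq n ω s ((j ℕ.+ 22) ℕ.* (j ℕ.+ 22)))
      (ℕ.+-mono-≤ (ℕ.+-mono-≤ (ℕ.*-monoˡ-≤ 100 6n≤) (ℕ.*-monoʳ-≤ ω j+22)) 55200≤n)
      where eq : ∀ n ω s t → n ℕ.* 599 ℕ.+ ((ω ℕ.* t ℕ.+ 552) ℕ.* 100 ℕ.+ ω ℕ.* (s ℕ.* 103) ℕ.+ n) ℕ.+ 0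
                   ≡ ω ℕ.* (s ℕ.* 103) ℕ.+ (n ℕ.* 6 ℕ.* 100 ℕ.+ ω ℕ.* (t ℕ.* 100) ℕ.+ 55200)
            eq = ℕ-solve-∀

  -- k₀ < 3 · 2^(64 u) because its square is below 9 · 2^(128 u). The surplus 2 u in ω = 66 u
  -- outgrows the factor ω lost in Chebyshev's estimate.
  enough-primes : ω ℕ.* (k₀ ℕ.+ 6) ℕ.+ 2 < 2 ℕ.^ ω
  enough-primes = begin-strict
    ω ℕ.* (k₀ ℕ.+ 6) ℕ.+ 2        ≤⟨ ℕ.+-monoʳ-≤ (ω ℕ.* (k₀ ℕ.+ 6)) (ℕ.*-mono-≤ {1} {ω} {2} {13} 1≤ω (s≤s (s≤s z≤n))) ⟩
    ω ℕ.* (k₀ ℕ.+ 6) ℕ.+ ω ℕ.* 13 ≡⟨ eq ω k₀ ⟩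
    ω ℕ.* (k₀ ℕ.+ 19)             <⟨ ℕ.*-monoʳ-< ω {{ℕ.>-nonZero 1≤ω}} k₀< ⟩
    ω ℕ.* (Q ℕ.* 3)               ≡⟨ eq′ u Q ⟩
    u ℕ.* 198 ℕ.* Q               ≤⟨ ℕ.*-monoˡ-≤ Q 198u≤ ⟩
    2 ℕ.^ u ℕ.* 2 ℕ.^ u ℕ.* Q     ≡⟨ cong (ℕ._* Q) (sym (ℕ.^-distribˡ-+-* 2 u u)) ⟩
    2 ℕ.^ (u ℕ.+ u) ℕ.* 2 ℕ.^ (u ℕ.* 64) ≡⟨ sym (ℕ.^-distribˡ-+-* 2 (u ℕ.+ u) (u ℕ.* 64)) ⟩
    2 ℕ.^ (u ℕ.+ u ℕ.+ u ℕ.* 64)  ≡⟨ cong (2 ℕ.^_) (eq″ u) ⟩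
    2 ℕ.^ ω                       ∎
    where
    Q = 2 ℕ.^ (u ℕ.* 64)
    eq : ∀ ω k → ω ℕ.* (k ℕ.+ 6) ℕ.+ ω ℕ.* 13 ≡ ω ℕ.* (k ℕ.+ 19)
    eq = ℕ-solve-∀
    eq′ : ∀ u q → u ℕ.* 66 ℕ.* (q ℕ.* 3) ≡ u ℕ.* 198 ℕ.* q
    eq′ = ℕ-solve-∀
    eq″ : ∀ u → u ℕ.+ u ℕ.+ u ℕ.* 64 ≡ u ℕ.* 66
    eq″ = ℕ-solve-∀
    198u≤ : u ℕ.* 198 ≤ 2 ℕ.^ u ℕ.* 2 ℕ.^ u
    198u≤ = ℕ.*-mono-≤ (ℕ.<⇒≤ (n<b^n (s≤s (s≤s z≤n)) u))
      (ℕ.≤-trans (toWitness {a? = 198 ℕ.≤? 2 ℕ.^ 8} _) (ℕ.^-monoʳ-≤ 2 {8} (ℕ.≤-trans (ℕ.m≤m+n 8 33) 41≤u)))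
    n<Q² : n < Q ℕ.* Q
    n<Q² = ℕ.<-≤-trans n<2^ (ℕ.≤-trans (ℕ.^-monoʳ-≤ 2 D<) (ℕ.≤-reflexive (trans (cong (2 ℕ.^_) (eq₃ u)) (ℕ.^-distribˡ-+-* 2 (u ℕ.* 64) (u ℕ.* 64)))))
      where eq₃ : ∀ u → u ℕ.* 128 ≡ u ℕ.* 64 ℕ.+ u ℕ.* 64
            eq₃ = ℕ-solve-∀
    k₀< : k₀ ℕ.+ 19 < Q ℕ.* 3
    k₀< = sq-cancel-< (k₀ ℕ.+ 19) (Q ℕ.* 3) (begin-strict
      s                      ≡⟨ sym (ℕ.*-identityˡ s) ⟩
      1 ℕ.* s                ≤⟨ ℕ.*-monoˡ-≤ s 1≤ω ⟩
      ω ℕ.* s                ≤⟨ ℕ.m≤m+n (ω ℕ.* s) 552 ⟩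
      ω ℕ.* s ℕ.+ 552        ≤⟨ fits ⟩
      n ℕ.* 6                <⟨ ℕ.*-monoˡ-< 6 n<Q² ⟩
      Q ℕ.* Q ℕ.* 6          ≤⟨ ℕ.*-monoʳ-≤ (Q ℕ.* Q) (ℕ.m≤m+n 6 3) ⟩
      Q ℕ.* Q ℕ.* 9          ≡⟨ eq₄ Q ⟩
      Q ℕ.* 3 ℕ.* (Q ℕ.* 3)  ∎)
      where s = (k₀ ℕ.+ 19) ℕ.* (k₀ ℕ.+ 19)
            eq₄ : ∀ q → q ℕ.* q ℕ.* 9 ≡ q ℕ.* 3 ℕ.* (q ℕ.* 3)
            eq₄ = ℕ-solve-∀

  k₀≤size : k₀ ≤ size (2 ℕ.^ ω)
  k₀≤size = ℕ.≤-trans (ℕ.≮⇒≥ λ π<k₀ → ℕ.<⇒≱ enough-primes (ℕ.≤-trans (π⁺-≥ ω (2 ℕ.^ ω) ℕ.≤-refl)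
    (ℕ.+-monoˡ-≤ 2 (ℕ.*-monoʳ-≤ ω (ℕ.+-monoˡ-≤ 6 (ℕ.<⇒≤ π<k₀)))))) (ℕ.m≤m+n (π⁺ (2 ℕ.^ ω)) _)

  ∣A∣-lower : ∃[ k ] (suc (2 ℕ.^ j) ≤ 2 ℕ.^ k × (2 ℕ.^ k) ≤∣ A n ∣)
  ∣A∣-lower = from-X (first-above k₀ (2 ℕ.^ ω) k₀≤size)
    where
    1≤k₀ : 1 ≤ k₀
    1≤k₀ = ℕ.≤-trans (s≤s z≤n) 2200≤k₀
    from-X : ∃[ X ] (X ≤ 2 ℕ.^ ω × k₀ ≤ size X × size X ≤ suc k₀) → ∃[ k ] (suc (2 ℕ.^ j) ≤ 2 ℕ.^ k × (2 ℕ.^ k) ≤∣ A n ∣)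
    from-X (X , X≤ , k₀≤ , ≤k₀) = k , bound , many-A X n fits′ k (ℕ.m+[n∸m]≡n {1} (ℕ.≤-trans 1≤k₀ k₀≤))
      where
      k = size X ℕ.∸ 1
      suc-j : suc j ≡ k₀ ℕ.∸ 1
      suc-j = ℕ.+-cancelʳ-≡ 1 (suc j) (k₀ ℕ.∸ 1) (trans (eq j) (trans j+2 (sym (ℕ.m∸n+n≡m 1≤k₀))))
        where eq : ∀ j → suc j ℕ.+ 1 ≡ j ℕ.+ 2
              eq = ℕ-solve-∀
      suc-j≤k : suc j ≤ k
      suc-j≤k = ℕ.≤-trans (ℕ.≤-reflexive suc-j) (ℕ.∸-monoˡ-≤ 1 k₀≤)
      bound : suc (2 ℕ.^ j) ≤ 2 ℕ.^ k
      bound = ℕ.≤-trans (ℕ.+-monoˡ-≤ (2 ℕ.^ j) (ℕ.m^n>0 2 j))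
        (ℕ.≤-trans (ℕ.≤-reflexive (sym (2p≡ (2 ℕ.^ j)))) (ℕ.^-monoʳ-≤ 2 suc-j≤k))
      Σₑ = S⁺ X ℕ.+ 2 ℕ.* S⁺ ℕ.⌊ X /2⌋
      fits′ : Σₑ ℕ.+ 184 ≤ 2 ℕ.* n
      fits′ = ℕ.*-cancelˡ-≤ 3 (begin
        3 ℕ.* (Σₑ ℕ.+ 184)                                     ≡⟨ ℕ.*-distribˡ-+ 3 Σₑ 184 ⟩
        3 ℕ.* Σₑ ℕ.+ 552                                       ≤⟨ ℕ.+-monoˡ-≤ 552 (sum-bound ω X 1≤ω X≤) ⟩
        ω ℕ.* ((size X ℕ.+ 18) ℕ.* (size X ℕ.+ 18)) ℕ.+ 552    ≤⟨ ℕ.+-monoˡ-≤ 552 (ℕ.*-monoʳ-≤ ω (ℕ.*-mono-≤ s≤ s≤)) ⟩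
        ω ℕ.* ((k₀ ℕ.+ 19) ℕ.* (k₀ ℕ.+ 19)) ℕ.+ 552            ≤⟨ fits ⟩
        n ℕ.* 6                                                ≡⟨ eq n ⟩
        3 ℕ.* (2 ℕ.* n)                                        ∎)
        where s≤ : size X ℕ.+ 18 ≤ k₀ ℕ.+ 19
              s≤ = ℕ.≤-trans (ℕ.+-monoˡ-≤ 18 ≤k₀) (ℕ.≤-reflexive (sym (ℕ.+-suc k₀ 18)))
              eq : ∀ n → n ℕ.* 6 ≡ 3 ℕ.* (2 ℕ.* n)
              eq = ℕ-solve-∀

-- The lower bound

λ₀ : ℚ
λ₀ = ℤ.+ 11 ℚ./ 16

-- xᵏ / k! ≤ xᵏ, hence exp x ≤ 1 / (1 - x).
expSum-geometric : ∀ {x} → 0≤ x → x ℚ.≤ 1ℚ → ∀ n → (1ℚ - x) * expSum x n ℚ.≤ 1ℚ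
expSum-geometric {x} 0≤x x≤1 n = begin
  (1ℚ - x) * expSum x n       ≤⟨ ≤-*ˡ (slack x≤1) (Σ-mono n (λ k _ → term k)) ⟩
  (1ℚ - x) * Σ n (x ^_)       ≡⟨ geometric x n ⟩
  1ℚ - x ^ n                  ≤⟨ by-slack (^-≥0 0≤x n) (eq (x ^ n)) ⟩
  1ℚ                          ∎
  where
  open ℚ.≤-Reasoning
  eq : ∀ a → 1ℚ ≡ 1ℚ - a + a
  eq = solve-∀ ℚ-ring
  1/≤1 : ∀ k → 1/ℕ suc k ℚ.≤ 1ℚ
  1/≤1 k = ≤-*-cancelˡ (0<ℕ→ℚ-suc k) (subst₂ ℚ._≤_ (sym (suc*1/ k)) (sym (ℚ.*-identityʳ _)) (1≤ℕ→ℚ-suc k))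
  term : ∀ k → powOverFact x k ℚ.≤ x ^ k
  term zero    = ℚ.≤-refl
  term (suc k) = ℚ.≤-trans (mono₂ (powOverFact-≥0 0≤x k) 0≤x (term k)
      (subst (x * (1/ℕ suc k) ℚ.≤_) (ℚ.*-identityʳ x) (≤-*ˡ 0≤x (1/≤1 k)))) (ℚ.≤-reflexive (ℚ.*-comm (x ^ k) x))

-- λ₀ = 64 · 11/1024 is slightly below log 2.
expSum-λ₀≤2 : ∀ n → expSum λ₀ (suc n) ℚ.≤ 2ℚ
expSum-λ₀≤2 n = begin
  expSum λ₀ (suc n)               ≤⟨ expSum-multiple 0≤x 64 n ⟩
  expSum x (suc n) ^ 64           ≤⟨ ^-mono (expSum-≥0 0≤x (suc n)) expSum≤y 64 ⟩
  y ^ 64                          ≤⟨ toWitness {a? = y ^ 64 ℚ.≤? 2ℚ} _ ⟩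
  2ℚ                              ∎
  where
  open ℚ.≤-Reasoning
  -- x = λ₀ / 64 and y = 1 / (1 - x); at an argument this small the loss in exp x ≤ y, raised to the
  -- power 64, fits between λ₀ and log 2.
  x y : ℚ
  x = ℤ.+ 11 ℚ./ 1024
  y = ℤ.+ 1024 ℚ./ 1013
  0≤x : 0≤ x
  0≤x = c≥0 x
  0<1-x : 0< (1ℚ - x)
  0<1-x = c>0 (1ℚ - x)
  1≡ : 1ℚ ≡ (1ℚ - x) * y
  1≡ = refl
  expSum≤y : expSum x (suc n) ℚ.≤ y
  expSum≤y = ≤-*-cancelˡ 0<1-x (subst ((1ℚ - x) * expSum x (suc n) ℚ.≤_) 1≡
    (expSum-geometric 0≤x (toWitness {a? = x ℚ.≤? 1ℚ} _) (suc n)))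

ℕ→ℚ-^ : ∀ b n → ℕ→ℚ (b ℕ.^ n) ≡ ℕ→ℚ b ^ n
ℕ→ℚ-^ b zero    = refl
ℕ→ℚ-^ b (suc n) = trans (ℕ→ℚ-* b (b ℕ.^ n)) (cong (ℕ→ℚ b *_) (ℕ→ℚ-^ b n))

0≤λ₀ : 0≤ λ₀
0≤λ₀ = c≥0 λ₀

expSum-λ₀*≤2^ : ∀ d n → expSum (ℕ→ℚ d * λ₀) (suc n) ℚ.≤ ℕ→ℚ (2 ℕ.^ d)
expSum-λ₀*≤2^ d n = ℚ.≤-trans (expSum-multiple 0≤λ₀ d n) (ℚ.≤-trans (^-mono (expSum-≥0 0≤λ₀ (suc n)) (expSum-λ₀≤2 n) d) (ℚ.≤-reflexive (sym (ℕ→ℚ-^ 2 d))))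

module LowerBound (n D j : ℕ) (1≤D : 1 ≤ D) (1000≤n : 1000 ≤ n) (2^D≤n : 2 ℕ.^ D ≤ n)
                  (j²-upper : j ℕ.* j ℕ.* 2000 ≤ n ℕ.* 6) (j²-lower : n ℕ.* 21 ≤ D ℕ.* (j ℕ.* j) ℕ.* 2) where
  open ℚ.≤-Reasoning

  1≤n : 1 ≤ n
  1≤n = ℕ.≤-trans (s≤s z≤n) 1000≤n

  open Log n 1≤n

  n′ D′ j′ : ℚ
  n′ = ℕ→ℚ n
  D′ = ℕ→ℚ D
  j′ = ℕ→ℚ j

  one : ℕ → ℚ
  one _ = 1ℚ

  -- exp (D λ₀) ≤ 2ᴰ ≤ n, and the exponential sums have slope at least 1, so an approximate
  -- logarithm below D λ₀ - δ would miss n by more than δ.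
  log≥ : ∀ δ → 0< δ → Ev (λ k → D′ * λ₀ ℚ.≤ seq log k + δ)
  log≥ δ 0<δ = ev₂ step (ev-≥ 2) (exp-log δ 0<δ)
    where
    step : ∀ k → 2 ≤ k → ∣ partialSum one (seq log k) k - n′ ∣ ℚ.< δ → D′ * λ₀ ℚ.≤ seq log k + δ
    step (suc k) 2≤k p = ℚ.≮⇒≥ λ l+δ< →
      let l = seq log (suc k)
          a = D′ * λ₀
          l≤a : l ℚ.≤ a
          l≤a = ℚ.≤-trans (x≤x+y (<-weaken 0<δ)) (<-weaken l+δ<)
      in ℚ.<-irrefl refl (begin-strict
        n′                                    ≤⟨ ∣-∣≥ {partialSum one l (suc k)} (<-weaken p) ⟩
        partialSum one l (suc k) + δ          ≡⟨ cong (_+ δ) (partialSum≡expSum l (suc k)) ⟩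
        expSum l (suc k) + δ                  <⟨ by-slack⁺ (slack⁺ l+δ< ⊕⁺ slack (expSum-slope (0≤log (suc k)) l≤a 2≤k)) (eq l a δ (expSum l (suc k)) (expSum a (suc k))) ⟩
        expSum a (suc k)                      ≤⟨ expSum-λ₀*≤2^ D k ⟩
        ℕ→ℚ (2 ℕ.^ D)                         ≤⟨ ℕ→ℚ-mono 2^D≤n ⟩
        n′                                    ∎)
      where eq : ∀ l a d e f → f ≡ e + d + ((a - (l + d)) + (f - e - (a - l)))
            eq = solve-∀ ℚ-ring

  log≥½ : Ev (λ k → ½ ℚ.≤ seq log k)
  log≥½ = ev₁ (λ k p → ℚ.≤-trans (by-slack (slack (ℚ.≤-trans (ℚ.≤-trans (ℚ.≤-reflexive (sym (ℚ.*-identityˡ λ₀))) (≤-*ʳ 0≤λ₀ (ℕ→ℚ-mono 1≤D))) p) ⊕ c≥0 (λ₀ - δ - ½)) (eq (seq log k))) ℚ.≤-refl)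
      (log≥ δ (c>0 δ))
    where δ = ½ * ⅛
          eq : ∀ l → l ≡ ½ + ((l + ½ * ⅛ - λ₀) + (λ₀ - ½ * ⅛ - ½))
          eq = solve-∀ ℚ-ring

  open SqrtQuotient n 1≤n log (proj₁ log≥½) (proj₂ log≥½) (λ k _ → log≤n k)
    using (1≤root) renaming (root to ρ; root-value to ρ-value) public

  r : ℕ → ℚ
  r = seq ρ

  0≤r : ∀ k → 0≤ r k
  0≤r k = ℚ.≤-trans (c≥0 1ℚ) (1≤root k)

  -- Compared after squaring and multiplying by l ≈ log n: as r² l ≈ n, the claim becomes c² n ≤ λ₀²
  -- j² log n up to errors, where log n ≥ D λ₀ and 10.5 λ₀³ > 3.3 ≥ c².
  exponent≤ : Ev (λ k → ĉ k * r k ℚ.≤ j′ * λ₀)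
  exponent≤ = ev₃ step log≥½ (ev₂ (λ k p q → p , q) (t²-null (1/ℕ 2000) (c>0 (1/ℕ 2000))) (ρ-value 1ℚ (c>0 1ℚ))) (log≥ 1ℚ (c>0 1ℚ))
    where
    upper : ℕ→ℚ 2000 * (j′ * j′) ℚ.≤ ℕ→ℚ 6 * n′
    upper = subst₂ ℚ._≤_ (trans (ℕ→ℚ-* (j ℕ.* j) 2000) (trans (cong (_* ℕ→ℚ 2000) (ℕ→ℚ-* j j)) (ℚ.*-comm (j′ * j′) (ℕ→ℚ 2000))))
      (trans (ℕ→ℚ-* n 6) (ℚ.*-comm n′ (ℕ→ℚ 6))) (ℕ→ℚ-mono j²-upper)
    lower : ℕ→ℚ 21 * n′ ℚ.≤ 2ℚ * (D′ * (j′ * j′))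
    lower = subst₂ ℚ._≤_ (trans (ℕ→ℚ-* n 21) (ℚ.*-comm n′ (ℕ→ℚ 21)))
      (trans (ℕ→ℚ-* (D ℕ.* (j ℕ.* j)) 2) (trans (cong (_* 2ℚ) (trans (ℕ→ℚ-* D (j ℕ.* j)) (cong (D′ *_) (ℕ→ℚ-* j j)))) (ℚ.*-comm (D′ * (j′ * j′)) 2ℚ)))
      (ℕ→ℚ-mono j²-lower)
    1000≤n′ : ℕ→ℚ 1000 ℚ.≤ n′
    1000≤n′ = ℕ→ℚ-mono 1000≤n
    0≤j′ : 0≤ j′
    0≤j′ = 0≤ℕ→ℚ j
    c² : ℚ
    c² = ℤ.+ 33 ℚ./ 10
    numeric : c² * (n′ + 1ℚ) ℚ.≤ λ₀ * λ₀ * (j′ * j′) * (D′ * λ₀ - 1ℚ)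
    numeric = by-slack (c≥0 α ⊗ slack lower ⊕ c≥0 β ⊗ slack upper ⊕ c≥0 γ ⊗ slack 1000≤n′ ⊕ c≥0 (γ * ℕ→ℚ 1000 - c²))
        (eq λ₀ c² β (ℕ→ℚ 2000) (ℕ→ℚ 1000) (ℕ→ℚ 21) (ℕ→ℚ 6) n′ D′ (j′ * j′) λ₀²≡)
      where
      -- γ n is what 10.5 λ₀³ n leaves after c² n and the cost of the term -1; with n ≥ 1000 it also
      -- pays for the remaining c².
      α β γ : ℚ
      α = ½ * (λ₀ * λ₀ * λ₀)
      β = λ₀ * λ₀ * (1/ℕ 2000)
      γ = α * ℕ→ℚ 21 - β * ℕ→ℚ 6 - c²
      λ₀²≡ : λ₀ * λ₀ ≡ β * ℕ→ℚ 2000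
      λ₀²≡ = refl
      eq₀ : ∀ l c b k m x y n D s → l * l * s * (D * l) - b * k * s ≡ c * (n + 1ℚ)
           + (½ * (l * l * l) * (2ℚ * (D * s) - x * n) + b * (y * n - k * s)
              + (½ * (l * l * l) * x - b * y - c) * (n - m) + ((½ * (l * l * l) * x - b * y - c) * m - c))
      eq₀ = solve-∀ ℚ-ring
      eq₁ : ∀ l D s → l * l * s * (D * l - 1ℚ) ≡ l * l * s * (D * l) - l * l * s
      eq₁ = solve-∀ ℚ-ring
      eq : ∀ l c b k m x y n D s → l * l ≡ b * k → l * l * s * (D * l - 1ℚ) ≡ c * (n + 1ℚ)
           + (½ * (l * l * l) * (2ℚ * (D * s) - x * n) + b * (y * n - k * s)
              + (½ * (l * l * l) * x - b * y - c) * (n - m) + ((½ * (l * l * l) * x - b * y - c) * m - c))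
      eq l c b k m x y n D s e = trans (eq₁ l D s) (trans (cong (λ z → l * l * s * (D * l) - z * s) e) (eq₀ l c b k m x y n D s))
    c²-bound : ∀ k → ∣ t k * t k - ℕ→ℚ 3 ∣ ℚ.< 1/ℕ 2000 → ĉ k * ĉ k ℚ.≤ c²
    c²-bound k p = begin
      ĉ k * ĉ k                                              ≡⟨ eq (h k) (t k) ⟩
      4ℚ * (⅓ * ⅓) * (h k * h k * (t k * t k))               ≤⟨ ≤-*ˡ (c≥0 (4ℚ * (⅓ * ⅓))) (mono₂ (sq≥0 (h k)) (c≥0 (ℕ→ℚ 3 + (1/ℕ 2000))) (mono₂ (0≤h k) (c≥0 cosRootBound) (π/2≤ k) (π/2≤ k)) (∣-∣≤ {t k * t k} {ℕ→ℚ 3} {1/ℕ 2000} (<-weaken p))) ⟩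
      4ℚ * (⅓ * ⅓) * (cosRootBound * cosRootBound * (ℕ→ℚ 3 + (1/ℕ 2000))) ≤⟨ toWitness {a? = 4ℚ * (⅓ * ⅓) * (cosRootBound * cosRootBound * (ℕ→ℚ 3 + (1/ℕ 2000))) ℚ.≤? c²} _ ⟩
      c²                                                     ∎
      where eq : ∀ h t → ⅓ * ((h + h) * t) * (⅓ * ((h + h) * t)) ≡ 4ℚ * (⅓ * ⅓) * (h * h * (t * t))
            eq = solve-∀ ℚ-ring
    step : ∀ k → ½ ℚ.≤ seq log k → ∣ t k * t k - ℕ→ℚ 3 ∣ ℚ.< 1/ℕ 2000 × ∣ r k * r k * seq log k - n′ ∣ ℚ.< 1ℚ →
           D′ * λ₀ ℚ.≤ seq log k + 1ℚ → ĉ k * r k ℚ.≤ j′ * λ₀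
    step k ½≤l (ht , hr) hl = ≤-sq-cancel (0≤j′ ⊗ 0≤λ₀) (≤-*-cancelʳ 0<l (begin
      ĉ k * r k * (ĉ k * r k) * l             ≡⟨ eq₁ (ĉ k) (r k) l ⟩
      ĉ k * ĉ k * (r k * r k * l)             ≤⟨ mono₂ (sq≥0 (ĉ k)) (0≤ℕ→ℚ n ⊕ c≥0 1ℚ) (c²-bound k ht) (∣-∣≤ {r k * r k * l} (<-weaken hr)) ⟩
      c² * (n′ + 1ℚ)                          ≤⟨ numeric ⟩
      λ₀ * λ₀ * (j′ * j′) * (D′ * λ₀ - 1ℚ)    ≤⟨ ≤-*ˡ (0≤λ₀ ⊗ 0≤λ₀ ⊗ (0≤j′ ⊗ 0≤j′)) (by-slack (slack hl) (eq₂ l (D′ * λ₀))) ⟩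
      λ₀ * λ₀ * (j′ * j′) * l                 ≡⟨ eq₃ j′ l ⟩
      j′ * λ₀ * (j′ * λ₀) * l                 ∎))
      where
      l = seq log k
      0<l : 0< l
      0<l = ℚ.<-≤-trans (c>0 ½) ½≤l
      eq₁ : ∀ c r l → c * r * (c * r) * l ≡ c * c * (r * r * l)
      eq₁ = solve-∀ ℚ-ring
      eq₂ : ∀ l a → l ≡ a - 1ℚ + (l + 1ℚ - a)
      eq₂ = solve-∀ ℚ-ring
      eq₃ : ∀ j l → λ₀ * λ₀ * (j * j) * l ≡ j * λ₀ * (j * λ₀) * l
      eq₃ = solve-∀ ℚ-ring

  -- exp ((c - η) r) exp (η r) ≈ exp (c r) ≤ 2ʲ, and exp (η r) ≥ 1. The detour is due to the unknown
  -- sign of c - η: the exponential sums are known to be monotone only for non-negative arguments.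
  exp<ᴿ : ∀ η → 0ᴿ <ᴿ η → ∀ K → suc (2 ℕ.^ j) ≤ K → exp ((π/√3 -ᴿ η) *ᴿ ρ) <ᴿ fromℕ K
  exp<ᴿ η (ε , 0<ε , N , hη) K 2^j<K = ½ , c>0 ½ , ev₂ (λ k f g → f g)
    (ev₃ (λ k 1≤k η≥ e p → step k 1≤k η≥ e p) (ev-≥ 1) (N , hη) exponent≤)
    (exp-+ ((π/√3 -ᴿ η) *ᴿ ρ) (η *ᴿ ρ) ½ (c>0 ½))
    where
    step : ∀ k → 1 ≤ k → 0ℚ + ε ℚ.≤ seq η k → ĉ k * r k ℚ.≤ j′ * λ₀ →
      ∣ partialSum one ((ĉ k + - seq η k) * r k) k * partialSum one (seq η k * r k) k
        - partialSum one ((ĉ k + - seq η k) * r k + seq η k * r k) k ∣ ℚ.< ½ →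
      partialSum one ((ĉ k + - seq η k) * r k) k + ½ ℚ.≤ ℕ→ℚ K
    step (suc i) _ η≥ hexp herr = begin
      X + ½                      ≤⟨ ℚ.+-monoˡ-≤ ½ X≤ ⟩
      ℕ→ℚ (2 ℕ.^ j) + ½ + ½      ≡⟨ eq₁ (ℕ→ℚ (2 ℕ.^ j)) ⟩
      1ℚ + ℕ→ℚ (2 ℕ.^ j)         ≡⟨ sym (ℕ→ℚ-suc (2 ℕ.^ j)) ⟩
      ℕ→ℚ (suc (2 ℕ.^ j))        ≤⟨ ℕ→ℚ-mono 2^j<K ⟩
      ℕ→ℚ K                      ∎
      where
      k = suc i
      c = ĉ k
      e = seq η k
      R = r k
      X Y : ℚ
      X = partialSum one ((c + - e) * R) k
      Y = partialSum one (e * R) k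
      eq₁ : ∀ a → a + ½ + ½ ≡ 1ℚ + a
      eq₁ = solve-∀ ℚ-ring
      eq₂ : ∀ c e r → (c + - e) * r + e * r ≡ c * r
      eq₂ = solve-∀ ℚ-ring
      0≤e : 0≤ e
      0≤e = ℚ.≤-trans (<-weaken 0<ε) (subst (ℚ._≤ e) (ℚ.+-identityˡ ε) η≥)
      1≤Y : 1ℚ ℚ.≤ Y
      1≤Y = ℚ.≤-trans (by-slack (Σ-≥0 i (λ m _ → powOverFact-≥0 (0≤e ⊗ 0≤r k) (suc m))) (Σ-front i _)) (ℚ.≤-reflexive (sym (partialSum≡expSum (e * R) k)))
      XY≤ : X * Y ℚ.≤ ℕ→ℚ (2 ℕ.^ j) + ½
      XY≤ = begin
        X * Y                                         ≤⟨ ∣-∣≤ {X * Y} {partialSum one ((c + - e) * R + e * R) k} (<-weaken herr) ⟩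
        partialSum one ((c + - e) * R + e * R) k + ½  ≡⟨ cong (_+ ½) (trans (partialSum≡expSum _ k) (cong (λ z → expSum z k) (eq₂ c e R))) ⟩
        expSum (c * R) k + ½                          ≤⟨ ℚ.+-monoˡ-≤ ½ (ℚ.≤-trans (expSum-mono {m = k} {n = k} (0≤ĉ k ⊗ 0≤r k) hexp ℕ.≤-refl) (expSum-λ₀*≤2^ j i)) ⟩
        ℕ→ℚ (2 ℕ.^ j) + ½                             ∎
      X≤ : X ℚ.≤ ℕ→ℚ (2 ℕ.^ j) + ½
      X≤ = case ℚ.≤-total X 0ℚ of λ where
        (inj₁ X≤0) → ℚ.≤-trans X≤0 (0≤ℕ→ℚ (2 ℕ.^ j) ⊕ c≥0 ½)
        (inj₂ 0≤X) → ℚ.≤-trans (ℚ.≤-trans (ℚ.≤-reflexive (sym (ℚ.*-identityʳ X))) (≤-*ˡ 0≤X 1≤Y)) XY≤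

dyadic : ∀ n → 1 ≤ n → ∃[ D ] (2 ℕ.^ D ≤ n × n < 2 ℕ.^ suc D × (∀ v → 2 ℕ.^ v ≤ n → v ≤ D))
dyadic n 1≤n = let (D , p , max) = max-exponent 2 n (s≤s (s≤s z≤n)) 1≤n
  in D , p , ℕ.≰⇒> (λ q → ℕ.1+n≰n (max (suc D) q)) , max

eventually-many : ∀ η → 0ᴿ <ᴿ η → ∀ n → 0 < n → 2 ℕ.^ 5120 ≤ n →
  ∃[ l ] ∃[ q ] ∃[ r ] l IsLogOf fromℕ n × q IsQuotientOf fromℕ n and l × r IsSqrtOf q
    × exp ((π/√3 -ᴿ η) *ᴿ r) <∣ A n ∣
eventually-many η 0<η n 0<n N≤n =
  -- The quotient n / log n is presented as ρ², so that ρ is its square root by construction.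
  log , ρ *ᴿ ρ , ρ , log-IsLogOf
  , (inj₁ (½ , c>0 ½ , proj₁ log≥½ , λ k p → ℚ.≤-trans (ℚ.≤-reflexive (ℚ.+-identityˡ ½)) (proj₂ log≥½ k p)) , ρ-value)
  , (nonneg-≤ᴿ {ρ} 0≤r , ≃-pointwise {ρ *ᴿ ρ} {ρ *ᴿ ρ} (λ _ → refl))
  , 2 ℕ.^ proj₁ ∣A∣-lower , proj₂ (proj₂ ∣A∣-lower) , exp<ᴿ η 0<η (2 ℕ.^ proj₁ ∣A∣-lower) (proj₁ (proj₂ ∣A∣-lower))
  where
  d : ℕ
  d = proj₁ (dyadic n 0<n)
  2^d≤n : 2 ℕ.^ d ≤ n
  2^d≤n = proj₁ (proj₂ (dyadic n 0<n))
  5120≤d : 5120 ≤ d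
  5120≤d = proj₂ (proj₂ (proj₂ (dyadic n 0<n))) 5120 N≤n
  -- Rounding d / 128 up strictly gives both d < 128 u and 128 u ≤ d + 128; d ≥ 5120 = 40 · 128
  -- gives u ≥ 41.
  u : ℕ
  u = suc (d ℕ./ 128)
  d≡ : d ≡ d ℕ.% 128 ℕ.+ (d ℕ./ 128) ℕ.* 128
  d≡ = DivMod.m≡m%n+[m/n]*n d 128
  d< : d < u ℕ.* 128
  d< = ℕ.≤-trans (s≤s (ℕ.≤-reflexive d≡)) (ℕ.+-monoˡ-≤ ((d ℕ./ 128) ℕ.* 128) (DivMod.m%n<n d 128))
  d≥ : u ℕ.* 128 ≤ d ℕ.+ 128
  d≥ = ℕ.≤-trans (ℕ.≤-reflexive (ℕ.+-comm 128 ((d ℕ./ 128) ℕ.* 128)))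
    (ℕ.+-monoˡ-≤ 128 (ℕ.≤-trans (ℕ.m≤n+m ((d ℕ./ 128) ℕ.* 128) (d ℕ.% 128)) (ℕ.≤-reflexive (sym d≡))))
  41≤u : 41 ≤ u
  41≤u = s≤s (DivMod./-monoˡ-≤ 128 5120≤d)
  1000≤n : 1000 ≤ n
  1000≤n = ℕ.≤-trans (ℕ.≤-trans (ℕ.m≤m+n 1000 24) (ℕ.^-monoʳ-≤ 2 {10} {5120} (ℕ.m≤m+n 10 5110))) N≤n
  open Parameters n d u 41≤u d< d≥ 2^d≤n (proj₁ (proj₂ (proj₂ (dyadic n 0<n)))) using (j; j²-upper; j²-lower; ∣A∣-lower)
  open LowerBound n d j (ℕ.≤-trans (s≤s z≤n) 5120≤d) 1000≤n 2^d≤n j²-upper j²-lower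
  open Log n (ℕ.≤-trans (s≤s z≤n) 1000≤n) using (log; log-IsLogOf)

√n-bound : ∀ n → 0 < n → ∃[ r ] (r IsSqrtOf fromℕ n × ∣ B n ∣< exp (π/√3 *ᴿ r))
√n-bound (suc n) _ = Sqrt.√ (suc n) (s≤s z≤n) , √-IsSqrtOf (suc n) (s≤s z≤n) , UpperBound.∣B∣< n

theorem4 : ∃[ π ] ∃[ √3 ] ∃[ c ]
    IsPi π × √3 IsSqrtOf fromℕ 3 × c IsQuotientOf π and √3
    × (∀ η → 0ᴿ <ᴿ η → ∃[ N ] (∀ n → 0 < n → N ≤ n →
    ∃[ l ] ∃[ q ] ∃[ r ]
    l IsLogOf fromℕ n × q IsQuotientOf fromℕ n and l × r IsSqrtOf q
    × exp ((c -ᴿ η) *ᴿ r) <∣ A n ∣))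
    × (∀ n → 0 < n → ∣ A n ∣≤∣ B n ∣)
    × (∀ n → 0 < n → ∃[ r ] (r IsSqrtOf fromℕ n × ∣ B n ∣< exp (c *ᴿ r)))
theorem4 = π , √3 , π/√3 , π-IsPi , √-IsSqrtOf 3 (s≤s z≤n) , π/√3-IsQuotientOf
  , (λ η 0<η → 2 ℕ.^ 5120 , eventually-many η 0<η)
  , (λ n _ k (αs , unique , all , size) → αs , unique , All.map (A⇒B n) all , size)
  , √n-bound
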